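{- Let $\mathbb{F}$ be a field and let $\Delta$ be a $d$-dimensional normal pseudomanifold with nonempty boundary, with $d\ge3$. Then \[ g_2(\Delta,\partial\Delta)\ge\binom{d+2}{2}\big(\mu_1(\Delta,\partial\Delta;\mathbb{F})-\mu_0(\Delta,\partial\Delta;\mathbb{F})\big). \] Furthermore, equality holds if and only if for every boundary vertex $v$, $\binom{d+2}{2}\tilde\sigma_0\big(\mathrm{lk}_\Delta(v),\partial\,\mathrm{lk}_\Delta(v)\big)=\frac12 f_0\big(\mathrm{lk}_\Delta(v),\partial\,\mathrm{lk}_\Delta(v)\big)$, and for every interior vertex $v$, the link of $v$ is a stacked sphere.
   Context: Simplicial complexes are families of subsets of a finite ground set closed under subsets. For $\Gamma\subseteq\Delta$, $(\Delta,\Gamma)$ consists of the faces of $\Delta$ not in $\Gamma$; $f_i$ counts its faces of cardinality $i+1$ ($i\ge-1$); if $\dim(\Delta,\Gamma)=D-1$, $h_j=\sum_{i=0}^j(-1)^{j-i}\binom{D-i}{D-j}f_{i-1}$, $g_0=h_0$, $g_j=h_j-h_{j-1}$. $\Delta_W=\{F\in\Delta:F\subseteq W\}$; $\mathrm{lk}_\Delta(G)=\{H\in\Delta:H\cup G\in\Delta,H\cap G=\emptyset\}$ (empty if $G\notin\Delta$). $\tilde b_i(\Delta,\Gamma;\mathbb{F})$ is the dimension of the $i$-th homology of $C_\bullet(\Delta)/C_\bullet(\Gamma)$, $C_k(\Delta)$ ($k\ge-1$) having basis the faces of cardinality $k+1$ ($C_{ -1}(\Delta)=\mathbb{F}$ if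 $\Delta\ne\emptyset$, else $0$). $\tilde\sigma_i(\Delta,\Gamma)=\frac{1}{|V|+1}\sum_{W\subseteq V}\binom{|V|}{|W|}^{ -1}\tilde b_i(\Delta_W,\Gamma_W)$ with $V$ any finite set containing the vertices of $\Delta$ (independent of choice); $\mu_i(\Delta,\Gamma;\mathbb{F})=\sum_{v\in V(\Delta)}\tilde\sigma_{i-1}(\mathrm{lk}_\Delta(v),\mathrm{lk}_\Gamma(v))$ for $i\ge0$. A $d$-dimensional complex is a normal pseudomanifold if it is pure, every $(d-1)$-face (ridge) lies in at most two facets, and the link of every nonempty face of dimension $\le d-2$ is connected; it has boundary if some ridge is in exactly one facet, and the boundary $\partial\Delta$ is the pure $(d-1)$-dimensional complex whose facets are those ridges. Interior vertices: vertices $v$ with $\{v\}\notin\partial\Delta$; boundary vertices: $\{v\}\in\partial\Delta$. For a boundary vertex, $\partial\,\mathrm{lk}_\Delta(v)$ denotes the boundary of the normal pseudomanifold with boundary $\mathrm{lk}_\Delta(v)$. A stacked sphere is a connected sum of boundary complexes of simplices of equal dimension, where the connected sum of two pure equidimensional complexes on disjoint vertex sets identifies a facet of one with a facet of the other via a bijection of vertices and then removes the identified facet. -}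

module Defs where

open import Level using (Level; _⊔_) renaming (suc to lsuc)
open import Data.Bool as B using (Bool; true; false; _∧_; _∨_; not; if_then_else_)
open import Data.Nat as ℕ using (ℕ; zero; suc; _∸_; _≡ᵇ_; _≤_)
open import Data.Nat.Combinatorics using (_C_)
open import Data.Fin using (Fin; zero; suc)
open import Data.Fin.Subset using (Subset; inside; outside; ⁅_⁆; _∪_; _∩_; ∣_∣; _⊆_; _∈_; _-_; ⊥)
open import Data.Fin.Subset.Properties using (_⊆?_)
open import Data.Vec as V using (Vec; []; _∷_)
open import Data.Vec.Properties using (≡-dec)
open import Data.List as L using (List; []; _∷_; _++_; length; map; filterᵇ; upTo; allFin)
open import Data.Bool.ListAction using (any)
open import Data.Integer as ℤ using (ℤ; +_)
open import Data.Rational as ℚ using (ℚ; 0ℚ)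
open import Data.Product using (Σ; ∃; _×_; _,_)
open import Relation.Nullary using (¬_)
open import Relation.Nullary.Decidable using (⌊_⌋)
open import Relation.Binary.PropositionalEquality using (_≡_)
open import Algebra.Bundles using (CommutativeRing)

record Field (c ℓ : Level) : Set (lsuc (c ⊔ ℓ)) where
  field
    commutativeRing : CommutativeRing c ℓ
  open CommutativeRing commutativeRing public
  field
    0≉1     : ¬ (0# ≈ 1#)
    inverse : ∀ x → ¬ (x ≈ 0#) → ∃ λ y → (x * y) ≈ 1#

-- Finite combinatorics on the ground set Fin n.
-- A (candidate) simplicial complex on Fin n is a decidable family of
-- subsets; faces are the subsets G with K G ≡ true.

Complex : ℕ → Set
Complex n = Subset n → Bool

module _ {n : ℕ} where

  eqᵇ : Subset n → Subset n → Bool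
  eqᵇ G H = ⌊ ≡-dec B._≟_ G H ⌋

  subᵇ : Subset n → Subset n → Bool
  subᵇ G H = ⌊ G ⊆? H ⌋

  IsComplex : Complex n → Set
  IsComplex K = ∀ G H → H ⊆ G → K G ≡ true → K H ≡ true

  relᵇ : Complex n → Complex n → Subset n → Bool
  relᵇ Δ Γ G = Δ G ∧ not (Γ G)

  restrict : Complex n → Subset n → Complex n
  restrict K W G = K G ∧ subᵇ G W

  -- link lk_K(A) = {H : H ∪ A ∈ K, H ∩ A = ∅}  (void if A ∉ K)
  link : Complex n → Subset n → Complex n
  link K A H = K (H ∪ A) ∧ eqᵇ (H ∩ A) ⊥

allSubsets : (n : ℕ) → List (Subset n)
allSubsets zero    = [] ∷ []
allSubsets (suc n) = map (outside ∷_) (allSubsets n) ++ map (inside ∷_) (allSubsets n)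

count : ∀ {a} {A : Set a} → (A → Bool) → List A → ℕ
count p xs = length (filterᵇ p xs)

module _ {n : ℕ} where

  -- faces of (Δ,Γ) of cardinality j, and their number  (= f_{j-1}(Δ,Γ))
  facesCard : Complex n → Complex n → ℕ → List (Subset n)
  facesCard Δ Γ j = filterᵇ (λ G → relᵇ Δ Γ G ∧ (∣ G ∣ ≡ᵇ j)) (allSubsets n)

  fCard : Complex n → Complex n → ℕ → ℕ
  fCard Δ Γ j = length (facesCard Δ Γ j)

  cofaces : Complex n → Subset n → ℕ → ℕ
  cofaces K R k = count (λ F → K F ∧ (∣ F ∣ ≡ᵇ k) ∧ subᵇ R F) (allSubsets n)

  -- boundary of a pure complex K whose facets have cardinality k:
  -- the complex generated by the ridges (cardinality k-1) lying in
  -- exactly one facet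
  Bd : Complex n → ℕ → Complex n
  Bd K k G = any (λ R → K R ∧ (∣ R ∣ ≡ᵇ (k ∸ 1)) ∧ (cofaces K R k ≡ᵇ 1) ∧ subᵇ G R) (allSubsets n)

  HasDim : Complex n → ℕ → Set
  HasDim K d = (∃ λ G → K G ≡ true × ∣ G ∣ ≡ suc d) × (∀ G → K G ≡ true → ∣ G ∣ ≤ suc d)

  Pure : Complex n → ℕ → Set
  Pure K d = ∀ G → K G ≡ true → ∃ λ F → K F ≡ true × ∣ F ∣ ≡ suc d × G ⊆ F

  data Walk (K : Complex n) : Fin n → Fin n → Set where
    here : ∀ {u} → Walk K u u
    step : ∀ {u w x} → K (⁅ u ⁆ ∪ ⁅ w ⁆) ≡ true → Walk K w x → Walk K u x

  Connected : Complex n → Set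
  Connected K = ∀ u w → K ⁅ u ⁆ ≡ true → K ⁅ w ⁆ ≡ true → Walk K u w

  NormalPseudomanifold : Complex n → ℕ → Set
  NormalPseudomanifold K d =
    IsComplex K × HasDim K d × Pure K d
    × (∀ R → K R ≡ true → ∣ R ∣ ≡ d → cofaces K R (suc d) ≤ 2)
    × (∀ G → K G ≡ true → 1 ≤ ∣ G ∣ → ∣ G ∣ ≤ d ∸ 1 → Connected (link K G))

  HasBoundary : Complex n → ℕ → Set
  HasBoundary K d = ∃ λ R → K R ≡ true × ∣ R ∣ ≡ d × cofaces K R (suc d) ≡ 1

  -- stacked spheres whose simplices have cardinality e+1 (dimension e),
  -- realised on vertex subsets of Fin n (all relabellings are covered
  -- since the constructions are label-independent).
  data IsStacked (e : ℕ) : Complex n → Set where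
    simplexBd : ∀ K S → ∣ S ∣ ≡ suc e
              → (∀ G → K G ≡ (subᵇ G S ∧ not (eqᵇ G S)))
              → IsStacked e K
    connSum : ∀ K K₁ K₂ F → IsStacked e K₁ → IsStacked e K₂
            → ∣ F ∣ ≡ e → K₁ F ≡ true → K₂ F ≡ true
            → (∀ v → K₁ ⁅ v ⁆ ≡ true → K₂ ⁅ v ⁆ ≡ true → v ∈ F)
            → (∀ G → K G ≡ ((K₁ G ∨ K₂ G) ∧ not (eqᵇ G F)))
            → IsStacked e K

-- h- and g-numbers of (Δ,Γ) with dim(Δ,Γ) = D - 1, computed in ℤ.

module _ {n : ℕ} where

  signℤ : ℕ → ℤ
  signℤ zero    = + 1
  signℤ (suc k) = ℤ.- signℤ k

  sumℤ : List ℤ → ℤ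
  sumℤ = L.foldr ℤ._+_ (+ 0)

  hNum : Complex n → Complex n → ℕ → ℕ → ℤ
  hNum Δ Γ D j = sumℤ (map (λ i → signℤ (j ∸ i) ℤ.* (+ ((D ∸ i) C (D ∸ j))) ℤ.* (+ fCard Δ Γ i)) (upTo (suc j)))

  gNum : Complex n → Complex n → ℕ → ℕ → ℤ
  gNum Δ Γ D zero    = hNum Δ Γ D zero
  gNum Δ Γ D (suc j) = hNum Δ Γ D (suc j) ℤ.- hNum Δ Γ D j

-- Linear algebra over a field: chains are functions Subset n → Carrier.

module Lin {c ℓ} (𝔽 : Field c ℓ) (n : ℕ) where
  open Field 𝔽 using (Carrier; _≈_; _+_; _*_; 0#)

  Vect : Set c
  Vect = Subset n → Carrier

  ∑ : ∀ {r} → (Fin r → Carrier) → Carrier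
  ∑ {zero}  f = 0#
  ∑ {suc r} f = f zero + ∑ (λ i → f (suc i))

  Independent : ∀ {r} → (Fin r → Vect) → Set (c ⊔ ℓ)
  Independent {r} v = ∀ (a : Fin r → Carrier) → (∀ G → ∑ (λ i → a i * v i G) ≈ 0#) → ∀ i → a i ≈ 0#

  InjectiveFin : ∀ {r m} → (Fin r → Fin m) → Set
  InjectiveFin ι = ∀ i j → ι i ≡ ι j → i ≡ j

  HasRank : ∀ {m} → (Fin m → Vect) → ℕ → Set (c ⊔ ℓ)
  HasRank {m} v r =
    (Σ (Fin r → Fin m) λ ι → InjectiveFin ι × Independent (λ i → v (ι i)))
    × (∀ (ι : Fin (suc r) → Fin m) → InjectiveFin ι → ¬ Independent (λ i → v (ι i)))

  RankFunction : Set (c ⊔ ℓ)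
  RankFunction = Σ (List Vect → ℕ) λ rk → ∀ vs → HasRank (L.lookup vs) (rk vs)

divℕ : ℕ → ℕ → ℚ
divℕ a zero    = 0ℚ    -- never used: denominators are binomials C(n,k) with k ≤ n
divℕ a (suc b) = (+ a) ℚ./ suc b

sumℚ : List ℚ → ℚ
sumℚ = L.foldr ℚ._+_ 0ℚ

module Hom {c ℓ} (𝔽 : Field c ℓ) (n : ℕ) (rkF : Lin.RankFunction 𝔽 n) where
  open Field 𝔽 using (Carrier; 0#; 1#; -_)
  open Lin 𝔽 n

  rk : List Vect → ℕ
  rk = Data.Product.proj₁ rkF
    where import Data.Product

  sgn : ℕ → Carrier
  sgn zero    = 1#
  sgn (suc k) = - sgn k

  below : ∀ {m} → Subset m → Fin m → ℕ
  below (b ∷ F) zero    = 0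
  below (b ∷ F) (suc i) = (if b then 1 else 0) ℕ.+ below F i

  -- relative boundary of the face F in C(Δ)/C(Γ):
  -- ∂F = Σ_{i ∈ F} (-1)^{#{j ∈ F : j < i}} (F ∖ {i}), terms in Γ dropped
  bd : Complex n → Complex n → Subset n → Vect
  bd Δ Γ F G = ∑ (λ i → if V.lookup F i ∧ eqᵇ G (F - i) ∧ relᵇ Δ Γ G then sgn (below F i) else 0#)

  -- rank of ∂ : C_{j-1} → C_{j-2} (faces of cardinality j to j-1)
  rank∂ : Complex n → Complex n → ℕ → ℕ
  rank∂ Δ Γ j = rk (map (bd Δ Γ) (facesCard Δ Γ j))

  -- bettiCard Δ Γ j = b̃_{j-1}(Δ,Γ;𝔽)
  bettiCard : Complex n → Complex n → ℕ → ℕ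
  bettiCard Δ Γ j = (fCard Δ Γ j ∸ rank∂ Δ Γ j) ∸ rank∂ Δ Γ (suc j)

  -- σCard Δ Γ j = σ̃_{j-1}(Δ,Γ), with V = Fin n
  σCard : Complex n → Complex n → ℕ → ℚ
  σCard Δ Γ j = divℕ 1 (suc n) ℚ.*
    sumℚ (map (λ W → divℕ (bettiCard (restrict Δ W) (restrict Γ W) j) (n C ∣ W ∣)) (allSubsets n))

  μ : Complex n → Complex n → ℕ → ℚ
  μ Δ Γ i = sumℚ (map (λ v → if Δ ⁅ v ⁆ then σCard (link Δ ⁅ v ⁆) (link Γ ⁅ v ⁆) i else 0ℚ) (allFin n))

{-# OPTIONS --safe #-}

-- Since f₋₁(Δ,∂Δ) = 0, g₂(Δ,∂Δ) = f₁ - (d+1) f₀, and 2 f₁ is the sum over all vertices v of the number of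
-- vertices in lk_Δ(v) but not in lk_∂Δ(v); so both sides are sums over vertices, compared link by link.
-- For a link, σ̃₀ - σ̃₋₁ is an expectation over a random set W of vertices: of the number of vertices
-- of W minus the rank of the graph induced on W (minus 1 for interior v).  Let B be the set of boundary
-- vertices of the link, or any facet of it if v is interior, and identify the vertices of B.  The local
-- inequality then says that the expected rank of a link with k vertices outside B is at least
-- k (1/2 - 1/((d+1)(d+2))).
--
-- This bound is proved, by Fogelsanger's method, for minimal mod-2 (d-1)-chains Z with boundary in B.
-- Contract an edge uv with v ∈ B and u ∉ B, and pass to a minimal subchain of the image containing v; its
-- boundary still lies in B, and u and v have a set X of d-1 common neighbours.  By submodularity of the graphic
-- rank, averaged over the ways in which W can meet {u,v}, contraction lowers the expected rank by at least
-- 1/2 - P(u ∈ W, W misses {v} ∪ X), and that probability is 1/((d+1)(d+2)).  The vertices of Z lost by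
-- passing to the subchain are accounted for by the same bound with the other vertices added to B.
--
-- If equality holds for an interior vertex whose link is not the boundary of a simplex, the contraction is
-- tight for every W, which forces a set F of d vertices to separate the graph of the link.  The minimal cycle
-- splits along F into two minimal cycles, both tight, so by induction the link is a connected sum of two
-- stacked spheres.  Conversely, the expected rank is additive under gluing along F.

module Submission where

-- The weights |W|!(n-|W|)! come from a model: order the n vertices and a marker at random and let W
-- be the vertices before the marker. For u outside C, the event that W contains u and misses C says
-- that among these |C|+2 objects u is first and the marker second, with probability
-- 1/((|C|+1)(|C|+2)). For |C| = d the denominator is twice the binomial coefficient of the theorem.
-- It does not depend on n, so contracted vertices can stay in the ground set as isolated points.
-- Vertex links are not closed under edge contraction, which is why minimal chains replace them; and
-- since the graph need only contain the edges of the facets, monotonicity of the rank absorbs all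
-- discrepancies between the two. Minimality quantifies over all functions on subsets, so minimal
-- subchains are obtained only up to double negation; this suffices because the inequalities sought
-- are decidable statements about natural numbers. The field enters only through the rank of a
-- signed incidence matrix, which is the graphic rank over every field.

open import Defs

-- Finite subsets as Boolean vectors, and sums over them.

module Subsets where

  open import Data.Bool using (Bool; true; false; _∧_; _∨_; not; _xor_; if_then_else_)
  open import Data.Nat using (ℕ; zero; suc; _+_; _*_; _≤_; _<_; z≤n; s≤s)
  open import Data.Nat.Properties
  open import Data.Fin using (Fin; zero; suc)
  import Data.Fin.Properties as Finₚ
  open import Data.Fin.Subset using (Subset; ∣_∣)
  open import Data.Vec using ([]; _∷_; lookup; _[_]≔_)
  open import Data.Vec.Properties using (lookup∘update; lookup∘update′; []≔-commutes)
  open import Data.Product using (∃; _×_; _,_; proj₁; proj₂)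
  open import Data.Sum using (_⊎_; inj₁; inj₂)
  open import Data.Empty using (⊥-elim)
  open import Relation.Nullary using (¬_; yes; no)
  open import Relation.Nullary.Decidable using (⌊_⌋)
  open import Relation.Binary.PropositionalEquality using (_≡_; _≢_; refl; sym; trans; cong; cong₂; subst)
  open import Function using (_∘_)

  ∧⁻ : ∀ {a b} → a ∧ b ≡ true → a ≡ true × b ≡ true
  ∧⁻ {true} {true} refl = refl , refl

  ∧⁺ : ∀ {a b} → a ≡ true → b ≡ true → a ∧ b ≡ true
  ∧⁺ refl refl = refl

  ∨⁻ : ∀ {a b} → a ∨ b ≡ true → a ≡ true ⊎ b ≡ true
  ∨⁻ {true} _ = inj₁ refl
  ∨⁻ {false} e = inj₂ e

  ∨⁺ˡ : ∀ {a b} → a ≡ true → a ∨ b ≡ true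
  ∨⁺ˡ refl = refl

  ∨⁺ʳ : ∀ {a b} → b ≡ true → a ∨ b ≡ true
  ∨⁺ʳ {true} _ = refl
  ∨⁺ʳ {false} e = e

  t≢f : ∀ {a} {ℓ} {X : Set ℓ} → a ≡ true → a ≡ false → X
  t≢f refl ()

  not⁻ : ∀ {a} → not a ≡ true → a ≡ false
  not⁻ {false} _ = refl

  not⁺ : ∀ {a} → a ≡ false → not a ≡ true
  not⁺ refl = refl

  bool : (b : Bool) → b ≡ true ⊎ b ≡ false
  bool true = inj₁ refl
  bool false = inj₂ refl

  ≢true⇒false : ∀ {b} → ¬ (b ≡ true) → b ≡ false
  ≢true⇒false {true} h = ⊥-elim (h refl)
  ≢true⇒false {false} h = refl

  ⇔⇒≡ : ∀ {a b} → (a ≡ true → b ≡ true) → (b ≡ true → a ≡ true) → a ≡ b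
  ⇔⇒≡ {true} {b} f g = sym (f refl)
  ⇔⇒≡ {false} {true} f g = g refl
  ⇔⇒≡ {false} {false} f g = refl

  xor≡false : ∀ {a b} → a xor b ≡ false → a ≡ b
  xor≡false {true} {true} _ = refl
  xor≡false {false} {false} _ = refl

  𝟙 : Bool → ℕ
  𝟙 true = 1
  𝟙 false = 0

  𝟙≤1 : ∀ b → 𝟙 b ≤ 1
  𝟙≤1 true = ≤-refl
  𝟙≤1 false = z≤n

  𝟙-mono : ∀ {a b} → (a ≡ true → b ≡ true) → 𝟙 a ≤ 𝟙 b
  𝟙-mono {true} f rewrite f refl = ≤-refl
  𝟙-mono {false} f = z≤n

  module _ {n : ℕ} where

    infix 9 _!_
    opaque
      _!_ : Subset n → Fin n → Bool
      A ! x = lookup A x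

    opaque
      eqF : Fin n → Fin n → Bool
      eqF x y = ⌊ x Finₚ.≟ y ⌋

      eqF-refl : ∀ x → eqF x x ≡ true
      eqF-refl x with x Finₚ.≟ x
      ... | yes _ = refl
      ... | no ne = ⊥-elim (ne refl)

      eqF-≢ : ∀ {x y} → x ≢ y → eqF x y ≡ false
      eqF-≢ {x} {y} ne with x Finₚ.≟ y
      ... | yes p = ⊥-elim (ne p)
      ... | no _ = refl

      eqF⇒≡ : ∀ {x y} → eqF x y ≡ true → x ≡ y
      eqF⇒≡ {x} {y} e with x Finₚ.≟ y
      ... | yes p = p

    ≢⇐! : ∀ {A : Subset n} {x y} → A ! x ≡ true → A ! y ≡ false → x ≢ y
    ≢⇐! p q refl = t≢f p q

    infix 4 _⊑_
    _⊑_ : Subset n → Subset n → Set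
    A ⊑ B = ∀ x → A ! x ≡ true → B ! x ≡ true

    opaque
      unfolding _!_

      ins del : Fin n → Subset n → Subset n
      ins x A = A [ x ]≔ true
      del x A = A [ x ]≔ false

      ins-this : ∀ x A → ins x A ! x ≡ true
      ins-this x A = lookup∘update x A true

      ins-other : ∀ {x y} A → y ≢ x → ins x A ! y ≡ A ! y
      ins-other A ne = lookup∘update′ ne A true

      del-this : ∀ x A → del x A ! x ≡ false
      del-this x A = lookup∘update x A false

      del-other : ∀ {x y} A → y ≢ x → del x A ! y ≡ A ! y
      del-other A ne = lookup∘update′ ne A false

      ins-comm : ∀ x y A → ins x (ins y A) ≡ ins y (ins x A)
      ins-comm x y A with x Finₚ.≟ y
      ... | yes refl = refl
      ... | no ne = []≔-commutes A y x (ne ∘ sym)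

      ins-del-comm : ∀ {x y} A → x ≢ y → ins x (del y A) ≡ del y (ins x A)
      ins-del-comm {x} {y} A ne = []≔-commutes A y x (ne ∘ sym)

    ins-⊒ : ∀ x A → A ⊑ ins x A
    ins-⊒ x A y e with y Finₚ.≟ x
    ... | yes refl = ins-this x A
    ... | no ne = trans (ins-other A ne) e

    ins⁻ : ∀ {x A y} → ins x A ! y ≡ true → y ≡ x ⊎ A ! y ≡ true
    ins⁻ {x} {A} {y} e with y Finₚ.≟ x
    ... | yes p = inj₁ p
    ... | no ne = inj₂ (trans (sym (ins-other A ne)) e)

    del⁻ : ∀ {x A y} → del x A ! y ≡ true → y ≢ x × A ! y ≡ true
    del⁻ {x} {A} {y} e with y Finₚ.≟ x
    ... | yes refl = t≢f e (del-this x A)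
    ... | no ne = ne , trans (sym (del-other A ne)) e

    ins-lub : ∀ {x A B} → A ⊑ B → B ! x ≡ true → ins x A ⊑ B
    ins-lub h e y p with ins⁻ p
    ... | inj₁ refl = e
    ... | inj₂ q = h y q

    del-⊑ : ∀ x A → del x A ⊑ A
    del-⊑ x A y e = proj₂ (del⁻ {x} {A} e)

  opaque
    unfolding _!_ ins del

    ext : ∀ {n} {A B : Subset n} → (∀ x → A ! x ≡ B ! x) → A ≡ B
    ext {A = []} {[]} h = refl
    ext {A = a ∷ A} {b ∷ B} h = cong₂ _∷_ (h zero) (ext (h ∘ suc))

  module _ {n : ℕ} where

    ⊑-antisym : ∀ {A B : Subset n} → A ⊑ B → B ⊑ A → A ≡ B
    ⊑-antisym f g = ext λ x → ⇔⇒≡ (f x) (g x)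

    ins-del : ∀ {x} {A : Subset n} → A ! x ≡ true → ins x (del x A) ≡ A
    ins-del {x} {A} e = ext λ y → ptw y
      where
      ptw : ∀ y → ins x (del x A) ! y ≡ A ! y
      ptw y with y Finₚ.≟ x
      ... | yes refl = trans (ins-this x (del x A)) (sym e)
      ... | no ne = trans (ins-other (del x A) ne) (del-other A ne)

    del-ins : ∀ {x} {A : Subset n} → A ! x ≡ false → del x (ins x A) ≡ A
    del-ins {x} {A} e = ext λ y → ptw y
      where
      ptw : ∀ y → del x (ins x A) ! y ≡ A ! y
      ptw y with y Finₚ.≟ x
      ... | yes refl = trans (del-this x (ins x A)) (sym e)
      ... | no ne = trans (del-other (ins x A) ne) (ins-other A ne)

    ins-id : ∀ {x} {A : Subset n} → A ! x ≡ true → ins x A ≡ A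
    ins-id {x} {A} e = ⊑-antisym (ins-lub (λ _ p → p) e) (ins-⊒ x A)

  opaque
    unfolding _!_ ins del

    ∣ins∣ : ∀ {n} (A : Subset n) x → A ! x ≡ false → ∣ ins x A ∣ ≡ suc ∣ A ∣
    ∣ins∣ (false ∷ A) zero e = refl
    ∣ins∣ (false ∷ A) (suc x) e = ∣ins∣ A x e
    ∣ins∣ (true ∷ A) (suc x) e = cong suc (∣ins∣ A x e)

  ∣del∣ : ∀ {n} (A : Subset n) x → A ! x ≡ true → ∣ A ∣ ≡ suc ∣ del x A ∣
  ∣del∣ A x e = trans (cong ∣_∣ (sym (ins-del e))) (∣ins∣ (del x A) x (del-this x A))

  ΣF : ∀ {n} → (Fin n → ℕ) → ℕ
  ΣF {zero} f = 0
  ΣF {suc n} f = f zero + ΣF (f ∘ suc)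

  ΣF-cong : ∀ {n} {f g : Fin n → ℕ} → (∀ x → f x ≡ g x) → ΣF f ≡ ΣF g
  ΣF-cong {zero} h = refl
  ΣF-cong {suc n} h = cong₂ _+_ (h zero) (ΣF-cong (h ∘ suc))

  ΣF-mono : ∀ {n} {f g : Fin n → ℕ} → (∀ x → f x ≤ g x) → ΣF f ≤ ΣF g
  ΣF-mono {zero} h = z≤n
  ΣF-mono {suc n} h = +-mono-≤ (h zero) (ΣF-mono (h ∘ suc))

  +-swap : ∀ a b c d → (a + b) + (c + d) ≡ (a + c) + (b + d)
  +-swap a b c d = trans (+-assoc a b (c + d)) (trans (cong (a +_) (trans (sym (+-assoc b c d)) (trans (cong (_+ d) (+-comm b c)) (+-assoc c b d)))) (sym (+-assoc a c (b + d))))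

  ΣF-+ : ∀ {n} (f g : Fin n → ℕ) → ΣF (λ x → f x + g x) ≡ ΣF f + ΣF g
  ΣF-+ {zero} f g = refl
  ΣF-+ {suc n} f g = trans (cong (f zero + g zero +_) (ΣF-+ (f ∘ suc) (g ∘ suc))) (+-swap (f zero) (g zero) _ _)

  ΣF-0 : ∀ {n} {f : Fin n → ℕ} → (∀ x → f x ≡ 0) → ΣF f ≡ 0
  ΣF-0 {zero} h = refl
  ΣF-0 {suc n} h = cong₂ _+_ (h zero) (ΣF-0 (h ∘ suc))

  ΣF-* : ∀ {n} k (f : Fin n → ℕ) → ΣF (λ x → k * f x) ≡ k * ΣF f
  ΣF-* {zero} k f = sym (*-zeroʳ k)
  ΣF-* {suc n} k f = trans (cong (k * f zero +_) (ΣF-* k (f ∘ suc))) (sym (*-distribˡ-+ k (f zero) _))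

  ΣF-term : ∀ {n} (f : Fin n → ℕ) x → f x ≤ ΣF f
  ΣF-term f zero = m≤m+n _ _
  ΣF-term f (suc x) = ≤-trans (ΣF-term (f ∘ suc) x) (m≤n+m _ (f zero))

  opaque
    unfolding _!_ ins del

    card≡Σ : ∀ {n} (A : Subset n) → ∣ A ∣ ≡ ΣF (λ x → 𝟙 (A ! x))
    card≡Σ [] = refl
    card≡Σ (false ∷ A) = card≡Σ A
    card≡Σ (true ∷ A) = cong suc (card≡Σ A)

  ∣∣-mono : ∀ {n} {A B : Subset n} → A ⊑ B → ∣ A ∣ ≤ ∣ B ∣
  ∣∣-mono {A = A} {B} h = subst₂ _≤_ (sym (card≡Σ A)) (sym (card≡Σ B)) (ΣF-mono λ x → 𝟙-mono (h x))
    where open import Relation.Binary.PropositionalEquality using (subst₂)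

  ∣∣≡0 : ∀ {n} {A : Subset n} → ∣ A ∣ ≡ 0 → ∀ x → A ! x ≡ false
  ∣∣≡0 {A = A} e x = ≢true⇒false λ p → n≮0 (subst (1 ≤_) (trans (sym (card≡Σ A)) e) (≤-trans (≤-reflexive (cong 𝟙 (sym p))) (ΣF-term (λ y → 𝟙 (A ! y)) x)))

  opaque
    unfolding _!_ ins del

    ∣∣>0 : ∀ {n} (A : Subset n) → 0 < ∣ A ∣ → ∃ λ x → A ! x ≡ true
    ∣∣>0 [] ()
    ∣∣>0 (true ∷ A) _ = zero , refl
    ∣∣>0 (false ∷ A) p with ∣∣>0 A p
    ... | x , e = suc x , e

  ∈⇒∣∣>0 : ∀ {n} {A : Subset n} {x} → A ! x ≡ true → 0 < ∣ A ∣
  ∈⇒∣∣>0 {A = A} {x} e = subst (0 <_) (sym (∣del∣ A x e)) (s≤s z≤n)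

  opaque
    unfolding _!_ ins del

    ⊑∧card⇒≡ : ∀ {n} {A B : Subset n} → A ⊑ B → ∣ B ∣ ≤ ∣ A ∣ → A ≡ B
    ⊑∧card⇒≡ {A = []} {[]} h c = refl
    ⊑∧card⇒≡ {A = false ∷ A} {false ∷ B} h c = cong (false ∷_) (⊑∧card⇒≡ (h ∘ suc) c)
    ⊑∧card⇒≡ {A = false ∷ A} {true ∷ B} h c = ⊥-elim (<-irrefl refl (≤-trans c (∣∣-mono {A = A} {B} (h ∘ suc))))
    ⊑∧card⇒≡ {A = true ∷ A} {false ∷ B} h c with h zero refl
    ... | ()
    ⊑∧card⇒≡ {A = true ∷ A} {true ∷ B} h (s≤s c) = cong (true ∷_) (⊑∧card⇒≡ (h ∘ suc) c)

  findF : ∀ {n} (p : Fin n → Bool) → (∃ λ x → p x ≡ true) ⊎ (∀ x → p x ≡ false)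
  findF {zero} p = inj₂ λ ()
  findF {suc n} p with bool (p zero) | findF (p ∘ suc)
  ... | inj₁ e | _ = inj₁ (zero , e)
  ... | inj₂ e | inj₁ (x , e′) = inj₁ (suc x , e′)
  ... | inj₂ e | inj₂ h = inj₂ λ { zero → e ; (suc x) → h x }

  card<⇒∃ : ∀ {n} (A B : Subset n) → ∣ A ∣ < ∣ B ∣ → ∃ λ x → B ! x ≡ true × A ! x ≡ false
  card<⇒∃ A B lt with findF (λ x → B ! x ∧ not (A ! x))
  ... | inj₁ (x , e) = x , proj₁ (∧⁻ e) , not⁻ (proj₂ (∧⁻ e))
  ... | inj₂ h = ⊥-elim (<⇒≱ lt (∣∣-mono sub))
    where
    sub : B ⊑ A
    sub x p with bool (A ! x)
    ... | inj₁ q = q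
    ... | inj₂ q = t≢f (∧⁺ p (not⁺ q)) (h x)

  findS : ∀ {n} (p : Subset n → Bool) → (∃ λ F → p F ≡ true) ⊎ (∀ F → p F ≡ false)
  findS {zero} p with bool (p [])
  ... | inj₁ e = inj₁ ([] , e)
  ... | inj₂ e = inj₂ λ { [] → e }
  findS {suc n} p with findS (p ∘ (false ∷_)) | findS (p ∘ (true ∷_))
  ... | inj₁ (F , e) | _ = inj₁ (_ , e)
  ... | inj₂ _ | inj₁ (F , e) = inj₁ (_ , e)
  ... | inj₂ h | inj₂ h′ = inj₂ λ { (false ∷ F) → h F ; (true ∷ F) → h′ F }

  anyS : ∀ {n} → (Subset n → Bool) → Bool
  anyS p with findS p
  ... | inj₁ _ = true
  ... | inj₂ _ = false

  anyS⁻ : ∀ {n} {p : Subset n → Bool} → anyS p ≡ true → ∃ λ F → p F ≡ true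
  anyS⁻ {p = p} e with findS p
  ... | inj₁ h = h

  anyS⁺ : ∀ {n} {p : Subset n → Bool} F → p F ≡ true → anyS p ≡ true
  anyS⁺ {p = p} F e with findS p
  ... | inj₁ _ = refl
  ... | inj₂ h = t≢f e (h F)

  ΣS : ∀ {n} → (Subset n → ℕ) → ℕ
  ΣS {zero} f = f []
  ΣS {suc n} f = ΣS (f ∘ (false ∷_)) + ΣS (f ∘ (true ∷_))

  ΣS-cong : ∀ {n} {f g : Subset n → ℕ} → (∀ F → f F ≡ g F) → ΣS f ≡ ΣS g
  ΣS-cong {zero} h = h []
  ΣS-cong {suc n} h = cong₂ _+_ (ΣS-cong (h ∘ (false ∷_))) (ΣS-cong (h ∘ (true ∷_)))

  ΣS-mono : ∀ {n} {f g : Subset n → ℕ} → (∀ F → f F ≤ g F) → ΣS f ≤ ΣS g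
  ΣS-mono {zero} h = h []
  ΣS-mono {suc n} h = +-mono-≤ (ΣS-mono (h ∘ (false ∷_))) (ΣS-mono (h ∘ (true ∷_)))

  ΣS-+ : ∀ {n} (f g : Subset n → ℕ) → ΣS (λ F → f F + g F) ≡ ΣS f + ΣS g
  ΣS-+ {zero} f g = refl
  ΣS-+ {suc n} f g = trans (cong₂ _+_ (ΣS-+ (f ∘ (false ∷_)) (g ∘ (false ∷_))) (ΣS-+ (f ∘ (true ∷_)) (g ∘ (true ∷_)))) (+-swap (ΣS (f ∘ (false ∷_))) _ _ _)

  ΣS-* : ∀ {n} k (f : Subset n → ℕ) → ΣS (λ x → k * f x) ≡ k * ΣS f
  ΣS-* {zero} k f = refl
  ΣS-* {suc n} k f = trans (cong₂ _+_ (ΣS-* k (f ∘ (false ∷_))) (ΣS-* k (f ∘ (true ∷_)))) (sym (*-distribˡ-+ k (ΣS (f ∘ (false ∷_))) _))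

  ΣS-0 : ∀ {n} {f : Subset n → ℕ} → (∀ F → f F ≡ 0) → ΣS f ≡ 0
  ΣS-0 {zero} h = h []
  ΣS-0 {suc n} h = cong₂ _+_ (ΣS-0 (h ∘ (false ∷_))) (ΣS-0 (h ∘ (true ∷_)))

  ΣS-ΣF : ∀ {n m} (f : Subset n → Fin m → ℕ) → ΣS (λ W → ΣF (f W)) ≡ ΣF (λ x → ΣS (λ W → f W x))
  ΣS-ΣF {n} {zero} f = ΣS-0 {n} (λ _ → refl)
  ΣS-ΣF {n} {suc m} f = trans (ΣS-+ (λ W → f W zero) (λ W → ΣF (f W ∘ suc))) (cong (ΣS (λ W → f W zero) +_) (ΣS-ΣF (λ W x → f W (suc x))))

  ΣS-< : ∀ {n} {f g : Subset n → ℕ} → (∀ F → f F ≤ g F) → ∀ F → f F < g F → ΣS f < ΣS g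
  ΣS-< {zero} h [] lt = lt
  ΣS-< {suc n} h (false ∷ F) lt = +-mono-<-≤ (ΣS-< (h ∘ (false ∷_)) F lt) (ΣS-mono (h ∘ (true ∷_)))
  ΣS-< {suc n} h (true ∷ F) lt = +-mono-≤-< (ΣS-mono (h ∘ (false ∷_))) (ΣS-< (h ∘ (true ∷_)) F lt)

  -- Each set without `u` collects its own term and that of its extension by `u`. Sets containing
  -- `u` are kept with value 0, so that the sum still ranges over all subsets and pivots can be
  -- iterated.
  pair-up : ∀ {n} → Fin n → (Subset n → ℕ) → Subset n → ℕ
  pair-up u f W = if W ! u then 0 else f W + f (ins u W)

  opaque
    unfolding _!_ ins del

    ΣS-pivot : ∀ {n} (u : Fin n) (f : Subset n → ℕ) → ΣS f ≡ ΣS (pair-up u f)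
    ΣS-pivot {suc n} zero f = sym (trans (cong₂ _+_ (ΣS-+ (f ∘ (false ∷_)) (f ∘ (true ∷_))) (ΣS-0 {n} (λ _ → refl))) (+-identityʳ _))
    ΣS-pivot {suc n} (suc u) f = cong₂ _+_ (ΣS-pivot u (f ∘ (false ∷_))) (ΣS-pivot u (f ∘ (true ∷_)))

-- Graphic rank computed by merging vertex labels.

module UnionFind where

  open Subsets
  open import Data.Bool using (Bool; true; false; _∧_; if_then_else_)
  open import Data.Nat using (ℕ; zero; suc; _+_; _≤_; z≤n)
  open import Data.Nat.Properties
  open import Data.Fin using (Fin; zero; suc)
  import Data.Fin.Properties as Finₚ
  open import Data.Product using (_×_; _,_; proj₁; proj₂)
  open import Data.Sum using (_⊎_; inj₁; inj₂)
  open import Data.Empty using (⊥-elim)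
  open import Data.Unit using (⊤; tt)
  open import Data.List using (List; []; _∷_; _++_; length; filterᵇ; allFin; cartesianProduct)
  open import Data.List.Membership.Propositional using () renaming (_∈_ to _∈ˡ_)
  open import Data.List.Membership.Propositional.Properties using (∈-++⁺ʳ; ∈-++⁻; ∈-filter⁺; ∈-filter⁻; ∈-cartesianProduct⁺; ∈-allFin)
  open import Data.List.Relation.Unary.Any using () renaming (here to hereˡ; there to thereˡ)
  open import Data.Fin.Subset using (Subset)
  open import Relation.Nullary using (yes; no)
  open import Relation.Binary.PropositionalEquality using (_≡_; _≢_; refl; sym; trans; cong; cong₂; subst; module ≡-Reasoning)
  open import Function using (_∘_)

  module _ {n : ℕ} where

    Label Labeling Edge : Set
    Label = Fin (suc n)
    Labeling = Fin n → Label
    Edge = Fin n × Fin n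

    source target : Label → Label → Label
    source p zero = p
    source p (suc q) = suc q
    target p zero = zero
    target p (suc q) = p

    relabel : Label → Label → Label → Label
    relabel p q r with r Finₚ.≟ source p q
    ... | yes _ = target p q
    ... | no _ = r

    -- The label zero marks the root class and is never renamed unless it equals its replacement.
    merge : Labeling → Edge → Labeling
    merge L (c , d) x = relabel (L c) (L d) (L x)

    mergeAll : Labeling → List Edge → Labeling
    mergeAll L [] = L
    mergeAll L (e ∷ E) = mergeAll (merge L e) E

    differ : Label → Label → ℕ
    differ p q with p Finₚ.≟ q
    ... | yes _ = 0
    ... | no _ = 1

    -- The rank of the edges in the cycle matroid of the graph with each class of L contracted.
    ρ : Labeling → List Edge → ℕ
    ρ L [] = 0
    ρ L ((c , d) ∷ E) = differ (L c) (L d) + ρ (merge L (c , d)) E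

    infix 4 _≼_
    -- Label values carry no meaning beyond the partition they induce, so labelings are compared by
    -- their kernels: the partition of `L` refines that of `M`.
    _≼_ : Labeling → Labeling → Set
    L ≼ M = ∀ x y → L x ≡ L y → M x ≡ M y

    differ-≡ : ∀ {p q} → p ≡ q → differ p q ≡ 0
    differ-≡ {p} {q} e with p Finₚ.≟ q
    ... | yes _ = refl
    ... | no ne = ⊥-elim (ne e)

    differ-≢ : ∀ {p q} → p ≢ q → differ p q ≡ 1
    differ-≢ {p} {q} ne with p Finₚ.≟ q
    ... | yes e = ⊥-elim (ne e)
    ... | no _ = refl

    differ≤1 : ∀ p q → differ p q ≤ 1
    differ≤1 p q with p Finₚ.≟ q
    ... | yes _ = z≤n
    ... | no _ = ≤-refl

    relabel-source : ∀ p q → relabel p q (source p q) ≡ target p q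
    relabel-source p q with source p q Finₚ.≟ source p q
    ... | yes _ = refl
    ... | no ne = ⊥-elim (ne refl)

    relabel-target : ∀ p q → relabel p q (target p q) ≡ target p q
    relabel-target p q with target p q Finₚ.≟ source p q
    ... | yes _ = refl
    ... | no _ = refl

    relabel-joins : ∀ p q → relabel p q p ≡ relabel p q q
    relabel-joins p zero = trans (relabel-source p zero) (sym (relabel-target p zero))
    relabel-joins p (suc q) = trans (relabel-target p (suc q)) (sym (relabel-source p (suc q)))

    relabel-id : ∀ p q r → p ≡ q → relabel p q r ≡ r
    relabel-id p q r e with r Finₚ.≟ source p q
    relabel-id p zero r e | yes refl = sym e
    relabel-id p (suc q) r e | yes refl = e
    ... | no _ = refl

    relabel⁻ : ∀ p q r s → relabel p q r ≡ relabel p q s → r ≡ s ⊎ (r ≡ p × s ≡ q) ⊎ (r ≡ q × s ≡ p)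
    relabel⁻ p q r s e with r Finₚ.≟ source p q | s Finₚ.≟ source p q
    ... | yes a | yes b = inj₁ (trans a (sym b))
    relabel⁻ p zero r s e | yes a | no b = inj₂ (inj₁ (a , sym e))
    relabel⁻ p (suc q) r s e | yes a | no b = inj₂ (inj₂ (a , sym e))
    relabel⁻ p zero r s e | no a | yes b = inj₂ (inj₂ (e , b))
    relabel⁻ p (suc q) r s e | no a | yes b = inj₂ (inj₁ (e , b))
    ... | no a | no b = inj₁ e

    ≼-refl : ∀ {L} → L ≼ L
    ≼-refl x y e = e

    ≼-trans : ∀ {L M N} → L ≼ M → M ≼ N → L ≼ N
    ≼-trans f g x y e = g x y (f x y e)

    merge-≽ : ∀ L e → L ≼ merge L e
    merge-≽ L (c , d) x y e = cong (relabel (L c) (L d)) e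

    merge-joins : ∀ L c d → merge L (c , d) c ≡ merge L (c , d) d
    merge-joins L c d = relabel-joins (L c) (L d)

    -- Kernels are compared on a set of vertices carrying all edges involved.
    mergeOn : ∀ {L M : Labeling} {c d} (P : Fin n → Set) → P c → P d
      → (∀ x y → P x → P y → L x ≡ L y → M x ≡ M y) → M c ≡ M d
      → ∀ x y → P x → P y → merge L (c , d) x ≡ merge L (c , d) y → M x ≡ M y
    mergeOn {L} {M} {c} {d} P Pc Pd h e x y Px Py eq with relabel⁻ (L c) (L d) (L x) (L y) eq
    ... | inj₁ p = h x y Px Py p
    ... | inj₂ (inj₁ (p , q)) = trans (h x c Px Pc p) (trans e (sym (h y d Py Pd q)))
    ... | inj₂ (inj₂ (p , q)) = trans (h x d Px Pd p) (trans (sym e) (sym (h y c Py Pc q)))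

    merge-least : ∀ {L M c d} → L ≼ M → M c ≡ M d → merge L (c , d) ≼ M
    merge-least h e x y = mergeOn (λ _ → ⊤) tt tt (λ x y _ _ → h x y) e x y tt tt

    -- An edge inside a class of the finer partition is inside a class of the coarser one, and
    -- refinement survives merging the same edge in both. The predicate `P` confines the comparison
    -- to vertices that the edges touch, which later allows two choices of `B` to be compared inside
    -- `W` only.
    ρ-antiOn : ∀ (P : Fin n → Set) {L M} E → (∀ {c d} → (c , d) ∈ˡ E → P c × P d)
      → (∀ x y → P x → P y → L x ≡ L y → M x ≡ M y) → ρ M E ≤ ρ L E
    ρ-antiOn P [] PE h = z≤n
    ρ-antiOn P {L} {M} ((c , d) ∷ E) PE h = +-mono-≤ first (ρ-antiOn P E (PE ∘ thereˡ) h′)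
      where
      Pcd = PE (hereˡ refl)
      first : differ (M c) (M d) ≤ differ (L c) (L d)
      first with L c Finₚ.≟ L d
      ... | yes e = ≤-reflexive (differ-≡ (h c d (proj₁ Pcd) (proj₂ Pcd) e))
      ... | no _ = differ≤1 (M c) (M d)
      h′ : ∀ x y → P x → P y → merge L (c , d) x ≡ merge L (c , d) y → merge M (c , d) x ≡ merge M (c , d) y
      h′ = mergeOn P (proj₁ Pcd) (proj₂ Pcd) (λ x y Px Py e → merge-≽ M (c , d) x y (h x y Px Py e)) (merge-joins M c d)

    ρ-anti : ∀ {L M} E → L ≼ M → ρ M E ≤ ρ L E
    ρ-anti E h = ρ-antiOn (λ _ → ⊤) E (λ _ → tt , tt) (λ x y _ _ → h x y)

    mergeAll-≽ : ∀ L E → L ≼ mergeAll L E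
    mergeAll-≽ L [] = ≼-refl {L}
    mergeAll-≽ L (e ∷ E) = ≼-trans {L} {merge L e} {mergeAll (merge L e) E} (merge-≽ L e) (mergeAll-≽ (merge L e) E)

    mergeAll-joins : ∀ L E {c d} → (c , d) ∈ˡ E → mergeAll L E c ≡ mergeAll L E d
    mergeAll-joins L ((c , d) ∷ E) (hereˡ refl) = mergeAll-≽ (merge L (c , d)) E c d (merge-joins L c d)
    mergeAll-joins L (e ∷ E) (thereˡ m) = mergeAll-joins (merge L e) E m

    -- With `mergeAll-≽` and `mergeAll-joins` this makes `mergeAll` the join of the starting
    -- partition with the edges. A labeling `M` that is constant along the edges thus certifies what
    -- does not get joined.
    mergeAll-least : ∀ {L M} E → L ≼ M → (∀ {c d} → (c , d) ∈ˡ E → M c ≡ M d) → mergeAll L E ≼ M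
    mergeAll-least [] h j = h
    mergeAll-least {L} {M} ((c , d) ∷ E) h j = mergeAll-least {merge L (c , d)} {M} E (merge-least {L} {M} h (j (hereˡ refl))) (j ∘ thereˡ)

    ρ-++ : ∀ L E F → ρ L (E ++ F) ≡ ρ L E + ρ (mergeAll L E) F
    ρ-++ L [] F = refl
    ρ-++ L ((c , d) ∷ E) F = trans (cong (differ (L c) (L d) +_) (ρ-++ (merge L (c , d)) E F)) (sym (+-assoc (differ (L c) (L d)) _ _))

    ρ≤length : ∀ L E → ρ L E ≤ length E
    ρ≤length L [] = z≤n
    ρ≤length L ((c , d) ∷ E) = +-mono-≤ (differ≤1 (L c) (L d)) (ρ≤length (merge L (c , d)) E)

    ρ-≈ : ∀ {L M} E → L ≼ M → M ≼ L → ρ L E ≡ ρ M E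
    ρ-≈ {L} {M} E f g = ≤-antisym (ρ-anti {M} {L} E g) (ρ-anti {L} {M} E f)

    ρ-0 : ∀ L E → (∀ {c d} → (c , d) ∈ˡ E → L c ≡ L d) → ρ L E ≡ 0
    ρ-0 L [] h = refl
    ρ-0 L ((c , d) ∷ E) h = cong₂ _+_ (differ-≡ (h (hereˡ refl)))
      (ρ-0 (merge L (c , d)) E λ m → merge-≽ L (c , d) _ _ (h (thereˡ m)))

    merge-id : ∀ {L c d} → L c ≡ L d → merge L (c , d) ≼ L
    merge-id {L} e = merge-least {L} {L} (≼-refl {L}) e

    merge-comm-≼ : ∀ L e f → merge (merge L e) f ≼ merge (merge L f) e
    merge-comm-≼ L (a , b) (c , d) = merge-least {merge L (a , b)} {M}
        (merge-least {L} {M} (≼-trans {L} {merge L (c , d)} {M} (merge-≽ L (c , d)) (merge-≽ (merge L (c , d)) (a , b))) (merge-joins (merge L (c , d)) a b))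
        (merge-≽ (merge L (c , d)) (a , b) c d (merge-joins L c d))
      where M = merge (merge L (c , d)) (a , b)

    -- The exchange property of the cycle matroid.
    exchange : ∀ L a b c d → L a ≢ L b → L c ≢ L d
      → merge L (a , b) c ≡ merge L (a , b) d → merge L (c , d) a ≡ merge L (c , d) b
    exchange L a b c d ne ne′ e with relabel⁻ (L a) (L b) (L c) (L d) e
    ... | inj₁ p = ⊥-elim (ne′ p)
    ... | inj₂ (inj₁ (p , q)) = trans (merge-≽ L (c , d) a c (sym p)) (trans (merge-joins L c d) (merge-≽ L (c , d) d b q))
    ... | inj₂ (inj₂ (p , q)) = trans (merge-≽ L (c , d) a d (sym q)) (trans (sym (merge-joins L c d)) (merge-≽ L (c , d) c b p))

    -- Two edges have the same total rank in either order. The case that needs `exchange` is the one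
    -- where both join new classes: after one of them the other is closed in both orders or in
    -- neither.
    differ-exchange : ∀ L a b c d → differ (L a) (L b) + differ (merge L (a , b) c) (merge L (a , b) d)
      ≡ differ (L c) (L d) + differ (merge L (c , d) a) (merge L (c , d) b)
    differ-exchange L a b c d with L a Finₚ.≟ L b | L c Finₚ.≟ L d
    ... | yes p | yes q = trans (differ-≡ (merge-≽ L (a , b) c d q)) (sym (differ-≡ (merge-≽ L (c , d) a b p)))
    ... | yes p | no q = trans (differ-≢ (λ e → q (merge-id {L} {a} {b} p c d e))) (cong suc (sym (differ-≡ (merge-≽ L (c , d) a b p))))
    ... | no p | yes q = trans (cong suc (differ-≡ (merge-≽ L (a , b) c d q))) (sym (differ-≢ (λ e → p (merge-id {L} {c} {d} q a b e))))
    ... | no p | no q with merge L (a , b) c Finₚ.≟ merge L (a , b) d | merge L (c , d) a Finₚ.≟ merge L (c , d) b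
    ...   | yes _ | yes _ = refl
    ...   | no _ | no _ = refl
    ...   | yes r | no s = ⊥-elim (s (exchange L a b c d p q r))
    ...   | no r | yes s = ⊥-elim (r (exchange L c d a b q p s))

    ρ-∷ʳ : ∀ L e E → ρ L (e ∷ E) ≡ ρ L (E ++ e ∷ [])
    ρ-∷ʳ L e [] = refl
    ρ-∷ʳ L e@(a , b) (f@(c , d) ∷ E) = begin
      differ (L a) (L b) + (differ (L′ c) (L′ d) + ρ (merge L′ f) E) ≡⟨ sym (+-assoc (differ (L a) (L b)) _ _) ⟩
      differ (L a) (L b) + differ (L′ c) (L′ d) + ρ (merge L′ f) E
        ≡⟨ cong₂ _+_ (differ-exchange L a b c d) (ρ-≈ {merge L′ f} {merge L″ e} E (merge-comm-≼ L e f) (merge-comm-≼ L f e)) ⟩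
      differ (L c) (L d) + differ (L″ a) (L″ b) + ρ (merge L″ e) E ≡⟨ +-assoc (differ (L c) (L d)) _ _ ⟩
      differ (L c) (L d) + ρ L″ (e ∷ E) ≡⟨ cong (differ (L c) (L d) +_) (ρ-∷ʳ L″ e E) ⟩
      differ (L c) (L d) + ρ L″ (E ++ e ∷ []) ∎
      where
      open ≡-Reasoning
      L′ = merge L e
      L″ = merge L f

    -- One edge at a time is rotated to the end by `ρ-∷ʳ`; this frees the greedy count from the
    -- order of the list.
    ρ-swap : ∀ L E F → ρ L (E ++ F) ≡ ρ L (F ++ E)
    ρ-swap L [] F = cong (ρ L) (sym (++-identityʳ F))
      where open import Data.List.Properties using (++-identityʳ)
    ρ-swap L (e ∷ E) F = begin
      ρ L (e ∷ (E ++ F)) ≡⟨ ρ-∷ʳ L e (E ++ F) ⟩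
      ρ L ((E ++ F) ++ e ∷ []) ≡⟨ cong (ρ L) (++-assoc E F (e ∷ [])) ⟩
      ρ L (E ++ (F ++ e ∷ [])) ≡⟨ ρ-swap L E (F ++ e ∷ []) ⟩
      ρ L ((F ++ e ∷ []) ++ E) ≡⟨ cong (ρ L) (++-assoc F (e ∷ []) E) ⟩
      ρ L (F ++ e ∷ E) ∎
      where
      open ≡-Reasoning
      open import Data.List.Properties using (++-assoc)

    Spans : Labeling → List Edge → List Edge → Set
    Spans L E F = ∀ {c d} → (c , d) ∈ˡ F → mergeAll L E c ≡ mergeAll L E d

    -- Count `F ++ E` and `E ++ F`: the first is at least the rank of `F`, and in the second `F`
    -- contributes nothing after `E`.
    ρ-span : ∀ L E F → Spans L E F → ρ L F ≤ ρ L E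
    ρ-span L E F s = begin
      ρ L F ≤⟨ m≤m+n _ _ ⟩
      ρ L F + ρ (mergeAll L F) E ≡⟨ sym (ρ-++ L F E) ⟩
      ρ L (F ++ E) ≡⟨ ρ-swap L F E ⟩
      ρ L (E ++ F) ≡⟨ ρ-++ L E F ⟩
      ρ L E + ρ (mergeAll L E) F ≡⟨ cong (ρ L E +_) (ρ-0 (mergeAll L E) F s) ⟩
      ρ L E + 0 ≡⟨ +-identityʳ _ ⟩
      ρ L E ∎
      where open ≤-Reasoning

    ρ-⊆ : ∀ L {E F} → (∀ {e} → e ∈ˡ F → e ∈ˡ E) → ρ L F ≤ ρ L E
    ρ-⊆ L {E} {F} s = ρ-span L E F (λ m → mergeAll-joins L E (s m))

    -- The matroid identity r(E) = r(F) + r(E/F) for F inside E, where the contraction of `F` is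
    -- realised by starting from the labeling `mergeAll L F`.
    ρ-absorb : ∀ L {E F} → (∀ {e} → e ∈ˡ F → e ∈ˡ E) → ρ L E ≡ ρ L F + ρ (mergeAll L F) E
    ρ-absorb L {E} {F} s = trans (≤-antisym
        (ρ-⊆ L (∈-++⁺ʳ F)) (ρ-⊆ L (λ m → case (∈-++⁻ F m)))) (ρ-++ L F E)
      where
      case : ∀ {e} → e ∈ˡ F ⊎ e ∈ˡ E → e ∈ˡ E
      case (inj₁ m) = s m
      case (inj₂ m) = m

    -- Contracting `C` merges no more than contracting `A`, so `B` keeps at least as much rank over
    -- `C` as over `A`. Concatenation plays the part of the union, and any list contained in both
    -- that of the intersection.
    ρ-submodular : ∀ L {A B C} → (∀ {e} → e ∈ˡ C → e ∈ˡ A) → (∀ {e} → e ∈ˡ C → e ∈ˡ B)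
      → ρ L (A ++ B) + ρ L C ≤ ρ L A + ρ L B
    ρ-submodular L {A} {B} {C} CA CB = begin
      ρ L (A ++ B) + ρ L C ≡⟨ cong (_+ ρ L C) (ρ-++ L A B) ⟩
      ρ L A + ρ (mergeAll L A) B + ρ L C ≡⟨ +-assoc (ρ L A) _ _ ⟩
      ρ L A + (ρ (mergeAll L A) B + ρ L C) ≤⟨ +-monoʳ-≤ (ρ L A) (+-monoˡ-≤ (ρ L C) (ρ-anti {mergeAll L C} {mergeAll L A} B lem)) ⟩
      ρ L A + (ρ (mergeAll L C) B + ρ L C) ≡⟨ cong (ρ L A +_) (+-comm _ (ρ L C)) ⟩
      ρ L A + (ρ L C + ρ (mergeAll L C) B) ≡⟨ cong (ρ L A +_) (sym (ρ-absorb L CB)) ⟩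
      ρ L A + ρ L B ∎
      where
      open ≤-Reasoning
      lem : mergeAll L C ≼ mergeAll L A
      lem = mergeAll-least {L} {mergeAll L A} C (mergeAll-≽ L A) (λ m → mergeAll-joins L A (CA m))

    -- The classes of lab B are B itself (the root class) and singletons.
    opaque
      lab : Subset n → Labeling
      lab B x = if B ! x then zero else suc x

      lab⁻ : ∀ B x y → lab B x ≡ lab B y → x ≡ y ⊎ (B ! x ≡ true × B ! y ≡ true)
      lab⁻ B x y e with B ! x | B ! y
      ... | true | true = inj₂ (refl , refl)
      ... | false | false = inj₁ (Finₚ.suc-injective e)

      lab-in : ∀ {B x y} → B ! x ≡ true → B ! y ≡ true → lab B x ≡ lab B y
      lab-in {B} {x} {y} p q rewrite p | q = refl

    opaque
      unfolding lab

      lab-root : ∀ {B x} → B ! x ≡ true → lab B x ≡ zero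
      lab-root p rewrite p = refl

      lab-out : ∀ {B x} → B ! x ≡ false → lab B x ≡ suc x
      lab-out p rewrite p = refl

    lab-least : ∀ {B M} → (∀ x y → B ! x ≡ true → B ! y ≡ true → M x ≡ M y) → lab B ≼ M
    lab-least {B} h x y e with lab⁻ B x y e
    ... | inj₁ refl = refl
    ... | inj₂ (p , q) = h x y p q

    lab-mono : ∀ {B B′} → B ⊑ B′ → lab B ≼ lab B′
    lab-mono {B} {B′} h = lab-least {B} {lab B′} λ x y p q → lab-in {B′} (h x p) (h y q)

    lab-antiOn : ∀ {B B′} W E → (∀ {c d} → (c , d) ∈ˡ E → W ! c ≡ true × W ! d ≡ true)
      → (∀ x → W ! x ≡ true → B ! x ≡ true → B′ ! x ≡ true) → ρ (lab B′) E ≤ ρ (lab B) E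
    lab-antiOn {B} {B′} W E WE h = ρ-antiOn (λ x → W ! x ≡ true) {lab B} {lab B′} E WE
      λ { x y Wx Wy e → lem x y Wx Wy (lab⁻ B x y e) }
      where
      lem : ∀ x y → W ! x ≡ true → W ! y ≡ true → x ≡ y ⊎ (B ! x ≡ true × B ! y ≡ true) → lab B′ x ≡ lab B′ y
      lem x .x _ _ (inj₁ refl) = refl
      lem x y Wx Wy (inj₂ (p , q)) = lab-in {B′} (h x Wx p) (h y Wy q)

    Graph : Set
    Graph = Fin n → Fin n → Bool

    Symm : Graph → Set
    Symm G = ∀ {x y} → G x y ≡ true → G y x ≡ true

    opaque
      -- Both orientations of an edge, and loops, occur in this list. They leave `ρ` unchanged,
      -- because an edge counts only when it joins two different classes.
      edges : Graph → Subset n → List Edge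
      edges G W = filterᵇ (λ e → W ! proj₁ e ∧ W ! proj₂ e ∧ G (proj₁ e) (proj₂ e)) (cartesianProduct (allFin n) (allFin n))

      edges⁺ : ∀ {G W x y} → W ! x ≡ true → W ! y ≡ true → G x y ≡ true → (x , y) ∈ˡ edges G W
      edges⁺ {G} {W} {x} {y} p q r = ∈-filter⁺ _ (∈-cartesianProduct⁺ (∈-allFin x) (∈-allFin y)) (subst B.T (sym (∧⁺ p (∧⁺ q r))) tt)
        where import Data.Bool as B

      edges⁻ : ∀ {G W x y} → (x , y) ∈ˡ edges G W → W ! x ≡ true × W ! y ≡ true × G x y ≡ true
      edges⁻ {G} {W} {x} {y} m with ∧⁻ (Equivalence.to T-≡ (proj₂ (∈-filter⁻ _ {xs = cartesianProduct (allFin n) (allFin n)} m)))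
        where open import Data.Bool.Properties using (T-≡)
              open import Function.Bundles using (Equivalence)
      ... | p , qr = p , ∧⁻ qr

    -- `B` is identified at no cost in rank. Only labels of vertices in `W` are ever compared along
    -- the edges, so the value is that of the induced graph on `W` with the part of `B` in `W` made
    -- one vertex.
    rk : Graph → Subset n → Subset n → ℕ
    rk G B W = ρ (lab B) (edges G W)

-- Averages over random vertex sets, and the effect of an edge contraction on the average rank.

module Expectation where

  open Subsets
  open UnionFind
  open import Data.Bool using (Bool; true; false; _∧_; _∨_; not; if_then_else_)
  open import Data.Nat using (ℕ; zero; suc; _+_; _*_; _∸_; _≤_; _<_; z≤n; s≤s; _!; >-nonZero)
  open import Data.Nat.Properties
  open import Data.Nat.Tactic.RingSolver using (solve-∀)
  open import Data.Fin using (Fin; zero; suc)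
  import Data.Fin.Properties as Finₚ
  open import Data.Vec using ([]; _∷_)
  open import Data.Product using (∃; _×_; _,_; proj₁; proj₂)
  open import Data.Sum using (_⊎_; inj₁; inj₂)
  open import Data.Empty using (⊥-elim)
  open import Data.List using ([]; _∷_; _++_)
  open import Data.List.Membership.Propositional using () renaming (_∈_ to _∈ˡ_)
  open import Data.List.Membership.Propositional.Properties using (∈-++⁺ˡ; ∈-++⁺ʳ; ∈-++⁻)
  open import Data.List.Relation.Unary.Any using () renaming (here to hereˡ)
  open import Data.Fin.Subset using (Subset; ∣_∣; ⊥)
  open import Relation.Nullary using (Dec; yes; no)
  open import Relation.Binary.PropositionalEquality using (_≡_; _≢_; refl; sym; trans; cong; cong₂; subst; subst₂; module ≡-Reasoning)
  open import Function using (_∘_)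

  opaque
    unfolding _!_ ins del

    disj : ∀ {n} → Subset n → Subset n → Bool
    disj [] [] = true
    disj (a ∷ A) (b ∷ B) = not (a ∧ b) ∧ disj A B

    disj⁻ : ∀ {n} {A B : Subset n} → disj A B ≡ true → ∀ x → A ! x ≡ true → B ! x ≡ false
    disj⁻ {A = true ∷ A} {false ∷ B} e zero p = refl
    disj⁻ {A = a ∷ A} {b ∷ B} e (suc x) p = disj⁻ {A = A} {B} (proj₂ (∧⁻ {not (a ∧ b)} e)) x p

    disj⁺ : ∀ {n} {A B : Subset n} → (∀ x → A ! x ≡ true → B ! x ≡ false) → disj A B ≡ true
    disj⁺ {A = []} {[]} h = refl
    disj⁺ {A = false ∷ A} {b ∷ B} h = disj⁺ {A = A} (h ∘ suc)
    disj⁺ {A = true ∷ A} {false ∷ B} h = disj⁺ {A = A} (h ∘ suc)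
    disj⁺ {A = true ∷ A} {true ∷ B} h with h zero refl
    ... | ()

  disj-false : ∀ {n} {A B : Subset n} → disj A B ≡ false → ∃ λ x → A ! x ≡ true × B ! x ≡ true
  disj-false {A = A} {B} e with findF (λ x → A ! x ∧ B ! x)
  ... | inj₁ (x , p) = x , ∧⁻ p
  ... | inj₂ h = t≢f (disj⁺ {A = A} {B} λ x p → ≢true⇒false λ q → t≢f (∧⁺ p q) (h x)) e

  opaque
    fac : ℕ → ℕ
    fac n = n !

    fac-0 : fac 0 ≡ 1
    fac-0 = refl

    fac-suc : ∀ n → fac (suc n) ≡ suc n * fac n
    fac-suc n = refl

    fac>0 : ∀ n → 0 < fac n
    fac>0 zero = s≤s z≤n
    fac>0 (suc n) = ≤-trans (fac>0 n) (m≤m+n (n !) (n * n !))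

  suc-shift : ∀ i j c → 1 + (i + j + (1 + c)) ≡ 1 + (i + (1 + j) + c)
  suc-shift = solve-∀

  suc-shift′ : ∀ i j c → 1 + (1 + (i + j + c)) ≡ 1 + (i + (1 + j) + c)
  suc-shift′ = solve-∀

  avoid-rearr : ∀ s x y q → s * ((x + y) * q) ≡ x * (s * q) + y * (s * q)
  avoid-rearr = solve-∀

  avoid-final : ∀ i j c f a m → f * ((1 + (j + c)) * a) * m + ((1 + i) * f) * a * m ≡ (1 + (1 + (i + j + c))) * (f * a * m)
  avoid-final = solve-∀

  wt : ℕ → ℕ → ℕ
  wt n k = fac k * fac (n ∸ k)

  -- Up to the factor (n+1)!, this is the expectation of φ over a random W whose size is uniform
  -- on {0,…,n} and which is uniform among the sets of its size.
  𝔼 : ∀ {n} → (Subset n → ℕ) → ℕ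
  𝔼 {n} φ = ΣS (λ W → wt n ∣ W ∣ * φ W)

  wt>0 : ∀ n k → 0 < wt n k
  wt>0 n k = *-mono-≤ (fac>0 k) (fac>0 (n ∸ k))

  𝔼-cong : ∀ {n} {φ ψ : Subset n → ℕ} → (∀ W → φ W ≡ ψ W) → 𝔼 φ ≡ 𝔼 ψ
  𝔼-cong h = ΣS-cong λ W → cong (wt _ ∣ W ∣ *_) (h W)

  𝔼-mono : ∀ {n} {φ ψ : Subset n → ℕ} → (∀ W → φ W ≤ ψ W) → 𝔼 φ ≤ 𝔼 ψ
  𝔼-mono h = ΣS-mono λ W → *-monoʳ-≤ (wt _ ∣ W ∣) (h W)

  𝔼-+ : ∀ {n} (φ ψ : Subset n → ℕ) → 𝔼 (λ W → φ W + ψ W) ≡ 𝔼 φ + 𝔼 ψ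
  𝔼-+ {n} φ ψ = trans (ΣS-cong λ W → *-distribˡ-+ (wt _ ∣ W ∣) (φ W) (ψ W)) (ΣS-+ {n} (λ W → wt n ∣ W ∣ * φ W) (λ W → wt n ∣ W ∣ * ψ W))

  opaque
    unfolding _!_ disj

    outs : ∀ {n} → Subset n → ℕ
    outs [] = 0
    outs (true ∷ A) = outs A
    outs (false ∷ A) = suc (outs A)

    card+outs : ∀ {n} (A : Subset n) → ∣ A ∣ + outs A ≡ n
    card+outs [] = refl
    card+outs (true ∷ A) = cong suc (card+outs A)
    card+outs (false ∷ A) = trans (+-suc ∣ A ∣ (outs A)) (cong suc (card+outs A))

    -- A discrete Beta integral. Choose x uniformly in [0,1] and put each vertex into W with
    -- probability x; the weight of W is, up to a factorial, the integral of a power of x times a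
    -- power of 1-x, and summing over all W that miss `C` leaves the integral of x^i (1-x)^(j+|C|).
    -- The parameters `i` and `j` count elements already placed inside and outside W, which makes
    -- the identity inductive in n.
    avoid-sum : ∀ {n} (C : Subset n) i j →
      ΣS (λ W → (fac (i + ∣ W ∣) * fac (j + outs W)) * 𝟙 (disj C W)) * fac (suc (i + j + ∣ C ∣)) ≡ (fac i * fac (j + ∣ C ∣)) * fac (suc (i + j + n))
    avoid-sum [] i j = trans (cong₂ (λ a b → fac a * fac b * 1 * fac (suc (i + j + 0))) (+-identityʳ i) (+-identityʳ j))
      (cong₂ _*_ (trans (*-identityʳ _) (cong (λ a → fac i * fac a) (sym (+-identityʳ j)))) refl)
    avoid-sum {suc n} (true ∷ C) i j = begin
      (ΣS (λ W → (fac (i + ∣ W ∣) * fac (j + suc (outs W))) * 𝟙 (disj C W)) + ΣS {n} (λ W → (fac (i + suc ∣ W ∣) * fac (j + outs W)) * 0)) * fac (suc (i + j + suc ∣ C ∣))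
        ≡⟨ cong₂ (λ a b → a * fac b) (trans (cong₂ _+_ (ΣS-cong {n} λ W → cong (λ a → (fac (i + ∣ W ∣) * fac a) * 𝟙 (disj C W)) (+-suc j (outs W))) (ΣS-0 {n} λ W → *-zeroʳ (fac (i + suc ∣ W ∣) * fac (j + outs W)))) (+-identityʳ _)) (suc-shift i j ∣ C ∣) ⟩
      ΣS (λ W → (fac (i + ∣ W ∣) * fac (suc j + outs W)) * 𝟙 (disj C W)) * fac (suc (i + suc j + ∣ C ∣))
        ≡⟨ avoid-sum C i (suc j) ⟩
      fac i * fac (suc j + ∣ C ∣) * fac (suc (i + suc j + n))
        ≡⟨ cong₂ (λ a b → fac i * fac a * fac b) (sym (+-suc j ∣ C ∣)) (sym (suc-shift i j n)) ⟩
      fac i * fac (j + suc ∣ C ∣) * fac (suc (i + j + suc n)) ∎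
      where
      open ≡-Reasoning
    -- The first element is unconstrained: `X` leaves it outside and raises j, `Y` puts it inside
    -- and raises i. The factor `s₂` lifts the common factorial to the one that both induction
    -- hypotheses involve.
    avoid-sum {suc n} (false ∷ C) i j = *-cancelˡ-≡ ((X + Y) * q) (fac i * a * fac (suc (i + j + suc n))) s₂ (begin
      s₂ * ((X + Y) * q) ≡⟨ avoid-rearr s₂ X Y q ⟩
      X * (s₂ * q) + Y * (s₂ * q) ≡⟨ cong₂ _+_ X-eq Y-eq ⟩
      fac i * (suc (j + c) * a) * m + (suc i * fac i) * a * m ≡⟨ avoid-final i j c (fac i) a m ⟩
      s₂ * (fac i * a * m) ≡⟨ cong (λ k → s₂ * (fac i * a * fac k)) (sym (suc-shift i j n)) ⟩
      s₂ * (fac i * a * fac (suc (i + j + suc n))) ∎)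
      where
      open ≡-Reasoning
      c s₂ q X Y a m : ℕ
      c = ∣ C ∣
      s₂ = suc (suc (i + j + c))
      q = fac (suc (i + j + c))
      X = ΣS (λ W → (fac (i + ∣ W ∣) * fac (j + suc (outs W))) * 𝟙 (disj C W))
      Y = ΣS (λ W → (fac (i + suc ∣ W ∣) * fac (j + outs W)) * 𝟙 (disj C W))
      a = fac (j + c)
      m = fac (suc (i + suc j + n))
      X-eq : X * (s₂ * q) ≡ fac i * (suc (j + c) * a) * m
      X-eq = trans (cong₂ _*_ (ΣS-cong {n} λ W → cong (λ b → (fac (i + ∣ W ∣) * fac b) * 𝟙 (disj C W)) (+-suc j (outs W))) (trans (sym (fac-suc (suc (i + j + c)))) (cong fac (suc-shift′ i j c))))
        (trans (avoid-sum C i (suc j)) (cong (λ k → fac i * k * m) (fac-suc (j + c))))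
      Y-eq : Y * (s₂ * q) ≡ (suc i * fac i) * a * m
      Y-eq = trans (cong₂ _*_ (ΣS-cong {n} λ W → cong (λ b → (fac b * fac (j + outs W)) * 𝟙 (disj C W)) (+-suc i ∣ W ∣)) (sym (fac-suc (suc (i + j + c)))))
        (trans (avoid-sum C (suc i) j) (cong₂ (λ x k → x * a * fac k) (fac-suc i) (suc-shift′ i j n)))

  -- Probability 1/(|C|+1): the marker comes before all of `C`. This is the case i = j = 0 of
  -- `avoid-sum`.
  𝔼-avoid : ∀ {n} (C : Subset n) → suc ∣ C ∣ * 𝔼 (λ W → 𝟙 (disj C W)) ≡ fac (suc n)
  𝔼-avoid {n} C = *-cancelˡ-≡ (suc ∣ C ∣ * 𝔼 (λ W → 𝟙 (disj C W))) (fac (suc n)) (fac ∣ C ∣) {{>-nonZero (fac>0 ∣ C ∣)}} (begin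
    fac ∣ C ∣ * (suc ∣ C ∣ * 𝔼 (λ W → 𝟙 (disj C W))) ≡⟨ rearr (fac ∣ C ∣) (suc ∣ C ∣) (𝔼 (λ W → 𝟙 (disj C W))) ⟩
    𝔼 (λ W → 𝟙 (disj C W)) * (suc ∣ C ∣ * fac ∣ C ∣) ≡⟨ cong₂ _*_ (ΣS-cong λ W → cong (λ k → fac ∣ W ∣ * fac k * 𝟙 (disj C W)) (outs-eq W)) (sym (fac-suc ∣ C ∣)) ⟩
    ΣS (λ W → (fac (0 + ∣ W ∣) * fac (0 + outs W)) * 𝟙 (disj C W)) * fac (suc ∣ C ∣) ≡⟨ avoid-sum C 0 0 ⟩
    fac 0 * fac ∣ C ∣ * fac (suc n) ≡⟨ cong (_* fac (suc n)) (trans (cong (_* fac ∣ C ∣) fac-0) (*-identityˡ (fac ∣ C ∣))) ⟩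
    fac ∣ C ∣ * fac (suc n) ∎)
    where
    open ≡-Reasoning
    rearr : ∀ a s x → a * (s * x) ≡ x * (s * a)
    rearr = solve-∀
    outs-eq : ∀ W → n ∸ ∣ W ∣ ≡ outs W
    outs-eq W = trans (cong (_∸ ∣ W ∣) (sym (card+outs W))) (m+n∸m≡n ∣ W ∣ (outs W))

  -- A set that misses `C` either contains `u` or misses `C` together with `u`. So the probability
  -- is 1/(c+1) - 1/(c+2) = 1/((c+1)(c+2)) with c = |C|.
  𝔼-hit : ∀ {n} (C : Subset n) u → C ! u ≡ false →
    suc ∣ C ∣ * suc (suc ∣ C ∣) * 𝔼 (λ W → 𝟙 (W ! u ∧ disj C W)) ≡ fac (suc n)
  𝔼-hit {n} C u nu = +-cancelʳ-≡ (suc c * M) (suc c * suc (suc c) * P) M (begin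
    suc c * suc (suc c) * P + suc c * M ≡⟨ cong (λ m → suc c * suc (suc c) * P + suc c * m) (sym eqY) ⟩
    suc c * suc (suc c) * P + suc c * (suc (suc c) * Y) ≡⟨ rearr (suc c) (suc (suc c)) P Y ⟩
    suc (suc c) * (suc c * (P + Y)) ≡⟨ cong (λ x → suc (suc c) * (suc c * x)) (trans (sym (𝔼-+ {n} (λ W → 𝟙 (W ! u ∧ disj C W)) (λ W → 𝟙 (disj (ins u C) W)))) (𝔼-cong split)) ⟩
    suc (suc c) * (suc c * 𝔼 (λ W → 𝟙 (disj C W))) ≡⟨ cong (suc (suc c) *_) (𝔼-avoid C) ⟩
    M + suc c * M ∎)
    where
    open ≡-Reasoning
    c = ∣ C ∣
    M = fac (suc n)
    P = 𝔼 (λ W → 𝟙 (W ! u ∧ disj C W))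
    Y = 𝔼 (λ W → 𝟙 (disj (ins u C) W))
    eqY : suc (suc c) * Y ≡ M
    eqY = trans (cong (λ k → suc k * Y) (sym (∣ins∣ C u nu))) (𝔼-avoid (ins u C))
    rearr : ∀ a b p y → a * b * p + a * (b * y) ≡ b * (a * (p + y))
    rearr = solve-∀
    split : ∀ W → 𝟙 (W ! u ∧ disj C W) + 𝟙 (disj (ins u C) W) ≡ 𝟙 (disj C W)
    split W with bool (W ! u)
    ... | inj₁ e rewrite e | ≢true⇒false {disj (ins u C) W} (λ h → t≢f e (disj⁻ {A = ins u C} h u (ins-this u C))) = +-identityʳ _
    ... | inj₂ e rewrite e = cong 𝟙 (⇔⇒≡ {disj (ins u C) W}
        (λ h → disj⁺ {A = C} λ x p → disj⁻ {A = ins u C} h x (ins-⊒ u C x p))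
        (λ h → disj⁺ {A = ins u C} λ x p → aux h x (ins⁻ p)))
      where
      aux : disj C W ≡ true → ∀ x → x ≡ u ⊎ C ! x ≡ true → W ! x ≡ false
      aux h x (inj₁ refl) = e
      aux h x (inj₂ p) = disj⁻ {A = C} h x p

  ⊥! : ∀ {n} (x : Fin n) → ⊥ ! x ≡ false
  ⊥! {n} x = ∣∣≡0 {A = ⊥} (∣⊥∣≡0 n) x
    where open import Data.Fin.Subset.Properties using (∣⊥∣≡0)

  𝔼-∈ : ∀ {n} (u : Fin n) → 2 * 𝔼 (λ W → 𝟙 (W ! u)) ≡ fac (suc n)
  𝔼-∈ {n} u = trans (cong₂ (λ c x → suc c * suc (suc c) * x) (sym (∣⊥∣≡0 n)) (𝔼-cong λ W → cong 𝟙 (eq W)))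
    (𝔼-hit ⊥ u (⊥! u))
    where
    open import Data.Fin.Subset.Properties using (∣⊥∣≡0)
    eq : ∀ W → W ! u ≡ W ! u ∧ disj ⊥ W
    eq W = ⇔⇒≡ (λ p → ∧⁺ p (disj⁺ {A = ⊥} λ x q → t≢f q (⊥! x))) (λ p → proj₁ (∧⁻ p))

  cardIn : ∀ {n} → Subset n → Subset n → ℕ
  cardIn U W = ΣF (λ x → 𝟙 (W ! x ∧ U ! x))

  𝔼-cardIn : ∀ {n} (U : Subset n) → 2 * 𝔼 (cardIn U) ≡ ∣ U ∣ * fac (suc n)
  𝔼-cardIn {n} U = begin
    2 * 𝔼 (cardIn U) ≡⟨ cong (2 *_) (trans (ΣS-cong {n} λ W → sym (ΣF-* (wt n ∣ W ∣) (λ x → 𝟙 (W ! x ∧ U ! x)))) (ΣS-ΣF {n} {n} (λ W x → wt n ∣ W ∣ * 𝟙 (W ! x ∧ U ! x)))) ⟩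
    2 * ΣF (λ x → 𝔼 (λ W → 𝟙 (W ! x ∧ U ! x))) ≡⟨ sym (ΣF-* 2 (λ x → 𝔼 (λ W → 𝟙 (W ! x ∧ U ! x)))) ⟩
    ΣF (λ x → 2 * 𝔼 (λ W → 𝟙 (W ! x ∧ U ! x))) ≡⟨ ΣF-cong term ⟩
    ΣF (λ x → M * 𝟙 (U ! x)) ≡⟨ ΣF-* M (λ x → 𝟙 (U ! x)) ⟩
    M * ΣF (λ x → 𝟙 (U ! x)) ≡⟨ cong (M *_) (sym (card≡Σ U)) ⟩
    M * ∣ U ∣ ≡⟨ *-comm M ∣ U ∣ ⟩
    ∣ U ∣ * M ∎
    where
    open ≡-Reasoning
    M = fac (suc n)
    term : ∀ x → 2 * 𝔼 (λ W → 𝟙 (W ! x ∧ U ! x)) ≡ M * 𝟙 (U ! x)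
    term x with U ! x
    ... | true = trans (trans (cong (2 *_) (𝔼-cong {n} λ W → cong 𝟙 (∧-identityʳ (W ! x)))) (𝔼-∈ x)) (sym (*-identityʳ M))
      where open import Data.Bool.Properties using (∧-identityʳ)
    ... | false = trans (trans (cong (2 *_) (ΣS-0 {n} λ W → trans (cong (wt n ∣ W ∣ *_) (cong 𝟙 (∧-zeroʳ (W ! x)))) (*-zeroʳ (wt n ∣ W ∣)))) (*-zeroʳ 2)) (sym (*-zeroʳ M))
      where open import Data.Bool.Properties using (∧-zeroʳ)

  -- The four sets that agree off `u` and `v` are collected at the one containing neither. For a set
  -- containing v but not u the contracted graph may have the larger rank; the comparison succeeds
  -- for the four sets together.
  quad : ∀ {n} → Fin n → Fin n → (Subset n → ℕ) → Subset n → ℕ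
  quad u v f W = if W ! v then 0 else (if W ! u then 0 else (f W + f (ins u W)) + (f (ins v W) + f (ins u (ins v W))))

  ΣS-quad : ∀ {n} {u v : Fin n} → u ≢ v → ∀ f → ΣS f ≡ ΣS (quad u v f)
  ΣS-quad {u = u} {v} ne f = trans (ΣS-pivot u f) (trans (ΣS-pivot v _) (ΣS-cong eq))
    where
    eq : ∀ W → pair-up v (pair-up u f) W ≡ quad u v f W
    eq W rewrite ins-other {x = v} {y = u} W ne with W ! v | W ! u
    ... | true | _ = refl
    ... | false | true = refl
    ... | false | false = refl

  quad-out : ∀ {n} {u v : Fin n} f {W} → W ! v ≡ false → W ! u ≡ false → quad u v f W ≡ (f W + f (ins u W)) + (f (ins v W) + f (ins u (ins v W)))
  quad-out f p q rewrite p | q = refl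

  quad-in : ∀ {n} {u v : Fin n} f {W} → W ! v ≡ true ⊎ W ! u ≡ true → quad u v f W ≡ 0
  quad-in f (inj₁ p) rewrite p = refl
  quad-in {v = v} f {W} (inj₂ p) rewrite p with W ! v
  ... | true = refl
  ... | false = refl

  quad-left : ∀ w₀ w₁ w₂ a b c e → w₀ * a + (w₁ * (b + (c + 1)) + w₂ * (e + 1)) ≡ (w₀ * (a + 0) + w₁ * (b + 1)) + (w₁ * (c + 0) + w₂ * (e + 1))
  quad-left = solve-∀

  quad-right : ∀ w₀ w₁ w₂ a b c e t → w₀ * a + (w₁ * (b + c + t) + w₂ * e) ≡ (w₀ * (a + 0) + w₁ * (b + t)) + (w₁ * (c + 0) + w₂ * (e + 0))
  quad-right = solve-∀

  quad-slack : ∀ w₀ w₁ w₂ a b c e t s → (w₀ * (a + 0) + w₁ * (b + t)) + (w₁ * (c + 0) + w₂ * (e + 0)) + w₁ * s ≡ (w₀ * (a + 0) + w₁ * (b + (t + s))) + (w₁ * (c + 0) + w₂ * (e + 0))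
  quad-slack = solve-∀

  module _ {n : ℕ} where

    opaque
      -- The vertex `u` stays in the ground set but becomes isolated, so that the ranks before and
      -- after are averages over the same random sets.
      contract : Graph {n} → Fin n → Fin n → Graph {n}
      contract G u v x y = not (eqF x u) ∧ not (eqF y u) ∧ (G x y ∨ (eqF x v ∧ G u y) ∨ (eqF y v ∧ G x u))

      contract⁻ : ∀ {G u v x y} → contract G u v x y ≡ true →
        x ≢ u × y ≢ u × (G x y ≡ true ⊎ (x ≡ v × G u y ≡ true) ⊎ (y ≡ v × G x u ≡ true))
      contract⁻ {G} {u} {v} {x} {y} e with ∧⁻ {not (eqF x u)} e
      ... | p , q with ∧⁻ {not (eqF y u)} q
      ... | p′ , r = (λ { refl → t≢f (eqF-refl x) (not⁻ p) }) , (λ { refl → t≢f (eqF-refl y) (not⁻ p′) }) , cases (∨⁻ {G x y} r)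
        where
        cases : G x y ≡ true ⊎ (eqF x v ∧ G u y) ∨ (eqF y v ∧ G x u) ≡ true
          → G x y ≡ true ⊎ (x ≡ v × G u y ≡ true) ⊎ (y ≡ v × G x u ≡ true)
        cases (inj₁ g) = inj₁ g
        cases (inj₂ s) with ∨⁻ {eqF x v ∧ G u y} s
        ... | inj₁ t = inj₂ (inj₁ (eqF⇒≡ (proj₁ (∧⁻ t)) , proj₂ (∧⁻ t)))
        ... | inj₂ t = inj₂ (inj₂ (eqF⇒≡ (proj₁ (∧⁻ t)) , proj₂ (∧⁻ t)))

      contract⁺ : ∀ {G : Graph {n}} {u v x y} → x ≢ u → y ≢ u → (G x y ≡ true ⊎ (x ≡ v × G u y ≡ true) ⊎ (y ≡ v × G x u ≡ true)) → contract G u v x y ≡ true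
      contract⁺ {G} {u} {v} {x} {y} p q r = ∧⁺ (not⁺ (eqF-≢ p)) (∧⁺ (not⁺ (eqF-≢ q)) (cases r))
        where
        cases : (G x y ≡ true ⊎ (x ≡ v × G u y ≡ true) ⊎ (y ≡ v × G x u ≡ true)) → G x y ∨ (eqF x v ∧ G u y) ∨ (eqF y v ∧ G x u) ≡ true
        cases (inj₁ g) = ∨⁺ˡ g
        cases (inj₂ (inj₁ (refl , g))) = ∨⁺ʳ {G x y} (∨⁺ˡ (∧⁺ (eqF-refl x) g))
        cases (inj₂ (inj₂ (refl , g))) = ∨⁺ʳ {G x y} (∨⁺ʳ {eqF x v ∧ G u y} (∧⁺ (eqF-refl y) g))

    contract-symm : ∀ {G u v} → Symm G → Symm (contract G u v)
    contract-symm {G} {u} {v} s {x} {y} e with contract⁻ {G} e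
    ... | p , q , inj₁ g = contract⁺ q p (inj₁ (s g))
    ... | p , q , inj₂ (inj₁ (h , g)) = contract⁺ q p (inj₂ (inj₂ (h , s g)))
    ... | p , q , inj₂ (inj₂ (h , g)) = contract⁺ q p (inj₂ (inj₁ (h , s g)))

    -- The labeling `M` that separates `u` from everything else is constant along the edges; by the
    -- universal property of `mergeAll` it certifies that nothing is joined to `u`.
    isolated : ∀ (L : Labeling {n}) E u → (∀ x → L x ≡ L u → x ≡ u) → (∀ {c d} → (c , d) ∈ˡ E → c ≢ u × d ≢ u)
      → ∀ x → mergeAll L E x ≡ mergeAll L E u → x ≡ u
    isolated L E u h a x e with x Finₚ.≟ u
    ... | yes p = p
    ... | no ne = ⊥-elim (zero≢one (trans (sym (M-other ne)) (trans (mergeAll-least {L = L} {M} E least joins x u e) M-this)))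
      where
      M : Labeling {n}
      M y = if eqF y u then suc u else zero
      zero≢one : zero ≢ suc u
      zero≢one ()
      M-this : M u ≡ suc u
      M-this rewrite eqF-refl u = refl
      M-other : ∀ {y} → y ≢ u → M y ≡ zero
      M-other ne rewrite eqF-≢ ne = refl
      least : L ≼ M
      least y z eq = cases (y Finₚ.≟ u) (z Finₚ.≟ u)
        where
        cases : Dec (y ≡ u) → Dec (z ≡ u) → M y ≡ M z
        cases (yes refl) (yes refl) = refl
        cases (yes refl) (no q) = ⊥-elim (q (h z (sym eq)))
        cases (no p) (yes refl) = ⊥-elim (p (h y eq))
        cases (no p) (no q) = trans (M-other p) (sym (M-other q))
      joins : ∀ {c d} → (c , d) ∈ˡ E → M c ≡ M d
      joins m = trans (M-other (proj₁ (a m))) (sym (M-other (proj₂ (a m))))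

    ρ-∷ʳ-≡ : ∀ (L : Labeling {n}) E c d → ρ L (E ++ (c , d) ∷ []) ≡ ρ L E + differ (mergeAll L E c) (mergeAll L E d)
    ρ-∷ʳ-≡ L E c d = trans (ρ-++ L E _) (cong (ρ L E +_) (+-identityʳ _))

    module Split (G : Graph {n}) (G-symm : Symm G) (B : Subset n) (u v : Fin n)
      (u∉B : B ! u ≡ false) (u≢v : u ≢ v) (Guv : G u v ≡ true)
      (X : Subset n) (u∉X : X ! u ≡ false)
      (Xu : ∀ x → X ! x ≡ true → G u x ≡ true) (Xv : ∀ x → X ! x ≡ true → G v x ≡ true) where

      H : Graph {n}
      H = contract G u v

      L : Labeling {n}
      L = lab B

      u-alone : ∀ x → L x ≡ L u → x ≡ u
      u-alone x e with lab⁻ B x u e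
      ... | inj₁ p = p
      ... | inj₂ (_ , q) = t≢f q u∉B

      H-rank-step : ∀ W → ρ L (edges H W ++ (u , v) ∷ []) ≡ rk H B W + 1
      H-rank-step W = trans (ρ-∷ʳ-≡ L (edges H W) u v) (cong (rk H B W +_) (differ-≢ λ e → u≢v (sym
        (isolated L (edges H W) u u-alone (λ m → let _ , _ , h = edges⁻ {G = H} m; p , q , _ = contract⁻ {G} h in p , q) v (sym e)))))

      -- In the presence of uv, the edges of the contracted graph are spanned by those of G.
      H-span : ∀ W E → (∀ {x y} → x ≢ u → y ≢ u → W ! x ≡ true → W ! y ≡ true → G x y ≡ true → (x , y) ∈ˡ E)
        → (∀ {x} → x ≢ u → x ≢ v → W ! x ≡ true → G u x ≡ true → (u , x) ∈ˡ E)
        → (u , v) ∈ˡ E → rk H B W + 1 ≤ ρ L E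
      H-span W E i ii iii = ≤-trans (≤-reflexive (sym (H-rank-step W))) (ρ-span L E _ spans)
        where
        spans : Spans L E (edges H W ++ (u , v) ∷ [])
        spans m with ∈-++⁻ (edges H W) m
        ... | inj₂ (hereˡ refl) = mergeAll-joins L E iii
        ... | inj₁ m′ with edges⁻ {G = H} m′
        spans {x} {y} m | inj₁ m′ | Wx , Wy , h with contract⁻ {G} h
        ... | p , q , inj₁ g = mergeAll-joins L E (i p q Wx Wy g)
        ... | p , q , inj₂ (inj₁ (refl , g)) with y Finₚ.≟ v
        ...   | yes refl = refl
        ...   | no ne = trans (sym (mergeAll-joins L E iii)) (mergeAll-joins L E (ii q ne Wy g))
        spans {x} {y} m | inj₁ m′ | Wx , Wy , h | p , q , inj₂ (inj₂ (refl , g)) with x Finₚ.≟ v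
        ...   | yes refl = refl
        ...   | no ne = trans (sym (mergeAll-joins L E (ii p ne Wx (G-symm g)))) (mergeAll-joins L E iii)

      module _ (W : Subset n) (u∉W : W ! u ≡ false) (v∉W : W ! v ≡ false) where

        private
          P = edges G W
          PU = edges G (ins u W)
          PV = edges G (ins v W)

        linked : Set
        linked = mergeAll L (PU ++ PV) u ≡ mergeAll L (PU ++ PV) v

        -- Whether the edge uv would still raise the rank after all edges inside W+u and all edges
        -- inside W+v. A common neighbour of `u` and `v` in W makes it 0.
        δ : ℕ
        δ = differ (mergeAll L (PU ++ PV) u) (mergeAll L (PU ++ PV) v)

        X-linked : ∀ x → X ! x ≡ true → W ! x ≡ true → linked
        X-linked x p q = trans
          (mergeAll-joins L (PU ++ PV) (∈-++⁺ˡ (edges⁺ (ins-this u W) (ins-⊒ u W x q) (Xu x p))))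
          (sym (mergeAll-joins L (PU ++ PV) (∈-++⁺ʳ PU (edges⁺ (ins-this v W) (ins-⊒ v W x q) (Xv x p)))))

        shrink : ∀ {x} → x ≢ u → ins u W ! x ≡ true → W ! x ≡ true
        shrink ne e with ins⁻ e
        ... | inj₁ p = ⊥-elim (ne p)
        ... | inj₂ p = p

        H⊆P : ∀ {e} → e ∈ˡ edges H (ins u W) → e ∈ˡ P
        H⊆P m with edges⁻ {G = H} m
        ... | Wx , Wy , h with contract⁻ {G} h
        ... | p , q , inj₁ g = edges⁺ (shrink p Wx) (shrink q Wy) g
        ... | p , q , inj₂ (inj₁ (refl , g)) = t≢f (shrink p Wx) v∉W
        ... | p , q , inj₂ (inj₂ (refl , g)) = t≢f (shrink q Wy) v∉W

        rank-none : rk H B W ≤ rk G B W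
        rank-none = ρ-⊆ L (λ m → H⊆P (lift m))
          where
          lift : ∀ {e} → e ∈ˡ edges H W → e ∈ˡ edges H (ins u W)
          lift m with edges⁻ {G = H} m
          ... | Wx , Wy , h = edges⁺ (ins-⊒ u W _ Wx) (ins-⊒ u W _ Wy) h

        -- In the contracted graph `u` is isolated, so the first term sees only edges of G inside W.
        -- The second term, raised by the edge uv, is spanned by `PU`, `PV` and uv. Submodularity
        -- for `PU` and `PV`, which share `P`, gives the claim with error `δ`.
        rank-one : rk H B (ins u W) + (rk H B (ins v W) + 1) ≤ rk G B (ins u W) + rk G B (ins v W) + δ
        rank-one = begin
          rk H B (ins u W) + (rk H B (ins v W) + 1) ≤⟨ +-mono-≤ (ρ-⊆ L H⊆P) (H-span (ins v W) ((PU ++ PV) ++ (u , v) ∷ []) (λ _ _ p q g → ∈-++⁺ˡ (∈-++⁺ʳ PU (edges⁺ p q g))) ii (∈-++⁺ʳ (PU ++ PV) (hereˡ refl))) ⟩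
          ρ L P + ρ L ((PU ++ PV) ++ (u , v) ∷ []) ≡⟨ cong (ρ L P +_) (ρ-∷ʳ-≡ L (PU ++ PV) u v) ⟩
          ρ L P + (ρ L (PU ++ PV) + δ) ≡⟨ sym (+-assoc (ρ L P) _ _) ⟩
          ρ L P + ρ L (PU ++ PV) + δ ≡⟨ cong (_+ δ) (+-comm (ρ L P) _) ⟩
          ρ L (PU ++ PV) + ρ L P + δ ≤⟨ +-monoˡ-≤ δ (ρ-submodular L P⊆PU P⊆PV) ⟩
          ρ L PU + ρ L PV + δ ∎
          where
          open ≤-Reasoning
          P⊆PU : ∀ {e} → e ∈ˡ P → e ∈ˡ PU
          P⊆PU m with edges⁻ {G = G} m
          ... | p , q , g = edges⁺ (ins-⊒ u W _ p) (ins-⊒ u W _ q) g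
          P⊆PV : ∀ {e} → e ∈ˡ P → e ∈ˡ PV
          P⊆PV m with edges⁻ {G = G} m
          ... | p , q , g = edges⁺ (ins-⊒ v W _ p) (ins-⊒ v W _ q) g
          ii : ∀ {x} → x ≢ u → x ≢ v → ins v W ! x ≡ true → G u x ≡ true → (u , x) ∈ˡ (PU ++ PV) ++ (u , v) ∷ []
          ii {x} p q e g with ins⁻ e
          ... | inj₁ r = ⊥-elim (q r)
          ... | inj₂ r = ∈-++⁺ˡ (∈-++⁺ˡ (edges⁺ (ins-this u W) (ins-⊒ u W x r) g))

        -- Here uv is itself an edge of G inside the set, so no error term appears.
        rank-both : rk H B (ins u (ins v W)) + 1 ≤ rk G B (ins u (ins v W))
        rank-both = H-span W′ (edges G W′) (λ _ _ p q g → edges⁺ p q g) (λ _ _ p g → edges⁺ (ins-this u (ins v W)) p g)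
          (edges⁺ (ins-this u (ins v W)) (ins-⊒ u (ins v W) v (ins-this v W)) Guv)
          where W′ = ins u (ins v W)

      hit : Subset n → Bool
      hit W = W ! u ∧ disj (ins v X) W

      -- The unit in `lhs` for a set containing `u` is the rank lost under contraction. Of the two
      -- such sets in a group of four, W+u+v pays by `rank-both`; W+u pays together with W+v, which
      -- has the same weight, by `rank-one` up to `hit`.
      lhs rhs : Subset n → ℕ
      lhs W = wt n ∣ W ∣ * (rk H B W + 𝟙 (W ! u))
      rhs W = wt n ∣ W ∣ * (rk G B W + 𝟙 (hit W))

      private
        combine : ∀ {w₀ w₁ w₂ a a′ b b′ c c′ e e′ t} → a ≤ a′ → b + (c + 1) ≤ b′ + c′ + t → e + 1 ≤ e′ →
          (w₀ * (a + 0) + w₁ * (b + 1)) + (w₁ * (c + 0) + w₂ * (e + 1)) ≤ (w₀ * (a′ + 0) + w₁ * (b′ + t)) + (w₁ * (c′ + 0) + w₂ * (e′ + 0))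
        combine {w₀} {w₁} {w₂} {a} {a′} {b} {b′} {c} {c′} {e} {e′} {t} p q r = subst₂ _≤_ (quad-left w₀ w₁ w₂ a b c e) (quad-right w₀ w₁ w₂ a′ b′ c′ e′ t)
          (+-mono-≤ (*-monoʳ-≤ w₀ p) (+-mono-≤ (*-monoʳ-≤ w₁ q) (*-monoʳ-≤ w₂ r)))

      quad-≤ : ∀ W (u∉W : W ! u ≡ false) (v∉W : W ! v ≡ false) t → δ W u∉W v∉W ≤ t → t ≤ 𝟙 (hit (ins u W)) →
        (lhs W + lhs (ins u W)) + (lhs (ins v W) + lhs (ins u (ins v W))) + wt n (suc ∣ W ∣) * (𝟙 (hit (ins u W)) ∸ t)
          ≤ (rhs W + rhs (ins u W)) + (rhs (ins v W) + rhs (ins u (ins v W)))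
      quad-≤ W u∉W v∉W t δ≤t t≤h
        rewrite u∉W | ins-this u W | ins-other {x = v} {y = u} W u≢v | u∉W | ins-this u (ins v W)
          | ∣ins∣ W u u∉W | ∣ins∣ W v v∉W | ∣ins∣ (ins v W) u (trans (ins-other W u≢v) u∉W) | ∣ins∣ W v v∉W
        = begin
          A + w₁ * (h ∸ t) ≤⟨ +-monoˡ-≤ (w₁ * (h ∸ t)) (combine {w₀} {w₁} {w₂} {b′ = b′} {t = t} (rank-none W u∉W v∉W) (≤-trans (rank-one W u∉W v∉W) (+-monoʳ-≤ _ δ≤t)) (rank-both W u∉W v∉W)) ⟩
          (w₀ * (a′ + 0) + w₁ * (b′ + t)) + (w₁ * (c′ + 0) + w₂ * (e′ + 0)) + w₁ * (h ∸ t) ≡⟨ quad-slack w₀ w₁ w₂ a′ b′ c′ e′ t (h ∸ t) ⟩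
          (w₀ * (a′ + 0) + w₁ * (b′ + (t + (h ∸ t)))) + (w₁ * (c′ + 0) + w₂ * (e′ + 0)) ≡⟨ cong (λ k → (w₀ * (a′ + 0) + w₁ * (b′ + k)) + (w₁ * (c′ + 0) + w₂ * (e′ + 0))) (m+[n∸m]≡n t≤h) ⟩
          (w₀ * (a′ + 0) + w₁ * (b′ + h)) + (w₁ * (c′ + 0) + w₂ * (e′ + 0)) ≤⟨ +-monoʳ-≤ (w₀ * (a′ + 0) + w₁ * (b′ + h)) (+-monoʳ-≤ (w₁ * (c′ + 0)) (*-monoʳ-≤ w₂ (+-monoʳ-≤ e′ z≤n))) ⟩
          _ ∎
        where
        open ≤-Reasoning
        w₀ = wt n ∣ W ∣
        w₁ = wt n (suc ∣ W ∣)
        w₂ = wt n (suc (suc ∣ W ∣))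
        h = 𝟙 (disj (ins v X) (ins u W))
        a′ = rk G B W
        b′ = rk G B (ins u W)
        c′ = rk G B (ins v W)
        e′ = rk G B (ins u (ins v W))
        A = (w₀ * (rk H B W + 0) + w₁ * (rk H B (ins u W) + 1)) + (w₁ * (rk H B (ins v W) + 0) + w₂ * (rk H B (ins u (ins v W)) + 1))

      δ≤hit : ∀ W (u∉W : W ! u ≡ false) (v∉W : W ! v ≡ false) → δ W u∉W v∉W ≤ 𝟙 (hit (ins u W))
      δ≤hit W u∉W v∉W rewrite ins-this u W with bool (disj (ins v X) (ins u W))
      ... | inj₁ e rewrite e = differ≤1 _ _
      ... | inj₂ e with disj-false {A = ins v X} e
      ...   | x , p , q with ins⁻ {x = v} {X} p
      ...     | inj₁ refl = t≢f q (trans (ins-other W (u≢v ∘ sym)) v∉W)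
      ...     | inj₂ Xx rewrite e = ≤-reflexive (differ-≡ (X-linked W u∉W v∉W x Xx (shrink W u∉W v∉W (λ { refl → t≢f Xx u∉X }) q)))

      quad-mono : ∀ W → quad u v lhs W ≤ quad u v rhs W
      quad-mono W with bool (W ! v) | bool (W ! u)
      ... | inj₁ e | _ = ≤-reflexive (trans (quad-in lhs (inj₁ e)) (sym (quad-in rhs (inj₁ e))))
      ... | inj₂ e | inj₁ f = ≤-reflexive (trans (quad-in lhs (inj₂ f)) (sym (quad-in rhs (inj₂ f))))
      ... | inj₂ e | inj₂ f = subst₂ _≤_ (sym (quad-out lhs e f)) (sym (quad-out rhs e f))
        (≤-trans (m≤m+n _ _) (quad-≤ W f e _ (δ≤hit W f e) ≤-refl))

      vertex-split : 𝔼 (λ W → rk H B W + 𝟙 (W ! u)) ≤ 𝔼 (λ W → rk G B W + 𝟙 (hit W))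
      vertex-split = subst₂ _≤_ (sym (ΣS-quad u≢v lhs)) (sym (ΣS-quad u≢v rhs)) (ΣS-mono quad-mono)

      -- One W for which the error is allowed but does not occur makes the average strict, because
      -- every W has positive weight.
      vertex-split-strict : ∀ W (u∉W : W ! u ≡ false) (v∉W : W ! v ≡ false) → disj X W ≡ true → X ! v ≡ false → linked W u∉W v∉W
        → 𝔼 (λ W → rk H B W + 𝟙 (W ! u)) < 𝔼 (λ W → rk G B W + 𝟙 (hit W))
      vertex-split-strict W u∉W v∉W dj v∉X lk = subst₂ _<_ (sym (ΣS-quad u≢v lhs)) (sym (ΣS-quad u≢v rhs)) (ΣS-< quad-mono W strict)
        where
        hit≡ : hit (ins u W) ≡ true
        hit≡ = ∧⁺ (ins-this u W) (disj⁺ {A = ins v X} λ x p → aux x (ins⁻ {x = v} {X} p))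
          where
          aux : ∀ x → x ≡ v ⊎ X ! x ≡ true → ins u W ! x ≡ false
          aux x (inj₁ refl) = trans (ins-other W (u≢v ∘ sym)) v∉W
          aux x (inj₂ p) = trans (ins-other W λ { refl → t≢f p u∉X }) (disj⁻ {A = X} dj x p)
        strict : quad u v lhs W < quad u v rhs W
        strict = subst₂ _<_ (sym (quad-out lhs v∉W u∉W)) (sym (quad-out rhs v∉W u∉W)) (≤-trans (m<m+n _ w₁>0)
          (quad-≤ W u∉W v∉W 0 (≤-reflexive (differ-≡ lk)) z≤n))
          where
          w₁>0 : 0 < wt n (suc ∣ W ∣) * (𝟙 (hit (ins u W)) ∸ 0)
          w₁>0 = subst (λ b → 0 < wt n (suc ∣ W ∣) * 𝟙 b) (sym hit≡) (subst (0 <_) (sym (*-identityʳ _)) (wt>0 n (suc ∣ W ∣)))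

-- Mod-2 chains, and contraction of an edge in a minimal chain.

module Chains where

  open Subsets
  open UnionFind
  open Expectation
  open import Data.Bool using (Bool; true; false; _∧_; _∨_; not; _xor_; if_then_else_)
  open import Data.Bool.Properties using (xor-assoc; xor-comm; xor-same; xor-identityʳ; ∧-distribˡ-xor; ∧-zeroʳ)
  open import Data.Nat using (ℕ; zero; suc; _+_; _≤_; _<_; z≤n; s≤s)
  open import Data.Nat.Properties
  open import Data.Fin using (Fin; zero; suc)
  import Data.Fin.Properties as Finₚ
  open import Data.Vec using (tabulate)
  open import Data.Vec.Properties using (lookup∘tabulate)
  open import Data.Product using (∃; _×_; _,_; proj₁; proj₂)
  open import Data.Sum using (_⊎_; inj₁; inj₂)
  open import Data.Empty using (⊥-elim) renaming (⊥ to Void)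
  open import Data.Fin.Subset using (Subset; ∣_∣)
  open import Relation.Nullary using (¬_; Dec; yes; no)
  open import Relation.Binary.PropositionalEquality using (_≡_; _≢_; refl; sym; trans; cong; cong₂; subst; subst₂; module ≡-Reasoning)
  open import Function using (_∘_; id)

  ⊕F : ∀ {n} → (Fin n → Bool) → Bool
  ⊕F {zero} f = false
  ⊕F {suc n} f = f zero xor ⊕F (f ∘ suc)

  ⊕F-cong : ∀ {n} {f g : Fin n → Bool} → (∀ x → f x ≡ g x) → ⊕F f ≡ ⊕F g
  ⊕F-cong {zero} h = refl
  ⊕F-cong {suc n} h = cong₂ _xor_ (h zero) (⊕F-cong (h ∘ suc))

  ⊕F-0 : ∀ {n} {f : Fin n → Bool} → (∀ x → f x ≡ false) → ⊕F f ≡ false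
  ⊕F-0 {zero} h = refl
  ⊕F-0 {suc n} h = cong₂ _xor_ (h zero) (⊕F-0 (h ∘ suc))

  xor-swap : ∀ a b c d → (a xor b) xor (c xor d) ≡ (a xor c) xor (b xor d)
  xor-swap a b c d = trans (xor-assoc a b (c xor d)) (trans (cong (a xor_) (trans (sym (xor-assoc b c d)) (trans (cong (_xor d) (xor-comm b c)) (xor-assoc c b d)))) (sym (xor-assoc a c (b xor d))))

  ⊕F-xor : ∀ {n} (f g : Fin n → Bool) → ⊕F (λ x → f x xor g x) ≡ ⊕F f xor ⊕F g
  ⊕F-xor {zero} f g = refl
  ⊕F-xor {suc n} f g = trans (cong ((f zero xor g zero) xor_) (⊕F-xor (f ∘ suc) (g ∘ suc))) (xor-swap (f zero) (g zero) _ _)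

  ⊕F-∧ : ∀ {n} b (f : Fin n → Bool) → b ∧ ⊕F f ≡ ⊕F (λ x → b ∧ f x)
  ⊕F-∧ true f = refl
  ⊕F-∧ {n} false f = sym (⊕F-0 {n} λ _ → refl)

  ⊕F-true : ∀ {n} (f : Fin n → Bool) → ⊕F f ≡ true → ∃ λ x → f x ≡ true
  ⊕F-true f e with findF f
  ... | inj₁ h = h
  ... | inj₂ h = t≢f e (⊕F-0 h)

  ⊕F-point : ∀ {n} (f : Fin n → Bool) x → (∀ y → y ≢ x → f y ≡ false) → ⊕F f ≡ f x
  ⊕F-point {suc n} f zero h = trans (cong (f zero xor_) (⊕F-0 λ y → h (suc y) λ ())) (xor-identityʳ (f zero))
  ⊕F-point {suc n} f (suc x) h = trans (cong (_xor ⊕F (f ∘ suc)) (h zero λ ())) (⊕F-point (f ∘ suc) x λ y ne → h (suc y) (ne ∘ Finₚ.suc-injective))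

  -- Contraction alters the terms of a boundary sum only at `u` and `v`, where the changes cancel;
  -- boundaries of a chain and of its contraction are compared in this form.
  ⊕F-agree : ∀ {n} (f g : Fin n → Bool) x y → x ≢ y → (∀ z → z ≢ x → z ≢ y → f z ≡ g z)
    → f x xor g x ≡ f y xor g y → ⊕F f ≡ ⊕F g
  ⊕F-agree {n} f g x y x≢y h e = xor≡false (begin
    ⊕F f xor ⊕F g ≡⟨ sym (⊕F-xor f g) ⟩
    ⊕F fg ≡⟨ ⊕F-cong (λ z → split z (z Finₚ.≟ x) (z Finₚ.≟ y)) ⟩
    ⊕F (λ z → (eqF z x ∧ fg z) xor (eqF z y ∧ fg z)) ≡⟨ ⊕F-xor (λ z → eqF z x ∧ fg z) (λ z → eqF z y ∧ fg z) ⟩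
    ⊕F (λ z → eqF z x ∧ fg z) xor ⊕F (λ z → eqF z y ∧ fg z) ≡⟨ cong₂ _xor_ (at x) (at y) ⟩
    fg x xor fg y ≡⟨ cong (_xor fg y) e ⟩
    fg y xor fg y ≡⟨ xor-same (fg y) ⟩
    false ∎)
    where
    open ≡-Reasoning
    fg : Fin n → Bool
    fg z = f z xor g z
    at : ∀ x → ⊕F (λ z → eqF z x ∧ fg z) ≡ fg x
    at x = trans (⊕F-point (λ z → eqF z x ∧ fg z) x (λ z ne → cong (_∧ fg z) (eqF-≢ ne))) (cong (_∧ fg x) (eqF-refl x))
    split : ∀ z → Dec (z ≡ x) → Dec (z ≡ y) → fg z ≡ (eqF z x ∧ fg z) xor (eqF z y ∧ fg z)
    split z (yes refl) (yes refl) = ⊥-elim (x≢y refl)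
    split z (yes refl) (no q) = sym (trans (cong₂ (λ a b → (a ∧ fg z) xor (b ∧ fg z)) (eqF-refl z) (eqF-≢ q)) (xor-identityʳ (fg z)))
    split z (no p) (yes refl) = sym (cong₂ (λ a b → (a ∧ fg z) xor (b ∧ fg z)) (eqF-≢ p) (eqF-refl z))
    split z (no p) (no q) = trans (trans (cong (_xor g z) (h z p q)) (xor-same (g z))) (sym (cong₂ (λ a b → (a ∧ fg z) xor (b ∧ fg z)) (eqF-≢ p) (eqF-≢ q)))

  ⊕F-other : ∀ {n} (f : Fin n → Bool) x → ⊕F f ≡ false → f x ≡ true → ∃ λ y → y ≢ x × f y ≡ true
  ⊕F-other f x e p with findF (λ y → not (eqF y x) ∧ f y)
  ... | inj₁ (y , q) = y , (λ { refl → t≢f (eqF-refl y) (not⁻ (proj₁ (∧⁻ q))) }) , proj₂ (∧⁻ q)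
  ... | inj₂ h = t≢f p (trans (sym (⊕F-point f x λ y ne → ≢true⇒false λ q → t≢f (∧⁺ (not⁺ (eqF-≢ ne)) q) (h y))) e)

  -- Off-diagonal terms cancel in pairs. Applied to the two orders of adding two vertices, this is
  -- ∂∂ = 0.
  ⊕F-symm : ∀ {n} (g : Fin n → Fin n → Bool) → (∀ x y → g x y ≡ g y x) → (∀ x → g x x ≡ false) → ⊕F (λ x → ⊕F (g x)) ≡ false
  ⊕F-symm {zero} g s d = refl
  ⊕F-symm {suc n} g s d = begin
    (g zero zero xor ⊕F (g zero ∘ suc)) xor ⊕F (λ x → g (suc x) zero xor ⊕F (g (suc x) ∘ suc))
      ≡⟨ cong₂ _xor_ (cong (_xor ⊕F (g zero ∘ suc)) (d zero)) (⊕F-xor (λ x → g (suc x) zero) (λ x → ⊕F (g (suc x) ∘ suc))) ⟩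
    ⊕F (g zero ∘ suc) xor (⊕F (λ x → g (suc x) zero) xor ⊕F (λ x → ⊕F (g (suc x) ∘ suc)))
      ≡⟨ cong₂ (λ a b → ⊕F (g zero ∘ suc) xor (a xor b)) (⊕F-cong λ x → s (suc x) zero) (⊕F-symm (λ x y → g (suc x) (suc y)) (λ x y → s (suc x) (suc y)) (d ∘ suc)) ⟩
    ⊕F (g zero ∘ suc) xor (⊕F (g zero ∘ suc) xor false) ≡⟨ cong (⊕F (g zero ∘ suc) xor_) (xor-identityʳ _) ⟩
    ⊕F (g zero ∘ suc) xor ⊕F (g zero ∘ suc) ≡⟨ xor-same (⊕F (g zero ∘ suc)) ⟩
    false ∎
    where open ≡-Reasoning

  module _ {n : ℕ} where

    Chain : Set
    Chain = Subset n → Bool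

    ∂ : Chain → Chain
    ∂ Z R = ⊕F (λ x → not (R ! x) ∧ Z (ins x R))

    ∂-cong : ∀ {Y Z : Chain} → (∀ F → Y F ≡ Z F) → ∀ R → ∂ Y R ≡ ∂ Z R
    ∂-cong h R = ⊕F-cong λ x → cong (not (R ! x) ∧_) (h (ins x R))

    ∂-xor : ∀ (Y Z : Chain) R → ∂ (λ F → Y F xor Z F) R ≡ ∂ Y R xor ∂ Z R
    ∂-xor Y Z R = trans (⊕F-cong λ x → ∧-distribˡ-xor (not (R ! x)) (Y (ins x R)) (Z (ins x R)))
      (⊕F-xor (λ x → not (R ! x) ∧ Y (ins x R)) (λ x → not (R ! x) ∧ Z (ins x R)))

    ∂-true : ∀ (Z : Chain) {R} → ∂ Z R ≡ true → ∃ λ x → R ! x ≡ false × Z (ins x R) ≡ true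
    ∂-true Z {R} e with ⊕F-true _ e
    ... | x , p = x , not⁻ (proj₁ (∧⁻ p)) , proj₂ (∧⁻ p)

    ∂-other : ∀ (Z : Chain) {R x} → ∂ Z R ≡ false → R ! x ≡ false → Z (ins x R) ≡ true → ∃ λ y → y ≢ x × R ! y ≡ false × Z (ins y R) ≡ true
    ∂-other Z {R} {x} e p q with ⊕F-other (λ x → not (R ! x) ∧ Z (ins x R)) x e (∧⁺ (not⁺ p) q)
    ... | y , ne , r = y , ne , not⁻ (proj₁ (∧⁻ r)) , proj₂ (∧⁻ r)

    ∂∂ : ∀ (Z : Chain) T → ∂ (∂ Z) T ≡ false
    ∂∂ Z T = trans (⊕F-cong λ x → ⊕F-∧ (not (T ! x)) (λ y → not (ins x T ! y) ∧ Z (ins y (ins x T)))) (⊕F-symm g symm diag)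
      where
      g : Fin n → Fin n → Bool
      g x y = not (T ! x) ∧ (not (ins x T ! y) ∧ Z (ins y (ins x T)))
      symm : ∀ x y → g x y ≡ g y x
      symm x y with x Finₚ.≟ y
      ... | yes refl = refl
      ... | no ne rewrite ins-other {x = x} {y = y} T (ne ∘ sym) | ins-other {x = y} {y = x} T ne | ins-comm x y T with T ! x | T ! y
      ... | true | true = refl
      ... | true | false = refl
      ... | false | true = refl
      ... | false | false = refl
      diag : ∀ x → g x x ≡ false
      diag x rewrite ins-this x T = ∧-zeroʳ (not (T ! x))

    opaque
      unfolding _!_

      subset : (Fin n → Bool) → Subset n
      subset = tabulate

      subset! : ∀ p x → subset p ! x ≡ p x
      subset! p x = lookup∘tabulate p x

    opaque
      vert : Chain → Subset n
      vert Z = subset (λ x → anyS (λ F → Z F ∧ F ! x))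

      vert⁺ : ∀ {Z F x} → Z F ≡ true → F ! x ≡ true → vert Z ! x ≡ true
      vert⁺ {Z} {F} {x} p q = trans (subset! _ x) (anyS⁺ F (∧⁺ p q))

      vert⁻ : ∀ {Z x} → vert Z ! x ≡ true → ∃ λ F → Z F ≡ true × F ! x ≡ true
      vert⁻ {Z} {x} e with anyS⁻ (trans (sym (subset! _ x)) e)
      ... | F , p = F , ∧⁻ p

    infixl 8 _∖_
    infixl 7 _∪′_
    opaque
      _∖_ _∪′_ : Subset n → Subset n → Subset n
      A ∖ B = subset (λ x → A ! x ∧ not (B ! x))
      A ∪′ B = subset (λ x → A ! x ∨ B ! x)

      ∖⁻ : ∀ {A B x} → (A ∖ B) ! x ≡ true → A ! x ≡ true × B ! x ≡ false
      ∖⁻ {A} {B} {x} e with ∧⁻ {A ! x} (trans (sym (subset! _ x)) e)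
      ... | p , q = p , not⁻ q

      ∖⁺ : ∀ {A B x} → A ! x ≡ true → B ! x ≡ false → (A ∖ B) ! x ≡ true
      ∖⁺ {x = x} p q = trans (subset! _ x) (∧⁺ p (not⁺ q))

      ∪⁻ : ∀ {A B x} → (A ∪′ B) ! x ≡ true → A ! x ≡ true ⊎ B ! x ≡ true
      ∪⁻ {A} {B} {x} e = ∨⁻ {A ! x} (trans (sym (subset! _ x)) e)

      ∪⁺ˡ : ∀ {A B x} → A ! x ≡ true → (A ∪′ B) ! x ≡ true
      ∪⁺ˡ {x = x} p = trans (subset! _ x) (∨⁺ˡ p)

      ∪⁺ʳ : ∀ {A B x} → B ! x ≡ true → (A ∪′ B) ! x ≡ true
      ∪⁺ʳ {A} {x = x} p = trans (subset! _ x) (∨⁺ʳ {A ! x} p)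

    opaque
      unfolding _∖_

      ∣∖∪∣ : ∀ (A B S : Subset n) → S ⊑ A → ∣ A ∖ B ∣ ≡ ∣ S ∖ B ∣ + ∣ A ∖ (B ∪′ S) ∣
      ∣∖∪∣ A B S h = begin
        ∣ A ∖ B ∣ ≡⟨ card≡Σ (A ∖ B) ⟩
        ΣF (λ x → 𝟙 ((A ∖ B) ! x)) ≡⟨ ΣF-cong ptw ⟩
        ΣF (λ x → 𝟙 ((S ∖ B) ! x) + 𝟙 ((A ∖ (B ∪′ S)) ! x)) ≡⟨ ΣF-+ (λ x → 𝟙 ((S ∖ B) ! x)) (λ x → 𝟙 ((A ∖ (B ∪′ S)) ! x)) ⟩
        ΣF (λ x → 𝟙 ((S ∖ B) ! x)) + ΣF (λ x → 𝟙 ((A ∖ (B ∪′ S)) ! x)) ≡⟨ sym (cong₂ _+_ (card≡Σ (S ∖ B)) (card≡Σ (A ∖ (B ∪′ S)))) ⟩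
        ∣ S ∖ B ∣ + ∣ A ∖ (B ∪′ S) ∣ ∎
        where
        open ≡-Reasoning
        ptw : ∀ x → 𝟙 ((A ∖ B) ! x) ≡ 𝟙 ((S ∖ B) ! x) + 𝟙 ((A ∖ (B ∪′ S)) ! x)
        ptw x rewrite subset! (λ x → A ! x ∧ not (B ! x)) x | subset! (λ x → S ! x ∧ not (B ! x)) x
          | subset! (λ x → A ! x ∧ not ((B ∪′ S) ! x)) x | subset! (λ x → B ! x ∨ S ! x) x with bool (S ! x)
        ... | inj₁ s rewrite s | h x s with B ! x
        ...   | true = refl
        ...   | false = refl
        ptw x | inj₂ s rewrite s with A ! x | B ! x
        ... | true | true = refl
        ... | true | false = refl
        ... | false | _ = refl

    -- Equivalently, Z contains no nonempty mod-2 cycle: a subchain with the same boundary differs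
    -- from Z by such a cycle.
    Minimal : Chain → Set
    Minimal Z = ∀ (Y : Chain) → (∀ {F} → Y F ≡ true → Z F ≡ true) → (∀ R → ∂ Y R ≡ ∂ Z R) → ∀ {F} → Z F ≡ true → Y F ≡ true

    -- The graph is only required to contain the edges of the facets, so it can be replaced by a
    -- contraction or a restriction without computing a new 1-skeleton. Likewise `B` may be any
    -- vertex set that contains the boundary ridges.
    record Admissible (d : ℕ) (G : Graph {n}) (B : Subset n) (Z : Chain) : Set where
      field
        size : ∀ {F} → Z F ≡ true → ∣ F ∣ ≡ d
        clique : ∀ {F x y} → Z F ≡ true → F ! x ≡ true → F ! y ≡ true → G x y ≡ true
        boundary : ∀ {R} → ∂ Z R ≡ true → R ⊑ B
        minimal : Minimal Z

    -- Assume that there is none. A subchain of Z with the same boundary and a facet missing would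
    -- by induction contain a minimal one; so Z is itself minimal. Minimality is never decided,
    -- hence the double negation.
    minimal-subchain : ∀ (Z : Chain) → ¬ ¬ (∃ λ Y → (∀ {F} → Y F ≡ true → Z F ≡ true) × (∀ R → ∂ Y R ≡ ∂ Z R) × Minimal Y)
    minimal-subchain Z = go (suc (ΣS (λ F → 𝟙 (Z F)))) Z ≤-refl
      where
      go : ∀ k (Z : Chain) → ΣS (λ F → 𝟙 (Z F)) < k → ¬ ¬ (∃ λ Y → (∀ {F} → Y F ≡ true → Z F ≡ true) × (∀ R → ∂ Y R ≡ ∂ Z R) × Minimal Y)
      go (suc k) Z (s≤s le) none = none (Z , id , (λ _ → refl) , λ Y sub eq {F} ZF → case Y sub eq F ZF (bool (Y F)))
        where
        case : ∀ (Y : Chain) → (∀ {F} → Y F ≡ true → Z F ≡ true) → (∀ R → ∂ Y R ≡ ∂ Z R) → ∀ F → Z F ≡ true → Y F ≡ true ⊎ Y F ≡ false → Y F ≡ true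
        case Y sub eq F ZF (inj₁ e) = e
        case Y sub eq F ZF (inj₂ e) = ⊥-elim (go k Y
          (<-≤-trans (ΣS-< (λ F → 𝟙-mono sub) F (subst₂ _<_ (cong 𝟙 (sym e)) (cong 𝟙 (sym ZF)) (s≤s z≤n))) le)
          λ { (X , s , q , m) → none (X , (λ h → sub (s h)) , (λ R → trans (q R) (eq R)) , m) })

    -- Contraction of u to v; faces containing both collapse, and faces with the same image cancel.
    push : Fin n → Fin n → Chain → Chain
    push u v Z F = not (F ! u) ∧ (Z F xor (F ! v ∧ Z (ins u (del v F))))

    module _ {u v : Fin n} (u≢v : u ≢ v) where

      private
        v≢u : v ≢ u
        v≢u = u≢v ∘ sym

      push-in : ∀ Z {F} → F ! u ≡ true → push u v Z F ≡ false
      push-in Z p rewrite p = refl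

      push-out : ∀ Z {F} → F ! u ≡ false → F ! v ≡ false → push u v Z F ≡ Z F
      push-out Z {F} p q rewrite p | q = xor-identityʳ (Z F)

      push-at : ∀ Z {F} → F ! u ≡ false → F ! v ≡ false → push u v Z (ins v F) ≡ Z (ins v F) xor Z (ins u F)
      push-at Z {F} p q rewrite ins-other F u≢v | p | ins-this v F | del-ins q = refl

      ∂push-in : ∀ Z {R} → R ! u ≡ true → ∂ (push u v Z) R ≡ false
      ∂push-in Z {R} p = ⊕F-0 λ x → trans (cong (not (R ! x) ∧_) (push-in Z (ins-⊒ x R u p))) (∧-zeroʳ (not (R ! x)))

      ∂push-out : ∀ Z {R} → R ! u ≡ false → R ! v ≡ false → ∂ (push u v Z) R ≡ ∂ Z R
      ∂push-out Z {R} p q = ⊕F-agree _ _ u v u≢v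
        (λ x x≢u x≢v → cong (not (R ! x) ∧_) (push-out Z (trans (ins-other R (x≢u ∘ sym)) p) (trans (ins-other R (x≢v ∘ sym)) q))) at
        where
        at : (not (R ! u) ∧ push u v Z (ins u R)) xor (not (R ! u) ∧ Z (ins u R)) ≡ (not (R ! v) ∧ push u v Z (ins v R)) xor (not (R ! v) ∧ Z (ins v R))
        at rewrite p | q | push-in Z (ins-this u R) | push-at Z p q with Z (ins u R) | Z (ins v R)
        ... | true | true = refl
        ... | true | false = refl
        ... | false | true = refl
        ... | false | false = refl

      -- Contraction is a chain map: the two ridges that collapse to the same image are added.
      ∂push-at : ∀ Z {Q} → Q ! u ≡ false → Q ! v ≡ false → ∂ (push u v Z) (ins v Q) ≡ ∂ Z (ins v Q) xor ∂ Z (ins u Q)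
      ∂push-at Z {Q} p q = trans (⊕F-agree _ (λ x → (not (ins v Q ! x) ∧ Z (ins x (ins v Q))) xor (not (ins u Q ! x) ∧ Z (ins x (ins u Q)))) u v u≢v rest at)
        (⊕F-xor (λ x → not (ins v Q ! x) ∧ Z (ins x (ins v Q))) (λ x → not (ins u Q ! x) ∧ Z (ins x (ins u Q))))
        where
        rest : ∀ x → x ≢ u → x ≢ v → not (ins v Q ! x) ∧ push u v Z (ins x (ins v Q)) ≡ (not (ins v Q ! x) ∧ Z (ins x (ins v Q))) xor (not (ins u Q ! x) ∧ Z (ins x (ins u Q)))
        rest x x≢u x≢v rewrite ins-other Q x≢v | ins-other Q x≢u | ins-comm x v Q | ins-comm x u Q
          | push-at Z {ins x Q} (trans (ins-other Q (x≢u ∘ sym)) p) (trans (ins-other Q (x≢v ∘ sym)) q) = ∧-distribˡ-xor (not (Q ! x)) _ _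
        at : (not (ins v Q ! u) ∧ push u v Z (ins u (ins v Q))) xor ((not (ins v Q ! u) ∧ Z (ins u (ins v Q))) xor (not (ins u Q ! u) ∧ Z (ins u (ins u Q))))
          ≡ (not (ins v Q ! v) ∧ push u v Z (ins v (ins v Q))) xor ((not (ins v Q ! v) ∧ Z (ins v (ins v Q))) xor (not (ins u Q ! v) ∧ Z (ins v (ins u Q))))
        at rewrite ins-this v Q | ins-this u Q | ins-other Q u≢v | ins-other Q v≢u | p | q | push-in Z (ins-this u (ins v Q)) | ins-comm v u Q = xor-identityʳ _

      -- The part of Z lying over a subchain Y of its contraction.
      lift : Chain → Chain → Chain
      lift Z Y F = Z F ∧ (if F ! u then not (F ! v) ∧ Y (ins v (del u F)) else Y F)

      lift-⊆ : ∀ Z Y {F} → lift Z Y F ≡ true → Z F ≡ true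
      lift-⊆ Z Y e = proj₁ (∧⁻ e)

      lift-in : ∀ Z Y {F} → lift Z Y F ≡ true → F ! u ≡ true → F ! v ≡ false × Y (ins v (del u F)) ≡ true
      lift-in Z Y {F} e p with ∧⁻ {Z F} e
      ... | _ , q rewrite p with ∧⁻ {not (F ! v)} q
      ... | r , s = not⁻ r , s

      -- Faces of Z with equal images cancel in `push`, so a face of the image through v has exactly
      -- one preimage in Z. The lift keeps that preimage, and nothing cancels when it is pushed
      -- forward again.
      push-lift : ∀ Z Y → (∀ {F} → Y F ≡ true → push u v Z F ≡ true) → ∀ F → push u v (lift Z Y) F ≡ Y F
      push-lift Z Y sub F with bool (F ! u) | bool (F ! v)
      ... | inj₁ p | _ = trans (push-in (lift Z Y) p) (sym (≢true⇒false λ y → t≢f (sub y) (push-in Z p)))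
      ... | inj₂ p | inj₂ q = trans (push-out (lift Z Y) p q) (trans lift≡ (⇔⇒≡ (proj₂ ∘ ∧⁻) λ y → ∧⁺ (trans (sym (push-out Z p q)) (sub y)) y))
        where
        lift≡ : lift Z Y F ≡ Z F ∧ Y F
        lift≡ rewrite p = refl
      ... | inj₂ p | inj₁ q = trans (cong (push u v (lift Z Y)) (sym (ins-del q))) (trans (push-at (lift Z Y) Qu Qv)
            (trans (cong₂ _xor_ liftv liftu) (fin (Z F) (Z (ins u Q)) (Y F) refl λ y → trans (sym (trans (cong (push u v Z) (sym (ins-del q))) (trans (push-at Z Qu Qv) (cong (λ A → Z A xor Z (ins u Q)) (ins-del q))))) (sub y))))
        where
        Q = del v F
        Qv = del-this v F
        Qu = trans (del-other F u≢v) p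
        liftv : lift Z Y (ins v Q) ≡ Z F ∧ Y F
        liftv rewrite ins-del q | p = refl
        liftu : lift Z Y (ins u Q) ≡ Z (ins u Q) ∧ Y F
        liftu rewrite ins-this u Q | ins-other Q v≢u | Qv | del-ins Qu | ins-del q = refl
        fin : ∀ a b y → y ≡ Y F → (y ≡ true → a xor b ≡ true) → (a ∧ y) xor (b ∧ y) ≡ y
        fin a b true e h = trans (cong₂ _xor_ (∧-identityʳ a) (∧-identityʳ b)) (h refl)
          where open import Data.Bool.Properties using (∧-identityʳ)
        fin a b false e h = cong₂ _xor_ (∧-zeroʳ a) (∧-zeroʳ b)

    -- Together with `v` the set `X` has d elements; avoiding these is the event that determines the
    -- constant. That `v` and `X` lie in `Z₁` keeps all edges used by the estimate among the
    -- vertices that the contracted chain accounts for.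
    record Step (d : ℕ) (G : Graph {n}) (B : Subset n) (Z : Chain) (u v : Fin n) : Set where
      field
        Z₁ : Chain
        admissible : Admissible d (contract G u v) B Z₁
        vert-⊑ : vert Z₁ ⊑ vert Z
        u∉Z₁ : vert Z₁ ! u ≡ false
        v∈Z₁ : vert Z₁ ! v ≡ true
        X : Subset n
        card-X : suc ∣ X ∣ ≡ d
        X⊑ : X ⊑ vert Z₁
        u∉X : X ! u ≡ false
        v∉X : X ! v ≡ false
        Xu : ∀ x → X ! x ≡ true → G u x ≡ true
        Xv : ∀ x → X ! x ≡ true → G v x ≡ true

    module _ {d : ℕ} (3≤d : 3 ≤ d) {G : Graph {n}} {B : Subset n} {Z : Chain} (adm : Admissible d G B Z)
      {u v : Fin n} (u∉B : B ! u ≡ false) (v∈B : B ! v ≡ true)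
      {F₀ : Subset n} (ZF₀ : Z F₀ ≡ true) (uF₀ : F₀ ! u ≡ true) (vF₀ : F₀ ! v ≡ true) where

      open Admissible adm

      private
        u≢v : u ≢ v
        u≢v = ≢⇐! v∈B u∉B ∘ sym
        v≢u : v ≢ u
        v≢u = u≢v ∘ sym

      Guv : G u v ≡ true
      Guv = clique ZF₀ uF₀ vF₀

      ∂Z-u : ∀ {R} → R ! u ≡ true → ∂ Z R ≡ false
      ∂Z-u p = ≢true⇒false λ e → t≢f (boundary e u p) u∉B

      -- Ridges through `u` are not in the boundary of Z, since `u` lies outside `B`; so contraction
      -- moves no boundary ridge.
      ∂push : ∀ R → ∂ (push u v Z) R ≡ ∂ Z R
      ∂push R with bool (R ! u) | bool (R ! v)
      ... | inj₁ p | _ = trans (∂push-in u≢v Z p) (sym (∂Z-u p))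
      ... | inj₂ p | inj₂ q = ∂push-out u≢v Z p q
      ... | inj₂ p | inj₁ q = begin
        ∂ (push u v Z) R ≡⟨ cong (∂ (push u v Z)) (sym (ins-del q)) ⟩
        ∂ (push u v Z) (ins v Q) ≡⟨ ∂push-at u≢v Z (trans (del-other R u≢v) p) (del-this v R) ⟩
        ∂ Z (ins v Q) xor ∂ Z (ins u Q) ≡⟨ cong₂ _xor_ (cong (∂ Z) (ins-del q)) (∂Z-u (ins-this u Q)) ⟩
        ∂ Z R xor false ≡⟨ xor-identityʳ _ ⟩
        ∂ Z R ∎
        where
        open ≡-Reasoning
        Q = del v R

      push⁻ : ∀ {F} → push u v Z F ≡ true → F ! u ≡ false × (Z F ≡ true ⊎ (F ! v ≡ true × Z (ins u (del v F)) ≡ true))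
      push⁻ {F} e with ∧⁻ {not (F ! u)} e
      ... | p , q with bool (Z F)
      ...   | inj₁ z = not⁻ p , inj₁ z
      ...   | inj₂ z rewrite z = not⁻ p , inj₂ (∧⁻ q)

      module _ (Z₁ : Chain) (sub : ∀ {F} → Z₁ F ≡ true → push u v Z F ≡ true) (∂Z₁ : ∀ R → ∂ Z₁ R ≡ ∂ (push u v Z) R) (min : Minimal Z₁) where

        Lf : Chain
        Lf = lift u≢v Z Z₁

        ∂Z₁≡∂Z : ∀ R → ∂ Z₁ R ≡ ∂ Z R
        ∂Z₁≡∂Z R = trans (∂Z₁ R) (∂push R)

        ∂push-lift : ∀ R → ∂ (push u v Lf) R ≡ ∂ Z₁ R
        ∂push-lift = ∂-cong (push-lift u≢v Z Z₁ sub)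

        size₁ : ∀ {F} → Z₁ F ≡ true → ∣ F ∣ ≡ d
        size₁ {F} e with push⁻ (sub e)
        ... | p , inj₁ z = size z
        ... | p , inj₂ (q , z) = trans (∣del∣ F v q) (trans (sym (∣ins∣ (del v F) u (trans (del-other F u≢v) p))) (size z))

        clique₁ : ∀ {F x y} → Z₁ F ≡ true → F ! x ≡ true → F ! y ≡ true → contract G u v x y ≡ true
        clique₁ {F} {x} {y} e Fx Fy with push⁻ (sub e)
        ... | p , inj₁ z = contract⁺ (≢⇐! Fx p) (≢⇐! Fy p) (inj₁ (clique z Fx Fy))
        ... | p , inj₂ (q , z) = contract⁺ (≢⇐! Fx p) (≢⇐! Fy p) (cases (x Finₚ.≟ v) (y Finₚ.≟ v))
          where
          F′ = ins u (del v F)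
          in′ : ∀ {x} → F ! x ≡ true → x ≢ v → F′ ! x ≡ true
          in′ Fx ne = ins-⊒ u (del v F) _ (trans (del-other F ne) Fx)
          uF′ = ins-this u (del v F)
          cases : Dec (x ≡ v) → Dec (y ≡ v) → G x y ≡ true ⊎ (x ≡ v × G u y ≡ true) ⊎ (y ≡ v × G x u ≡ true)
          cases (yes refl) (yes refl) = inj₂ (inj₁ (refl , Guv))
          cases (yes refl) (no b) = inj₂ (inj₁ (refl , clique z uF′ (in′ Fy b)))
          cases (no a) (yes refl) = inj₂ (inj₂ (refl , clique z (in′ Fx a) uF′))
          cases (no a) (no b) = inj₁ (clique z (in′ Fx a) (in′ Fy b))

        vert₁ : vert Z₁ ⊑ vert Z
        vert₁ x e with vert⁻ {Z₁} e
        ... | F , z₁ , Fx with push⁻ (sub z₁)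
        ...   | p , inj₁ z = vert⁺ z Fx
        ...   | p , inj₂ (q , z) with x Finₚ.≟ v
        ...     | yes refl = vert⁺ ZF₀ vF₀
        ...     | no ne = vert⁺ z (ins-⊒ u (del v F) x (trans (del-other F ne) Fx))

        u∉₁ : vert Z₁ ! u ≡ false
        u∉₁ = ≢true⇒false λ e → let F , z₁ , Fu = vert⁻ {Z₁} e in t≢f Fu (proj₁ (push⁻ (sub z₁)))

        -- Were all ridges of the lift away from u, the lift would be a proper subchain of Z with the same boundary.
        ridge : ∃ λ R → R ! u ≡ true × ∂ Lf R ≡ true
        ridge with findS (λ R → R ! u ∧ ∂ Lf R)
        ... | inj₁ (R , e) = R , ∧⁻ e
        ... | inj₂ h = ⊥-elim (t≢f vF₀ (proj₁ (lift-in u≢v Z Z₁ (minimal Lf (lift-⊆ u≢v Z Z₁) same ZF₀) uF₀)))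
          where
          no-u : ∀ {R} → R ! u ≡ true → ∂ Lf R ≡ false
          no-u {R} p = ≢true⇒false λ e → t≢f (∧⁺ p e) (h R)
          same : ∀ R → ∂ Lf R ≡ ∂ Z R
          same R with bool (R ! u) | bool (R ! v)
          ... | inj₁ p | _ = trans (no-u p) (sym (∂Z-u p))
          ... | inj₂ p | inj₂ q = trans (sym (∂push-out u≢v Lf p q)) (trans (∂push-lift R) (∂Z₁≡∂Z R))
          ... | inj₂ p | inj₁ q = begin
            ∂ Lf R ≡⟨ sym (xor-identityʳ _) ⟩
            ∂ Lf R xor false ≡⟨ cong₂ _xor_ (cong (∂ Lf) (sym (ins-del q))) (sym (no-u (ins-this u Q))) ⟩
            ∂ Lf (ins v Q) xor ∂ Lf (ins u Q) ≡⟨ sym (∂push-at u≢v Lf (trans (del-other R u≢v) p) (del-this v R)) ⟩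
            ∂ (push u v Lf) (ins v Q) ≡⟨ cong (∂ (push u v Lf)) (ins-del q) ⟩
            ∂ (push u v Lf) R ≡⟨ trans (∂push-lift R) (∂Z₁≡∂Z R) ⟩
            ∂ Z R ∎
            where
            open ≡-Reasoning
            Q = del v R

        module Ridge {R : Subset n} (Ru : R ! u ≡ true) (∂R : ∂ Lf R ≡ true) where

          cof = ∂-true Lf ∂R
          w = proj₁ cof
          F = ins w R
          LF : Lf F ≡ true
          LF = proj₂ (proj₂ cof)
          Fu : F ! u ≡ true
          Fu = ins-⊒ w R u Ru
          ZF : Z F ≡ true
          ZF = lift-⊆ u≢v Z Z₁ LF
          image = lift-in u≢v Z Z₁ LF Fu

          v∉R : R ! v ≡ false
          v∉R = ≢true⇒false λ e → t≢f (ins-⊒ w R v e) (proj₁ image)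

          card-R : suc ∣ R ∣ ≡ d
          card-R = trans (sym (∣ins∣ R w (proj₁ (proj₂ cof)))) (size ZF)

          v∈₁ : vert Z₁ ! v ≡ true
          v∈₁ = vert⁺ (proj₂ image) (ins-this v (del u F))

          module _ {y} (Ry : R ! y ≡ true) (y≢u : y ≢ u) where

            y∈₁ : vert Z₁ ! y ≡ true
            y∈₁ = vert⁺ (proj₂ image) (ins-⊒ v (del u F) y (trans (del-other F y≢u) (ins-⊒ w R y Ry)))

            Guy : G u y ≡ true
            Guy = clique ZF Fu (ins-⊒ w R y Ry)

            -- Replace `u` by `v` in `R`. If the new ridge were in the boundary of neither the lift
            -- nor Z, contraction would carry `R` to a boundary ridge of `Z₁` that Z lacks. So some
            -- facet of Z contains `v` and the rest of `R`.
            Gvy : G v y ≡ true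
            Gvy with bool (∂ Lf (ins v Q)) | bool (∂ Z (ins v Q))
              where Q = del u R
            ... | inj₁ e | _ = let x , _ , z = ∂-true Lf e in clique (lift-⊆ u≢v Z Z₁ z) (ins-⊒ x _ v (ins-this v _)) (ins-⊒ x _ y (ins-⊒ v _ y (trans (del-other R y≢u) Ry)))
            ... | inj₂ _ | inj₁ e = let x , _ , z = ∂-true Z e in clique z (ins-⊒ x _ v (ins-this v _)) (ins-⊒ x _ y (ins-⊒ v _ y (trans (del-other R y≢u) Ry)))
            ... | inj₂ e | inj₂ e′ = t≢f ∂R (trans (sym (cong₂ _xor_ e refl)) (trans (sym (trans (∂push-at u≢v Lf (del-this u R) (trans (del-other R v≢u) v∉R)) (cong (λ A → ∂ Lf (ins v (del u R)) xor ∂ Lf A) (ins-del Ru)))) (trans (∂push-lift (ins v (del u R))) (trans (∂Z₁≡∂Z (ins v (del u R))) e′))))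

        module _ {R : Subset n} (Ru : R ! u ≡ true) (∂R : ∂ Lf R ≡ true) {h : Fin n} (h≢u : h ≢ u)
          {h′ : Fin n} (h′≢h : h′ ≢ h) (h′∉T : del h R ! h′ ≡ false) (∂R′ : ∂ Lf (ins h′ (del h R)) ≡ true) where

          private
            T R′ Y : Subset n
            T = del h R
            R′ = ins h′ T
            Y = del u (ins h′ R)
            R′u : R′ ! u ≡ true
            R′u = ins-⊒ h′ T u (trans (del-other R (h≢u ∘ sym)) Ru)
            module R₁ = Ridge Ru ∂R
            module R₂ = Ridge R′u ∂R′
            h′∉R : R ! h′ ≡ false
            h′∉R = trans (sym (del-other R h′≢h)) h′∉T
            h′≢u : h′ ≢ u
            h′≢u = ≢⇐! Ru h′∉R ∘ sym
            card-Y : suc ∣ Y ∣ ≡ d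
            card-Y = trans (sym (∣del∣ (ins h′ R) u (ins-⊒ h′ R u Ru))) (trans (∣ins∣ R h′ h′∉R) R₁.card-R)
            v∉ : v ≡ h′ ⊎ R ! v ≡ true → Void
            v∉ (inj₁ e) = t≢f (subst (λ x → R′ ! x ≡ true) (sym e) (ins-this h′ T)) R₂.v∉R
            v∉ (inj₂ e) = t≢f e R₁.v∉R
            common : ∀ x → x ≢ u → x ≡ h′ ⊎ R ! x ≡ true → vert Z₁ ! x ≡ true × G u x ≡ true × G v x ≡ true
            common x x≢u (inj₁ refl) = R₂.y∈₁ (ins-this h′ T) h′≢u , R₂.Guy (ins-this h′ T) h′≢u , R₂.Gvy (ins-this h′ T) h′≢u
            common x x≢u (inj₂ Rx) = R₁.y∈₁ Rx x≢u , R₁.Guy Rx x≢u , R₁.Gvy Rx x≢u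
            common′ : ∀ x → Y ! x ≡ true → vert Z₁ ! x ≡ true × G u x ≡ true × G v x ≡ true
            common′ x p = common x (proj₁ (del⁻ {x = u} {ins h′ R} p)) (ins⁻ {x = h′} {R} (proj₂ (del⁻ {x = u} {ins h′ R} p)))

          -- One ridge through `u` provides d-2 common neighbours of `u` and `v`, one too few. A
          -- second ridge that differs from it in one vertex supplies `h′`, so the set `X` of the
          -- step is `R` with `h′` added and `u` removed.
          two-ridges : Step d G B Z u v
          two-ridges .Step.Z₁ = Z₁
          two-ridges .Step.admissible .Admissible.size = size₁
          two-ridges .Step.admissible .Admissible.clique = clique₁
          two-ridges .Step.admissible .Admissible.boundary {R} e = boundary (trans (sym (∂Z₁≡∂Z R)) e)
          two-ridges .Step.admissible .Admissible.minimal = min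
          two-ridges .Step.vert-⊑ = vert₁
          two-ridges .Step.u∉Z₁ = u∉₁
          two-ridges .Step.v∈Z₁ = R₁.v∈₁
          two-ridges .Step.X = Y
          two-ridges .Step.card-X = card-Y
          two-ridges .Step.X⊑ x p = proj₁ (common′ x p)
          two-ridges .Step.u∉X = del-this u (ins h′ R)
          two-ridges .Step.v∉X = ≢true⇒false λ e → v∉ (ins⁻ (del-⊑ u (ins h′ R) v e))
          two-ridges .Step.Xu x p = proj₁ (proj₂ (common′ x p))
          two-ridges .Step.Xv x p = proj₂ (proj₂ (common′ x p))

        -- The boundary of the lift is a cycle, so the face left after deleting a vertex `h` of `R`
        -- lies in a second ridge of that boundary.
        step₁ : Step d G B Z u v
        step₁ = let R , Ru , ∂R = ridge in from R Ru ∂R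
          where
          from : ∀ R → R ! u ≡ true → ∂ Lf R ≡ true → Step d G B Z u v
          -- As d is at least 3, `R` has at least two elements, so a vertex `h` can be deleted while
          -- `u` stays in the shared face.
          from R Ru ∂R with ∣∣>0 (del u R) (≤-pred (subst (2 ≤_) (∣del∣ R u Ru) (≤-pred (subst (3 ≤_) (sym (Ridge.card-R Ru ∂R)) 3≤d))))
          ... | h , p with del⁻ {x = u} {R} p
          ...   | h≢u , Rh with ∂-other (∂ Lf) {del h R} {h} (∂∂ Lf (del h R)) (del-this h R) (trans (cong (∂ Lf) (ins-del Rh)) ∂R)
          ...     | h′ , h′≢h , h′∉T , ∂R′ = two-ridges Ru ∂R h≢u h′≢h h′∉T ∂R′

      contraction-step : ¬ ¬ Step d G B Z u v
      contraction-step k = minimal-subchain (push u v Z) λ { (Z₁ , sub , eq , min) → k (step₁ Z₁ sub eq min) }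

-- The lower bound for the expected rank.

module RankBound where

  open Subsets
  open UnionFind
  open Expectation
  open Chains
  open import Data.Bool using (true; false; _∧_; not; _xor_)
  open import Data.Bool.Properties using (xor-identityʳ)
  open import Data.Nat using (ℕ; zero; suc; _+_; _*_; _≤_; _<_; z≤n; s≤s; >-nonZero)
  open import Data.Nat.Properties
  open import Data.Nat.Tactic.RingSolver using (solve-∀)
  open import Data.Fin using (Fin; zero; suc)
  open import Data.Product using (∃; _×_; _,_; proj₁; proj₂)
  open import Data.Sum using (_⊎_; inj₁; inj₂)
  open import Data.List using (_++_)
  open import Data.List.Membership.Propositional using () renaming (_∈_ to _∈ˡ_)
  open import Data.Fin.Subset using (Subset; ∣_∣)
  open import Relation.Nullary using (¬_; Dec)
  open import Relation.Nullary.Decidable using (decidable-stable; map′)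
  open import Relation.Binary.PropositionalEquality using (_≡_; _≢_; refl; sym; trans; cong; subst; subst₂)
  open import Function using (_∘_)

  -- With N = (d+1)(d+2), M = (n+1)! and e = M E[rank], this reads E[rank] ≥ k (1/2 - 1/N), freed of fractions and subtraction.
  record Bound (N M k e : ℕ) : Set where
    constructor bound
    field lower : N * (k * M) ≤ 2 * N * e + 2 * (k * M)

  open Bound

  bound? : ∀ N M k e → Dec (Bound N M k e)
  bound? N M k e = map′ bound lower (_ ≤? _)

  bound-add : ∀ {N M k k′ e e′ e″} → Bound N M k e → Bound N M k′ e′ → e + e′ ≤ e″ → Bound N M (k + k′) e″
  bound-add {N} {M} {k} {k′} {e} {e′} {e″} (bound p) (bound q) r = bound (begin
    N * ((k + k′) * M) ≡⟨ lemL N M k k′ ⟩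
    N * (k * M) + N * (k′ * M) ≤⟨ +-mono-≤ p q ⟩
    (2 * N * e + 2 * (k * M)) + (2 * N * e′ + 2 * (k′ * M)) ≡⟨ lemR N M k k′ e e′ ⟩
    2 * N * (e + e′) + 2 * ((k + k′) * M) ≤⟨ +-monoˡ-≤ (2 * ((k + k′) * M)) (*-monoʳ-≤ (2 * N) r) ⟩
    2 * N * e″ + 2 * ((k + k′) * M) ∎)
    where
    open ≤-Reasoning
    lemL : ∀ N M k k′ → N * ((k + k′) * M) ≡ N * (k * M) + N * (k′ * M)
    lemL = solve-∀
    lemR : ∀ N M k k′ e e′ → (2 * N * e + 2 * (k * M)) + (2 * N * e′ + 2 * (k′ * M)) ≡ 2 * N * (e + e′) + 2 * ((k + k′) * M)
    lemR = solve-∀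

  private
    suc-lem₁ : ∀ N M k → N * ((1 + k) * M) ≡ N * (k * M) + N * M
    suc-lem₁ = solve-∀
    suc-lem₂ : ∀ N M k e p → 2 * N * e + 2 * (k * M) + N * (2 * p) ≡ 2 * N * (e + p) + 2 * (k * M)
    suc-lem₂ = solve-∀
    suc-lem₃ : ∀ N M k e h → 2 * N * (e + h) + 2 * (k * M) ≡ 2 * N * e + 2 * (N * h + k * M)
    suc-lem₃ = solve-∀

  module _ {N M k e e′ p h : ℕ} (p≡ : 2 * p ≡ M) (h≡ : N * h ≡ M) (b : Bound N M k e) where

    private
      open ≤-Reasoning
      before : N * (suc k * M) ≤ 2 * N * (e + p) + 2 * (k * M)
      before = begin
        N * (suc k * M) ≡⟨ suc-lem₁ N M k ⟩
        N * (k * M) + N * M ≤⟨ +-monoˡ-≤ (N * M) (lower b) ⟩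
        2 * N * e + 2 * (k * M) + N * M ≡⟨ cong (λ m → 2 * N * e + 2 * (k * M) + N * m) (sym p≡) ⟩
        2 * N * e + 2 * (k * M) + N * (2 * p) ≡⟨ suc-lem₂ N M k e p ⟩
        2 * N * (e + p) + 2 * (k * M) ∎
      after : 2 * N * (e′ + h) + 2 * (k * M) ≡ 2 * N * e′ + 2 * (suc k * M)
      after = trans (suc-lem₃ N M k e′ h) (cong (λ m → 2 * N * e′ + 2 * (m + k * M)) h≡)

    -- With p = M/2 and h = M/N the gain p - h is M times 1/2 - 1/N, exactly what the bound asks of
    -- one more vertex.
    bound-suc : e + p ≤ e′ + h → Bound N M (suc k) e′
    bound-suc le = bound (begin
      N * (suc k * M) ≤⟨ before ⟩
      2 * N * (e + p) + 2 * (k * M) ≤⟨ +-monoˡ-≤ (2 * (k * M)) (*-monoʳ-≤ (2 * N) le) ⟩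
      2 * N * (e′ + h) + 2 * (k * M) ≡⟨ after ⟩
      2 * N * e′ + 2 * (suc k * M) ∎)

    bound-suc-strict : 0 < N → e + p < e′ + h → N * (suc k * M) < 2 * N * e′ + 2 * (suc k * M)
    bound-suc-strict N>0 lt = begin-strict
      N * (suc k * M) ≤⟨ before ⟩
      2 * N * (e + p) + 2 * (k * M) <⟨ +-monoˡ-< (2 * (k * M)) (*-monoʳ-< (2 * N) {{>-nonZero (≤-trans N>0 (m≤m+n N _))}} lt) ⟩
      2 * N * (e′ + h) + 2 * (k * M) ≡⟨ after ⟩
      2 * N * e′ + 2 * (suc k * M) ∎

  module _ {n : ℕ} where

    opaque
      restrictG : Graph {n} → Subset n → Graph {n}
      restrictG G S x y = G x y ∧ (S ! x ∧ S ! y)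

      restrictG⁺ : ∀ {G : Graph {n}} {S x y} → G x y ≡ true → S ! x ≡ true → S ! y ≡ true → restrictG G S x y ≡ true
      restrictG⁺ p q r = ∧⁺ p (∧⁺ q r)

      restrictG⁻ : ∀ {G S x y} → restrictG G S x y ≡ true → G x y ≡ true × S ! x ≡ true × S ! y ≡ true
      restrictG⁻ {G} {S} {x} {y} e with ∧⁻ {G x y} e
      ... | g , p = g , ∧⁻ p

    restrictG-symm : ∀ {G S} → Symm G → Symm (restrictG G S)
    restrictG-symm {G} {S} s e with restrictG⁻ {G} {S} e
    ... | g , a , b = restrictG⁺ {G} (s g) b a

    -- Edges inside S merge only vertices of S, so contracting them is finer than identifying all of
    -- S; the rank that remains is at least the rank over S.
    rk-split : ∀ G B {S} → B ⊑ S → ∀ W → rk (restrictG G S) B W + rk G S W ≤ rk G B W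
    rk-split G B {S} B⊑S W = begin
      ρ L E′ + ρ (lab S) E ≤⟨ +-monoʳ-≤ (ρ L E′) (ρ-anti {L = mergeAll L E′} {lab S} E (mergeAll-least {L = L} {lab S} E′ (lab-mono B⊑S) joins)) ⟩
      ρ L E′ + ρ (mergeAll L E′) E ≡⟨ sym (ρ-absorb L sub) ⟩
      ρ L E ∎
      where
      open ≤-Reasoning
      L = lab B
      E = edges G W
      E′ = edges (restrictG G S) W
      joins : ∀ {c d} → (c , d) ∈ˡ E′ → lab S c ≡ lab S d
      joins m with restrictG⁻ {G} {S} (proj₂ (proj₂ (edges⁻ {G = restrictG G S} m)))
      ... | _ , p , q = lab-in {B = S} p q
      sub : ∀ {e} → e ∈ˡ E′ → e ∈ˡ E
      sub m with edges⁻ {G = restrictG G S} m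
      ... | p , q , r = edges⁺ p q (proj₁ (restrictG⁻ {G} {S} r))

    rk-mono : ∀ (G H : Graph {n}) B W → (∀ {x y} → H x y ≡ true → G x y ≡ true) → rk H B W ≤ rk G B W
    rk-mono G H B W h = ρ-⊆ (lab B) λ m → let p , q , r = edges⁻ {G = H} m in edges⁺ p q (h r)

    Nof : ℕ → ℕ
    Nof d = suc d * suc (suc d)

    Mof : ℕ
    Mof = fac (suc n)

    RankBound : ℕ → Graph {n} → Subset n → ℕ → Set
    RankBound d G B k = Bound (Nof d) Mof k (𝔼 (rk G B))

    -- The set avoided in `hit` is `X` with `v`, of size d, so its probability is 1/N, and undoing
    -- the contraction gains at least 1/2 - 1/N of expected rank.
    contract-bound : ∀ {d G B u v X} → Symm G → B ! u ≡ false → u ≢ v → G u v ≡ true → X ! u ≡ false → X ! v ≡ false → suc ∣ X ∣ ≡ d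
      → (∀ x → X ! x ≡ true → G u x ≡ true) → (∀ x → X ! x ≡ true → G v x ≡ true)
      → ∀ {k} → RankBound d (contract G u v) B k → RankBound d G B (suc k)
    contract-bound {d} {G} {B} {u} {v} {X} sG u∉B u≢v Guv u∉X v∉X cX Xu Xv {k} b =
      bound-suc {Nof d} {Mof} {k} {𝔼 (rk H B)} {𝔼 (rk G B)} {𝔼 (λ W → 𝟙 (W ! u))} {𝔼 (λ W → 𝟙 (hit W))} (𝔼-∈ u) hit≡ b
        (subst₂ _≤_ (𝔼-+ (rk H B) (λ W → 𝟙 (W ! u))) (𝔼-+ (rk G B) (λ W → 𝟙 (hit W))) vertex-split)
      where
      open Split G sG B u v u∉B u≢v Guv X u∉X Xu Xv
      hit≡ : Nof d * 𝔼 (λ W → 𝟙 (hit W)) ≡ Mof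
      hit≡ = trans (cong (λ c → suc c * suc (suc c) * 𝔼 (λ W → 𝟙 (hit W))) (sym (trans (∣ins∣ X v v∉X) cX)))
        (𝔼-hit (ins v X) u (trans (ins-other X u≢v) u∉X))

    contract-bound-strict : ∀ {d G B u v X} → Symm G → B ! u ≡ false → u ≢ v → G u v ≡ true → X ! u ≡ false → X ! v ≡ false → suc ∣ X ∣ ≡ d
      → (Xu : ∀ x → X ! x ≡ true → G u x ≡ true) → (Xv : ∀ x → X ! x ≡ true → G v x ≡ true)
      → ∀ W → W ! u ≡ false → W ! v ≡ false → disj X W ≡ true
      → mergeAll (lab B) (edges G (ins u W) ++ edges G (ins v W)) u ≡ mergeAll (lab B) (edges G (ins u W) ++ edges G (ins v W)) v
      → ∀ {k} → RankBound d (contract G u v) B k → Nof d * (suc k * Mof) < 2 * Nof d * 𝔼 (rk G B) + 2 * (suc k * Mof)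
    contract-bound-strict {d} {G} {B} {u} {v} {X} sG u∉B u≢v Guv u∉X v∉X cX Xu Xv W u∉W v∉W dj lk {k} b =
      bound-suc-strict {Nof d} {Mof} {k} {𝔼 (rk H B)} {𝔼 (rk G B)} {𝔼 (λ W → 𝟙 (W ! u))} {𝔼 (λ W → 𝟙 (hit W))} (𝔼-∈ u) hit≡ b (s≤s z≤n)
        (subst₂ _<_ (𝔼-+ (rk H B) (λ W → 𝟙 (W ! u))) (𝔼-+ (rk G B) (λ W → 𝟙 (hit W))) (vertex-split-strict W u∉W v∉W dj v∉X lk))
      where
      open Split G sG B u v u∉B u≢v Guv X u∉X Xu Xv
      hit≡ : Nof d * 𝔼 (λ W → 𝟙 (hit W)) ≡ Mof
      hit≡ = trans (cong (λ c → suc c * suc (suc c) * 𝔼 (λ W → 𝟙 (hit W))) (sym (trans (∣ins∣ X v v∉X) cX)))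
        (𝔼-hit (ins v X) u (trans (ins-other X u≢v) u∉X))

    -- By minimality, some facet meets both B and its complement.
    crossing : ∀ {d} {G : Graph {n}} {B : Subset n} {Z : Chain {n}} → 2 ≤ d → Admissible d G B Z → ∀ {y} → vert Z ! y ≡ true → B ! y ≡ false
      → ¬ ¬ (∃ λ F → ∃ λ u → ∃ λ v → Z F ≡ true × F ! u ≡ true × F ! v ≡ true × B ! u ≡ false × B ! v ≡ true)
    crossing {d} {G} {B} {Z} 2≤d adm {y} Vy y∉B none with vert⁻ {Z = Z} Vy
    ... | F , ZF , Fy = none (F , y , proj₁ meet , ZF , Fy , proj₁ (proj₂ meet) , y∉B , proj₂ (proj₂ meet))
      where
      open Admissible adm
      Y D : Chain
      Y F = Z F ∧ not (disj F B)
      D F = Z F ∧ disj F B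
      -- A boundary ridge of the facets missing `B` has a vertex `r` outside `B`. Without crossing
      -- facets every facet of Z through `r` misses `B`, so the ridge would be a boundary ridge of Z
      -- not contained in `B`.
      ∂D : ∀ R → ∂ D R ≡ false
      ∂D R = ≢true⇒false bad
        where
        bad : ¬ (∂ D R ≡ true)
        bad e with ∂-true D e
        ... | x , x∉R , p with ∧⁻ {Z (ins x R)} p
        ...   | ZRx , dj with ∣∣>0 R (≤-pred (subst (2 ≤_) (trans (sym (size ZRx)) (∣ins∣ R x x∉R)) 2≤d))
        ...     | r , Rr = t≢f (boundary (trans (∂-same) e) r Rr) r∉B
          where
          r∉B : B ! r ≡ false
          r∉B = disj⁻ {A = ins x R} dj r (ins-⊒ x R r Rr)
          ∂-same : ∂ Z R ≡ ∂ D R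
          ∂-same = ⊕F-cong λ z → cong (not (R ! z) ∧_) (⇔⇒≡ (λ q → ∧⁺ q (disj⁺ {A = ins z R} λ w Fw → ≢true⇒false λ Bw →
            none (ins z R , r , w , q , ins-⊒ z R r Rr , Fw , r∉B , Bw))) (proj₁ ∘ ∧⁻))
      ∂Y : ∀ R → ∂ Y R ≡ ∂ Z R
      ∂Y R = sym (trans (∂-cong (λ F → split (Z F) (disj F B)) R) (trans (∂-xor Y D R) (trans (cong (∂ Y R xor_) (∂D R)) (xor-identityʳ _))))
        where
        split : ∀ a b → a ≡ (a ∧ not b) xor (a ∧ b)
        split true true = refl
        split true false = refl
        split false _ = refl
      meet : ∃ λ v → F ! v ≡ true × B ! v ≡ true
      meet = disj-false {A = F} (not⁻ (proj₂ (∧⁻ {Z F} (minimal Y (proj₁ ∘ ∧⁻) ∂Y ZF))))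

    enlarge : ∀ {d} {G : Graph {n}} {B B′ : Subset n} {Z : Chain {n}} → B ⊑ B′ → Admissible d G B Z → Admissible d G B′ Z
    enlarge h adm = record { size = size ; clique = clique ; boundary = λ {R} e x p → h x (boundary {R} e x p) ; minimal = minimal }
      where open Admissible adm

    contract-restrict : ∀ {G S u v x y} → S ! u ≡ true → S ! x ≡ true → S ! y ≡ true → contract G u v x y ≡ true → contract (restrictG G S) u v x y ≡ true
    contract-restrict {G} Su Sx Sy e with contract⁻ {G = G} e
    ... | p , q , inj₁ g = contract⁺ p q (inj₁ (restrictG⁺ {G} g Sx Sy))
    ... | p , q , inj₂ (inj₁ (r , g)) = contract⁺ p q (inj₂ (inj₁ (r , restrictG⁺ {G} g Su Sy)))
    ... | p , q , inj₂ (inj₂ (r , g)) = contract⁺ p q (inj₂ (inj₂ (r , restrictG⁺ {G} g Sx Su)))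

    module _ {d : ℕ} {G : Graph {n}} {B : Subset n} {Z : Chain} (sG : Symm G)
      {u v : Fin n} (Zu : vert Z ! u ≡ true) (u∉B : B ! u ≡ false) (v∈B : B ! v ≡ true) (Guv : G u v ≡ true) (st : Step d G B Z u v) where

      open Step st

      -- The vertices accounted for by the contraction. The rest of Z is treated with all of `Core`
      -- identified.
      Core : Subset n
      Core = B ∪′ ins u (vert Z₁)

      core-∋ : ∀ {x} → vert Z₁ ! x ≡ true → Core ! x ≡ true
      core-∋ {x} p = ∪⁺ʳ {B = ins u (vert Z₁)} (ins-⊒ u (vert Z₁) x p)

      u∈core : Core ! u ≡ true
      u∈core = ∪⁺ʳ {B = ins u (vert Z₁)} (ins-this u (vert Z₁))

      core-step : RankBound d (contract (restrictG G Core) u v) B ∣ vert Z₁ ∖ B ∣ → RankBound d (restrictG G Core) B (suc ∣ vert Z₁ ∖ B ∣)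
      core-step = contract-bound {d} {restrictG G Core} (restrictG-symm {G} {Core} sG) u∉B (≢⇐! v∈B u∉B ∘ sym) (restrictG⁺ {G} Guv u∈core (core-∋ v∈Z₁)) u∉X v∉X card-X
        (λ x p → restrictG⁺ {G} (Xu x p) u∈core (core-∋ (X⊑ x p))) (λ x p → restrictG⁺ {G} (Xv x p) (core-∋ v∈Z₁) (core-∋ (X⊑ x p)))

      admissible-core : Admissible d (contract (restrictG G Core) u v) B Z₁
      admissible-core = record
        { size = Admissible.size admissible
        ; clique = λ z p q → contract-restrict {G = G} u∈core (core-∋ (vert⁺ z p)) (core-∋ (vert⁺ z q)) (Admissible.clique admissible z p q)
        ; boundary = λ {R} → Admissible.boundary admissible {R}
        ; minimal = Admissible.minimal admissible
        }

      card-split : ∣ vert Z ∖ B ∣ ≡ suc ∣ vert Z₁ ∖ B ∣ + ∣ vert Z ∖ Core ∣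
      card-split = trans (∣∖∪∣ (vert Z) B (ins u (vert Z₁)) (ins-lub vert-⊑ Zu))
        (cong (_+ ∣ vert Z ∖ Core ∣) (trans (cong ∣_∣ ins-∖) (∣ins∣ (vert Z₁ ∖ B) u (≢true⇒false λ e → t≢f (proj₁ (∖⁻ {A = vert Z₁} {B} e)) u∉Z₁))))
        where
        ins-∖ : ins u (vert Z₁) ∖ B ≡ ins u (vert Z₁ ∖ B)
        ins-∖ = ⊑-antisym (λ x p → to x (∖⁻ {A = ins u (vert Z₁)} {B} p)) (λ x p → from x (ins⁻ p))
          where
          to : ∀ x → ins u (vert Z₁) ! x ≡ true × B ! x ≡ false → ins u (vert Z₁ ∖ B) ! x ≡ true
          to x (p , q) with ins⁻ {x = u} {vert Z₁} p
          ... | inj₁ refl = ins-this u _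
          ... | inj₂ r = ins-⊒ u _ x (∖⁺ r q)
          from : ∀ x → x ≡ u ⊎ (vert Z₁ ∖ B) ! x ≡ true → (ins u (vert Z₁) ∖ B) ! x ≡ true
          from x (inj₁ refl) = ∖⁺ (ins-this u _) u∉B
          from x (inj₂ p) = ∖⁺ (ins-⊒ u _ x (proj₁ (∖⁻ {A = vert Z₁} {B} p))) (proj₂ (∖⁻ {A = vert Z₁} {B} p))

    module _ {d : ℕ} (3≤d : 3 ≤ d) where

      -- Induction on the number of vertices outside `B`. The two recursive calls are for the
      -- subchain in the contracted graph on `Core`, and for Z itself with `Core` as the new `B`.
      -- The second recovers the vertices dropped by the subchain, as enlarging `B` keeps the same
      -- chain admissible; `rk-split` adds the two ranks.
      rank-bound : ∀ {G : Graph {n}} {B : Subset n} {Z : Chain {n}} → Symm G → Admissible d G B Z → RankBound d G B ∣ vert Z ∖ B ∣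
      rank-bound {G} {B} {Z} = go (suc ∣ vert Z ∖ B ∣) ≤-refl
        where
        go : ∀ k {G : Graph {n}} {B : Subset n} {Z : Chain {n}} → ∣ vert Z ∖ B ∣ < k → Symm G → Admissible d G B Z → RankBound d G B ∣ vert Z ∖ B ∣
        go (suc k) {G} {B} {Z} (s≤s le) sG adm with ∣ vert Z ∖ B ∣ in eq
        ... | zero = bound (≤-trans (≤-reflexive (*-zeroʳ (Nof d))) z≤n)
        -- A crossing facet and a contraction exist only up to double negation; decidability of the
        -- bound removes it.
        ... | suc m = decidable-stable (bound? _ _ _ _) (refute (∣∣>0 (vert Z ∖ B) (subst (0 <_) (sym eq) (s≤s z≤n))))
          where
          done : ∀ {F u v} → Z F ≡ true → F ! u ≡ true → F ! v ≡ true → B ! u ≡ false → B ! v ≡ true → Step d G B Z u v → RankBound d G B (suc m)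
          done {F} {u} {v} ZF Fu Fv u∉B v∈B st = subst (RankBound d G B) (trans (sym (card-split sG Zu u∉B v∈B Guv′ st)) eq)
            (bound-add {Nof d} {Mof} {suc ∣ vert Z₁ ∖ B ∣} {∣ vert Z ∖ S ∣} {𝔼 (rk (restrictG G S) B)} {𝔼 (rk G S)} {𝔼 (rk G B)}
              (core-step sG Zu u∉B v∈B Guv′ st (go k lt₁ (contract-symm {G = restrictG G S} (restrictG-symm {G} {S} sG)) (admissible-core sG Zu u∉B v∈B Guv′ st)))
              (go k lt₂ sG (enlarge (λ x p → ∪⁺ˡ {B = ins u (vert Z₁)} p) adm))
              (subst (_≤ 𝔼 (rk G B)) (𝔼-+ (rk (restrictG G S) B) (rk G S)) (𝔼-mono (rk-split G B (λ x p → ∪⁺ˡ {B = ins u (vert Z₁)} p)))))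
            where
            open Step st
            Zu = vert⁺ ZF Fu
            Guv′ = Admissible.clique adm ZF Fu Fv
            S = B ∪′ ins u (vert Z₁)
            total : suc (∣ vert Z₁ ∖ B ∣ + ∣ vert Z ∖ S ∣) ≤ k
            total = ≤-trans (≤-reflexive (trans (sym (card-split sG Zu u∉B v∈B Guv′ st)) eq)) le
            lt₁ : ∣ vert Z₁ ∖ B ∣ < k
            lt₁ = ≤-trans (s≤s (m≤m+n _ _)) total
            lt₂ : ∣ vert Z ∖ S ∣ < k
            lt₂ = ≤-trans (s≤s (m≤n+m _ _)) total
          refute : (∃ λ y → (vert Z ∖ B) ! y ≡ true) → ¬ ¬ RankBound d G B (suc m)
          refute (y , p) none = crossing (≤-trans (s≤s (s≤s z≤n)) 3≤d) adm (proj₁ (∖⁻ {A = vert Z} {B} p)) (proj₂ (∖⁻ {A = vert Z} {B} p))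
            λ { (F , u , v , ZF , Fu , Fv , u∉B , v∈B) → contraction-step 3≤d adm u∉B v∈B ZF Fu Fv λ st → none (done ZF Fu Fv u∉B v∈B st) }

-- Identified cliques, the case of equality, and minimal cycles.

module MinimalCycles where

  open Subsets
  open UnionFind
  open Expectation
  open Chains
  open RankBound
  open import Data.Bool using (Bool; true; false; _∧_; not; _xor_)
  open import Data.Bool.Properties using (xor-same; ∧-zeroʳ)
  open import Data.Nat using (ℕ; zero; suc; _+_; _*_; _≤_; _<_; z≤n; s≤s; pred; >-nonZero)
  open import Data.Nat.Properties
  open import Data.Nat.Tactic.RingSolver using (solve-∀)
  open import Data.Fin using (zero; suc)
  import Data.Fin.Properties as Finₚ
  open import Data.Vec using ([]; _∷_)
  open import Data.Product using (∃; _×_; _,_; proj₁; proj₂)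
  open import Data.Sum using (_⊎_; inj₁; inj₂)
  open import Data.Empty using (⊥-elim) renaming (⊥ to Void)
  open import Data.List using ([]; _∷_)
  open import Data.List.Relation.Unary.Any using () renaming (here to hereˡ)
  open import Data.Vec.Properties using (≡-dec)
  open import Data.List.Membership.Propositional using () renaming (_∈_ to _∈ˡ_)
  open import Data.Fin.Subset using (Subset; ∣_∣; ⊥)
  open import Relation.Nullary using (¬_; Dec; yes; no)
  open import Relation.Binary.PropositionalEquality using (_≡_; _≢_; refl; sym; trans; cong; cong₂; subst; subst₂; module ≡-Reasoning)
  open import Function using (_∘_)

  open Bound

  𝔼-1 : ∀ {n} → 𝔼 {n} (λ _ → 1) ≡ fac (suc n)
  𝔼-1 {n} = trans (𝔼-cong {n} λ W → cong 𝟙 (sym (disj⁺ {A = ⊥} {W} λ x p → t≢f p (⊥! x))))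
    (trans (sym (*-identityˡ _)) (subst (λ c → suc c * 𝔼 {n} (λ W → 𝟙 (disj ⊥ W)) ≡ fac (suc n)) (∣⊥∣≡0 n) (𝔼-avoid {n} ⊥)))
    where open import Data.Fin.Subset.Properties using (∣⊥∣≡0)

  cardIn-∋ : ∀ {n} (A W : Subset n) {x} → A ! x ≡ true → W ! x ≡ true → 0 < cardIn A W
  cardIn-∋ A W {x} p q = ≤-trans (≤-reflexive (cong 𝟙 (sym (∧⁺ q p)))) (ΣF-term (λ x → 𝟙 (W ! x ∧ A ! x)) x)

  cardIn-0 : ∀ {n} (A W : Subset n) → (∀ x → A ! x ≡ true → W ! x ≡ false) → cardIn A W ≡ 0
  cardIn-0 A W h = ΣF-0 λ x → cong 𝟙 (≢true⇒false λ e → t≢f (proj₁ (∧⁻ e)) (h x (proj₂ (∧⁻ e))))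

  -- The truncation at 0 is corrected by the indicator of an empty intersection, whose average is
  -- known from `𝔼-avoid`.
  pred-cardIn : ∀ {n} (A W : Subset n) → pred (cardIn A W) + 1 ≡ cardIn A W + 𝟙 (disj A W)
  pred-cardIn A W with bool (disj A W)
  ... | inj₁ e rewrite e | cardIn-0 A W (disj⁻ {A = A} e) = refl
  ... | inj₂ e rewrite e with disj-false {A = A} e
  ...   | x , p , q with cardIn A W | cardIn-∋ A W p q
  ...     | suc c | _ = trans (+-comm c 1) (sym (+-identityʳ (suc c)))

  𝔼-pred-cardIn : ∀ {n} (A B : Subset n) → ∣ A ∣ ≡ ∣ B ∣ → 𝔼 (pred ∘ cardIn A) ≡ 𝔼 (pred ∘ cardIn B)
  𝔼-pred-cardIn {n} A B eq = +-cancelʳ-≡ (fac (suc n)) _ _ (trans (lem A) (trans (cong₂ _+_ cards disjs) (sym (lem B))))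
    where
    lem : ∀ A → 𝔼 (pred ∘ cardIn A) + fac (suc n) ≡ 𝔼 (cardIn A) + 𝔼 (λ W → 𝟙 (disj A W))
    lem A = begin
      𝔼 (pred ∘ cardIn A) + fac (suc n) ≡⟨ cong (𝔼 (pred ∘ cardIn A) +_) (sym (𝔼-1 {n})) ⟩
      𝔼 (pred ∘ cardIn A) + 𝔼 {n} (λ _ → 1) ≡⟨ sym (𝔼-+ (pred ∘ cardIn A) (λ _ → 1)) ⟩
      𝔼 (λ W → pred (cardIn A W) + 1) ≡⟨ 𝔼-cong (pred-cardIn A) ⟩
      𝔼 (λ W → cardIn A W + 𝟙 (disj A W)) ≡⟨ 𝔼-+ (cardIn A) (λ W → 𝟙 (disj A W)) ⟩
      𝔼 (cardIn A) + 𝔼 (λ W → 𝟙 (disj A W)) ∎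
      where open ≡-Reasoning
    cards : 𝔼 (cardIn A) ≡ 𝔼 (cardIn B)
    cards = *-cancelˡ-≡ (𝔼 (cardIn A)) (𝔼 (cardIn B)) 2 (trans (𝔼-cardIn A) (trans (cong (_* fac (suc n)) eq) (sym (𝔼-cardIn B))))
    disjs : 𝔼 (λ W → 𝟙 (disj A W)) ≡ 𝔼 (λ W → 𝟙 (disj B W))
    disjs = *-cancelˡ-≡ (𝔼 (λ W → 𝟙 (disj A W))) (𝔼 (λ W → 𝟙 (disj B W))) (suc ∣ A ∣)
      (trans (𝔼-avoid A) (trans (sym (𝔼-avoid B)) (cong (λ c → suc c * 𝔼 (λ W → 𝟙 (disj B W))) (sym eq))))

  -- The inequality of `Bound` reversed; where the bound is known, this is the case of equality.
  record Tight (N M k e : ℕ) : Set where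
    constructor tight
    field upper : 2 * N * e + 2 * (k * M) ≤ N * (k * M)

  open Tight

  -- The first summand already uses its full share, which leaves no room for the second to exceed
  -- its own.
  tight-cancel : ∀ {N M k k′ e e′ e″} → Tight N M (k + k′) e″ → Bound N M k e → e + e′ ≤ e″ → Tight N M k′ e′
  tight-cancel {N} {M} {k} {k′} {e} {e′} {e″} (tight t) (bound b) le = tight (+-cancelˡ-≤ (N * (k * M)) _ _ (begin
    N * (k * M) + (2 * N * e′ + 2 * (k′ * M)) ≤⟨ +-monoˡ-≤ (2 * N * e′ + 2 * (k′ * M)) b ⟩
    (2 * N * e + 2 * (k * M)) + (2 * N * e′ + 2 * (k′ * M)) ≡⟨ lemR N M k k′ e e′ ⟩
    2 * N * (e + e′) + 2 * ((k + k′) * M) ≤⟨ +-monoˡ-≤ (2 * ((k + k′) * M)) (*-monoʳ-≤ (2 * N) le) ⟩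
    2 * N * e″ + 2 * ((k + k′) * M) ≤⟨ t ⟩
    N * ((k + k′) * M) ≡⟨ lemL N M k k′ ⟩
    N * (k * M) + N * (k′ * M) ∎))
    where
    open ≤-Reasoning
    lemL : ∀ N M k k′ → N * ((k + k′) * M) ≡ N * (k * M) + N * (k′ * M)
    lemL = solve-∀
    lemR : ∀ N M k k′ e e′ → (2 * N * e + 2 * (k * M)) + (2 * N * e′ + 2 * (k′ * M)) ≡ 2 * N * (e + e′) + 2 * ((k + k′) * M)
    lemR = solve-∀

  module _ {n : ℕ} where

    RankTight : ℕ → Graph {n} → Subset n → ℕ → Set
    RankTight d G B k = Tight (Nof {n} d) (Mof {n}) k (𝔼 (rk G B))

    rk-lab-≤ : ∀ (G : Graph {n}) {B B′} W → (∀ x → W ! x ≡ true → B ! x ≡ true → B′ ! x ≡ true) → rk G B′ W ≤ rk G B W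
    rk-lab-≤ G W h = lab-antiOn W (edges G W) (λ m → let p , q , _ = edges⁻ {G = G} m in p , q) h

    cardIn-ins : ∀ {B W : Subset n} {x} → B ! x ≡ false → W ! x ≡ true → cardIn (ins x B) W ≡ suc (cardIn B W)
    cardIn-ins {B} {W} {x} x∉B Wx = begin
      cardIn (ins x B) W ≡⟨ sym (card-as (ins x B)) ⟩
      ∣ subset (λ y → W ! y ∧ ins x B ! y) ∣ ≡⟨ cong ∣_∣ (ext λ y → ptw y (y Finₚ.≟ x)) ⟩
      ∣ ins x (subset (λ y → W ! y ∧ B ! y)) ∣ ≡⟨ ∣ins∣ _ x (trans (subset! _ x) (trans (cong (W ! x ∧_) x∉B) (∧-zeroʳ (W ! x)))) ⟩
      suc ∣ subset (λ y → W ! y ∧ B ! y) ∣ ≡⟨ cong suc (card-as B) ⟩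
      suc (cardIn B W) ∎
      where
      open ≡-Reasoning
      card-as : ∀ B → ∣ subset (λ y → W ! y ∧ B ! y) ∣ ≡ cardIn B W
      card-as B = trans (card≡Σ (subset (λ y → W ! y ∧ B ! y))) (ΣF-cong λ y → cong 𝟙 (subset! (λ y → W ! y ∧ B ! y) y))
      ptw : ∀ y → Dec (y ≡ x) → subset (λ y → W ! y ∧ ins x B ! y) ! y ≡ ins x (subset (λ y → W ! y ∧ B ! y)) ! y
      ptw y (yes refl) = trans (subset! _ y) (trans (∧⁺ Wx (ins-this y B)) (sym (ins-this y _)))
      ptw y (no ne) = trans (subset! _ y) (trans (cong (W ! y ∧_) (ins-other B ne)) (sym (trans (ins-other _ ne) (subset! _ y))))

    merge-lab : ∀ {B : Subset n} {b x} → B ! b ≡ true → merge (lab B) (b , x) ≼ lab (ins x B) × lab (ins x B) ≼ merge (lab B) (b , x)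
    merge-lab {B} {b} {x} Bb =
        merge-least {L = lab B} {lab (ins x B)} (lab-mono (ins-⊒ x B)) (lab-in {B = ins x B} (ins-⊒ x B b Bb) (ins-this x B))
      , lab-least {M = M} (λ y z p q → trans (to-b y (ins⁻ p)) (sym (to-b z (ins⁻ q))))
      where
      M = merge (lab B) (b , x)
      to-b : ∀ y → y ≡ x ⊎ B ! y ≡ true → M y ≡ M b
      to-b y (inj₁ refl) = sym (merge-joins (lab B) b y)
      to-b y (inj₂ p) = merge-≽ (lab B) (b , x) y b (lab-in {B = B} p Bb)

    -- If `x` and some b in `B` both lie in W, the edge bx is present and joining it costs one unit
    -- of rank, paid by the extra vertex in `cardIn`. Otherwise no two vertices of W are newly
    -- identified, and `pred` gives 0 on both sides when W contains `x` but misses `B`.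
    rk-absorb : ∀ (G : Graph {n}) {B x} W → B ! x ≡ false → (∀ b → B ! b ≡ true → G b x ≡ true)
      → rk G B W + pred (cardIn B W) ≡ rk G (ins x B) W + pred (cardIn (ins x B) W)
    rk-absorb G {B} {x} W x∉B adj = cases (bool (W ! x)) (bool (disj B W))
      where
      E = edges G W
      cases : W ! x ≡ true ⊎ W ! x ≡ false → disj B W ≡ true ⊎ disj B W ≡ false → rk G B W + pred (cardIn B W) ≡ rk G (ins x B) W + pred (cardIn (ins x B) W)
      cases (inj₂ x∉W) _ = cong₂ (λ r c → r + pred c) (≤-antisym (rk-lab-≤ G W λ y Wy p → out y Wy (ins⁻ p)) (rk-lab-≤ G W λ y _ → ins-⊒ x B y))
        (ΣF-cong λ y → cong 𝟙 (⇔⇒≡ (λ e → ∧⁺ (proj₁ (∧⁻ e)) (ins-⊒ x B y (proj₂ (∧⁻ e)))) λ e → ∧⁺ (proj₁ (∧⁻ e)) (out y (proj₁ (∧⁻ e)) (ins⁻ (proj₂ (∧⁻ e))))))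
        where
        out : ∀ y → W ! y ≡ true → y ≡ x ⊎ B ! y ≡ true → B ! y ≡ true
        out y Wy (inj₁ refl) = t≢f Wy x∉W
        out y Wy (inj₂ p) = p
      cases (inj₁ Wx) (inj₁ dj) = cong₂ _+_ (≤-antisym (ρ-antiOn (λ y → W ! y ≡ true) {lab (ins x B)} {lab B} E (λ m → let p , q , _ = edges⁻ {G = G} m in p , q) same) (rk-lab-≤ G W λ y _ → ins-⊒ x B y))
        (trans (cong pred none) (sym (cong pred (trans (cardIn-ins {B} {W} x∉B Wx) (cong suc none)))))
        where
        none : cardIn B W ≡ 0
        none = cardIn-0 B W (disj⁻ {A = B} dj)
        only : ∀ y → W ! y ≡ true → y ≡ x ⊎ B ! y ≡ true → y ≡ x
        only y Wy (inj₁ e) = e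
        only y Wy (inj₂ p) = t≢f Wy (disj⁻ {A = B} dj y p)
        same : ∀ y z → W ! y ≡ true → W ! z ≡ true → lab (ins x B) y ≡ lab (ins x B) z → lab B y ≡ lab B z
        same y z Wy Wz e with lab⁻ (ins x B) y z e
        ... | inj₁ refl = refl
        ... | inj₂ (p , q) = cong (lab B) (trans (only y Wy (ins⁻ p)) (sym (only z Wz (ins⁻ q))))
      cases (inj₁ Wx) (inj₂ ndj) with disj-false {A = B} ndj
      ... | b , Bb , Wb = begin
        rk G B W + pred (cardIn B W) ≡⟨ cong (_+ pred (cardIn B W)) (ρ-absorb (lab B) {E} {(b , x) ∷ []} sub) ⟩
        differ (lab B b) (lab B x) + 0 + ρ (merge (lab B) (b , x)) E + pred (cardIn B W)
          ≡⟨ cong₂ (λ k r → k + 0 + r + pred (cardIn B W)) (differ-≢ {p = lab B b} λ e → b≁x (lab⁻ B b x e)) (ρ-≈ E (proj₁ (merge-lab Bb)) (proj₂ (merge-lab Bb))) ⟩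
        suc (rk G (ins x B) W + pred (cardIn B W)) ≡⟨ sym (+-suc _ _) ⟩
        rk G (ins x B) W + suc (pred (cardIn B W)) ≡⟨ cong (rk G (ins x B) W +_) (trans (suc-pred (cardIn B W) {{>-nonZero (cardIn-∋ B W Bb Wb)}}) (sym (cong pred (cardIn-ins {B} {W} x∉B Wx)))) ⟩
        rk G (ins x B) W + pred (cardIn (ins x B) W) ∎
        where
        open ≡-Reasoning
        b≁x : b ≡ x ⊎ (B ! b ≡ true × B ! x ≡ true) → Void
        b≁x (inj₁ refl) = t≢f Bb x∉B
        b≁x (inj₂ (_ , p)) = t≢f p x∉B
        sub : ∀ {e} → e ∈ˡ (b , x) ∷ [] → e ∈ˡ E
        sub (hereˡ refl) = edges⁺ Wb Wx (adj b Bb)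

    Clique : Graph {n} → Subset n → Set
    Clique G A = ∀ {x y} → A ! x ≡ true → A ! y ≡ true → x ≢ y → G x y ≡ true

    -- The vertices of the clique are absorbed one by one, starting from no identification. The
    -- first one in W is free and each further one costs 1.
    rk-clique : ∀ {G : Graph {n}} {A} → Clique G A → ∀ W → rk G A W + pred (cardIn A W) ≡ rk G ⊥ W
    rk-clique {G} {A} cl W = go ∣ A ∣ A refl cl
      where
      go : ∀ k A → ∣ A ∣ ≡ k → Clique G A → rk G A W + pred (cardIn A W) ≡ rk G ⊥ W
      go zero A eq cl = trans (cong₂ (λ B c → rk G B W + pred c) (ext λ x → trans (∣∣≡0 {A = A} eq x) (sym (⊥! x))) (cardIn-0 A W λ x p → t≢f p (∣∣≡0 {A = A} eq x))) (+-identityʳ _)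
      go (suc k) A eq cl with ∣∣>0 A (subst (0 <_) (sym eq) (s≤s z≤n))
      ... | x , Ax = trans (subst (λ B → rk G B W + pred (cardIn B W) ≡ rk G (del x A) W + pred (cardIn (del x A) W)) (ins-del Ax)
          (sym (rk-absorb G {del x A} {x} W (del-this x A) λ b p → cl (del-⊑ x A b p) Ax (proj₁ (del⁻ {x = x} {A} p)))))
        (go k (del x A) (suc-injective (trans (sym (∣del∣ A x Ax)) eq)) λ p q → cl (del-⊑ x A _ p) (del-⊑ x A _ q))

    𝔼-rk-clique : ∀ {G : Graph {n}} {A} → Clique G A → 𝔼 (rk G A) + 𝔼 (pred ∘ cardIn A) ≡ 𝔼 (rk G ⊥)
    𝔼-rk-clique {G} {A} cl = trans (sym (𝔼-+ (rk G A) (pred ∘ cardIn A))) (𝔼-cong (rk-clique {G} cl))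

    -- The correction term depends only on the size of the clique. So every clique of d vertices may
    -- serve as the identified set, whether or not it is a facet; the separators found later are not
    -- facets.
    𝔼-clique-independent : ∀ {G : Graph {n}} {A A′} → Clique G A → Clique G A′ → ∣ A ∣ ≡ ∣ A′ ∣ → 𝔼 (rk G A) ≡ 𝔼 (rk G A′)
    𝔼-clique-independent {G} {A} {A′} c c′ eq = +-cancelʳ-≡ (𝔼 (pred ∘ cardIn A)) (𝔼 (rk G A)) (𝔼 (rk G A′))
      (trans (𝔼-rk-clique {G} c) (trans (sym (𝔼-rk-clique {G} c′)) (cong (𝔼 (rk G A′) +_) (𝔼-pred-cardIn A′ A (sym eq)))))

    opaque
      eqS : Subset n → Subset n → Bool
      eqS = eqᵇ

      eqS⁺ : ∀ {F} → eqS F F ≡ true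
      eqS⁺ {F} with ≡-dec Data.Bool._≟_ F F
      ... | yes _ = refl
      ... | no ne = ⊥-elim (ne refl)

      eqS⁻ : ∀ {F H} → eqS F H ≡ true → F ≡ H
      eqS⁻ {F} {H} e with ≡-dec Data.Bool._≟_ F H
      ... | yes p = p

    eqS-≢ : ∀ {F H} → F ≢ H → eqS F H ≡ false
    eqS-≢ ne = ≢true⇒false (ne ∘ eqS⁻)

    single : Subset n → Chain {n}
    single σ F = eqS F σ

    ∂-single⁻ : ∀ {σ R} → ∂ (single σ) R ≡ true → ∃ λ x → R ! x ≡ false × ins x R ≡ σ
    ∂-single⁻ {σ} e with ∂-true (single σ) e
    ... | x , p , q = x , p , eqS⁻ q

    ∂-single⁺ : ∀ {σ x} → σ ! x ≡ true → ∂ (single σ) (del x σ) ≡ true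
    ∂-single⁺ {σ} {x} p = trans (⊕F-point _ x λ y ne → ≢true⇒false λ e → t≢f (trans (sym (del-this x σ)) (trans (sym (ins-other (del x σ) (ne ∘ sym))) (trans (cong (_! x) (eqS⁻ (proj₂ (∧⁻ e)))) p))) refl)
      (∧⁺ (not⁺ (del-this x σ)) (trans (cong (λ F → eqS F σ) (ins-del p)) eqS⁺))

    -- A circuit of the mod-2 simplicial matroid: the only nonempty subcycle is the whole.
    record MinCycle (d : ℕ) (Z : Chain {n}) : Set where
      field
        size : ∀ {F} → Z F ≡ true → ∣ F ∣ ≡ d
        closed : ∀ R → ∂ Z R ≡ false
        irreducible : ∀ (D : Chain {n}) → (∀ {F} → D F ≡ true → Z F ≡ true) → (∀ R → ∂ D R ≡ false) → ∀ {F₀} → D F₀ ≡ true → ∀ {F} → Z F ≡ true → D F ≡ true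

    module _ {d : ℕ} {Z : Chain {n}} (mc : MinCycle d Z) {σ : Subset n} (Zσ : Z σ ≡ true) where

      open MinCycle mc

      puncture : Chain {n}
      puncture F = Z F ∧ not (eqS F σ)

      puncture-σ : ¬ (puncture σ ≡ true)
      puncture-σ e = t≢f eqS⁺ (not⁻ (proj₂ (∧⁻ e)))

      ∂-puncture : ∀ R → ∂ puncture R ≡ ∂ (single σ) R
      ∂-puncture R = trans (∂-cong {Y = puncture} {Z = λ F → Z F xor eqS F σ} (λ F → lem F (bool (eqS F σ))) R) (trans (∂-xor Z (single σ) R) (cong (_xor ∂ (single σ) R) (closed R)))
        where
        lem : ∀ F → eqS F σ ≡ true ⊎ eqS F σ ≡ false → Z F ∧ not (eqS F σ) ≡ Z F xor eqS F σ
        lem F (inj₁ e) rewrite e | eqS⁻ e | Zσ = refl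
        lem F (inj₂ e) rewrite e with Z F
        ... | true = refl
        ... | false = refl

      -- Without `σ` the chain has the boundary of `σ`. If a subchain with that boundary missed a
      -- facet, the difference would be a nonempty cycle in Z avoiding `σ`, against irreducibility.
      puncture-admissible : ∀ {G : Graph {n}} → (∀ {F x y} → Z F ≡ true → F ! x ≡ true → F ! y ≡ true → G x y ≡ true) → Admissible d G σ puncture
      puncture-admissible cl .Admissible.size e = size (proj₁ (∧⁻ e))
      puncture-admissible cl .Admissible.clique e = cl (proj₁ (∧⁻ e))
      puncture-admissible cl .Admissible.boundary {R} e y Ry with ∂-single⁻ {σ} (trans (sym (∂-puncture R)) e)
      ... | x , _ , refl = ins-⊒ x R y Ry
      puncture-admissible cl .Admissible.minimal Y sub eq {F} PF with bool (Y F)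
      ... | inj₁ e = e
      ... | inj₂ e = ⊥-elim (puncture-σ (proj₁ (∧⁻ (irreducible D (λ h → proj₁ (∧⁻ (proj₁ (∧⁻ {puncture _} h)))) ∂D {F} (∧⁺ PF (not⁺ e)) Zσ))))
        where
        D : Chain {n}
        D F = puncture F ∧ not (Y F)
        ∂D : ∀ R → ∂ D R ≡ false
        ∂D R = trans (∂-cong {Y = D} {Z = λ F → puncture F xor Y F} (λ F → lem F (bool (Y F))) R) (trans (∂-xor puncture Y R) (trans (cong (∂ puncture R xor_) (eq R)) (xor-same (∂ puncture R))))
          where
          lem : ∀ F → Y F ≡ true ⊎ Y F ≡ false → puncture F ∧ not (Y F) ≡ puncture F xor Y F
          lem F (inj₁ e) rewrite sub e | e = refl
          lem F (inj₂ e) rewrite e with puncture F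
          ... | true = refl
          ... | false = refl

      puncture-vert : ∀ {x} → vert Z ! x ≡ true → σ ! x ≡ false → vert puncture ! x ≡ true
      puncture-vert {x} p x∉σ with vert⁻ {Z = Z} p
      ... | F , ZF , Fx = vert⁺ {Z = puncture} (∧⁺ ZF (not⁺ (eqS-≢ λ { refl → t≢f Fx x∉σ }))) Fx

      puncture-∖ : ∀ {B} → σ ⊑ B → vert puncture ∖ B ≡ vert Z ∖ B
      puncture-∖ {B} h = ⊑-antisym
        (λ x p → ∖⁺ (let F , PF , Fx = vert⁻ {Z = puncture} (proj₁ (∖⁻ {A = vert puncture} {B} p)) in vert⁺ {Z = Z} (proj₁ (∧⁻ PF)) Fx) (proj₂ (∖⁻ {A = vert puncture} {B} p)))
        (λ x p → let a , b = ∖⁻ {A = vert Z} {B} p in ∖⁺ (puncture-vert a (≢true⇒false λ q → t≢f (h x q) b)) b)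

    ∣∖∣ : ∀ {A B : Subset n} → B ⊑ A → ∣ A ∖ B ∣ + ∣ B ∣ ≡ ∣ A ∣
    ∣∖∣ {A} {B} h = begin
      ∣ A ∖ B ∣ + ∣ B ∣ ≡⟨ cong₂ _+_ (card≡Σ (A ∖ B)) (card≡Σ B) ⟩
      ΣF (λ x → 𝟙 ((A ∖ B) ! x)) + ΣF (λ x → 𝟙 (B ! x)) ≡⟨ sym (ΣF-+ (λ x → 𝟙 ((A ∖ B) ! x)) (λ x → 𝟙 (B ! x))) ⟩
      ΣF (λ x → 𝟙 ((A ∖ B) ! x) + 𝟙 (B ! x)) ≡⟨ ΣF-cong (λ x → ptw x (bool (B ! x))) ⟩
      ΣF (λ x → 𝟙 (A ! x)) ≡⟨ sym (card≡Σ A) ⟩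
      ∣ A ∣ ∎
      where
      open ≡-Reasoning
      ptw : ∀ x → B ! x ≡ true ⊎ B ! x ≡ false → 𝟙 ((A ∖ B) ! x) + 𝟙 (B ! x) ≡ 𝟙 (A ! x)
      ptw x (inj₁ e) = trans (cong₂ (λ a b → 𝟙 a + 𝟙 b) (≢true⇒false λ q → t≢f e (proj₂ (∖⁻ {A = A} {B} q))) e) (cong 𝟙 (sym (h x e)))
      ptw x (inj₂ e) = trans (cong₂ (λ a b → 𝟙 a + 𝟙 b) (⇔⇒≡ {(A ∖ B) ! x} (λ q → proj₁ (∖⁻ {A = A} {B} q)) (λ q → ∖⁺ q e)) e) (+-identityʳ _)

    -- The bound is applied to the cycle opened at the facet `σ`, with `σ` identified; then `σ` is
    -- exchanged for the clique `A` of the same size.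
    cycle-bound : ∀ {d Z} {G : Graph {n}} → 3 ≤ d → Symm G → MinCycle d Z → (∀ {F x y} → Z F ≡ true → F ! x ≡ true → F ! y ≡ true → G x y ≡ true)
      → ∀ {σ} → Z σ ≡ true → ∀ {A k} → Clique G A → ∣ A ∣ ≡ d → k + d ≡ ∣ vert Z ∣ → RankBound d G A k
    cycle-bound {d} {Z} {G} 3≤d sG mc cl {σ} Zσ {A} {k} cA ∣A∣ keq = subst₂ (Bound (Nof {n} d) (Mof {n}))
      (trans (cong ∣_∣ (puncture-∖ mc Zσ (λ _ p → p))) (+-cancelʳ-≡ d ∣ vert Z ∖ σ ∣ k (trans (trans (cong (∣ vert Z ∖ σ ∣ +_) (sym (size Zσ))) (∣∖∣ λ x p → vert⁺ Zσ p)) (sym keq))))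
      (𝔼-clique-independent {G} (λ p q _ → cl Zσ p q) cA (trans (size Zσ) (sym ∣A∣)))
      (rank-bound 3≤d sG (puncture-admissible mc Zσ cl))
      where open MinCycle mc

-- Equality forces a separating set of d vertices.

module Separators where

  open Subsets
  open UnionFind
  open Expectation
  open Chains
  open RankBound
  open MinimalCycles
  open import Data.Bool using (Bool; true; false; _∧_; _∨_; not)
  open import Data.Nat using (ℕ; zero; suc; _+_; _*_; _≤_; _<_; z≤n; s≤s; >-nonZero)
  open import Data.Nat.Properties
  open import Data.Fin using (Fin; zero; suc)
  import Data.Fin.Properties as Finₚ
  open import Data.Vec using ([]; _∷_)
  open import Data.Product using (∃; _×_; _,_; proj₁; proj₂)
  open import Data.Sum using (_⊎_; inj₁; inj₂)
  open import Data.Empty using (⊥-elim) renaming (⊥ to Void)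
  open import Data.List using (List; []; _∷_; _++_)
  open import Data.List.Relation.Unary.Any using () renaming (here to hereˡ)
  open import Data.Vec.Properties using (≡-dec; lookup⇒[]=; []=⇒lookup)
  open import Data.List.Membership.Propositional.Properties using (∈-++⁺ˡ; ∈-++⁻)
  open import Data.List.Membership.Propositional using () renaming (_∈_ to _∈ˡ_)
  open import Data.Fin.Subset using (Subset; ∣_∣; ⊥; ⁅_⁆; _∈_)
  open import Relation.Nullary using (¬_; Dec; yes; no)
  open import Relation.Binary.PropositionalEquality using (_≡_; _≢_; refl; sym; trans; cong; subst)
  open import Function using (_∘_)
  open import Data.Bool.Properties using () renaming (_≟_ to _≟ᵇ_)
  open import Data.Fin.Subset.Properties using (anySubset?; x∈⁅x⁆; x∈⁅y⁆⇒x≡y; _⊆?_)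
  open import Relation.Nullary.Decidable using (_×-dec_; _→-dec_)

  open Bound
  open Tight

  module _ {n : ℕ} where

    opaque
      unfolding _!_

      ∈⇒! : ∀ {x} {A : Subset n} → x ∈ A → A ! x ≡ true
      ∈⇒! = []=⇒lookup

      !⇒∈ : ∀ {x} {A : Subset n} → A ! x ≡ true → x ∈ A
      !⇒∈ {x} {A} = lookup⇒[]= x A

    subᵇ⁺ : ∀ {A B : Subset n} → A ⊑ B → subᵇ A B ≡ true
    subᵇ⁺ {A} {B} h with A ⊆? B
    ... | yes _ = refl
    ... | no ne = ⊥-elim (ne λ p → !⇒∈ (h _ (∈⇒! p)))

    subᵇ⁻ : ∀ {A B : Subset n} → subᵇ A B ≡ true → A ⊑ B
    subᵇ⁻ {A} {B} e x p with A ⊆? B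
    ... | yes h = ∈⇒! (h (!⇒∈ p))

    eqᵇ⁺ : ∀ {A : Subset n} → eqᵇ A A ≡ true
    eqᵇ⁺ {A} with ≡-dec Data.Bool._≟_ A A
    ... | yes _ = refl
    ... | no ne = ⊥-elim (ne refl)

    eqᵇ⁻ : ∀ {A B : Subset n} → eqᵇ A B ≡ true → A ≡ B
    eqᵇ⁻ {A} {B} e with ≡-dec Data.Bool._≟_ A B
    ... | yes p = p

    ⁅⁆-∋ : ∀ (x : Fin n) → ⁅ x ⁆ ! x ≡ true
    ⁅⁆-∋ x = ∈⇒! (x∈⁅x⁆ x)

    ⁅⁆⁻ : ∀ {x y : Fin n} → ⁅ x ⁆ ! y ≡ true → y ≡ x
    ⁅⁆⁻ {x} p = x∈⁅y⁆⇒x≡y x (!⇒∈ p)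

    opaque
      adj : Chain {n} → Graph {n}
      adj Z x y = anyS (λ F → Z F ∧ (F ! x ∧ F ! y))

      adj⁺ : ∀ {Z : Chain {n}} {F x y} → Z F ≡ true → F ! x ≡ true → F ! y ≡ true → adj Z x y ≡ true
      adj⁺ {F = F} p q r = anyS⁺ F (∧⁺ p (∧⁺ q r))

      adj⁻ : ∀ {Z : Chain {n}} {x y} → adj Z x y ≡ true → ∃ λ F → Z F ≡ true × F ! x ≡ true × F ! y ≡ true
      adj⁻ {Z} e with anyS⁻ e
      ... | F , p = F , proj₁ (∧⁻ {Z F} p) , ∧⁻ (proj₂ (∧⁻ {Z F} p))

    adj-symm : ∀ {Z : Chain {n}} → Symm (adj Z)
    adj-symm {Z} e with adj⁻ {Z} e
    ... | F , p , q , r = adj⁺ {Z} p r q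

    adj-vert : ∀ {Z : Chain {n}} {x y} → adj Z x y ≡ true → vert Z ! y ≡ true
    adj-vert {Z} e with adj⁻ {Z} e
    ... | F , p , q , r = vert⁺ p r

    -- On the vertices of Z, `C` is a union of components of the graph after deletion of `F`; a
    -- vertex in `C` and one outside both sets make the separation proper. All quantifiers are
    -- finite, so existence can be decided.
    Separates : ℕ → Chain {n} → Subset n → Subset n → Set
    Separates d Z F C = ∣ F ∣ ≡ d × disj C F ≡ true × (∃ λ x → vert Z ! x ≡ true × C ! x ≡ true)
      × (∃ λ z → vert Z ! z ≡ true × C ! z ≡ false × F ! z ≡ false)
      × (∀ x y → C ! x ≡ true → adj Z x y ≡ true → C ! y ∨ F ! y ≡ true)

    separator? : ∀ d Z → Dec (∃ λ F → ∃ λ C → Separates d Z F C)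
    separator? d Z = anySubset? λ F → anySubset? λ C → (∣ F ∣ Data.Nat.≟ d) ×-dec (disj C F ≟ᵇ true)
      ×-dec Finₚ.any? (λ x → (vert Z ! x ≟ᵇ true) ×-dec (C ! x ≟ᵇ true))
      ×-dec Finₚ.any? (λ z → (vert Z ! z ≟ᵇ true) ×-dec (C ! z ≟ᵇ false) ×-dec (F ! z ≟ᵇ false))
      ×-dec Finₚ.all? (λ x → Finₚ.all? λ y → (C ! x ≟ᵇ true) →-dec ((adj Z x y ≟ᵇ true) →-dec (C ! y ∨ F ! y ≟ᵇ true)))

    ∣∖ins∣ : ∀ {A B : Subset n} {u} → A ! u ≡ true → B ! u ≡ false → ∣ A ∖ B ∣ ≡ suc ∣ A ∖ ins u B ∣
    ∣∖ins∣ {A} {B} {u} Au u∉B = trans (∣del∣ (A ∖ B) u (∖⁺ Au u∉B)) (cong (suc ∘ ∣_∣) (⊑-antisym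
      (λ x p → let ne , q = del⁻ {x = u} {A ∖ B} p ; a , b = ∖⁻ {A = A} {B} q in ∖⁺ a (trans (ins-other B ne) b))
      (λ x p → let a , b = ∖⁻ {A = A} {ins u B} p in back x a b (x Finₚ.≟ u))))
      where
      back : ∀ x → A ! x ≡ true → ins u B ! x ≡ false → Dec (x ≡ u) → del u (A ∖ B) ! x ≡ true
      back x a b (yes refl) = t≢f (ins-this x B) b
      back x a b (no ne) = trans (del-other (A ∖ B) ne) (∖⁺ a (trans (sym (ins-other B ne)) b))

    module _ {d : ℕ} {G : Graph {n}} {B Y : Subset n} {u : Fin n} (u∉B : B ! u ≡ false) (Y⊑B : Y ⊑ B) (∣Y∣ : ∣ Y ∣ ≡ d)
      (Yu : ∀ y → Y ! y ≡ true → G u y ≡ true) where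

      private
        hit : Subset n → ℕ
        hit W = 𝟙 (W ! u ∧ disj Y W)
        hit≡ : Nof {n} d * 𝔼 hit ≡ Mof {n}
        hit≡ = trans (cong (λ c → suc c * suc (suc c) * 𝔼 hit) (sym ∣Y∣)) (𝔼-hit Y u (≢true⇒false λ p → t≢f (Y⊑B u p) u∉B))

      rk-edge : ∀ {y} W → B ! y ≡ true → W ! u ≡ true → W ! y ≡ true → G u y ≡ true → 1 ≤ rk G B W
      rk-edge {y} W By Wu Wy g = ≤-trans (≤-reflexive (sym (trans (+-identityʳ _) (differ-≢ λ e → ne (lab⁻ B u y e))))) (ρ-⊆ (lab B) {edges G W} {(u , y) ∷ []} λ { (hereˡ refl) → edges⁺ Wu Wy g })
        where
        ne : u ≡ y ⊎ (B ! u ≡ true × B ! y ≡ true) → Void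
        ne (inj₁ refl) = t≢f By u∉B
        ne (inj₂ (p , _)) = t≢f p u∉B

      hit-bound : ∀ W → 𝟙 (W ! u) ≤ rk G B W + hit W
      hit-bound W = cases (bool (W ! u)) (bool (disj Y W))
        where
        cases : W ! u ≡ true ⊎ W ! u ≡ false → disj Y W ≡ true ⊎ disj Y W ≡ false → 𝟙 (W ! u) ≤ rk G B W + hit W
        cases (inj₂ e) _ rewrite e = z≤n
        cases (inj₁ e) (inj₁ f) rewrite e | f = m≤n+m 1 _
        cases (inj₁ e) (inj₂ f) with disj-false {A = Y} f
        ... | y , Yy , Wy = ≤-trans (𝟙≤1 (W ! u)) (≤-trans (rk-edge W (Y⊑B y Yy) e Wy (Yu y Yy)) (m≤m+n _ _))

      -- The degenerate form of the contraction estimate: a vertex joined to d vertices of `B`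
      -- contributes rank at least 1 whenever W contains it and meets `Y`.
      vertex-bound : RankBound d G B 1
      vertex-bound = bound-suc {Nof {n} d} {Mof {n}} {0} {0} {𝔼 (rk G B)} {𝔼 (λ W → 𝟙 (W ! u))} {𝔼 hit} (𝔼-∈ u) hit≡ (bound (≤-trans (≤-reflexive (*-zeroʳ (Nof {n} d))) z≤n))
        (subst (𝔼 (λ W → 𝟙 (W ! u)) ≤_) (𝔼-+ (rk G B) hit) (𝔼-mono hit-bound))

      -- A neighbour y in `B` outside `Y` makes uy an edge inside the set {u, y}, which misses `Y`.
      -- There the rank and `hit` both count, one more than equality permits.
      vertex-tight : ∀ {y} → B ! y ≡ true → Y ! y ≡ false → G u y ≡ true → ¬ RankTight d G B 1
      vertex-tight {y} By y∉Y g t = <⇒≱ (bound-suc-strict {Nof {n} d} {Mof {n}} {0} {0} {𝔼 (rk G B)} {𝔼 (λ W → 𝟙 (W ! u))} {𝔼 hit} (𝔼-∈ u) hit≡ (bound (≤-trans (≤-reflexive (*-zeroʳ (Nof {n} d))) z≤n)) (s≤s z≤n)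
        (subst (𝔼 (λ W → 𝟙 (W ! u)) <_) (𝔼-+ (rk G B) hit) (ΣS-< (λ W → *-monoʳ-≤ (wt n ∣ W ∣) (hit-bound W)) W₀ (*-monoʳ-< (wt n ∣ W₀ ∣) {{>-nonZero (wt>0 n ∣ W₀ ∣)}} strict)))) (upper t)
        where
        W₀ : Subset n
        W₀ = ins u (ins y ⊥)
        W₀u = ins-this u (ins y ⊥)
        W₀y = ins-⊒ u (ins y ⊥) y (ins-this y ⊥)
        dj : disj Y W₀ ≡ true
        dj = disj⁺ {A = Y} λ x p → ≢true⇒false λ q → no-x x p (ins⁻ q)
          where
          no-x : ∀ x → Y ! x ≡ true → x ≡ u ⊎ ins y ⊥ ! x ≡ true → Void
          no-x x p (inj₁ refl) = t≢f (Y⊑B x p) u∉B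
          no-x x p (inj₂ q) with ins⁻ {x = y} {⊥} q
          ... | inj₁ refl = t≢f p y∉Y
          ... | inj₂ r = t≢f r (⊥! x)
        strict : 𝟙 (W₀ ! u) < rk G B W₀ + hit W₀
        strict = ≤-trans (s≤s (𝟙≤1 (W₀ ! u))) (+-mono-≤ (rk-edge W₀ By W₀u W₀y g) (≤-reflexive (cong 𝟙 (sym (∧⁺ W₀u dj)))))

    module _ {d : ℕ} (3≤d : 3 ≤ d) {Z : Chain {n}} (mc : MinCycle d Z) (big : suc d < ∣ vert Z ∣) {σ : Subset n} (Zσ : Z σ ≡ true)
      (none : ¬ (∃ λ F → ∃ λ C → Separates d Z F C)) where

      private
        V = vert Z
        G = adj Z
        P = puncture mc Zσ
        ∣σ∣ = MinCycle.size mc Zσ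
        sG : Symm G
        sG = adj-symm {Z}

      ∣V∖∣ : ∀ {B} → σ ⊑ B → ∣ vert P ∖ B ∣ ≡ ∣ V ∖ B ∣
      ∣V∖∣ h = cong ∣_∣ (puncture-∖ mc Zσ h)

      -- Induction while `B` grows from `σ`. Tightness leaves no slack: if a contraction accounts
      -- for only part of the vertices, the rest is again tight over the larger `B`. If it accounts
      -- for all of them, then either some W makes the contraction strict, or the missing link
      -- between `u` and `v` exhibits a separator, or `B` can be enlarged by `u` alone.
      no-separator : ∀ k (B : Subset n) → ∣ V ∖ B ∣ < k → σ ⊑ B → 0 < ∣ V ∖ B ∣ → RankTight d G B ∣ V ∖ B ∣ → Void
      no-separator (suc k) B (s≤s le) σ⊑B pos t with ∣∣>0 (V ∖ B) pos
      ... | y₀ , p₀ = crossing (≤-trans (s≤s (s≤s z≤n)) 3≤d) adm (puncture-vert mc Zσ (proj₁ (∖⁻ {A = V} {B} p₀)) (≢true⇒false λ q → t≢f (σ⊑B y₀ q) (proj₂ (∖⁻ {A = V} {B} p₀)))) (proj₂ (∖⁻ {A = V} {B} p₀))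
          λ { (F , u , v , PF , Fu , Fv , u∉B , v∈B) → contraction-step 3≤d adm u∉B v∈B PF Fu Fv (via PF Fu Fv u∉B v∈B) }
        where
        adm : Admissible d G B P
        adm = enlarge σ⊑B (puncture-admissible mc Zσ (adj⁺ {Z}))

        recurse : ∀ {B′ c} → B ⊑ B′ → ∣ V ∖ B ∣ ≡ c + ∣ V ∖ B′ ∣ → 0 < c → RankBound d (restrictG G B′) B c → 0 < ∣ V ∖ B′ ∣ → Void
        recurse {B′} {c} h eq c>0 b pos′ = no-separator k B′ (≤-trans (+-monoˡ-≤ ∣ V ∖ B′ ∣ c>0) (≤-trans (≤-reflexive (sym eq)) le)) (λ x p → h x (σ⊑B x p)) pos′
          (tight-cancel {Nof {n} d} {Mof {n}} {c} {∣ V ∖ B′ ∣} {𝔼 (rk (restrictG G B′) B)} (subst (λ m → RankTight d G B m) eq t) b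
            (subst (_≤ 𝔼 (rk G B)) (𝔼-+ (rk (restrictG G B′) B) (rk G B′)) (𝔼-mono (rk-split G B h))))

        -- Enlarges `B` by a vertex joined to a d-set `Y` in `B`. If no vertex remains afterwards,
        -- tightness forbids neighbours of `u` outside `Y`, and `Y` cuts off the single vertex `u`.
        grow : ∀ {u Y} → V ! u ≡ true → B ! u ≡ false → Y ⊑ B → ∣ Y ∣ ≡ d → (∀ y → Y ! y ≡ true → G u y ≡ true) → Void
        grow {u} {Y} Vu u∉B Y⊑B ∣Y∣ Yu with ∣ V ∖ ins u B ∣ in eq
        ... | suc m = recurse {ins u B} {1} (ins-⊒ u B) (∣∖ins∣ Vu u∉B) (s≤s z≤n)
            (vertex-bound u∉B Y⊑B ∣Y∣ λ y p → restrictG⁺ {G = G} (Yu y p) (ins-this u B) (ins-⊒ u B y (Y⊑B y p))) (subst (0 <_) (sym eq) (s≤s z≤n))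
        ... | zero = none (Y , ins u ⊥ , ∣Y∣ , disj⁺ {A = ins u ⊥} (λ x p → ≢true⇒false λ q → t≢f (Y⊑B x q) (subst (λ z → B ! z ≡ false) (sym (only x (ins⁻ p))) u∉B))
              , (u , Vu , ins-this u ⊥) , outside-z , closed)
          where
          only : ∀ x → x ≡ u ⊎ ⊥ ! x ≡ true → x ≡ u
          only x (inj₁ e) = e
          only x (inj₂ p) = t≢f p (⊥! x)
          -- More than d+1 vertices leave one outside `Y` and `u`.
          outside-z : ∃ λ z → V ! z ≡ true × ins u ⊥ ! z ≡ false × Y ! z ≡ false
          outside-z with card<⇒∃ (ins u Y) V (subst (_< ∣ V ∣) (sym (trans (∣ins∣ Y u (≢true⇒false λ q → t≢f (Y⊑B u q) u∉B)) (cong suc ∣Y∣))) big)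
          ... | z , Vz , nz = z , Vz , ≢true⇒false (λ p → t≢f (subst (λ w → ins u Y ! w ≡ true) (sym (only z (ins⁻ p))) (ins-this u Y)) nz) , ≢true⇒false λ p → t≢f (ins-⊒ u Y z p) nz
          closed : ∀ x y → ins u ⊥ ! x ≡ true → G x y ≡ true → ins u ⊥ ! y ∨ Y ! y ≡ true
          closed x y Cx g with only x (ins⁻ Cx) | y Finₚ.≟ u | bool (Y ! y)
          ... | refl | yes refl | _ = ∨⁺ˡ (ins-this y ⊥)
          ... | refl | no ne | inj₁ p = ∨⁺ʳ {ins x ⊥ ! y} p
          ... | refl | no ne | inj₂ p = ⊥-elim (vertex-tight u∉B Y⊑B ∣Y∣ Yu By p g (subst (λ m → RankTight d G B m) (trans (∣∖ins∣ Vu u∉B) (cong suc eq)) t))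
            where
            By : B ! y ≡ true
            By with bool (B ! y)
            ... | inj₁ q = q
            ... | inj₂ q = t≢f (∖⁺ {A = V} {B = ins x B} (adj-vert {Z} g) (trans (ins-other B ne) q)) (∣∣≡0 {A = V ∖ ins x B} eq y)

        via : ∀ {F u v} → P F ≡ true → F ! u ≡ true → F ! v ≡ true → B ! u ≡ false → B ! v ≡ true → Step d G B P u v → Void
        via {F} {u} {v} PF Fu Fv u∉B v∈B st = cases (∣ V ∖ S ∣) refl
          where
          open Step st
          Pu : vert P ! u ≡ true
          Pu = vert⁺ PF Fu
          Vu : V ! u ≡ true
          Vu = vert⁺ {Z = Z} (proj₁ (∧⁻ PF)) Fu
          Gu-v : G u v ≡ true
          Gu-v = Admissible.clique adm PF Fu Fv
          u≢v : u ≢ v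
          u≢v = ≢⇐! v∈B u∉B ∘ sym
          S : Subset n
          S = Core sG Pu u∉B v∈B Gu-v st
          B⊑S : B ⊑ S
          B⊑S x p = ∪⁺ˡ {B = ins u (vert Z₁)} p
          tally : ∣ V ∖ B ∣ ≡ suc ∣ vert Z₁ ∖ B ∣ + ∣ V ∖ S ∣
          tally = trans (sym (∣V∖∣ σ⊑B)) (trans (card-split sG Pu u∉B v∈B Gu-v st) (cong (suc ∣ vert Z₁ ∖ B ∣ +_) (∣V∖∣ λ x p → B⊑S x (σ⊑B x p))))
          core-bound : RankBound d (restrictG G S) B (suc ∣ vert Z₁ ∖ B ∣)
          core-bound = core-step sG Pu u∉B v∈B Gu-v st (rank-bound 3≤d (contract-symm {G = restrictG G S} (restrictG-symm {G = G} {S} sG)) (admissible-core sG Pu u∉B v∈B Gu-v st))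
          -- The largest set missing `X`, `u` and `v`. If its edges do not link `u` to `v`, the
          -- class of `u` is closed under adjacency away from `Y`, so it can be tested as one side
          -- of a separation.
          W : Subset n
          W = subset (λ x → not (X ! x) ∧ (not (eqF x u) ∧ not (eqF x v)))
          W⁻ : ∀ {x} → W ! x ≡ true → X ! x ≡ false × x ≢ u × x ≢ v
          W⁻ {x} e with ∧⁻ {not (X ! x)} (trans (sym (subset! _ x)) e)
          ... | a , b with ∧⁻ {not (eqF x u)} b
          ... | b₁ , b₂ = not⁻ a , (λ { refl → t≢f (eqF-refl x) (not⁻ b₁) }) , (λ { refl → t≢f (eqF-refl x) (not⁻ b₂) })
          W⁺ : ∀ {x} → X ! x ≡ false → x ≢ u → x ≢ v → W ! x ≡ true
          W⁺ {x} a b c = trans (subset! _ x) (∧⁺ (not⁺ a) (∧⁺ (not⁺ (eqF-≢ b)) (not⁺ (eqF-≢ c))))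
          u∉W : W ! u ≡ false
          u∉W = ≢true⇒false λ e → proj₁ (proj₂ (W⁻ e)) refl
          v∉W : W ! v ≡ false
          v∉W = ≢true⇒false λ e → proj₂ (proj₂ (W⁻ e)) refl
          E : List (Edge {n})
          E = edges G (ins u W) ++ edges G (ins v W)
          M : Labeling {n}
          M = mergeAll (lab B) E
          Y : Subset n
          Y = ins v X
          ∣Y∣ : ∣ Y ∣ ≡ d
          ∣Y∣ = trans (∣ins∣ X v v∉X) card-X
          avoids-X : ∀ {x a b} → X ! x ≡ true → (a , b) ∈ˡ E → a ≢ x × b ≢ x
          avoids-X {x} Xx m with ∈-++⁻ (edges G (ins u W)) m
          ... | inj₁ q = let a∈ , b∈ , _ = edges⁻ {G = G} q in ne u∉X (ins⁻ a∈) , ne u∉X (ins⁻ b∈)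
            where
            ne : ∀ {a} → X ! u ≡ false → a ≡ u ⊎ W ! a ≡ true → a ≢ x
            ne nx (inj₁ refl) refl = t≢f Xx nx
            ne nx (inj₂ w) refl = t≢f Xx (proj₁ (W⁻ w))
          ... | inj₂ q = let a∈ , b∈ , _ = edges⁻ {G = G} q in ne v∉X (ins⁻ a∈) , ne v∉X (ins⁻ b∈)
            where
            ne : ∀ {a} → X ! v ≡ false → a ≡ v ⊎ W ! a ≡ true → a ≢ x
            ne nx (inj₁ refl) refl = t≢f Xx nx
            ne nx (inj₂ w) refl = t≢f Xx (proj₁ (W⁻ w))
          cases : ∀ m → ∣ V ∖ S ∣ ≡ m → Void
          cases (suc m) eq = recurse B⊑S tally (s≤s z≤n) core-bound (subst (0 <_) (sym eq) (s≤s z≤n))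
          cases zero eq = linked? (M u Finₚ.≟ M v)
            where
            t′ : RankTight d G B (suc ∣ vert Z₁ ∖ B ∣)
            t′ = subst (λ m → RankTight d G B m) (trans tally (trans (cong (suc ∣ vert Z₁ ∖ B ∣ +_) eq) (+-identityʳ _))) t
            linked? : Dec (M u ≡ M v) → Void
            linked? (yes e) = <⇒≱ (contract-bound-strict {d = d} sG u∉B u≢v Gu-v u∉X v∉X card-X Xu Xv W u∉W v∉W (disj⁺ {A = X} λ x p → ≢true⇒false λ w → t≢f p (proj₁ (W⁻ w))) e
                (rank-bound 3≤d (contract-symm {G = G} sG) admissible)) (upper t′)
            linked? (no u≁v) = finish (findF (λ z → V ! z ∧ (not (C ! z) ∧ not (Y ! z))))
              where
              C : Subset n
              C = subset (λ x → eqF (M x) (M u))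
              C⁺ : ∀ {x} → M x ≡ M u → C ! x ≡ true
              C⁺ {x} e = trans (subset! _ x) (trans (cong (λ l → eqF l (M u)) e) (eqF-refl (M u)))
              C⁻ : ∀ {x} → C ! x ≡ true → M x ≡ M u
              C⁻ {x} e = eqF⇒≡ (trans (sym (subset! _ x)) e)
              B∉C : ∀ {x} → B ! x ≡ true → C ! x ≡ false
              B∉C {x} Bx = ≢true⇒false λ c → u≁v (trans (sym (C⁻ c)) (mergeAll-≽ (lab B) E x v (lab-in {B = B} Bx v∈B)))
              -- A vertex of `X` outside `B` is touched by none of the edges in `E`, as W misses
              -- `X`; its class is a singleton different from that of `u`.
              X∉C : ∀ {x} → X ! x ≡ true → C ! x ≡ false
              X∉C {x} Xx with bool (B ! x)
              ... | inj₁ Bx = B∉C Bx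
              ... | inj₂ x∉B = ≢true⇒false λ c → t≢f (subst (λ w → X ! w ≡ true) (sym (isolated (lab B) E x (λ y e → alone y (lab⁻ B y x e)) (avoids-X Xx) u (sym (C⁻ c)))) Xx) u∉X
                where
                alone : ∀ y → y ≡ x ⊎ (B ! y ≡ true × B ! x ≡ true) → y ≡ x
                alone y (inj₁ e) = e
                alone y (inj₂ (_ , q)) = t≢f q x∉B
              Y∉C : ∀ x → Y ! x ≡ true → C ! x ≡ false
              Y∉C x p with ins⁻ {x = v} {X} p
              ... | inj₁ refl = B∉C v∈B
              ... | inj₂ q = X∉C q
              closed : ∀ x y → C ! x ≡ true → G x y ≡ true → C ! y ∨ Y ! y ≡ true
              closed x y Cx g with bool (Y ! y)
              ... | inj₁ p = ∨⁺ʳ {C ! y} p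
              ... | inj₂ p = ∨⁺ˡ (C⁺ (trans (sym (mergeAll-joins (lab B) E (∈-++⁺ˡ (edges⁺ (in-uW x (≢true⇒false λ q → t≢f Cx (Y∉C x q))) (in-uW y p) g)))) (C⁻ Cx)))
                where
                in-uW : ∀ x → Y ! x ≡ false → ins u W ! x ≡ true
                in-uW x q with x Finₚ.≟ u
                ... | yes refl = ins-this x W
                ... | no ne = ins-⊒ u W x (W⁺ (≢true⇒false λ r → t≢f (ins-⊒ v X x r) q) ne λ { refl → t≢f (ins-this x X) q })
              finish : (∃ λ z → V ! z ∧ (not (C ! z) ∧ not (Y ! z)) ≡ true) ⊎ (∀ z → V ! z ∧ (not (C ! z) ∧ not (Y ! z)) ≡ false) → Void
              finish (inj₁ (z , p)) = none (Y , C , ∣Y∣ , disj⁺ {A = C} (λ x c → ≢true⇒false λ q → t≢f c (Y∉C x q)) , (u , Vu , C⁺ refl)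
                , (z , proj₁ (∧⁻ p) , not⁻ (proj₁ (∧⁻ (proj₂ (∧⁻ {V ! z} p)))) , not⁻ (proj₂ (∧⁻ (proj₂ (∧⁻ {V ! z} p))))) , closed)
              -- Every vertex lies in `C` or `Y`. The facet `σ` lies in `B`, hence off `C`, so it
              -- fills `Y`; thus `Y` is contained in `B` and all of it is joined to `u`.
              finish (inj₂ h) = grow {u} {Y} Vu u∉B (λ x p → σ⊑B x (subst (λ A → A ! x ≡ true) (sym σ≡Y) p)) ∣Y∣ adj-Y
                where
                σ⊑Y : σ ⊑ Y
                σ⊑Y x p with bool (Y ! x)
                ... | inj₁ q = q
                ... | inj₂ q = t≢f (∧⁺ {V ! x} (vert⁺ Zσ p) (∧⁺ (not⁺ (B∉C (σ⊑B x p))) (not⁺ q))) (h x)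
                σ≡Y : σ ≡ Y
                σ≡Y = ⊑∧card⇒≡ σ⊑Y (≤-reflexive (trans ∣Y∣ (sym ∣σ∣)))
                adj-Y : ∀ y → Y ! y ≡ true → G u y ≡ true
                adj-Y y p with ins⁻ {x = v} {X} p
                ... | inj₁ refl = Gu-v
                ... | inj₂ q = Xu y q

-- Splitting a tight cycle along a separator.

module Decomposition where

  open Subsets
  open UnionFind
  open Expectation
  open Chains
  open RankBound
  open MinimalCycles
  open Separators
  open import Data.Bool using (Bool; true; false; _∧_; _∨_; not; _xor_)
  open import Data.Bool.Properties using (xor-same)
  open import Data.Nat using (ℕ; suc; _+_; _≤_; _<_; z≤n; s≤s)
  open import Data.Nat.Properties
  open import Data.Fin using (suc)
  import Data.Fin.Properties as Finₚ
  open import Data.Product using (∃; _×_; _,_; proj₁; proj₂)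
  open import Data.Sum using (_⊎_; inj₁; inj₂)
  open import Data.Empty using (⊥-elim) renaming (⊥ to Void)
  open import Data.Fin.Subset using (Subset; ∣_∣; ⊥; ⁅_⁆)
  open import Relation.Nullary using (yes; no)
  open import Relation.Binary.PropositionalEquality using (_≡_; _≢_; refl; sym; trans; cong; cong₂; subst; subst₂)
  open import Function using (_∘_)

  open Bound
  open Tight

  module _ {n : ℕ} where

    ⟨_⟩ : Chain {n} → Complex n
    ⟨ Z ⟩ G = anyS (λ F → Z F ∧ subᵇ G F)

    ⟨⟩⁺ : ∀ {Z : Chain {n}} {F G} → Z F ≡ true → G ⊑ F → ⟨ Z ⟩ G ≡ true
    ⟨⟩⁺ {F = F} p q = anyS⁺ F (∧⁺ p (subᵇ⁺ q))

    ⟨⟩⁻ : ∀ {Z : Chain {n}} {G} → ⟨ Z ⟩ G ≡ true → ∃ λ F → Z F ≡ true × G ⊑ F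
    ⟨⟩⁻ {Z} e with anyS⁻ e
    ... | F , p = F , proj₁ (∧⁻ {Z F} p) , subᵇ⁻ (proj₂ (∧⁻ {Z F} p))

    -- Of the subsets of `F` with one element missing, just two contain `F` with y and z removed; a
    -- mod-2 cycle that uses one of them must use the other.
    ridge-exchange : ∀ {F : Subset n} (Y : Chain {n}) → (∀ {R} → Y R ≡ true → R ⊑ F) → (∀ T → ∂ Y T ≡ false)
      → ∀ {y z} → F ! y ≡ true → F ! z ≡ true → Y (del y F) ≡ true → Y (del z F) ≡ true
    ridge-exchange {F} Y sub ∂Y {y} {z} Fy Fz Yy with y Finₚ.≟ z
    ... | yes refl = Yy
    ... | no ne with ∂-other Y {del z (del y F)} {z} (∂Y _) (del-this z (del y F)) (trans (cong Y (ins-del (trans (del-other F (ne ∘ sym)) Fz))) Yy)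
    ...   | w , w≢z , w∉T , Yw = trans (cong Y (sym eq)) Yw
      where
      w≡y : w ≡ y
      w≡y with w Finₚ.≟ y
      ... | yes e = e
      ... | no w≢y = t≢f (sub Yw w (ins-this w _)) (trans (sym (trans (del-other (del y F) w≢z) (del-other F w≢y))) w∉T)
      eq : ins w (del z (del y F)) ≡ del z F
      eq rewrite w≡y = trans (ins-del-comm (del y F) ne) (cong (del z) (ins-del Fy))

    ∂-single-del : ∀ {F R : Subset n} → ∂ (single F) R ≡ true → ∃ λ x → F ! x ≡ true × R ≡ del x F
    ∂-single-del {F} {R} e with ∂-single⁻ {σ = F} e
    ... | x , p , refl = x , ins-this x R , sym (del-ins p)

    part : (Subset n → Bool) → Chain {n} → Chain {n}
    part s Z G = Z G ∧ s G

    module Glue {d : ℕ} {Z : Chain {n}} (mc : MinCycle d Z) {F : Subset n} (F∉Z : Z F ≡ false) (∣F∣ : ∣ F ∣ ≡ d)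
      (s : Subset n → Bool) (∂P : ∀ R → ∂ (part s Z) R ≡ ∂ (single F) R) {F₂ : Subset n} (ZF₂ : Z F₂ ≡ true) (sF₂ : s F₂ ≡ false) where

      open MinCycle mc

      glued : Chain {n}
      glued G = part s Z G ∨ eqS G F

      glued⁻ : ∀ {G} → glued G ≡ true → (Z G ≡ true × s G ≡ true) ⊎ G ≡ F
      glued⁻ {G} e with ∨⁻ {part s Z G} e
      ... | inj₁ p = inj₁ (∧⁻ p)
      ... | inj₂ p = inj₂ (eqS⁻ p)

      glued-F : glued F ≡ true
      glued-F = ∨⁺ʳ {part s Z F} eqS⁺

      glued-part : ∀ {G} → Z G ≡ true → s G ≡ true → glued G ≡ true
      glued-part p q = ∨⁺ˡ (∧⁺ p q)

      private
        coparts : Chain {n}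
        coparts G = Z G ∧ not (s G)

        ∂coparts : ∀ R → ∂ coparts R ≡ ∂ (single F) R
        ∂coparts R = xor≡false (trans (cong (∂ coparts R xor_) (sym (∂P R))) (trans (sym (∂-xor coparts (part s Z) R)) (trans (∂-cong (λ G → split (Z G) (s G)) R) (closed R))))
          where
          split : ∀ a b → (a ∧ not b) xor (a ∧ b) ≡ a
          split true true = refl
          split true false = refl
          split false _ = refl

      -- A nonempty subcycle avoiding `F` would be a subcycle of Z missing `F₂`. A subcycle
      -- containing `F` becomes a subcycle of Z when `F` is replaced by the facets outside the part,
      -- which have the same boundary; so it was everything.
      glued-cycle : MinCycle d glued
      glued-cycle .MinCycle.size e with glued⁻ e
      ... | inj₁ (p , _) = size p
      ... | inj₂ refl = ∣F∣
      glued-cycle .MinCycle.closed R = trans (∂-cong {Z = λ G → part s Z G xor eqS G F} (λ G → lem G (bool (eqS G F))) R) (trans (∂-xor (part s Z) (single F) R) (trans (cong (_xor ∂ (single F) R) (∂P R)) (xor-same (∂ (single F) R))))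
        where
        lem : ∀ G → eqS G F ≡ true ⊎ eqS G F ≡ false → glued G ≡ part s Z G xor eqS G F
        lem G (inj₁ e) rewrite eqS⁻ e | F∉Z | eqS⁺ {F = F} = refl
        lem G (inj₂ e) rewrite e with part s Z G
        ... | true = refl
        ... | false = refl
      glued-cycle .MinCycle.irreducible D sub ∂D {F₀} DF₀ {G} gG with bool (D F)
      ... | inj₂ F∉D = t≢f (proj₂ (inP (irreducible D (λ h → proj₁ (inP h)) ∂D {F₀} DF₀ ZF₂))) sF₂
        where
        inP : ∀ {H} → D H ≡ true → Z H ≡ true × s H ≡ true
        inP h with glued⁻ (sub h)
        ... | inj₁ p = p
        ... | inj₂ refl = t≢f h F∉D
      ... | inj₁ DF with glued⁻ gG
      ...   | inj₂ refl = DF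
      ...   | inj₁ (ZG , sG) with ∨⁻ {D G ∧ not (eqS G F)} (irreducible E E⊆Z ∂E {F₂} (∨⁺ʳ {D F₂ ∧ not (eqS F₂ F)} (∧⁺ ZF₂ (not⁺ sF₂))) ZG)
        where
        E : Chain {n}
        E G = (D G ∧ not (eqS G F)) ∨ coparts G
        E⊆Z : ∀ {H} → E H ≡ true → Z H ≡ true
        E⊆Z {H} e with ∨⁻ {D H ∧ not (eqS H F)} e
        ... | inj₂ q = proj₁ (∧⁻ q)
        ... | inj₁ q with ∧⁻ {D H} q
        ...   | DH , ne with glued⁻ (sub DH)
        ...     | inj₁ p = proj₁ p
        ...     | inj₂ refl = t≢f eqS⁺ (not⁻ ne)
        ∂E : ∀ R → ∂ E R ≡ false
        ∂E R = trans (∂-cong {Z = λ H → (D H xor eqS H F) xor coparts H} (λ H → lem H (bool (eqS H F)) (bool (D H))) R)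
          (trans (∂-xor (λ H → D H xor eqS H F) coparts R) (trans (cong₂ _xor_ (trans (∂-xor D (single F) R) (cong (_xor ∂ (single F) R) (∂D R))) (∂coparts R)) (xor-same (∂ (single F) R))))
          where
          lem : ∀ H → eqS H F ≡ true ⊎ eqS H F ≡ false → D H ≡ true ⊎ D H ≡ false → E H ≡ (D H xor eqS H F) xor coparts H
          lem H (inj₁ e) _ rewrite eqS⁻ e | F∉Z | eqS⁺ {F = F} | DF = refl
          lem H (inj₂ e) (inj₂ f) rewrite e | f = refl
          lem H (inj₂ e) (inj₁ f) with glued⁻ (sub f)
          ... | inj₂ refl = t≢f eqS⁺ e
          ... | inj₁ (a , b) rewrite e | f | a | b = refl
      ... | inj₁ p = proj₁ (∧⁻ p)
      ... | inj₂ p = t≢f sG (not⁻ (proj₂ (∧⁻ {Z G} p)))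

    module Decompose {d : ℕ} (3≤d : 3 ≤ d) {Z : Chain {n}} (mc : MinCycle d Z) {F C : Subset n} (sep : Separates d Z F C) where

      open MinCycle mc

      private
        V = vert Z
        ∣F∣ : ∣ F ∣ ≡ d
        ∣F∣ = proj₁ sep
        C∩F : ∀ {x} → C ! x ≡ true → F ! x ≡ false
        C∩F {x} = disj⁻ {A = C} (proj₁ (proj₂ sep)) x
        neighbours : ∀ {x y} → C ! x ≡ true → adj Z x y ≡ true → C ! y ≡ true ⊎ F ! y ≡ true
        neighbours {x} {y} c g = ∨⁻ {C ! y} (proj₂ (proj₂ (proj₂ (proj₂ sep))) x y c g)
        x₀ = proj₁ (proj₁ (proj₂ (proj₂ sep)))
        Vx₀ : V ! x₀ ≡ true
        Vx₀ = proj₁ (proj₂ (proj₁ (proj₂ (proj₂ sep))))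
        Cx₀ : C ! x₀ ≡ true
        Cx₀ = proj₂ (proj₂ (proj₁ (proj₂ (proj₂ sep))))
        z₀ = proj₁ (proj₁ (proj₂ (proj₂ (proj₂ sep))))
        Vz₀ : V ! z₀ ≡ true
        Vz₀ = proj₁ (proj₂ (proj₁ (proj₂ (proj₂ (proj₂ sep)))))
        z₀∉C : C ! z₀ ≡ false
        z₀∉C = proj₁ (proj₂ (proj₂ (proj₁ (proj₂ (proj₂ (proj₂ sep))))))
        z₀∉F : F ! z₀ ≡ false
        z₀∉F = proj₂ (proj₂ (proj₂ (proj₁ (proj₂ (proj₂ (proj₂ sep))))))

      meets away : Subset n → Bool
      meets G = not (disj G C)
      away G = not (meets G)

      meets⁻ : ∀ {G} → meets G ≡ true → ∃ λ c → G ! c ≡ true × C ! c ≡ true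
      meets⁻ {G} e = disj-false {A = G} (not⁻ e)

      meets⁺ : ∀ {G c} → G ! c ≡ true → C ! c ≡ true → meets G ≡ true
      meets⁺ {G} {c} p q = not⁺ (≢true⇒false λ e → t≢f q (disj⁻ {A = G} e c p))

      F₁ = proj₁ (vert⁻ {Z = Z} Vx₀)
      ZF₁ : Z F₁ ≡ true
      ZF₁ = proj₁ (proj₂ (vert⁻ {Z = Z} Vx₀))
      mF₁ : meets F₁ ≡ true
      mF₁ = meets⁺ (proj₂ (proj₂ (vert⁻ {Z = Z} Vx₀))) Cx₀
      F₂ = proj₁ (vert⁻ {Z = Z} Vz₀)
      ZF₂ : Z F₂ ≡ true
      ZF₂ = proj₁ (proj₂ (vert⁻ {Z = Z} Vz₀))
      z₀F₂ : F₂ ! z₀ ≡ true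
      z₀F₂ = proj₂ (proj₂ (vert⁻ {Z = Z} Vz₀))
      mF₂ : meets F₂ ≡ false
      mF₂ = ≢true⇒false λ e → let c , p , q = meets⁻ {F₂} e in absurd (neighbours q (adj⁺ {Z = Z} ZF₂ p z₀F₂))
        where
        absurd : C ! z₀ ≡ true ⊎ F ! z₀ ≡ true → Void
        absurd (inj₁ p) = t≢f p z₀∉C
        absurd (inj₂ p) = t≢f p z₀∉F

      P : Chain {n}
      P = part meets Z

      -- Ridges meeting C lie only in facets meeting C, and there their number is even.
      ∂P⊑F : ∀ {R} → ∂ P R ≡ true → R ⊑ F
      ∂P⊑F {R} e r Rr with bool (meets R)
      ... | inj₁ m = t≢f e (trans (⊕F-cong λ x → cong (not (R ! x) ∧_) (⇔⇒≡ {P (ins x R)} (proj₁ ∘ ∧⁻) λ z → ∧⁺ z (let c , p , q = meets⁻ {R} m in meets⁺ (ins-⊒ x R c p) q))) (closed R))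
      ... | inj₂ m with ∂-true P e
      ...   | x , x∉R , PRx with ∧⁻ {Z (ins x R)} PRx
      ...     | ZRx , mRx with meets⁻ {ins x R} mRx
      ...       | c , p , q with ins⁻ {x = x} {R} p
      ...         | inj₂ Rc = t≢f (meets⁺ Rc q) m
      ...         | inj₁ refl with neighbours q (adj⁺ {Z = Z} ZRx p (ins-⊒ c R r Rr))
      ...           | inj₂ Fr = Fr
      ...           | inj₁ Cr = t≢f (meets⁺ Rr Cr) m

      ∂P-size : ∀ {R} → ∂ P R ≡ true → suc ∣ R ∣ ≡ d
      ∂P-size {R} e with ∂-true P e
      ... | x , x∉R , PRx = trans (sym (∣ins∣ R x x∉R)) (size (proj₁ (∧⁻ PRx)))

      ∂P-del : ∀ {R} → ∂ P R ≡ true → ∃ λ y → F ! y ≡ true × R ≡ del y F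
      ∂P-del {R} e with card<⇒∃ R F (≤-reflexive (trans (∂P-size e) (sym ∣F∣)))
      ... | y , Fy , y∉R = y , Fy , ⊑∧card⇒≡ (λ x p → trans (del-other F (λ { refl → t≢f p y∉R })) (∂P⊑F e x p))
          (≤-reflexive (suc-injective (trans (sym (∣del∣ F y Fy)) (trans ∣F∣ (sym (∂P-size e))))))

      -- If one ridge of `F` were missing, `ridge-exchange` would leave ∂P empty, and the facets
      -- meeting `C` would form a subcycle without `F₂`.
      ∂P-all : ∀ {y} → F ! y ≡ true → ∂ P (del y F) ≡ true
      ∂P-all {y} Fy with bool (∂ P (del y F))
      ... | inj₁ e = e
      ... | inj₂ e = t≢f (proj₂ (∧⁻ {Z F₂} (irreducible P (proj₁ ∘ ∧⁻) ∂P≡0 {F₁} (∧⁺ ZF₁ mF₁) ZF₂))) mF₂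
        where
        ∂P≡0 : ∀ R → ∂ P R ≡ false
        ∂P≡0 R = ≢true⇒false λ q → let z , Fz , eq = ∂P-del q in t≢f (ridge-exchange (∂ P) ∂P⊑F (∂∂ P) Fz Fy (trans (cong (∂ P) (sym eq)) q)) e

      ∂P : ∀ R → ∂ P R ≡ ∂ (single F) R
      ∂P R = ⇔⇒≡ (λ e → let y , Fy , eq = ∂P-del e in trans (cong (∂ (single F)) eq) (∂-single⁺ {σ = F} Fy))
        (λ e → let y , Fy , eq = ∂-single-del {F} e in trans (cong (∂ P) eq) (∂P-all Fy))

      ∂Q : ∀ R → ∂ (part away Z) R ≡ ∂ (single F) R
      ∂Q R = trans (xor≡false (trans (sym (∂-xor (part away Z) P R)) (trans (∂-cong (λ G → split (Z G) (meets G)) R) (closed R)))) (∂P R)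
        where
        split : ∀ a b → (a ∧ not b) xor (a ∧ b) ≡ a
        split true true = refl
        split true false = refl
        split false _ = refl

      -- Otherwise the facets meeting `C` together with `F` would form a subcycle of Z, and it
      -- misses the facet `F₂` through a vertex outside `C` and `F`.
      F∉Z : Z F ≡ false
      F∉Z = ≢true⇒false λ ZF → t≢f z₀F₂ (≢true⇒false λ _ → bad ZF (∨⁻ {P F₂} (irreducible (λ G → P G ∨ eqS G F) (sub ZF) (∂D ZF) {F} (∨⁺ʳ {P F} eqS⁺) ZF₂)))
        where
        mF : meets F ≡ false
        mF = ≢true⇒false λ e → let c , p , q = meets⁻ {F} e in t≢f p (C∩F q)
        sub : Z F ≡ true → ∀ {G} → P G ∨ eqS G F ≡ true → Z G ≡ true
        sub ZF {G} e with ∨⁻ {P G} e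
        ... | inj₁ p = proj₁ (∧⁻ p)
        ... | inj₂ p = trans (cong Z (eqS⁻ p)) ZF
        ∂D : Z F ≡ true → ∀ R → ∂ (λ G → P G ∨ eqS G F) R ≡ false
        ∂D ZF R = trans (∂-cong {Z = λ G → P G xor eqS G F} (λ G → lem G (bool (eqS G F))) R) (trans (∂-xor P (single F) R) (trans (cong (_xor ∂ (single F) R) (∂P R)) (xor-same (∂ (single F) R))))
          where
          lem : ∀ G → eqS G F ≡ true ⊎ eqS G F ≡ false → P G ∨ eqS G F ≡ P G xor eqS G F
          lem G (inj₁ e) rewrite eqS⁻ e | ZF | mF | eqS⁺ {F = F} = refl
          lem G (inj₂ e) rewrite e with P G
          ... | true = refl
          ... | false = refl
        bad : Z F ≡ true → P F₂ ≡ true ⊎ eqS F₂ F ≡ true → Void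
        bad _ (inj₁ p) = t≢f (proj₂ (∧⁻ {Z F₂} p)) mF₂
        bad _ (inj₂ p) = t≢f (subst (λ A → A ! z₀ ≡ true) (eqS⁻ p) z₀F₂) z₀∉F

      module G₁ = Glue mc F∉Z ∣F∣ meets ∂P ZF₂ mF₂
      module G₂ = Glue mc F∉Z ∣F∣ away ∂Q ZF₁ (cong not mF₁)

      Z₁ Z₂ : Chain {n}
      Z₁ = G₁.glued
      Z₂ = G₂.glued

      F-facet : ∀ {G y} → G ⊑ del y F → F ! y ≡ true → ∃ λ H → Z H ≡ true × meets H ≡ true × G ⊑ H
      F-facet {G} {y} h Fy with ∂-true P (∂P-all Fy)
      ... | x , _ , p = ins x (del y F) , proj₁ (∧⁻ p) , proj₂ (∧⁻ {Z (ins x (del y F))} p) , λ z q → ins-⊒ x (del y F) z (h z q)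

      third : ∀ x y → ∃ λ z → F ! z ≡ true × z ≢ x × z ≢ y
      third x y with card<⇒∃ (ins x (ins y ⊥)) F (≤-trans (s≤s (≤-trans (ins≤ x (ins y ⊥)) (s≤s (≤-trans (ins≤ y ⊥) (s≤s (≤-reflexive (∣⊥∣≡0 n))))))) (subst (3 ≤_) (sym ∣F∣) 3≤d))
        where
        open import Data.Fin.Subset.Properties using (∣⊥∣≡0)
        ins≤ : ∀ x (A : Subset n) → ∣ ins x A ∣ ≤ suc ∣ A ∣
        ins≤ x A with bool (A ! x)
        ... | inj₁ e = ≤-trans (≤-reflexive (cong ∣_∣ (ins-id e))) (n≤1+n _)
        ... | inj₂ e = ≤-reflexive (∣ins∣ A x e)
      ... | z , Fz , z∉ = z , Fz , (λ { refl → t≢f (ins-this z (ins y ⊥)) z∉ }) , (λ { refl → t≢f (ins-⊒ x (ins z ⊥) z (ins-this z ⊥)) z∉ })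

      -- `F` is not a facet of Z, but its ridges lie in facets; as d is at least 3, any two vertices
      -- of `F` lie in a common ridge.
      F-adj : ∀ {x y} → F ! x ≡ true → F ! y ≡ true → adj Z x y ≡ true
      F-adj {x} {y} Fx Fy with third x y
      ... | z , Fz , z≢x , z≢y with F-facet {del z F} (λ _ p → p) Fz
      ...   | H , ZH , _ , h = adj⁺ {Z = Z} ZH (h x (trans (del-other F (z≢x ∘ sym)) Fx)) (h y (trans (del-other F (z≢y ∘ sym)) Fy))

      adj₁⊆ : ∀ {x y} → adj Z₁ x y ≡ true → adj Z x y ≡ true
      adj₁⊆ e with adj⁻ {Z = Z₁} e
      ... | H , g , p , q with G₁.glued⁻ g
      ...   | inj₁ (ZH , _) = adj⁺ {Z = Z} ZH p q
      ...   | inj₂ refl = F-adj p q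

      adj₂⊆ : ∀ {x y} → adj Z₂ x y ≡ true → adj Z x y ≡ true
      adj₂⊆ e with adj⁻ {Z = Z₂} e
      ... | H , g , p , q with G₂.glued⁻ g
      ...   | inj₁ (ZH , _) = adj⁺ {Z = Z} ZH p q
      ...   | inj₂ refl = F-adj p q

      vert₁-C : ∀ {x} → vert Z₁ ! x ≡ true → C ! x ≡ true ⊎ F ! x ≡ true
      vert₁-C {x} e with vert⁻ {Z = Z₁} e
      ... | H , g , Hx with G₁.glued⁻ g
      ...   | inj₂ refl = inj₂ Hx
      ...   | inj₁ (ZH , m) with meets⁻ {H} m
      ...     | c , p , q = neighbours q (adj⁺ {Z = Z} ZH p Hx)

      vert₂-C : ∀ {x} → vert Z₂ ! x ≡ true → C ! x ≡ false
      vert₂-C {x} e with vert⁻ {Z = Z₂} e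
      ... | H , g , Hx with G₂.glued⁻ g
      ...   | inj₂ refl = ≢true⇒false λ c → t≢f Hx (C∩F c)
      ...   | inj₁ (ZH , a) = ≢true⇒false λ c → t≢f (meets⁺ Hx c) (not⁻ a)

      common : ∀ {x} → vert Z₁ ! x ≡ true → vert Z₂ ! x ≡ true → F ! x ≡ true
      common p q with vert₁-C p
      ... | inj₁ c = t≢f c (vert₂-C q)
      ... | inj₂ f = f

      F⊑V : F ⊑ V
      F⊑V x p with third x x
      ... | z , Fz , ne , _ with F-facet {del z F} (λ _ q → q) Fz
      ...   | H , ZH , _ , h = vert⁺ ZH (h x (trans (del-other F (ne ∘ sym)) p))

      V₁⊑V : vert Z₁ ⊑ V
      V₁⊑V x e with vert⁻ {Z = Z₁} e
      ... | H , g , Hx with G₁.glued⁻ g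
      ...   | inj₁ (ZH , _) = vert⁺ ZH Hx
      ...   | inj₂ refl = F⊑V x Hx

      V₂⊑V : vert Z₂ ⊑ V
      V₂⊑V x e with vert⁻ {Z = Z₂} e
      ... | H , g , Hx with G₂.glued⁻ g
      ...   | inj₁ (ZH , _) = vert⁺ ZH Hx
      ...   | inj₂ refl = F⊑V x Hx

      F⊑V₁ : F ⊑ vert Z₁
      F⊑V₁ x p = vert⁺ G₁.glued-F p

      F⊑V₂ : F ⊑ vert Z₂
      F⊑V₂ x p = vert⁺ G₂.glued-F p

      V₁<V : ∣ vert Z₁ ∣ < ∣ V ∣
      V₁<V = ≤-trans (s≤s (∣∣-mono sub)) (≤-reflexive (sym (∣del∣ V z₀ Vz₀)))
        where
        sub : vert Z₁ ⊑ del z₀ V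
        sub x p = trans (del-other V λ { refl → [ (λ c → t≢f c z₀∉C) , (λ f → t≢f f z₀∉F) ]′ (vert₁-C p) }) (V₁⊑V x p)
          where open Data.Sum using ([_,_]′)

      V₂<V : ∣ vert Z₂ ∣ < ∣ V ∣
      V₂<V = ≤-trans (s≤s (∣∣-mono sub)) (≤-reflexive (sym (∣del∣ V x₀ Vx₀)))
        where
        sub : vert Z₂ ⊑ del x₀ V
        sub x p = trans (del-other V λ { refl → t≢f Cx₀ (vert₂-C p) }) (V₂⊑V x p)

      cards : ∣ V ∖ F ∣ ≡ ∣ vert Z₁ ∖ F ∣ + ∣ vert Z₂ ∖ F ∣
      cards = trans (∣∖∪∣ V F (vert Z₁) V₁⊑V) (cong (λ A → ∣ vert Z₁ ∖ F ∣ + ∣ A ∣) (⊑-antisym to from))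
        where
        to : V ∖ (F ∪′ vert Z₁) ⊑ vert Z₂ ∖ F
        to x p with ∖⁻ {A = V} {F ∪′ vert Z₁} p
        ... | Vx , nx with vert⁻ {Z = Z} Vx
        ...   | H , ZH , Hx with bool (meets H)
        ...     | inj₁ m = t≢f (∪⁺ʳ {A = F} (vert⁺ (G₁.glued-part ZH m) Hx)) nx
        ...     | inj₂ m = ∖⁺ (vert⁺ (G₂.glued-part ZH (not⁺ m)) Hx) (≢true⇒false λ f → t≢f (∪⁺ˡ {B = vert Z₁} f) nx)
        from : vert Z₂ ∖ F ⊑ V ∖ (F ∪′ vert Z₁)
        from x p with ∖⁻ {A = vert Z₂} {F} p
        ... | V₂x , nx = ∖⁺ (V₂⊑V x V₂x) (≢true⇒false λ q → bad (∪⁻ {A = F} q))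
          where
          bad : F ! x ≡ true ⊎ vert Z₁ ! x ≡ true → Void
          bad (inj₁ f) = t≢f f nx
          bad (inj₂ v) = t≢f (common v V₂x) nx

      -- After the edges of the first piece are counted, all its vertices are contracted. The second
      -- piece meets them in `F` only, so its edges see no more than the contraction of `F`.
      rk-≥ : ∀ W → rk (adj Z₁) F W + rk (adj Z₂) F W ≤ rk (adj Z) F W
      rk-≥ W = ≤-trans (+-mono-≤ left right) (rk-split (adj Z) F F⊑V₁ W)
        where
        left : rk (adj Z₁) F W ≤ rk (restrictG (adj Z) (vert Z₁)) F W
        left = rk-mono (restrictG (adj Z) (vert Z₁)) (adj Z₁) F W λ e → restrictG⁺ {G = adj Z} (adj₁⊆ e) (adj-vert {Z = Z₁} (adj-symm {Z = Z₁} e)) (adj-vert {Z = Z₁} e)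
        right : rk (adj Z₂) F W ≤ rk (adj Z) (vert Z₁) W
        right = ≤-trans (lab-antiOn (vert Z₂) (edges (adj Z₂) W) (λ m → let _ , _ , e = edges⁻ {G = adj Z₂} m in adj-vert {Z = Z₂} (adj-symm {Z = Z₂} e) , adj-vert {Z = Z₂} e) (λ x v₂ v₁ → common v₁ v₂))
          (rk-mono (adj Z) (adj Z₂) (vert Z₁) W adj₂⊆)

      𝔼-≥ : 𝔼 (rk (adj Z₁) F) + 𝔼 (rk (adj Z₂) F) ≤ 𝔼 (rk (adj Z) F)
      𝔼-≥ = subst (_≤ 𝔼 (rk (adj Z) F)) (𝔼-+ (rk (adj Z₁) F) (rk (adj Z₂) F)) (𝔼-mono rk-≥)

      F-clique₁ : Clique (adj Z₁) F
      F-clique₁ p q _ = adj⁺ {Z = Z₁} G₁.glued-F p q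

      F-clique₂ : Clique (adj Z₂) F
      F-clique₂ p q _ = adj⁺ {Z = Z₂} G₂.glued-F p q

      count₁ : ∣ vert Z₁ ∖ F ∣ + d ≡ ∣ vert Z₁ ∣
      count₁ = trans (cong (∣ vert Z₁ ∖ F ∣ +_) (sym ∣F∣)) (∣∖∣ F⊑V₁)

      count₂ : ∣ vert Z₂ ∖ F ∣ + d ≡ ∣ vert Z₂ ∣
      count₂ = trans (cong (∣ vert Z₂ ∖ F ∣ +_) (sym ∣F∣)) (∣∖∣ F⊑V₂)

      module _ (t : RankTight d (adj Z) F ∣ V ∖ F ∣) where

        -- Each piece satisfies the lower bound, and their ranks together do not exceed the tight
        -- value, so neither has slack.
        tight₂ : RankTight d (adj Z₂) F ∣ vert Z₂ ∖ F ∣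
        tight₂ = tight-cancel {Nof {n} d} {Mof {n}} {∣ vert Z₁ ∖ F ∣} {∣ vert Z₂ ∖ F ∣} (subst (λ m → RankTight d (adj Z) F m) cards t)
          (cycle-bound 3≤d (adj-symm {Z = Z₁}) G₁.glued-cycle (adj⁺ {Z = Z₁}) G₁.glued-F F-clique₁ ∣F∣ count₁) 𝔼-≥

        tight₁ : RankTight d (adj Z₁) F ∣ vert Z₁ ∖ F ∣
        tight₁ = tight-cancel {Nof {n} d} {Mof {n}} {∣ vert Z₂ ∖ F ∣} {∣ vert Z₁ ∖ F ∣} (subst (λ m → RankTight d (adj Z) F m) (trans cards (+-comm ∣ vert Z₁ ∖ F ∣ _)) t)
          (cycle-bound 3≤d (adj-symm {Z = Z₂}) G₂.glued-cycle (adj⁺ {Z = Z₂}) G₂.glued-F F-clique₂ ∣F∣ count₂) (≤-trans (≤-reflexive (+-comm (𝔼 (rk (adj Z₂) F)) _)) 𝔼-≥)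

      F≢ : ∀ {G} → Z G ≡ true → G ≢ F
      F≢ ZG refl = t≢f ZG F∉Z

      ⟨⟩-sum : ∀ G → ⟨ Z ⟩ G ≡ (⟨ Z₁ ⟩ G ∨ ⟨ Z₂ ⟩ G) ∧ not (eqᵇ G F)
      ⟨⟩-sum G = ⇔⇒≡ to from
        where
        to : ⟨ Z ⟩ G ≡ true → (⟨ Z₁ ⟩ G ∨ ⟨ Z₂ ⟩ G) ∧ not (eqᵇ G F) ≡ true
        to e with ⟨⟩⁻ {Z} e
        ... | H , ZH , h = ∧⁺ side (not⁺ (≢true⇒false λ q → F≢ ZH (sym (⊑∧card⇒≡ (subst (_⊑ H) (eqᵇ⁻ q) h) (≤-reflexive (trans (size ZH) (sym ∣F∣)))))))
          where
          side : ⟨ Z₁ ⟩ G ∨ ⟨ Z₂ ⟩ G ≡ true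
          side with bool (meets H)
          ... | inj₁ m = ∨⁺ˡ (⟨⟩⁺ {Z₁} (G₁.glued-part ZH m) h)
          ... | inj₂ m = ∨⁺ʳ {⟨ Z₁ ⟩ G} (⟨⟩⁺ {Z₂} (G₂.glued-part ZH (not⁺ m)) h)
        from : (⟨ Z₁ ⟩ G ∨ ⟨ Z₂ ⟩ G) ∧ not (eqᵇ G F) ≡ true → ⟨ Z ⟩ G ≡ true
        from e with ∧⁻ {⟨ Z₁ ⟩ G ∨ ⟨ Z₂ ⟩ G} e
        ... | s , ne = sides (∨⁻ {⟨ Z₁ ⟩ G} s)
          where
          below-F : G ⊑ F → ⟨ Z ⟩ G ≡ true
          below-F h with card<⇒∃ G F (≰⇒> λ le → t≢f (trans (cong (λ A → eqᵇ A F) (⊑∧card⇒≡ h le)) eqᵇ⁺) (not⁻ ne))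
          ... | y , Fy , y∉G with F-facet {G} (λ x p → trans (del-other F λ { refl → t≢f p y∉G }) (h x p)) Fy
          ...   | H , ZH , _ , k = ⟨⟩⁺ {Z} ZH k
          sides : ⟨ Z₁ ⟩ G ≡ true ⊎ ⟨ Z₂ ⟩ G ≡ true → ⟨ Z ⟩ G ≡ true
          sides (inj₁ p) with ⟨⟩⁻ {Z₁} p
          ... | H , g , h with G₁.glued⁻ g
          ...   | inj₁ (ZH , _) = ⟨⟩⁺ {Z} ZH h
          ...   | inj₂ refl = below-F h
          sides (inj₂ p) with ⟨⟩⁻ {Z₂} p
          ... | H , g , h with G₂.glued⁻ g
          ...   | inj₁ (ZH , _) = ⟨⟩⁺ {Z} ZH h
          ...   | inj₂ refl = below-F h

    ⟨⟩-vert : ∀ {Z : Chain {n}} {x} → ⟨ Z ⟩ ⁅ x ⁆ ≡ true → vert Z ! x ≡ true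
    ⟨⟩-vert {Z} {x} e with ⟨⟩⁻ {Z} e
    ... | F , ZF , h = vert⁺ ZF (h x (⁅⁆-∋ x))

    module _ {d : ℕ} (3≤d : 3 ≤ d) where

      cycle-neighbour : ∀ {Z : Chain {n}} → MinCycle d Z → ∀ {σ} → Z σ ≡ true → ∃ λ w → σ ! w ≡ false × vert Z ! w ≡ true
      cycle-neighbour {Z} mc {σ} Zσ with ∣∣>0 σ (subst (0 <_) (sym (MinCycle.size mc Zσ)) (≤-trans (s≤s z≤n) 3≤d))
      ... | y , σy with ∂-other Z {del y σ} {y} (MinCycle.closed mc _) (del-this y σ) (trans (cong Z (ins-del σy)) Zσ)
      ...   | w , w≢y , w∉ , Zw = w , trans (sym (del-other σ w≢y)) w∉ , vert⁺ Zw (ins-this w _)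

      -- Induction on the number of vertices; each piece at a separator loses a vertex that belongs
      -- to the other. The clique `A` is arbitrary so that tightness can be carried over to the
      -- separator and from there to both pieces.
      tight⇒stacked : ∀ k {Z : Chain {n}} → ∣ vert Z ∣ < k → MinCycle d Z → ∀ {σ} → Z σ ≡ true → ∀ {A m} → Clique (adj Z) A → ∣ A ∣ ≡ d → m + d ≡ ∣ vert Z ∣
        → RankTight d (adj Z) A m → IsStacked d ⟨ Z ⟩
      tight⇒stacked (suc k) {Z} (s≤s le) mc {σ} Zσ {A} {m} cA ∣A∣ meq t with ∣ vert Z ∣ ≤? suc d
      -- A facet and a neighbouring vertex across one of its ridges already make d+1 vertices, so
      -- there are no others; `ridge-exchange` then produces every facet of the simplex.
      ... | yes small = simplexBd ⟨ Z ⟩ V ∣V∣ λ G → ⇔⇒≡ to (from G)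
        where
        V = vert Z
        w = proj₁ (cycle-neighbour mc Zσ)
        w∉σ = proj₁ (proj₂ (cycle-neighbour mc Zσ))
        Vw = proj₂ (proj₂ (cycle-neighbour mc Zσ))
        wσ⊑V : ins w σ ⊑ V
        wσ⊑V = ins-lub (λ x p → vert⁺ Zσ p) Vw
        ∣wσ∣ : ∣ ins w σ ∣ ≡ suc d
        ∣wσ∣ = trans (∣ins∣ σ w w∉σ) (cong suc (MinCycle.size mc Zσ))
        ∣V∣ : ∣ V ∣ ≡ suc d
        ∣V∣ = ≤-antisym small (subst (_≤ ∣ V ∣) ∣wσ∣ (∣∣-mono wσ⊑V))
        V≡ : ins w σ ≡ V
        V≡ = ⊑∧card⇒≡ wσ⊑V (subst (∣ V ∣ ≤_) (sym ∣wσ∣) small)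
        facet : ∀ {y} → V ! y ≡ true → Z (del y V) ≡ true
        facet Vy = ridge-exchange Z (λ ZR x p → vert⁺ ZR p) (MinCycle.closed mc) Vw Vy (trans (cong Z (trans (cong (del w) (sym V≡)) (del-ins w∉σ))) Zσ)
        to : ∀ {G} → ⟨ Z ⟩ G ≡ true → subᵇ G V ∧ not (eqᵇ G V) ≡ true
        to {G} e with ⟨⟩⁻ {Z} e
        ... | F , ZF , h = ∧⁺ (subᵇ⁺ λ x p → vert⁺ ZF (h x p)) (not⁺ (≢true⇒false λ q → <-irrefl refl (≤-trans (≤-reflexive (sym ∣V∣)) (≤-trans (∣∣-mono (subst (_⊑ F) (eqᵇ⁻ q) h)) (≤-reflexive (MinCycle.size mc ZF))))))
        from : ∀ G → subᵇ G V ∧ not (eqᵇ G V) ≡ true → ⟨ Z ⟩ G ≡ true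
        from G e with ∧⁻ {subᵇ G V} e
        ... | s , ne with card<⇒∃ G V (≰⇒> λ le → t≢f (trans (cong (λ A → eqᵇ A V) (⊑∧card⇒≡ (subᵇ⁻ s) le)) eqᵇ⁺) (not⁻ ne))
        ...   | y , Vy , y∉G = ⟨⟩⁺ {Z} (facet Vy) λ x p → trans (del-other V λ { refl → t≢f p y∉G }) (subᵇ⁻ s x p)
      ... | no large with separator? d Z
      ...   | no none = ⊥-elim (no-separator 3≤d mc (≰⇒> large) Zσ none (suc ∣ vert Z ∖ σ ∣) σ ≤-refl (λ _ p → p) (subst (0 <_) m≡ m>0)
                (subst₂ (λ a b → Tight (Nof {n} d) (Mof {n}) a b) m≡ (𝔼-clique-independent {G = adj Z} cA (λ p q _ → adj⁺ {Z = Z} Zσ p q) (trans ∣A∣ (sym ∣σ∣))) t))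
        where
        ∣σ∣ = MinCycle.size mc Zσ
        m≡ : m ≡ ∣ vert Z ∖ σ ∣
        m≡ = +-cancelʳ-≡ d m _ (trans meq (trans (sym (∣∖∣ λ x p → vert⁺ Zσ p)) (cong (∣ vert Z ∖ σ ∣ +_) ∣σ∣)))
        m>0 : 0 < m
        m>0 = +-cancelʳ-≤ d 1 m (subst (suc d ≤_) (sym meq) (<⇒≤ (≰⇒> large)))
      ...   | yes (F , C , sep) = connSum ⟨ Z ⟩ ⟨ Z₁ ⟩ ⟨ Z₂ ⟩ F
            (tight⇒stacked k (≤-trans V₁<V le) G₁.glued-cycle G₁.glued-F F-clique₁ (proj₁ sep) count₁ (tight₁ tF))
            (tight⇒stacked k (≤-trans V₂<V le) G₂.glued-cycle G₂.glued-F F-clique₂ (proj₁ sep) count₂ (tight₂ tF))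
            (proj₁ sep) (⟨⟩⁺ {Z₁} G₁.glued-F λ _ p → p) (⟨⟩⁺ {Z₂} G₂.glued-F λ _ p → p)
            (λ v p q → !⇒∈ (common (⟨⟩-vert {Z₁} p) (⟨⟩-vert {Z₂} q))) ⟨⟩-sum
        where
        open Decompose 3≤d mc sep
        tF : RankTight d (adj Z) F ∣ vert Z ∖ F ∣
        tF = subst₂ (λ a b → Tight (Nof {n} d) (Mof {n}) a b)
          (+-cancelʳ-≡ d m _ (trans meq (trans (sym (∣∖∣ F⊑V)) (cong (∣ vert Z ∖ F ∣ +_) (proj₁ sep)))))
          (𝔼-clique-independent {G = adj Z} cA (λ p q _ → F-adj p q) (trans ∣A∣ (sym (proj₁ sep)))) t

-- Stacked spheres attain equality.

module Stacked where

  open Subsets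
  open UnionFind
  open Expectation
  open Chains
  open RankBound
  open MinimalCycles
  open Separators
  open import Data.Bool using (true; false; _∧_; _∨_; not)
  open import Data.Nat using (ℕ; suc; _+_; _*_; _≤_; _<_; z≤n; s≤s)
  open import Data.Nat.Properties
  open import Data.Nat.Tactic.RingSolver using (solve-∀)
  open import Data.Fin using (Fin; suc)
  import Data.Fin.Properties as Finₚ
  open import Data.Vec using ([]; _∷_)
  open import Data.Product using (∃; _×_; _,_; proj₁; proj₂)
  open import Data.Sum using (_⊎_; inj₁; inj₂)
  open import Data.Empty using (⊥-elim) renaming (⊥ to Void)
  open import Data.List using ([]; _∷_; _++_)
  open import Data.List.Membership.Propositional.Properties using (∈-++⁺ˡ; ∈-++⁺ʳ)
  open import Data.List.Membership.Propositional using () renaming (_∈_ to _∈ˡ_)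
  open import Data.Fin.Subset using (Subset; ∣_∣; ⁅_⁆; _∈_)
  open import Relation.Nullary using (Dec; yes; no)
  open import Relation.Binary.PropositionalEquality using (_≡_; _≢_; refl; sym; trans; cong; subst; subst₂)
  open import Function using (_∘_)
  open import Data.Fin.Subset.Properties using (∣⁅x⁆∣≡1)

  open Bound
  open Tight
  import Data.Fin.Subset as FS

  tight-add-lemL : ∀ N M k k′ → N * (k * M) + N * (k′ * M) ≡ N * ((k + k′) * M)
  tight-add-lemL = solve-∀

  tight-add-lemR : ∀ N M k k′ e e′ → 2 * N * (e + e′) + 2 * ((k + k′) * M) ≡ (2 * N * e + 2 * (k * M)) + (2 * N * e′ + 2 * (k′ * M))
  tight-add-lemR = solve-∀

  tight-one-lemL : ∀ N e h → 2 * N * e + 2 * (1 * (N * h)) ≡ 2 * N * (e + h)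
  tight-one-lemL = solve-∀

  tight-one-lemR : ∀ N p → 2 * N * p ≡ N * (1 * (2 * p))
  tight-one-lemR = solve-∀

  module _ {n : ℕ} where

    pair : Fin n → Fin n → Subset n
    pair x y = ⁅ x ⁆ FS.∪ ⁅ y ⁆

    opaque
      unfolding _!_

      ∪! : ∀ (A B : Subset n) x → (A FS.∪ B) ! x ≡ A ! x ∨ B ! x
      ∪! A B x = lookup-zipWith _∨_ x A B
        where open import Data.Vec.Properties using (lookup-zipWith)

      ∩! : ∀ (A B : Subset n) x → (A FS.∩ B) ! x ≡ A ! x ∧ B ! x
      ∩! A B x = lookup-zipWith _∧_ x A B
        where open import Data.Vec.Properties using (lookup-zipWith)

    pair-ˡ : ∀ x y → pair x y ! x ≡ true
    pair-ˡ x y = trans (∪! ⁅ x ⁆ ⁅ y ⁆ x) (∨⁺ˡ (⁅⁆-∋ x))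

    pair-ʳ : ∀ x y → pair x y ! y ≡ true
    pair-ʳ x y = trans (∪! ⁅ x ⁆ ⁅ y ⁆ y) (∨⁺ʳ {⁅ x ⁆ ! y} (⁅⁆-∋ y))

    pair⁻ : ∀ {x y z} → pair x y ! z ≡ true → z ≡ x ⊎ z ≡ y
    pair⁻ {x} {y} {z} e with ∨⁻ {⁅ x ⁆ ! z} (trans (sym (∪! ⁅ x ⁆ ⁅ y ⁆ z)) e)
    ... | inj₁ p = inj₁ (⁅⁆⁻ p)
    ... | inj₂ p = inj₂ (⁅⁆⁻ p)

    pair-⊑ : ∀ {x y : Fin n} {F : Subset n} → F ! x ≡ true → F ! y ≡ true → pair x y ⊑ F
    pair-⊑ p q z e with pair⁻ e
    ... | inj₁ refl = p
    ... | inj₂ refl = q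

    ⁅⁆-⊑ : ∀ {x : Fin n} {F : Subset n} → F ! x ≡ true → ⁅ x ⁆ ⊑ F
    ⁅⁆-⊑ p z e with ⁅⁆⁻ e
    ... | refl = p

    ∣ins∣≤ : ∀ x (A : Subset n) → ∣ ins x A ∣ ≤ suc ∣ A ∣
    ∣ins∣≤ x A with bool (A ! x)
    ... | inj₁ e = ≤-trans (≤-reflexive (cong ∣_∣ (ins-id e))) (n≤1+n _)
    ... | inj₂ e = ≤-reflexive (∣ins∣ A x e)

    pair≡ins : ∀ x y → pair x y ≡ ins x ⁅ y ⁆
    pair≡ins x y = ⊑-antisym (pair-⊑ (ins-this x ⁅ y ⁆) (ins-⊒ x ⁅ y ⁆ y (⁅⁆-∋ y))) (ins-lub (⁅⁆-⊑ (pair-ʳ x y)) (pair-ˡ x y))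

    ∣pair∣≤2 : ∀ x y → ∣ pair x y ∣ ≤ 2
    ∣pair∣≤2 x y = ≤-trans (≤-reflexive (cong ∣_∣ (pair≡ins x y))) (≤-trans (∣ins∣≤ x ⁅ y ⁆) (s≤s (≤-reflexive (∣⁅x⁆∣≡1 y))))

    Closed : Complex n → Set
    Closed K = ∀ {G H} → K G ≡ true → H ⊑ G → K H ≡ true

    opaque
      -- The pair of x with itself is the singleton, so a vertex counts as adjacent to itself; for
      -- the rank this is a loop.
      skeleton : Complex n → Graph {n}
      skeleton K x y = K (pair x y)

      skeleton≡ : ∀ (K : Complex n) x y → skeleton K x y ≡ K (pair x y)
      skeleton≡ K x y = refl

    skeleton⁺ : ∀ {K : Complex n} {F x y} → Closed K → K F ≡ true → F ! x ≡ true → F ! y ≡ true → skeleton K x y ≡ true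
    skeleton⁺ {K} {x = x} {y} c KF p q = trans (skeleton≡ K x y) (c KF (pair-⊑ p q))

    verts : Complex n → Subset n
    verts K = subset (λ x → K ⁅ x ⁆)

    verts⁺ : ∀ {K : Complex n} {F x} → Closed K → K F ≡ true → F ! x ≡ true → verts K ! x ≡ true
    verts⁺ {x = x} c KF p = trans (subset! _ x) (c KF (⁅⁆-⊑ p))

    stacked-size : ∀ {e} {K : Complex n} → IsStacked e K → ∀ {G} → K G ≡ true → ∣ G ∣ ≤ e
    stacked-size (simplexBd K S ∣S∣ eq) {G} KG with ∧⁻ {subᵇ G S} (trans (sym (eq G)) KG)
    ... | s , ne = ≤-pred (subst (∣ G ∣ <_) ∣S∣ (≰⇒> λ le → t≢f (trans (cong (λ A → eqᵇ A S) (⊑∧card⇒≡ (subᵇ⁻ s) le)) eqᵇ⁺) (not⁻ ne)))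
    stacked-size (connSum K K₁ K₂ F st₁ st₂ ∣F∣ K₁F K₂F com eq) {G} KG with ∨⁻ {K₁ G} (proj₁ (∧⁻ {K₁ G ∨ K₂ G} (trans (sym (eq G)) KG)))
    ... | inj₁ p = stacked-size st₁ p
    ... | inj₂ p = stacked-size st₂ p

    stacked-closed : ∀ {e} {K : Complex n} → IsStacked e K → Closed K
    stacked-closed {e} st@(simplexBd K S ∣S∣ eq) {G} {H} KG h with ∧⁻ {subᵇ G S} (trans (sym (eq G)) KG)
    ... | s , ne = trans (eq H) (∧⁺ (subᵇ⁺ λ x p → subᵇ⁻ s x (h x p)) (not⁺ (≢true⇒false λ q →
      <-irrefl refl (≤-trans (≤-reflexive (sym ∣S∣)) (≤-trans (∣∣-mono (subst (_⊑ G) (eqᵇ⁻ q) h)) (stacked-size st KG))))))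
    stacked-closed {e} (connSum K K₁ K₂ F st₁ st₂ ∣F∣ K₁F K₂F com eq) {G} {H} KG h with ∧⁻ {K₁ G ∨ K₂ G} (trans (sym (eq G)) KG)
    ... | s , ne = trans (eq H) (∧⁺ (sides (∨⁻ {K₁ G} s)) (not⁺ (≢true⇒false λ q → t≢f (trans (cong (λ A → eqᵇ A F) (G≡F q)) eqᵇ⁺) (not⁻ ne))))
      where
      sides : K₁ G ≡ true ⊎ K₂ G ≡ true → K₁ H ∨ K₂ H ≡ true
      sides (inj₁ p) = ∨⁺ˡ (stacked-closed st₁ p h)
      sides (inj₂ p) = ∨⁺ʳ {K₁ H} (stacked-closed st₂ p h)
      G≤e : ∣ G ∣ ≤ e
      G≤e with ∨⁻ {K₁ G} s
      ... | inj₁ p = stacked-size st₁ p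
      ... | inj₂ p = stacked-size st₂ p
      G≡F : eqᵇ H F ≡ true → G ≡ F
      G≡F q = sym (⊑∧card⇒≡ (subst (_⊑ G) (eqᵇ⁻ q) h) (≤-trans G≤e (≤-reflexive (sym ∣F∣))))

    two-elements : ∀ (S : Subset n) → 2 ≤ ∣ S ∣ → ∃ λ x → ∃ λ y → S ! x ≡ true × S ! y ≡ true × x ≢ y
    two-elements S le with ∣∣>0 S (≤-trans (s≤s z≤n) le)
    ... | x , Sx with ∣∣>0 (del x S) (≤-pred (subst (2 ≤_) (∣del∣ S x Sx) le))
    ...   | y , p with del⁻ {x = x} {S} p
    ...     | ne , Sy = x , y , Sx , Sy , ne ∘ sym

    -- Gluing removes `F`, so the induction has to supply a facet different from a prescribed set.
    -- If both summands offered only `H`, all vertices of `H` would be common to them, so `H` would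
    -- lie in `F` and, by size, equal it.
    another-facet : ∀ {e} {K : Complex n} → 1 ≤ e → IsStacked e K → ∀ H → ∃ λ G → K G ≡ true × ∣ G ∣ ≡ e × G ≢ H
    another-facet {e} 1≤e (simplexBd K S ∣S∣ eq) H with two-elements S (subst (2 ≤_) (sym ∣S∣) (s≤s 1≤e))
    ... | x , y , Sx , Sy , x≢y = choose (bool (eqᵇ (del x S) H))
      where
      face : ∀ {x} → S ! x ≡ true → K (del x S) ≡ true
      face {x} Sx = trans (eq (del x S)) (∧⁺ (subᵇ⁺ (del-⊑ x S)) (not⁺ (≢true⇒false λ q → t≢f (trans (cong (_! x) (eqᵇ⁻ q)) Sx) (del-this x S))))
      size : ∀ {x} → S ! x ≡ true → ∣ del x S ∣ ≡ e
      size {x} Sx = suc-injective (trans (sym (∣del∣ S x Sx)) ∣S∣)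
      choose : eqᵇ (del x S) H ≡ true ⊎ eqᵇ (del x S) H ≡ false → ∃ λ G → K G ≡ true × ∣ G ∣ ≡ e × G ≢ H
      choose (inj₂ ne) = del x S , face Sx , size Sx , λ { refl → t≢f eqᵇ⁺ ne }
      choose (inj₁ q) = del y S , face Sy , size Sy , λ r → t≢f (trans (del-other S x≢y) Sx) (trans (cong (_! x) (trans r (sym (eqᵇ⁻ q)))) (del-this x S))
    another-facet {e} 1≤e (connSum K K₁ K₂ F st₁ st₂ ∣F∣ K₁F K₂F com eq) H with another-facet 1≤e st₁ F | another-facet 1≤e st₂ F
    ... | G₁ , K₁G₁ , ∣G₁∣ , G₁≢F | G₂ , K₂G₂ , ∣G₂∣ , G₂≢F = choose (bool (eqᵇ G₁ H)) (bool (eqᵇ G₂ H))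
      where
      not-F : ∀ {G} → G ≢ F → not (eqᵇ G F) ≡ true
      not-F ne = not⁺ (≢true⇒false λ q → ne (eqᵇ⁻ q))
      choose : eqᵇ G₁ H ≡ true ⊎ eqᵇ G₁ H ≡ false → eqᵇ G₂ H ≡ true ⊎ eqᵇ G₂ H ≡ false → ∃ λ G → K G ≡ true × ∣ G ∣ ≡ e × G ≢ H
      choose (inj₂ ne) _ = G₁ , trans (eq G₁) (∧⁺ (∨⁺ˡ K₁G₁) (not-F G₁≢F)) , ∣G₁∣ , λ { refl → t≢f eqᵇ⁺ ne }
      choose (inj₁ _) (inj₂ ne) = G₂ , trans (eq G₂) (∧⁺ (∨⁺ʳ {K₁ G₂} K₂G₂) (not-F G₂≢F)) , ∣G₂∣ , λ { refl → t≢f eqᵇ⁺ ne }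
      choose (inj₁ p) (inj₁ q) = ⊥-elim (G₁≢F (⊑∧card⇒≡ sub (≤-reflexive (trans ∣F∣ (sym ∣G₁∣)))))
        where
        sub : G₁ ⊑ F
        sub x G₁x = ∈⇒! (com x (stacked-closed st₁ K₁G₁ (⁅⁆-⊑ G₁x)) (stacked-closed st₂ K₂G₂ (⁅⁆-⊑ (subst (λ A → A ! x ≡ true) (trans (eqᵇ⁻ p) (sym (eqᵇ⁻ q))) G₁x))))

    tight-move : ∀ {d} {G : Graph {n}} {V A A′ : Subset n} → Clique G A → Clique G A′ → A ⊑ V → A′ ⊑ V → ∣ A ∣ ≡ d → ∣ A′ ∣ ≡ d
      → RankTight d G A ∣ V ∖ A ∣ → RankTight d G A′ ∣ V ∖ A′ ∣
    tight-move {d} {G} {V} {A} {A′} c c′ s s′ ∣A∣ ∣A′∣ t = subst₂ (Tight (Nof {n} d) (Mof {n}))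
      (+-cancelʳ-≡ d _ _ (trans (cong (∣ V ∖ A ∣ +_) (sym ∣A∣)) (trans (∣∖∣ s) (sym (trans (cong (∣ V ∖ A′ ∣ +_) (sym ∣A′∣)) (∣∖∣ s′))))))
      (𝔼-clique-independent {G = G} c c′ (trans ∣A∣ (sym ∣A′∣))) t

    tight-add : ∀ {N M k k′ e e′ e″} → Tight N M k e → Tight N M k′ e′ → e″ ≤ e + e′ → Tight N M (k + k′) e″
    tight-add {N} {M} {k} {k′} {e} {e′} {e″} (tight p) (tight q) r = tight (begin
      2 * N * e″ + 2 * ((k + k′) * M) ≤⟨ +-monoˡ-≤ (2 * ((k + k′) * M)) (*-monoʳ-≤ (2 * N) r) ⟩
      2 * N * (e + e′) + 2 * ((k + k′) * M) ≡⟨ tight-add-lemR N M k k′ e e′ ⟩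
      (2 * N * e + 2 * (k * M)) + (2 * N * e′ + 2 * (k′ * M)) ≤⟨ +-mono-≤ p q ⟩
      N * (k * M) + N * (k′ * M) ≡⟨ tight-add-lemL N M k k′ ⟩
      N * ((k + k′) * M) ∎)
      where open ≤-Reasoning

    tight-one : ∀ {N M e p h} → 2 * p ≡ M → N * h ≡ M → e + h ≤ p → Tight N M 1 e
    tight-one {N} {M} {e} {p} {h} p≡ h≡ le = tight (begin
      2 * N * e + 2 * (1 * M) ≡⟨ cong (λ m → 2 * N * e + 2 * (1 * m)) (sym h≡) ⟩
      2 * N * e + 2 * (1 * (N * h)) ≡⟨ tight-one-lemL N e h ⟩
      2 * N * (e + h) ≤⟨ *-monoʳ-≤ (2 * N) le ⟩
      2 * N * p ≡⟨ tight-one-lemR N p ⟩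
      N * (1 * (2 * p)) ≡⟨ cong (λ m → N * (1 * m)) p≡ ⟩
      N * (1 * M) ∎)
      where open ≤-Reasoning

    module _ {e : ℕ} (3≤e : 3 ≤ e) where

      private
        pair≢ : ∀ {x y F} → ∣ F ∣ ≡ e → eqᵇ (pair x y) F ≡ false
        pair≢ {x} {y} ∣F∣ = ≢true⇒false λ q → <-irrefl refl (≤-trans 3≤e (≤-trans (≤-reflexive (trans (sym ∣F∣) (cong ∣_∣ (sym (eqᵇ⁻ q))))) (∣pair∣≤2 x y)))

      -- With all vertices but `s` identified, the rank is 1 exactly when W contains `s` and meets
      -- the rest. Its average is therefore 1/2 - 1/N, the probability of containing `s` less that
      -- of containing `s` and missing the e others.
      simplex-tight : ∀ {K : Complex n} {S} → (st : IsStacked e K) → ∣ S ∣ ≡ suc e → (∀ G → K G ≡ subᵇ G S ∧ not (eqᵇ G S)) → ∀ {s} → S ! s ≡ true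
        → verts K ≡ S × Clique (skeleton K) (del s S) × RankTight e (skeleton K) (del s S) ∣ S ∖ del s S ∣
      simplex-tight {K} {S} st ∣S∣ eq {s} Ss = V≡S , (λ p q _ → trans (skeleton≡ K _ _) (face (del-⊑ s S _ p) (del-⊑ s S _ q))) , subst (λ m → RankTight e G A m) (sym card1)
          (tight-one {Nof {n} e} {Mof {n}} {𝔼 (rk G A)} {𝔼 (λ W → 𝟙 (W ! s))} {𝔼 (λ W → 𝟙 (W ! s ∧ disj A W))} (𝔼-∈ s)
            (trans (cong (λ c → suc c * suc (suc c) * 𝔼 (λ W → 𝟙 (W ! s ∧ disj A W))) (sym ∣A∣)) (𝔼-hit A s (del-this s S)))
            (subst (_≤ 𝔼 (λ W → 𝟙 (W ! s))) (𝔼-+ (rk G A) (λ W → 𝟙 (W ! s ∧ disj A W))) (𝔼-mono λ W → ptw W (bool (W ! s)) (bool (disj A W)))))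
        where
        A : Subset n
        A = del s S
        G = skeleton K
        ∣A∣ : ∣ A ∣ ≡ e
        ∣A∣ = suc-injective (trans (sym (∣del∣ S s Ss)) ∣S∣)
        face : ∀ {x y} → S ! x ≡ true → S ! y ≡ true → K (pair x y) ≡ true
        face {x} {y} p q = trans (eq (pair x y)) (∧⁺ (subᵇ⁺ (pair-⊑ p q)) (not⁺ (≢true⇒false λ r →
          <-irrefl refl (≤-trans (s≤s (≤-trans (s≤s (s≤s z≤n)) 3≤e)) (≤-trans (≤-reflexive (trans (sym ∣S∣) (cong ∣_∣ (sym (eqᵇ⁻ r))))) (∣pair∣≤2 x y))))))
        in-S : ∀ {H x} → K H ≡ true → H ! x ≡ true → S ! x ≡ true
        in-S {H} {x} KH p = subᵇ⁻ (proj₁ (∧⁻ {subᵇ H S} (trans (sym (eq H)) KH))) x p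
        V≡S : verts K ≡ S
        V≡S = ⊑-antisym (λ x p → in-S (trans (sym (subset! _ x)) p) (⁅⁆-∋ x)) (λ x p → trans (subset! _ x) (stacked-closed st (face p p) (⁅⁆-⊑ (pair-ˡ x x))))
        card1 : ∣ S ∖ A ∣ ≡ 1
        card1 = +-cancelʳ-≡ ∣ A ∣ _ _ (trans (∣∖∣ (del-⊑ s S)) (trans ∣S∣ (cong suc (sym ∣A∣))))
        ends : ∀ {W x y} → (x , y) ∈ˡ edges G W → W ! x ≡ true × W ! y ≡ true × S ! x ≡ true × S ! y ≡ true
        ends {W} {x} {y} m with edges⁻ {G = G} m
        ... | p , q , g = p , q , in-S (trans (sym (skeleton≡ K x y)) g) (pair-ˡ x y) , in-S (trans (sym (skeleton≡ K x y)) g) (pair-ʳ x y)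
        in-A : ∀ {x} → S ! x ≡ true → x ≢ s → A ! x ≡ true
        in-A p ne = trans (del-other S ne) p
        ptw : ∀ W → W ! s ≡ true ⊎ W ! s ≡ false → disj A W ≡ true ⊎ disj A W ≡ false → rk G A W + 𝟙 (W ! s ∧ disj A W) ≤ 𝟙 (W ! s)
        ptw W (inj₂ s∉W) _ rewrite s∉W = ≤-reflexive (trans (+-identityʳ _) (ρ-0 (lab A) (edges G W) λ m → let p , q , a , b = ends m in
          lab-in {B = A} (in-A a (≢⇐! p s∉W)) (in-A b (≢⇐! q s∉W))))
        ptw W (inj₁ Ws) (inj₁ dj) rewrite Ws | dj = ≤-reflexive (cong (_+ 1) (ρ-0 (lab A) (edges G W) λ m → let p , q , a , b = ends m in
          cong (lab A) (trans (only p a) (sym (only q b)))))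
          where
          only : ∀ {x} → W ! x ≡ true → S ! x ≡ true → x ≡ s
          only {x} p a with x Finₚ.≟ s
          ... | yes e = e
          ... | no ne = t≢f p (disj⁻ {A = A} dj x (in-A a ne))
        ptw W (inj₁ Ws) (inj₂ nd) rewrite Ws | nd = ≤-trans (≤-reflexive (+-identityʳ _)) (≤-trans (ρ-span (lab A) ((a , s) ∷ []) (edges G W) spans) (ρ≤length (lab A) ((a , s) ∷ [])))
          where
          a = proj₁ (disj-false {A = A} nd)
          Aa : A ! a ≡ true
          Aa = proj₁ (proj₂ (disj-false {A = A} nd))
          L′ = merge (lab A) (a , s)
          to-a : ∀ {x} → S ! x ≡ true → Dec (x ≡ s) → L′ x ≡ L′ a
          to-a p (yes refl) = sym (merge-joins (lab A) a s)
          to-a {x} p (no ne) = merge-≽ (lab A) (a , s) x a (lab-in {B = A} (in-A p ne) Aa)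
          spans : Spans (lab A) ((a , s) ∷ []) (edges G W)
          spans {x} {y} m = let p , q , b , c = ends m in trans (to-a b (x Finₚ.≟ s)) (sym (to-a c (y Finₚ.≟ s)))

      TightClique : Complex n → Set
      TightClique K = ∃ λ A → Clique (skeleton K) A × ∣ A ∣ ≡ e × A ⊑ verts K × RankTight e (skeleton K) A ∣ verts K ∖ A ∣

      -- Every edge of the sum is an edge of a summand, so the ranks over `F` are subadditive;
      -- removing the face `F` removes no edge, since e is at least 3. Both summands are first moved
      -- from their own cliques to `F`.
      sum-tight : ∀ {K K₁ K₂ : Complex n} {F} → IsStacked e K₁ → IsStacked e K₂ → ∣ F ∣ ≡ e → K₁ F ≡ true → K₂ F ≡ true
        → (∀ v → K₁ ⁅ v ⁆ ≡ true → K₂ ⁅ v ⁆ ≡ true → v ∈ F) → (∀ G → K G ≡ (K₁ G ∨ K₂ G) ∧ not (eqᵇ G F))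
        → ∀ {A₁ A₂} → Clique (skeleton K₁) A₁ → ∣ A₁ ∣ ≡ e → A₁ ⊑ verts K₁ → RankTight e (skeleton K₁) A₁ ∣ verts K₁ ∖ A₁ ∣
        → Clique (skeleton K₂) A₂ → ∣ A₂ ∣ ≡ e → A₂ ⊑ verts K₂ → RankTight e (skeleton K₂) A₂ ∣ verts K₂ ∖ A₂ ∣
        → Clique (skeleton K) F × F ⊑ verts K × RankTight e (skeleton K) F ∣ verts K ∖ F ∣
      sum-tight {K} {K₁} {K₂} {F} st₁ st₂ ∣F∣ K₁F K₂F com eq {A₁} {A₂} c₁ n₁ s₁ t₁ c₂ n₂ s₂ t₂ =
          (λ p q _ → lift₁ (F-clique K₁ cl₁ K₁F p q)) , (λ x p → V₁⊑V x (F⊑ K₁ cl₁ K₁F x p)) , total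
        where
        cl₁ = stacked-closed st₁
        cl₂ = stacked-closed st₂
        F-clique : ∀ (K : Complex n) → Closed K → K F ≡ true → ∀ {x y} → F ! x ≡ true → F ! y ≡ true → skeleton K x y ≡ true
        F-clique K c KF = skeleton⁺ {K = K} c KF
        F⊑ : ∀ (K : Complex n) → Closed K → K F ≡ true → F ⊑ verts K
        F⊑ K c KF x p = verts⁺ {K = K} c KF p
        edge : ∀ x y → K (pair x y) ≡ K₁ (pair x y) ∨ K₂ (pair x y)
        edge x y = trans (eq (pair x y)) (trans (cong (λ b → (K₁ (pair x y) ∨ K₂ (pair x y)) ∧ not b) (pair≢ {x} {y} ∣F∣)) (∧-identityʳ _))
          where open import Data.Bool.Properties using (∧-identityʳ)
        lift₁ : ∀ {x y} → skeleton K₁ x y ≡ true → skeleton K x y ≡ true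
        lift₁ {x} {y} e = trans (skeleton≡ K x y) (trans (edge x y) (∨⁺ˡ (trans (sym (skeleton≡ K₁ x y)) e)))
        descend : ∀ {x y} → skeleton K x y ≡ true → skeleton K₁ x y ≡ true ⊎ skeleton K₂ x y ≡ true
        descend {x} {y} e with ∨⁻ {K₁ (pair x y)} (trans (sym (edge x y)) (trans (sym (skeleton≡ K x y)) e))
        ... | inj₁ p = inj₁ (trans (skeleton≡ K₁ x y) p)
        ... | inj₂ p = inj₂ (trans (skeleton≡ K₂ x y) p)
        vertex : ∀ x → K ⁅ x ⁆ ≡ K₁ ⁅ x ⁆ ∨ K₂ ⁅ x ⁆
        vertex x = subst (λ A → K A ≡ K₁ A ∨ K₂ A) (⊑-antisym (λ z p → [ (λ { refl → ⁅⁆-∋ x }) , (λ { refl → ⁅⁆-∋ x }) ]′ (pair⁻ p)) (⁅⁆-⊑ (pair-ˡ x x))) (edge x x)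
          where open Data.Sum using ([_,_]′)
        V₁⊑V : verts K₁ ⊑ verts K
        V₁⊑V x p = trans (subset! _ x) (trans (vertex x) (∨⁺ˡ (trans (sym (subset! _ x)) p)))
        cards : ∣ verts K ∖ F ∣ ≡ ∣ verts K₁ ∖ F ∣ + ∣ verts K₂ ∖ F ∣
        cards = trans (∣∖∪∣ (verts K) F (verts K₁) V₁⊑V) (cong (λ A → ∣ verts K₁ ∖ F ∣ + ∣ A ∣) (⊑-antisym to from))
          where
          to : verts K ∖ (F ∪′ verts K₁) ⊑ verts K₂ ∖ F
          to x p with ∖⁻ {A = verts K} {F ∪′ verts K₁} p
          ... | Vx , nx with ∨⁻ {K₁ ⁅ x ⁆} (trans (sym (vertex x)) (trans (sym (subset! _ x)) Vx))
          ...   | inj₁ q = t≢f (∪⁺ʳ {A = F} (trans (subset! _ x) q)) nx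
          ...   | inj₂ q = ∖⁺ (trans (subset! _ x) q) (≢true⇒false λ f → t≢f (∪⁺ˡ {B = verts K₁} f) nx)
          from : verts K₂ ∖ F ⊑ verts K ∖ (F ∪′ verts K₁)
          from x p with ∖⁻ {A = verts K₂} {F} p
          ... | V₂x , nx = ∖⁺ (trans (subset! _ x) (trans (vertex x) (∨⁺ʳ {K₁ ⁅ x ⁆} (trans (sym (subset! _ x)) V₂x)))) (≢true⇒false λ q → bad (∪⁻ {A = F} q))
            where
            bad : F ! x ≡ true ⊎ verts K₁ ! x ≡ true → Void
            bad (inj₁ f) = t≢f f nx
            bad (inj₂ v) = t≢f (∈⇒! (com x (trans (sym (subset! _ x)) v) (trans (sym (subset! _ x)) V₂x))) nx
        rk-≤ : ∀ W → rk (skeleton K) F W ≤ rk (skeleton K₁) F W + rk (skeleton K₂) F W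
        rk-≤ W = begin
          ρ (lab F) (edges (skeleton K) W) ≤⟨ ρ-⊆ (lab F) (λ m → sub m) ⟩
          ρ (lab F) (E₁ ++ E₂) ≡⟨ ρ-++ (lab F) E₁ E₂ ⟩
          ρ (lab F) E₁ + ρ (mergeAll (lab F) E₁) E₂ ≤⟨ +-monoʳ-≤ (ρ (lab F) E₁) (ρ-anti E₂ (mergeAll-≽ (lab F) E₁)) ⟩
          ρ (lab F) E₁ + ρ (lab F) E₂ ∎
          where
          open ≤-Reasoning
          E₁ = edges (skeleton K₁) W
          E₂ = edges (skeleton K₂) W
          sub : ∀ {e} → e ∈ˡ edges (skeleton K) W → e ∈ˡ E₁ ++ E₂
          sub m with edges⁻ {G = skeleton K} m
          ... | p , q , g with descend g
          ...   | inj₁ h = ∈-++⁺ˡ (edges⁺ p q h)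
          ...   | inj₂ h = ∈-++⁺ʳ E₁ (edges⁺ p q h)
        moved₁ : RankTight e (skeleton K₁) F ∣ verts K₁ ∖ F ∣
        moved₁ = tight-move {d = e} {G = skeleton K₁} {V = verts K₁} {A = A₁} {A′ = F} c₁ (λ p q _ → F-clique K₁ cl₁ K₁F p q) s₁ (F⊑ K₁ cl₁ K₁F) n₁ ∣F∣ t₁
        moved₂ : RankTight e (skeleton K₂) F ∣ verts K₂ ∖ F ∣
        moved₂ = tight-move {d = e} {G = skeleton K₂} {V = verts K₂} {A = A₂} {A′ = F} c₂ (λ p q _ → F-clique K₂ cl₂ K₂F p q) s₂ (F⊑ K₂ cl₂ K₂F) n₂ ∣F∣ t₂
        𝔼-≤ : 𝔼 (rk (skeleton K) F) ≤ 𝔼 (rk (skeleton K₁) F) + 𝔼 (rk (skeleton K₂) F)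
        𝔼-≤ = subst (𝔼 (rk (skeleton K) F) ≤_) (𝔼-+ (rk (skeleton K₁) F) (rk (skeleton K₂) F)) (𝔼-mono rk-≤)
        total : RankTight e (skeleton K) F ∣ verts K ∖ F ∣
        total = subst (λ m → RankTight e (skeleton K) F m) (sym cards)
          (tight-add {N = Nof {n} e} {M = Mof {n}} {k = ∣ verts K₁ ∖ F ∣} {k′ = ∣ verts K₂ ∖ F ∣} {e = 𝔼 (rk (skeleton K₁) F)} {e′ = 𝔼 (rk (skeleton K₂) F)} {e″ = 𝔼 (rk (skeleton K) F)} moved₁ moved₂ 𝔼-≤)

      base-tight : ∀ {K S s} → IsStacked e K → ∣ S ∣ ≡ suc e → (∀ G → K G ≡ subᵇ G S ∧ not (eqᵇ G S)) → S ! s ≡ true → TightClique K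
      base-tight {K} {S} {s} st ∣S∣ eq Ss = let V≡S , c , t = simplex-tight st ∣S∣ eq Ss in
        del s S , c , suc-injective (trans (sym (∣del∣ S s Ss)) ∣S∣) , subst (del s S ⊑_) (sym V≡S) (del-⊑ s S)
        , subst (λ V → RankTight e (skeleton K) (del s S) ∣ V ∖ del s S ∣) (sym V≡S) t

      join-tight : ∀ {K K₁ K₂ : Complex n} {F} → IsStacked e K₁ → IsStacked e K₂ → ∣ F ∣ ≡ e → K₁ F ≡ true → K₂ F ≡ true
        → (∀ v → K₁ ⁅ v ⁆ ≡ true → K₂ ⁅ v ⁆ ≡ true → v ∈ F) → (∀ G → K G ≡ (K₁ G ∨ K₂ G) ∧ not (eqᵇ G F))
        → TightClique K₁ → TightClique K₂ → TightClique K
      join-tight {F = F} st₁ st₂ ∣F∣ K₁F K₂F com eq (A₁ , c₁ , n₁ , s₁ , t₁) (A₂ , c₂ , n₂ , s₂ , t₂) =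
        let c , s , t = sum-tight st₁ st₂ ∣F∣ K₁F K₂F com eq c₁ n₁ s₁ t₁ c₂ n₂ s₂ t₂ in F , c , ∣F∣ , s , t

      stacked⇒tight : ∀ {K : Complex n} → IsStacked e K → TightClique K
      stacked⇒tight st@(simplexBd K S ∣S∣ eq) = base-tight st ∣S∣ eq (proj₂ (∣∣>0 S (subst (0 <_) (sym ∣S∣) (s≤s z≤n))))
      stacked⇒tight (connSum K K₁ K₂ F st₁ st₂ ∣F∣ K₁F K₂F com eq) = join-tight st₁ st₂ ∣F∣ K₁F K₂F com eq (stacked⇒tight st₁) (stacked⇒tight st₂)

-- The rank of a vertex-edge incidence matrix over a field.

module LinearRank where

  open Subsets
  open UnionFind
  open import Level using (_⊔_)
  open import Data.Nat as ℕ using (ℕ; zero; suc; _≤_; _<_; z≤n; s≤s)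
  import Data.Nat.Properties as ℕₚ
  open import Data.Bool using (Bool; if_then_else_)
  open import Data.Fin using (Fin; zero; suc)
  import Data.Fin.Properties as Finₚ
  open import Data.Maybe using (nothing)
  open import Data.Product using (∃; _×_; _,_; proj₁; proj₂)
  open import Data.Sum using (_⊎_; inj₁; inj₂)
  open import Data.Empty using (⊥-elim) renaming (⊥ to Void)
  open import Data.List as L using (List; []; _∷_; length)
  open import Data.List.Membership.Propositional using () renaming (_∈_ to _∈ˡ_)
  open import Data.List.Membership.Propositional.Properties using (∈-lookup; ∈-tabulate⁻)
  open import Data.Fin.Subset using (Subset)
  open import Relation.Nullary using (Dec; yes; no)
  open import Relation.Binary.PropositionalEquality as ≡ using (_≡_; _≢_)
  open import Function using (_∘_)
  open import Tactic.RingSolver.Core.AlmostCommutativeRing using (AlmostCommutativeRing; fromCommutativeRing)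
  import Tactic.RingSolver as Solver

  module RingIdentities {c ℓ} (𝔽 : Field c ℓ) where

    acr : AlmostCommutativeRing c ℓ
    acr = fromCommutativeRing (Field.commutativeRing 𝔽) (λ _ → nothing)

    open AlmostCommutativeRing acr

    regroup : ∀ a x y z w → a * ((x + y) + - (z + w)) ≈ a * (x + - z) + a * (y + - w)
    regroup = Solver.solve-∀ acr
    interchange : ∀ a b c d → (a + b) + (c + d) ≈ (a + c) + (b + d)
    interchange = Solver.solve-∀ acr
    gather-t : ∀ a v w s t → (a * w + t) + (a * v + s) ≈ a * (v + w) + (t + s)
    gather-t = Solver.solve-∀ acr
    gather-s : ∀ a v w s t → (t + s) + a * (v + w) ≈ (a * w + t) + (a * v + s)
    gather-s = Solver.solve-∀ acr
    sum-row : ∀ a b c d → (a + - b) + (c + - d) ≈ (a + c) + - (b + d)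
    sum-row = Solver.solve-∀ acr
  module FieldAlgebra {c ℓ} (𝔽 : Field c ℓ) (n : ℕ) where

    open Field 𝔽 hiding (zero; ring)
    open Lin 𝔽 n using (∑)
    open import Relation.Binary.Reasoning.Setoid setoid

    open RingIdentities 𝔽

    open import Algebra.Properties.Ring (Field.ring 𝔽) using (-‿distribˡ-*; -‿distribʳ-*; -‿involutive)

    add-sub : ∀ x y → x ≈ (x + y) + - y
    add-sub x y = sym (trans (+-assoc x y (- y)) (trans (+-congˡ (-‿inverseʳ y)) (+-identityʳ x)))

    cancel-source : ∀ s v → - (s * v) * v + s ≈ s + - (s * (v * v))
    cancel-source s v = trans (+-comm _ _) (+-congˡ (trans (sym (-‿distribˡ-* (s * v) v)) (-‿cong (*-assoc s v v))))

    cancel-target : ∀ a v w s t → a * w + t ≈ (a * (v + w) + (t + s)) + - (a * v + s)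
    cancel-target a v w s t = trans (add-sub (a * w + t) (a * v + s)) (+-congʳ (gather-t a v w s t))

    push-row : ∀ a v w s t → t + s ≈ ((a * w + t) + (a * v + s)) + - (a * (v + w))
    push-row a v w s t = trans (add-sub (t + s) (a * (v + w))) (+-congʳ (gather-s a v w s t))

    neg-neg : ∀ x → - x * - x ≈ x * x
    neg-neg x = trans (sym (-‿distribˡ-* x (- x))) (trans (-‿cong (sym (-‿distribʳ-* x x))) (-‿involutive (x * x)))

    -0≈0 : - 0# ≈ 0#
    -0≈0 = trans (sym (+-identityˡ (- 0#))) (-‿inverseʳ 0#)

    x-0≈x : ∀ x → x + - 0# ≈ x
    x-0≈x x = trans (+-congˡ -0≈0) (+-identityʳ x)

    ∑-cong : ∀ {r} {f g : Fin r → Carrier} → (∀ i → f i ≈ g i) → ∑ f ≈ ∑ g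
    ∑-cong {zero} h = refl
    ∑-cong {suc r} h = +-cong (h zero) (∑-cong (h ∘ suc))

    ∑-0 : ∀ {r} {f : Fin r → Carrier} → (∀ i → f i ≈ 0#) → ∑ f ≈ 0#
    ∑-0 {zero} h = refl
    ∑-0 {suc r} h = trans (+-cong (h zero) (∑-0 (h ∘ suc))) (+-identityˡ 0#)

    ∑-+ : ∀ {r} (f g : Fin r → Carrier) → ∑ (λ i → f i + g i) ≈ ∑ f + ∑ g
    ∑-+ {zero} f g = sym (+-identityˡ 0#)
    ∑-+ {suc r} f g = trans (+-congˡ (∑-+ (f ∘ suc) (g ∘ suc))) (interchange _ _ _ _)

    ind : Bool → Carrier
    ind b = if b then 1# else 0#

    -- Column of the edge (c , d) when the vertices with equal labels are identified and the root is removed.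
    δ : Label {n} → Label {n} → Carrier
    δ p μ = ind (eqF p μ)

    δ-≡ : ∀ {p μ} → p ≡ μ → δ p μ ≈ 1#
    δ-≡ {p} ≡.refl rewrite eqF-refl p = refl

    δ-≢ : ∀ {p μ} → p ≢ μ → δ p μ ≈ 0#
    δ-≢ ne rewrite eqF-≢ ne = refl

    column : Labeling {n} → Edge {n} → Label {n} → Carrier
    column L (c , d) μ = δ (L d) μ + - δ (L c) μ

    row : ∀ {r} → (Fin r → Carrier) → Labeling {n} → (Fin r → Edge {n}) → Label {n} → Carrier
    row a L e μ = ∑ (λ i → a i * column L (e i) μ)

    Indep : ∀ {r} → Labeling {n} → (Fin r → Edge {n}) → Set (c ⊔ ℓ)
    Indep {r} L e = ∀ (a : Fin r → Carrier) → (∀ x → row a L e (suc x) ≈ 0#) → ∀ i → a i ≈ 0#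

    module _ (L : Labeling {n}) (e₀ : Edge {n}) where

      private
        p q s t : Label {n}
        p = L (proj₁ e₀)
        q = L (proj₂ e₀)
        s = source p q
        t = target p q
        L′ = merge L e₀

      column-≡ : p ≡ q → ∀ μ → column L e₀ μ ≈ 0#
      column-≡ e μ rewrite e = -‿inverseʳ _

      source≢target : ∀ {p q : Label {n}} → p ≢ q → source p q ≢ target p q
      source≢target {p} {zero} ne = ne
      source≢target {p} {suc q} ne = ne ∘ ≡.sym

      source≢0 : ∀ {p q : Label {n}} → p ≢ q → source p q ≢ zero
      source≢0 {p} {zero} ne = ne
      source≢0 {p} {suc q} ne ()

      module _ (p≢q : p ≢ q) where

        private
          s≢t = source≢target p≢q

        δ-at-s : ∀ r → δ (relabel p q r) s ≈ 0#
        δ-at-s r with r Finₚ.≟ s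
        ... | yes e = δ-≢ (s≢t ∘ ≡.sym)
        ... | no ne = δ-≢ ne

        δ-at-t : ∀ r → δ (relabel p q r) t ≈ δ r t + δ r s
        δ-at-t r with r Finₚ.≟ s
        ... | yes ≡.refl = trans (δ-≡ ≡.refl) (sym (trans (+-cong (δ-≢ s≢t) (δ-≡ ≡.refl)) (+-identityˡ 1#)))
        ... | no ne = sym (trans (+-congˡ (δ-≢ ne)) (+-identityʳ _))

        δ-at-other : ∀ {μ} → μ ≢ s → μ ≢ t → ∀ r → δ (relabel p q r) μ ≈ δ r μ
        δ-at-other ne ne′ r with r Finₚ.≟ s
        ... | yes ≡.refl = trans (δ-≢ (ne′ ∘ ≡.sym)) (sym (δ-≢ (ne ∘ ≡.sym)))
        ... | no _ = refl

        module _ {r : ℕ} (a : Fin r → Carrier) (e : Fin r → Edge {n}) where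

          private
            from to : Fin r → Label {n}
            from i = L (proj₁ (e i))
            to i = L (proj₂ (e i))

          row-s : row a L′ e s ≈ 0#
          row-s = ∑-0 {r} λ i → trans (*-congˡ {a i} (trans (+-cong (δ-at-s (to i)) (-‿cong (δ-at-s (from i)))) (-‿inverseʳ 0#))) (zeroʳ (a i))

          -- Merging the ends of `e₀` is the row operation that adds row s to row t; by `row-s` the
          -- row s itself becomes 0.
          row-t : row a L′ e t ≈ row a L e t + row a L e s
          row-t = trans (∑-cong {r} λ i → trans (*-congˡ {a i} (+-cong (δ-at-t (to i)) (-‿cong (δ-at-t (from i))))) (regroup (a i) (δ (to i) t) (δ (to i) s) (δ (from i) t) (δ (from i) s)))
            (∑-+ {r} (λ i → a i * column L (e i) t) (λ i → a i * column L (e i) s))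

          row-other : ∀ {μ} → μ ≢ s → μ ≢ t → row a L′ e μ ≈ row a L e μ
          row-other ne ne′ = ∑-cong {r} λ i → *-congˡ {a i} (+-cong (δ-at-other ne ne′ (to i)) (-‿cong (δ-at-other ne ne′ (from i))))

        v : Label {n} → Carrier
        v = column L e₀

        v-other : ∀ {μ} → μ ≢ s → μ ≢ t → v μ ≈ 0#
        v-other {μ} ne ne′ = trans (+-cong (δ-≢ {q} (q≢ ne ne′)) (trans (-‿cong (δ-≢ {p} (p≢ ne ne′))) -0≈0)) (+-identityˡ 0#)
          where
          q≢ : ∀ {μ} → μ ≢ source p q → μ ≢ target p q → q ≢ μ
          q≢ a b = lem p q a b
            where
            lem : ∀ p q {μ} → μ ≢ source p q → μ ≢ target p q → q ≢ μ
            lem p zero a b e = b (≡.sym e)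
            lem p (suc q) a b e = a (≡.sym e)
          p≢ : ∀ {μ} → μ ≢ source p q → μ ≢ target p q → p ≢ μ
          p≢ a b = lem p q a b
            where
            lem : ∀ p q {μ} → μ ≢ source p q → μ ≢ target p q → p ≢ μ
            lem p zero a b e = a (≡.sym e)
            lem p (suc q) a b e = b (≡.sym e)

        private
          δδ : ∀ p q → p ≢ q → (δ q (source p q) + - δ p (source p q)) * (δ q (source p q) + - δ p (source p q)) ≈ 1#
          δδ p zero ne = trans (*-cong w w) minus-square
            where
            w : δ zero p + - δ p p ≈ - 1#
            w = trans (+-cong (δ-≢ (ne ∘ ≡.sym)) (-‿cong (δ-≡ ≡.refl))) (+-identityˡ _)
            minus-square : - 1# * - 1# ≈ 1#
            minus-square = trans (neg-neg 1#) (*-identityˡ 1#)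
          δδ p (suc q) ne = trans (*-cong w w) (*-identityˡ 1#)
            where
            w : δ (suc q) (suc q) + - δ p (suc q) ≈ 1#
            w = trans (+-cong (δ-≡ ≡.refl) (-‿cong (δ-≢ ne))) (x-0≈x 1#)

          δ+δ : ∀ p q → p ≢ q → δ q (source p q) + δ q (target p q) ≈ δ p (source p q) + δ p (target p q)
          δ+δ p zero ne = trans (+-cong (δ-≢ (ne ∘ ≡.sym)) (δ-≡ ≡.refl)) (trans (+-comm 0# 1#) (sym (+-cong (δ-≡ ≡.refl) (δ-≢ ne))))
          δ+δ p (suc q) ne = trans (+-cong (δ-≡ ≡.refl) (δ-≢ (ne ∘ ≡.sym))) (trans (+-comm 1# 0#) (sym (+-cong (δ-≢ ne) (δ-≡ ≡.refl))))

        -- The entry at s is 1 or -1 according to the orientation, so it is its own inverse and can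
        -- serve as pivot in any characteristic.
        v² : v s * v s ≈ 1#
        v² = δδ p q p≢q

        v-sum : v s + v t ≈ 0#
        v-sum = trans (sum-row _ _ _ _) (trans (+-congʳ (δ+δ p q p≢q)) (-‿inverseʳ _))

        -- The coefficient of `e₀` is chosen to make coordinate s vanish; since the pivot is its own
        -- inverse, multiplying by it replaces a division.
        extend : ∀ {r} (a : Fin r → Carrier) → (Fin r → Edge {n}) → Fin (suc r) → Carrier
        extend a e zero = - (row a L e s * v s)
        extend a e (suc i) = a i

        cons : ∀ {r} → (Fin r → Edge {n}) → Fin (suc r) → Edge {n}
        cons e zero = e₀
        cons e (suc i) = e i

        extend-row : ∀ {r} (a : Fin r → Carrier) e → (∀ x → row a L′ e (suc x) ≈ 0#) → ∀ x → row (extend a e) L (cons e) (suc x) ≈ 0#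
        extend-row a e h x = go (suc x Finₚ.≟ s) (suc x Finₚ.≟ t)
          where
          S = row a L e s
          at-s : - (S * v s) * v s + S ≈ 0#
          at-s = trans (cancel-source S (v s)) (trans (+-congˡ (-‿cong (trans (*-congˡ v²) (*-identityʳ S)))) (-‿inverseʳ S))
          go : Dec (suc x ≡ s) → Dec (suc x ≡ t) → - (S * v s) * v (suc x) + row a L e (suc x) ≈ 0#
          go (yes eq) _ rewrite eq = at-s
          go (no ne) (yes eq) = ≡.subst (λ μ → - (S * v s) * v μ + row a L e μ ≈ 0#) (≡.sym eq) (trans (cancel-target (- (S * v s)) (v s) (v t) S (row a L e t))
            (trans (+-cong (+-cong (trans (*-congˡ v-sum) (zeroʳ _)) (trans (sym (row-t a e)) (≡.subst (λ μ → row a L′ e μ ≈ 0#) eq (h x)))) (-‿cong at-s))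
            (trans (+-cong (+-identityˡ 0#) -0≈0) (+-identityˡ 0#))))
          go (no ne) (no ne′) = trans (+-cong (trans (*-congˡ (v-other ne ne′)) (zeroʳ _)) (trans (sym (row-other a e ne ne′)) (h x))) (+-identityˡ 0#)

        restrict-row : ∀ {r} a₀ (a : Fin r → Carrier) e → (∀ x → a₀ * v (suc x) + row a L e (suc x) ≈ 0#) → ∀ x → row a L′ e (suc x) ≈ 0#
        restrict-row a₀ a e h x = go (suc x Finₚ.≟ s) (suc x Finₚ.≟ t)
          where
          nonzero : ∀ μ → μ ≢ zero → a₀ * v μ + row a L e μ ≈ 0#
          nonzero zero ne = ⊥-elim (ne ≡.refl)
          nonzero (suc x) ne = h x
          go : Dec (suc x ≡ s) → Dec (suc x ≡ t) → row a L′ e (suc x) ≈ 0#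
          go (yes eq) _ rewrite eq = row-s a e
          go (no ne) (yes eq) = ≡.subst (λ μ → row a L′ e μ ≈ 0#) (≡.sym eq) (trans (row-t a e) (trans (push-row a₀ (v s) (v t) (row a L e s) (row a L e t))
            (trans (+-cong (+-cong (nonzero t (λ z → zero≢suc (≡.trans (≡.sym z) (≡.sym eq)))) (nonzero s (source≢0 p≢q))) (-‿cong (trans (*-congˡ v-sum) (zeroʳ a₀)))) (trans (+-cong (+-identityˡ 0#) -0≈0) (+-identityˡ 0#)))))
            where
            zero≢suc : zero ≢ suc x
            zero≢suc ()
          go (no ne) (no ne′) = trans (row-other a e ne ne′) (trans (sym (trans (+-congʳ (trans (*-congˡ (v-other ne ne′)) (zeroʳ a₀))) (+-identityˡ _))) (h x))

        head-zero : ∀ {r} a₀ (a : Fin r → Carrier) e → (∀ x → a₀ * v (suc x) + row a L e (suc x) ≈ 0#) → (∀ i → a i ≈ 0#) → a₀ ≈ 0#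
        head-zero a₀ a e h z = begin
          a₀ ≈⟨ *-identityʳ a₀ ⟨
          a₀ * 1# ≈⟨ *-congˡ v² ⟨
          a₀ * (v s * v s) ≈⟨ *-assoc a₀ (v s) (v s) ⟨
          a₀ * v s * v s ≈⟨ *-congʳ (trans (sym (trans (+-congˡ (∑-0 λ i → trans (*-congʳ (z i)) (zeroˡ _))) (+-identityʳ _))) (nonzero s (source≢0 p≢q))) ⟩
          0# * v s ≈⟨ zeroˡ (v s) ⟩
          0# ∎
          where
          nonzero : ∀ μ → μ ≢ zero → a₀ * v μ + row a L e μ ≈ 0#
          nonzero zero ne = ⊥-elim (ne ≡.refl)
          nonzero (suc x) ne = h x

    -- An edge inside a class has the zero column, so the first edge joins two classes. A dependence
    -- of the remaining edges after merging would extend, by `extend-row`, to one of the whole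
    -- family.
    indep⇒ρ : ∀ r (L : Labeling {n}) (e : Fin r → Edge {n}) → Indep L e → ρ L (L.tabulate e) ≡ r
    indep⇒ρ zero L e ind = ≡.refl
    indep⇒ρ (suc r) L e ind with L (proj₁ (e zero)) Finₚ.≟ L (proj₂ (e zero))
    ... | yes eq = ⊥-elim (0≉1 (sym (ind unit (λ x → trans (+-cong (trans (*-congˡ (column-≡ L (e zero) eq (suc x))) (zeroʳ 1#)) (∑-0 {r} λ i → zeroˡ (column L (e (suc i)) (suc x)))) (+-identityˡ 0#)) zero)))
      where
      unit : Fin (suc r) → Carrier
      unit zero = 1#
      unit (suc _) = 0#
    ... | no ne = ≡.cong suc (indep⇒ρ r (merge L (e zero)) (e ∘ suc) λ a h i →
        ind (extend L (e zero) ne a (e ∘ suc)) (extend-row L (e zero) ne a (e ∘ suc) h) (suc i))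

    -- The edges that raise the greedy count form the family: eliminate with the first of them and
    -- continue in the merged labeling.
    ρ⇒indep : ∀ (L : Labeling {n}) es → ∃ λ (ι : Fin (ρ L es) → Fin (length es)) → (∀ i j → ι i ≡ ι j → i ≡ j) × Indep L (λ i → L.lookup es (ι i))
    ρ⇒indep L [] = (λ ()) , (λ ()) , λ a h ()
    ρ⇒indep L (e ∷ es) with L (proj₁ e) Finₚ.≟ L (proj₂ e) | ρ⇒indep (merge L e) es
    ... | yes eq | ι , inj , ind = (λ i → suc (ι i)) , (λ i j h → inj i j (Finₚ.suc-injective h)) , λ a h → ind a λ x → trans (sym (same a x)) (h x)
      where
      same : ∀ {r} (a : Fin r → Carrier) {ε : Fin r → Edge {n}} x → row a L ε (suc x) ≈ row a (merge L e) ε (suc x)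
      same a {ε} x = ∑-cong λ i → *-congˡ {a i} (reflexive (≡.cong₂ (λ p q → δ q (suc x) + - δ p (suc x)) (keep (proj₁ (ε i))) (keep (proj₂ (ε i)))))
        where
        keep : ∀ y → L y ≡ merge L e y
        keep y = ≡.sym (relabel-id (L (proj₁ e)) (L (proj₂ e)) (L y) eq)
    ... | no ne | ι , inj , ind = ι′ , inj′ , ind′
      where
      ι′ : Fin (suc (ρ (merge L e) es)) → Fin (suc (length es))
      ι′ zero = zero
      ι′ (suc i) = suc (ι i)
      inj′ : ∀ i j → ι′ i ≡ ι′ j → i ≡ j
      inj′ zero zero h = ≡.refl
      inj′ (suc i) (suc j) h = ≡.cong suc (inj i j (Finₚ.suc-injective h))
      ind′ : Indep L (λ i → L.lookup (e ∷ es) (ι′ i))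
      ind′ a h = λ { zero → head-zero L e ne (a zero) (a ∘ suc) ε h tail ; (suc i) → tail i }
        where
        ε = λ i → L.lookup es (ι i)
        tail : ∀ i → a (suc i) ≈ 0#
        tail = ind (a ∘ suc) (restrict-row L e ne (a zero) (a ∘ suc) ε h)

    inject : ∀ {m k} → m ≤ k → Fin m → Fin k
    inject (s≤s le) zero = zero
    inject (s≤s le) (suc i) = suc (inject le i)

    inject-injective : ∀ {m k} (le : m ≤ k) i j → inject le i ≡ inject le j → i ≡ j
    inject-injective (s≤s le) zero zero e = ≡.refl
    inject-injective (s≤s le) (suc i) (suc j) e = ≡.cong suc (inject-injective le i j (Finₚ.suc-injective e))

    -- Zero coefficients on the tail cut an independent family down to the exact length that
    -- `HasRank` speaks of.
    pad : ∀ {m k} → m ≤ k → (Fin m → Carrier) → Fin k → Carrier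
    pad z≤n a i = 0#
    pad (s≤s le) a zero = a zero
    pad (s≤s le) a (suc i) = pad le (a ∘ suc) i

    pad-inject : ∀ {m k} (le : m ≤ k) a i → pad le a (inject le i) ≡ a i
    pad-inject (s≤s le) a zero = ≡.refl
    pad-inject (s≤s le) a (suc i) = pad-inject le (a ∘ suc) i

    pad-∑ : ∀ {m k} (le : m ≤ k) a (w : Fin k → Carrier) → ∑ (λ i → pad le a i * w i) ≈ ∑ (λ i → a i * w (inject le i))
    pad-∑ z≤n a w = ∑-0 λ i → zeroˡ (w i)
    pad-∑ (s≤s le) a w = +-congˡ (pad-∑ le (a ∘ suc) (w ∘ suc))

    indep-inject : ∀ {m k} (le : m ≤ k) {L} {e : Fin k → Edge {n}} → Indep L e → Indep L (e ∘ inject le)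
    indep-inject le {L} {e} ind a h i = trans (reflexive (≡.sym (pad-inject le a i))) (ind (pad le a) (λ x → trans (pad-∑ le a (λ j → column L (e j) (suc x))) (h x)) (inject le i))

  module GraphicRank {c ℓ} (𝔽 : Field c ℓ) (n : ℕ) (rkF : Lin.RankFunction 𝔽 n) where

    open Field 𝔽 using (_≈_; 0#; sym; trans; *-congˡ)
    open Lin 𝔽 n
    open FieldAlgebra 𝔽 n

    -- The matrix vs is the vertex-edge incidence matrix of es, with the vertices of the root class of L deleted.
    module _ (vs : List Vect) (L : Labeling {n}) (es : List (Edge {n})) (len : length vs ≡ length es)
      (spot : Fin n → Subset n)
      (hit : ∀ i x → L.lookup vs i (spot x) ≈ column L (L.lookup es (≡.subst Fin len i)) (suc x))
      (miss : ∀ i G → (∃ λ x → G ≡ spot x) ⊎ L.lookup vs i G ≈ 0#) where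

      private
        at : Fin (length vs) → Fin (length es)
        at = ≡.subst Fin len
        back : Fin (length es) → Fin (length vs)
        back = ≡.subst Fin (≡.sym len)
        at-back : ∀ i → at (back i) ≡ i
        at-back i = ≡.subst-subst-sym len
        r = proj₁ rkF vs
        spec = proj₂ rkF vs

      private
        zero-sum : ∀ {k} (ι : Fin k → Fin (length vs)) a → (∀ x → row a L (λ i → L.lookup es (at (ι i))) (suc x) ≈ 0#) → ∀ G → ∑ (λ i → Field._*_ 𝔽 (a i) (L.lookup vs (ι i) G)) ≈ 0#
        -- Either G is the coordinate of a vertex, where the entries are those of the incidence
        -- columns, or all vectors of the family vanish there.
        zero-sum {k} ι a h G with known k ι
          where
          known : ∀ k (ι : Fin k → Fin (length vs)) → (∃ λ x → G ≡ spot x) ⊎ (∀ i → L.lookup vs (ι i) G ≈ 0#)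
          known zero ι = inj₂ λ ()
          known (suc k) ι with miss (ι zero) G | known k (ι ∘ suc)
          ... | inj₁ p | _ = inj₁ p
          ... | inj₂ _ | inj₁ p = inj₁ p
          ... | inj₂ z | inj₂ zs = inj₂ λ { zero → z ; (suc i) → zs i }
        ... | inj₁ (x , ≡.refl) = trans (∑-cong λ i → *-congˡ (hit (ι i) x)) (h x)
        ... | inj₂ z = ∑-0 λ i → trans (*-congˡ (z i)) (Field.zeroʳ 𝔽 (a i))

      independent⇒indep : ∀ {k} (ι : Fin k → Fin (length vs)) → Independent (λ i → L.lookup vs (ι i)) → Indep L (λ i → L.lookup es (at (ι i)))
      independent⇒indep ι ind a h = ind a (zero-sum ι a h)

      indep⇒independent : ∀ {k} (ι : Fin k → Fin (length vs)) → Indep L (λ i → L.lookup es (at (ι i))) → Independent (λ i → L.lookup vs (ι i))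
      indep⇒independent ι ind a h = ind a λ x → trans (∑-cong λ i → *-congˡ (sym (hit (ι i) x))) (h (spot x))

      -- Independence of the vectors and of the incidence columns coincide, so a largest independent
      -- family bounds the greedy count from one side and the greedy family bounds the rank from the
      -- other.
      graphic-rank : proj₁ rkF vs ≡ ρ L es
      graphic-rank = ℕₚ.≤-antisym upper (ℕₚ.≮⇒≥ λ r<ρ → lower r<ρ)
        where
        ι₁ = proj₁ (proj₁ spec)
        e₁ : Fin r → Edge {n}
        e₁ i = L.lookup es (at (ι₁ i))
        upper : r ≤ ρ L es
        upper = ≡.subst (_≤ ρ L es) (indep⇒ρ r L e₁ (independent⇒indep ι₁ (proj₂ (proj₂ (proj₁ spec))))) (ρ-⊆ L λ m → member (∈-tabulate⁻ m))
          where
          member : ∀ {e} → (∃ λ i → e ≡ e₁ i) → e ∈ˡ es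
          member (i , ≡.refl) = ∈-lookup (at (ι₁ i))
        lower : r < ρ L es → Void
        lower r<ρ = proj₂ spec ι₂ inj₂′ (indep⇒independent ι₂ ind₂)
          where
          fam = ρ⇒indep L es
          ι₂ : Fin (suc r) → Fin (length vs)
          ι₂ i = back (proj₁ fam (inject r<ρ i))
          inj₂′ : InjectiveFin ι₂
          inj₂′ i j h = inject-injective r<ρ i j (proj₁ (proj₂ fam) _ _ (≡.trans (≡.sym (at-back _)) (≡.trans (≡.cong at h) (at-back _))))
          ind₂ : Indep L (λ i → L.lookup es (at (ι₂ i)))
          ind₂ a h = indep-inject r<ρ {L} {λ i → L.lookup es (proj₁ fam i)} (proj₂ (proj₂ fam)) a λ x →
            trans (∑-cong {suc r} λ i → *-congˡ {a i} (Field.reflexive 𝔽 (≡.cong (λ j → column L (L.lookup es j) (suc x)) (≡.sym (at-back (proj₁ fam (inject r<ρ i))))))) (h x)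

-- Betti numbers of induced subcomplexes as graphic ranks.

module BettiNumbers where

  open Subsets
  open UnionFind
  open Expectation
  open Chains
  open MinimalCycles
  open Separators
  open Stacked
  open LinearRank
  open import Level using (_⊔_)
  open import Data.Nat as ℕ using (ℕ; zero; suc; _≤_; _<_; s≤s; _∸_; _≡ᵇ_)
  import Data.Nat.Properties as ℕₚ
  open import Data.Bool using (Bool; true; false; if_then_else_; _∧_; not)
  open import Data.Bool.Properties using (T-≡; ∧-identityʳ; ∧-zeroʳ)
  open import Data.Fin using (Fin; zero; suc)
  import Data.Fin.Properties as Finₚ
  open import Data.Product using (∃; _×_; _,_; proj₁; proj₂)
  open import Data.Sum using (_⊎_; inj₁; inj₂)
  open import Data.Empty using (⊥-elim) renaming (⊥ to Void)
  open import Data.Vec using ([]; _∷_; lookup)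
  open import Data.List as L using (List; []; _∷_; length; filterᵇ; map; _++_)
  open import Data.List.Properties using (length-++; filter-++; length-map)
  open import Data.List.Membership.Propositional using () renaming (_∈_ to _∈ˡ_)
  open import Data.List.Membership.Propositional.Properties using (∈-filter⁺; ∈-filter⁻; ∈-map⁺; ∈-++⁺ˡ; ∈-++⁺ʳ; ∈-allFin)
  open import Data.List.Relation.Unary.Any using () renaming (here to hereˡ; there to thereˡ)
  open import Data.Fin.Subset using (Subset; ∣_∣; ⊥; ⁅_⁆; _-_)
  open import Data.Fin.Subset.Properties using (∣⊥∣≡0; ∣⁅x⁆∣≡1; p─⊥≡p)
  open import Function.Bundles using (Equivalence)
  open import Relation.Nullary using (Dec; yes; no)
  open import Relation.Binary.PropositionalEquality as ≡ using (_≡_; _≢_)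
  open import Function using (_∘_; id)

  length-filter-map : ∀ {A B : Set} (p : B → Bool) (f : A → B) xs → length (filterᵇ p (map f xs)) ≡ length (filterᵇ (p ∘ f) xs)
  length-filter-map p f [] = ≡.refl
  length-filter-map p f (x ∷ xs) with p (f x)
  ... | true = ≡.cong suc (length-filter-map p f xs)
  ... | false = length-filter-map p f xs

  count≡ΣS : ∀ {n} (p : Subset n → Bool) → count p (allSubsets n) ≡ ΣS (λ F → 𝟙 (p F))
  count≡ΣS {zero} p with p []
  ... | true = ≡.refl
  ... | false = ≡.refl
  count≡ΣS {suc n} p = begin
    length (filterᵇ p (map (false ∷_) (allSubsets n) ++ map (true ∷_) (allSubsets n)))
      ≡⟨ ≡.cong length (filter-++ _ (map (false ∷_) (allSubsets n)) _) ⟩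
    length (filterᵇ p (map (false ∷_) (allSubsets n)) ++ filterᵇ p (map (true ∷_) (allSubsets n)))
      ≡⟨ length-++ (filterᵇ p (map (false ∷_) (allSubsets n))) ⟩
    length (filterᵇ p (map (false ∷_) (allSubsets n))) ℕ.+ length (filterᵇ p (map (true ∷_) (allSubsets n)))
      ≡⟨ ≡.cong₂ ℕ._+_ (≡.trans (length-filter-map p (false ∷_) (allSubsets n)) (count≡ΣS (p ∘ (false ∷_)))) (≡.trans (length-filter-map p (true ∷_) (allSubsets n)) (count≡ΣS (p ∘ (true ∷_)))) ⟩
    ΣS (λ F → 𝟙 (p (false ∷ F))) ℕ.+ ΣS (λ F → 𝟙 (p (true ∷ F))) ∎
    where open ≡.≡-Reasoning

  ∈-allSubsets : ∀ {n} (F : Subset n) → F ∈ˡ allSubsets n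
  ∈-allSubsets [] = hereˡ ≡.refl
  ∈-allSubsets (false ∷ F) = ∈-++⁺ˡ (∈-map⁺ (false ∷_) (∈-allSubsets F))
  ∈-allSubsets {suc n} (true ∷ F) = ∈-++⁺ʳ (map (false ∷_) (allSubsets n)) (∈-map⁺ (true ∷_) (∈-allSubsets F))

  ΣF-point : ∀ {n} (f : Fin n → ℕ) x → (∀ y → y ≢ x → f y ≡ 0) → ΣF f ≡ f x
  ΣF-point {suc n} f zero h = ≡.trans (≡.cong (f zero ℕ.+_) (ΣF-0 λ y → h (suc y) λ ())) (ℕₚ.+-identityʳ (f zero))
  ΣF-point {suc n} f (suc x) h = ≡.trans (≡.cong (ℕ._+ ΣF (f ∘ suc)) (h zero λ ())) (ΣF-point (f ∘ suc) x λ y ne → h (suc y) (ne ∘ Finₚ.suc-injective))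

  ΣS-point : ∀ {n} (f : Subset n → ℕ) R → (∀ F → F ≢ R → f F ≡ 0) → ΣS f ≡ f R
  ΣS-point f [] h = ≡.refl
  ΣS-point f (false ∷ R) h = ≡.trans (≡.cong₂ ℕ._+_ (ΣS-point (f ∘ (false ∷_)) R λ F ne → h (false ∷ F) λ { ≡.refl → ne ≡.refl }) (ΣS-0 λ F → h (true ∷ F) λ ())) (ℕₚ.+-identityʳ _)
  ΣS-point f (true ∷ R) h = ≡.cong₂ ℕ._+_ (ΣS-0 λ F → h (false ∷ F) λ ()) (ΣS-point (f ∘ (true ∷_)) R λ F ne → h (true ∷ F) λ { ≡.refl → ne ≡.refl })

  ≡ᵇ⁻ : ∀ {a b} → (a ≡ᵇ b) ≡ true → a ≡ b
  ≡ᵇ⁻ {a} {b} e = ℕₚ.≡ᵇ⇒≡ a b (Equivalence.from T-≡ e)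

  ≡ᵇ⁺ : ∀ {a b} → a ≡ b → (a ≡ᵇ b) ≡ true
  ≡ᵇ⁺ {a} {b} e = Equivalence.to T-≡ (ℕₚ.≡⇒≡ᵇ a b e)

  module _ {n : ℕ} where

    -- The sets counted are exactly the `ins x R` with x outside `R`. Counts over all subsets, as in
    -- the definitions, thereby become sums over vertices.
    count-above : ∀ (R : Subset n) (g : Subset n → Bool) →
      ΣS (λ F → 𝟙 (g F ∧ (∣ F ∣ ≡ᵇ suc ∣ R ∣) ∧ subᵇ R F)) ≡ ΣF (λ x → 𝟙 (not (R ! x) ∧ g (ins x R)))
    count-above R g = begin
      ΣS (λ F → 𝟙 (g F ∧ (∣ F ∣ ≡ᵇ suc ∣ R ∣) ∧ subᵇ R F)) ≡⟨ ΣS-cong (λ F → expand F (bool (above F))) ⟩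
      ΣS (λ F → ΣF (λ x → 𝟙 (eqS F (ins x R) ∧ (not (R ! x) ∧ g (ins x R))))) ≡⟨ ΣS-ΣF {n} {n} (λ F x → 𝟙 (eqS F (ins x R) ∧ (not (R ! x) ∧ g (ins x R)))) ⟩
      ΣF (λ x → ΣS (λ F → 𝟙 (eqS F (ins x R) ∧ (not (R ! x) ∧ g (ins x R))))) ≡⟨ ΣF-cong collapse ⟩
      ΣF (λ x → 𝟙 (not (R ! x) ∧ g (ins x R))) ∎
      where
      open ≡.≡-Reasoning
      above : Subset n → Bool
      above F = (∣ F ∣ ≡ᵇ suc ∣ R ∣) ∧ subᵇ R F
      collapse : ∀ x → ΣS (λ F → 𝟙 (eqS F (ins x R) ∧ (not (R ! x) ∧ g (ins x R)))) ≡ 𝟙 (not (R ! x) ∧ g (ins x R))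
      collapse x = ≡.trans (ΣS-point (λ F → 𝟙 (eqS F (ins x R) ∧ (not (R ! x) ∧ g (ins x R)))) (ins x R) λ F ne → ≡.cong (λ b → 𝟙 (b ∧ (not (R ! x) ∧ g (ins x R)))) (eqS-≢ ne)) (≡.cong (λ b → 𝟙 (b ∧ (not (R ! x) ∧ g (ins x R)))) eqS⁺)
      expand : ∀ F → above F ≡ true ⊎ above F ≡ false → 𝟙 (g F ∧ above F) ≡ ΣF (λ x → 𝟙 (eqS F (ins x R) ∧ (not (R ! x) ∧ g (ins x R))))
      expand F (inj₁ e) with ∧⁻ {∣ F ∣ ≡ᵇ suc ∣ R ∣} e
      ... | c , s with card<⇒∃ R F (ℕₚ.≤-reflexive (≡.sym (≡ᵇ⁻ c)))
      ...   | x , Fx , x∉R = ≡.sym (≡.trans (ΣF-point (λ x → 𝟙 (eqS F (ins x R) ∧ (not (R ! x) ∧ g (ins x R)))) x λ y ne → ≡.cong 𝟙 (≢true⇒false λ q → no-other y ne (eqS⁻ (proj₁ (∧⁻ q))) (not⁻ (proj₁ (∧⁻ (proj₂ (∧⁻ {eqS F (ins y R)} q)))))))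
              (≡.cong 𝟙 (≡.trans (≡.cong₂ (λ a b → a ∧ (not b ∧ g (ins x R))) (≡.trans (≡.cong (λ A → eqS A (ins x R)) F≡) eqS⁺) x∉R) (≡.trans (≡.cong g (≡.sym F≡)) (≡.sym (≡.trans (≡.cong (g F ∧_) e) (∧-identityʳ (g F))))))))
        where
        F≡ : F ≡ ins x R
        F≡ = ≡.sym (⊑∧card⇒≡ (ins-lub (subᵇ⁻ s) Fx) (ℕₚ.≤-reflexive (≡.trans (≡ᵇ⁻ c) (≡.sym (∣ins∣ R x x∉R)))))
        no-other : ∀ y → y ≢ x → F ≡ ins y R → R ! y ≡ false → Void
        no-other y ne q y∉R = t≢f (≡.trans (≡.sym (ins-other R (ne ∘ ≡.sym))) (≡.trans (≡.cong (_! x) (≡.sym q)) Fx)) x∉R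
      expand F (inj₂ e) = ≡.trans (≡.cong 𝟙 (≡.trans (≡.cong (g F ∧_) e) (∧-zeroʳ (g F)))) (≡.sym (ΣF-0 λ x → ≡.cong 𝟙 (≢true⇒false λ q → impossible x (eqS⁻ (proj₁ (∧⁻ q))) (not⁻ (proj₁ (∧⁻ (proj₂ (∧⁻ {eqS F (ins x R)} q))))))))
        where
        impossible : ∀ x → F ≡ ins x R → R ! x ≡ false → Void
        impossible x ≡.refl x∉R = t≢f (∧⁺ (≡ᵇ⁺ (∣ins∣ R x x∉R)) (subᵇ⁺ (ins-⊒ x R))) e

    ⊥⊑ : ∀ {F : Subset n} → ⊥ ⊑ F
    ⊥⊑ x p = t≢f p (⊥! x)

    ins-⊥ : ∀ (x : Fin n) → ins x ⊥ ≡ ⁅ x ⁆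
    ins-⊥ x = ⊑-antisym (ins-lub ⊥⊑ (⁅⁆-∋ x)) (⁅⁆-⊑ (ins-this x ⊥))

    count-vertices : ∀ (g : Subset n → Bool) → ΣS (λ F → 𝟙 (g F ∧ (∣ F ∣ ≡ᵇ 1))) ≡ ΣF (λ x → 𝟙 (g ⁅ x ⁆))
    count-vertices g = begin
      ΣS (λ F → 𝟙 (g F ∧ (∣ F ∣ ≡ᵇ 1))) ≡⟨ ΣS-cong (λ F → ≡.cong (λ b → 𝟙 (g F ∧ b)) (≡.trans (≡.sym (∧-identityʳ _)) (≡.cong₂ (λ k b → (∣ F ∣ ≡ᵇ suc k) ∧ b) (≡.sym (∣⊥∣≡0 n)) (≡.sym (subᵇ⁺ {A = ⊥} {B = F} ⊥⊑))))) ⟩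
      ΣS (λ F → 𝟙 (g F ∧ (∣ F ∣ ≡ᵇ suc ∣ ⊥ {n} ∣) ∧ subᵇ ⊥ F)) ≡⟨ count-above ⊥ g ⟩
      ΣF (λ x → 𝟙 (not (⊥ ! x) ∧ g (ins x ⊥))) ≡⟨ ΣF-cong (λ x → ≡.cong₂ (λ a A → 𝟙 (not a ∧ g A)) (⊥! x) (ins-⊥ x)) ⟩
      ΣF (λ x → 𝟙 (g ⁅ x ⁆)) ∎
      where open ≡.≡-Reasoning

    count-empty : ∀ (g : Subset n → Bool) → ΣS (λ F → 𝟙 (g F ∧ (∣ F ∣ ≡ᵇ 0))) ≡ 𝟙 (g ⊥)
    count-empty g = ≡.trans (ΣS-point (λ F → 𝟙 (g F ∧ (∣ F ∣ ≡ᵇ 0))) ⊥ λ F ne → ≡.cong 𝟙 (≢true⇒false λ q → ne (⊑-antisym (λ x p → t≢f p (∣∣≡0 {A = F} (≡ᵇ⁻ (proj₂ (∧⁻ {g F} q))) x)) ⊥⊑)))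
      (≡.cong 𝟙 (≡.trans (≡.cong (g ⊥ ∧_) (≡ᵇ⁺ (∣⊥∣≡0 n))) (∧-identityʳ (g ⊥))))

    ∈-faces⁺ : ∀ {K M : Complex n} {j F} → relᵇ K M F ≡ true → ∣ F ∣ ≡ j → F ∈ˡ facesCard K M j
    ∈-faces⁺ {F = F} p q = ∈-filter⁺ _ (∈-allSubsets F) (Equivalence.from T-≡ (∧⁺ p (≡ᵇ⁺ q)))

    ∈-faces⁻ : ∀ {K M : Complex n} {j F} → F ∈ˡ facesCard K M j → relᵇ K M F ≡ true × ∣ F ∣ ≡ j
    ∈-faces⁻ {K} {M} {j} {F} m with ∧⁻ {relᵇ K M F} (Equivalence.to T-≡ (proj₂ (∈-filter⁻ _ {xs = allSubsets n} m)))
    ... | p , q = p , ≡ᵇ⁻ q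

    rel⁻ : ∀ {K M : Complex n} {G} → relᵇ K M G ≡ true → K G ≡ true × M G ≡ false
    rel⁻ {K} {M} {G} e with ∧⁻ {K G} e
    ... | p , q = p , not⁻ q

    rel⁺ : ∀ {K M : Complex n} {G} → K G ≡ true → M G ≡ false → relᵇ K M G ≡ true
    rel⁺ p q = ∧⁺ p (not⁺ q)

    restrict⁺ : ∀ {K : Complex n} {W G} → K G ≡ true → G ⊑ W → restrict K W G ≡ true
    restrict⁺ p q = ∧⁺ p (subᵇ⁺ q)

    restrict⁻ : ∀ {K : Complex n} {W G} → restrict K W G ≡ true → K G ≡ true × G ⊑ W
    restrict⁻ {K} {W} {G} e with ∧⁻ {K G} e
    ... | p , q = p , subᵇ⁻ q

    rel-restrict : ∀ (K M : Complex n) W G → relᵇ (restrict K W) (restrict M W) G ≡ relᵇ K M G ∧ subᵇ G W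
    rel-restrict K M W G with K G | M G | subᵇ G W
    ... | true | true | true = ≡.refl
    ... | true | true | false = ≡.refl
    ... | true | false | true = ≡.refl
    ... | true | false | false = ≡.refl
    ... | false | _ | _ = ≡.refl

  opaque
    unfolding _!_ ins del

    minus≡del : ∀ {n} (F : Subset n) i → F - i ≡ del i F
    minus≡del (b ∷ F) zero = ≡.cong₂ _∷_ ≡.refl (p─⊥≡p F)
    minus≡del (b ∷ F) (suc i) = ≡.cong₂ _∷_ ≡.refl (minus≡del F i)

  module Betti {c ℓ} (𝔽 : Field c ℓ) (n : ℕ) (rkF : Lin.RankFunction 𝔽 n) where

    open Field 𝔽 using (Carrier; _≈_; 0#; 1#; _+_; _*_; -_; refl; sym; trans; reflexive; +-cong; +-congˡ; +-identityˡ; +-identityʳ; +-comm; *-congˡ; *-congʳ; zeroˡ; zeroʳ; *-identityˡ; *-identityʳ; -‿inverseʳ; -‿cong; 0≉1)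
    open Lin 𝔽 n
    open Hom 𝔽 n rkF hiding (rk)
    open FieldAlgebra 𝔽 n
    open GraphicRank 𝔽 n rkF

    ∑-point : ∀ {r} (f : Fin r → Carrier) x → (∀ y → y ≢ x → f y ≈ 0#) → ∑ f ≈ f x
    ∑-point {suc r} f zero h = trans (+-congˡ (∑-0 λ y → h (suc y) λ ())) (+-identityʳ (f zero))
    ∑-point {suc r} f (suc x) h = trans (+-cong (h zero λ ()) (∑-point (f ∘ suc) x λ y ne → h (suc y) (ne ∘ Finₚ.suc-injective))) (+-identityˡ _)

    ∑-two : ∀ {r} (f : Fin r → Carrier) x y → x ≢ y → (∀ z → z ≢ x → z ≢ y → f z ≈ 0#) → ∑ f ≈ f x + f y
    ∑-two {suc r} f zero zero ne h = ⊥-elim (ne ≡.refl)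
    ∑-two {suc r} f zero (suc y) ne h = +-congˡ (∑-point (f ∘ suc) y λ z q → h (suc z) (λ ()) (q ∘ Finₚ.suc-injective))
    ∑-two {suc r} f (suc x) zero ne h = trans (+-congˡ (∑-point (f ∘ suc) x λ z q → h (suc z) (q ∘ Finₚ.suc-injective) λ ())) (+-comm _ _)
    ∑-two {suc r} f (suc x) (suc y) ne h = trans (+-cong (h zero (λ ()) λ ()) (∑-two (f ∘ suc) x y (ne ∘ ≡.cong suc) λ z p q → h (suc z) (p ∘ Finₚ.suc-injective) (q ∘ Finₚ.suc-injective))) (+-identityˡ _)

    opaque
      unfolding _!_

      lookup≡! : ∀ (F : Subset n) i → lookup F i ≡ F ! i
      lookup≡! F i = ≡.refl

      ordered-one : ∀ {m} (F : Subset m) → ∣ F ∣ ≡ 1 → ∃ λ b → F ! b ≡ true × below F b ≡ 0 × (∀ x → F ! x ≡ true → x ≡ b)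
      ordered-one (true ∷ F) e = zero , ≡.refl , ≡.refl , λ { zero _ → ≡.refl ; (suc x) p → t≢f p (∣∣≡0 {A = F} (ℕₚ.suc-injective e) x) }
      ordered-one (false ∷ F) e with ordered-one F e
      ... | b , p , q , h = suc b , p , q , λ { (suc x) r → ≡.cong suc (h x r) }

      -- The smaller vertex has sign exponent 0 and the larger one 1, so their deletions enter the
      -- boundary with signs 1 and -1.
      ordered-two : ∀ {m} (F : Subset m) → ∣ F ∣ ≡ 2 → ∃ λ a → ∃ λ b → a ≢ b × F ! a ≡ true × F ! b ≡ true × below F a ≡ 0 × below F b ≡ 1
        × (∀ x → F ! x ≡ true → x ≡ a ⊎ x ≡ b)
      ordered-two (true ∷ F) e with ordered-one F (ℕₚ.suc-injective e)
      ... | b , p , q , h = zero , suc b , (λ ()) , ≡.refl , p , ≡.refl , ≡.cong suc q , λ { zero _ → inj₁ ≡.refl ; (suc x) r → inj₂ (≡.cong suc (h x r)) }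
      ordered-two (false ∷ F) e with ordered-two F e
      ... | a , b , ne , p , q , r , s , h = suc a , suc b , ne ∘ Finₚ.suc-injective , p , q , r , s , λ { (suc x) t → lift-cases (h x t) }
        where
        lift-cases : ∀ {m} {x a b : Fin m} → x ≡ a ⊎ x ≡ b → suc x ≡ suc a ⊎ suc x ≡ suc b
        lift-cases (inj₁ e) = inj₁ (≡.cong suc e)
        lift-cases (inj₂ e) = inj₂ (≡.cong suc e)

    bd-term : ∀ (K M : Complex n) F G i → Carrier
    bd-term K M F G i = if lookup F i ∧ eqᵇ G (F - i) ∧ relᵇ K M G then sgn (below F i) else 0#

    bd-out : ∀ {K M : Complex n} {F G i} → F ! i ≡ false → bd-term K M F G i ≈ 0#
    bd-out {F = F} {i = i} e rewrite lookup≡! F i | e = refl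

    bd-miss : ∀ {K M : Complex n} {F G i} → G ≢ del i F → bd-term K M F G i ≈ 0#
    bd-miss {K} {M} {F} {G} {i} ne rewrite minus≡del F i | ≢true⇒false {eqᵇ G (del i F)} (ne ∘ eqᵇ⁻) | ∧-zeroʳ (lookup F i) = refl

    bd-hit : ∀ {K M : Complex n} {F G i} → F ! i ≡ true → G ≡ del i F → bd-term K M F G i ≈ (if relᵇ K M G then sgn (below F i) else 0#)
    bd-hit {K} {M} {F} {_} {i} e ≡.refl rewrite lookup≡! F i | e | minus≡del F i | eqᵇ⁺ {A = del i F} = refl

    δ-lab : ∀ {B : Subset n} {b x} → δ (lab B b) (suc x) ≈ ind (not (B ! b) ∧ eqF x b)
    δ-lab {B} {b} {x} = go (bool (B ! b)) (x Finₚ.≟ b)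
      where
      go : B ! b ≡ true ⊎ B ! b ≡ false → Dec (x ≡ b) → δ (lab B b) (suc x) ≈ ind (not (B ! b) ∧ eqF x b)
      go (inj₁ e) _ rewrite lab-root {B = B} e | e = δ-≢ {p = zero} λ ()
      go (inj₂ e) (yes ≡.refl) rewrite lab-out {B = B} e | e | eqF-refl x = δ-≡ ≡.refl
      go (inj₂ e) (no ne) rewrite lab-out {B = B} e | e | eqF-≢ ne = δ-≢ (ne ∘ ≡.sym ∘ Finₚ.suc-injective)

    -- An edge face F gives the column of the edge of its two vertices.
    record Edgeface (K M : Complex n) (B : Subset n) (F : Subset n) : Set (c ⊔ ℓ) where
      field
        end₁ end₂ : Fin n
        F-pair : F ≡ pair end₁ end₂
        hit-column : ∀ x → bd K M F ⁅ x ⁆ ≈ column (lab B) (end₁ , end₂) (suc x)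
        other-zero : ∀ G → (∃ λ x → G ≡ ⁅ x ⁆) ⊎ bd K M F G ≈ 0#

    module _ {K M : Complex n} {B : Subset n} {F : Subset n} (∣F∣ : ∣ F ∣ ≡ 2) (rel-vertex : ∀ {x} → F ! x ≡ true → relᵇ K M ⁅ x ⁆ ≡ not (B ! x)) where

      -- Deleting the smaller vertex a leaves b with sign +, deleting b leaves a with sign -, and
      -- coordinates in the subcomplex are dropped: this is the column of (a, b) with the vertices
      -- of `B` in the root class.
      edgeface : Edgeface K M B F
      edgeface with ordered-two F ∣F∣
      ... | a , b , a≢b , Fa , Fb , βa , βb , only = record
        { end₁ = a ; end₂ = b ; F-pair = F≡ ; hit-column = λ x → trans (bd≈ ⁅ x ⁆) (at x) ; other-zero = λ G → other G (bool (eqᵇ G ⁅ a ⁆)) (bool (eqᵇ G ⁅ b ⁆)) }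
        where
        F≡ : F ≡ pair a b
        F≡ = ⊑-antisym (λ x p → in-pair x (only x p)) (pair-⊑ Fa Fb)
          where
          in-pair : ∀ x → x ≡ a ⊎ x ≡ b → pair a b ! x ≡ true
          in-pair x (inj₁ ≡.refl) = pair-ˡ x b
          in-pair x (inj₂ ≡.refl) = pair-ʳ a x
        del-a : del a F ≡ ⁅ b ⁆
        del-a = ⊑-antisym (λ x p → let ne , q = del⁻ {x = a} {F} p in out x ne (only x q)) (⁅⁆-⊑ (≡.trans (del-other F (a≢b ∘ ≡.sym)) Fb))
          where
          out : ∀ x → x ≢ a → x ≡ a ⊎ x ≡ b → ⁅ b ⁆ ! x ≡ true
          out x ne (inj₁ e) = ⊥-elim (ne e)
          out x ne (inj₂ ≡.refl) = ⁅⁆-∋ x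
        del-b : del b F ≡ ⁅ a ⁆
        del-b = ⊑-antisym (λ x p → let ne , q = del⁻ {x = b} {F} p in out x ne (only x q)) (⁅⁆-⊑ (≡.trans (del-other F a≢b) Fa))
          where
          out : ∀ x → x ≢ b → x ≡ a ⊎ x ≡ b → ⁅ a ⁆ ! x ≡ true
          out x ne (inj₁ ≡.refl) = ⁅⁆-∋ x
          out x ne (inj₂ e) = ⊥-elim (ne e)
        bd≈ : ∀ G → bd K M F G ≈ bd-term K M F G a + bd-term K M F G b
        bd≈ G = ∑-two (bd-term K M F G) a b a≢b λ z p q → bd-out {K} {M} {F} {G} (≢true⇒false λ r → none p q (only z r))
          where
          none : ∀ {z} → z ≢ a → z ≢ b → z ≡ a ⊎ z ≡ b → Void
          none p q (inj₁ e) = p e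
          none p q (inj₂ e) = q e
        other : ∀ G → eqᵇ G ⁅ a ⁆ ≡ true ⊎ eqᵇ G ⁅ a ⁆ ≡ false → eqᵇ G ⁅ b ⁆ ≡ true ⊎ eqᵇ G ⁅ b ⁆ ≡ false → (∃ λ x → G ≡ ⁅ x ⁆) ⊎ bd K M F G ≈ 0#
        other G (inj₁ e) _ = inj₁ (a , eqᵇ⁻ e)
        other G (inj₂ _) (inj₁ e) = inj₁ (b , eqᵇ⁻ e)
        other G (inj₂ e) (inj₂ f) = inj₂ (trans (bd≈ G) (trans (+-cong
          (bd-miss {K} {M} {F} {G} λ q → t≢f (≡.trans (≡.cong (λ A → eqᵇ A ⁅ b ⁆) (≡.trans q del-a)) eqᵇ⁺) f)
          (bd-miss {K} {M} {F} {G} λ q → t≢f (≡.trans (≡.cong (λ A → eqᵇ A ⁅ a ⁆) (≡.trans q del-b)) eqᵇ⁺) e)) (+-identityˡ 0#)))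
        ⁅⁆-injective : ∀ {x y : Fin n} → ⁅ x ⁆ ≡ ⁅ y ⁆ → x ≡ y
        ⁅⁆-injective {x} e = ⁅⁆⁻ (≡.subst (λ A → A ! x ≡ true) e (⁅⁆-∋ x))
        term-a : ∀ x → bd-term K M F ⁅ x ⁆ a ≈ ind (not (B ! b) ∧ eqF x b)
        term-a x = go (x Finₚ.≟ b)
          where
          go : Dec (x ≡ b) → bd-term K M F ⁅ x ⁆ a ≈ ind (not (B ! b) ∧ eqF x b)
          go (yes ≡.refl) = trans (bd-hit {K} {M} {F} Fa (≡.sym del-a)) (reflexive (≡.cong₂ (λ k r → if r then sgn k else 0#) βa (≡.trans (rel-vertex Fb) (≡.trans (≡.sym (∧-identityʳ _)) (≡.cong (not (B ! x) ∧_) (≡.sym (eqF-refl x)))))))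
          go (no ne) = trans (bd-miss {K} {M} {F} λ q → ne (⁅⁆-injective (≡.trans q del-a))) (reflexive (≡.cong ind (≡.sym (≡.trans (≡.cong (not (B ! b) ∧_) (eqF-≢ ne)) (∧-zeroʳ _)))))
        term-b : ∀ x → bd-term K M F ⁅ x ⁆ b ≈ - ind (not (B ! a) ∧ eqF x a)
        term-b x = go (x Finₚ.≟ a)
          where
          neg-if : ∀ r → (if r then - 1# else 0#) ≈ - ind r
          neg-if true = refl
          neg-if false = sym -0≈0
          go : Dec (x ≡ a) → bd-term K M F ⁅ x ⁆ b ≈ - ind (not (B ! a) ∧ eqF x a)
          go (yes ≡.refl) = trans (bd-hit {K} {M} {F} Fb (≡.sym del-b)) (trans (reflexive (≡.cong₂ (λ k r → if r then sgn k else 0#) βb (≡.trans (rel-vertex Fa) (≡.trans (≡.sym (∧-identityʳ _)) (≡.cong (not (B ! x) ∧_) (≡.sym (eqF-refl x))))))) (neg-if _))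
          go (no ne) = trans (bd-miss {K} {M} {F} λ q → ne (⁅⁆-injective (≡.trans q del-b))) (trans (sym -0≈0) (-‿cong (reflexive (≡.cong ind (≡.sym (≡.trans (≡.cong (not (B ! a) ∧_) (eqF-≢ ne)) (∧-zeroʳ _)))))))
        at : ∀ x → bd-term K M F ⁅ x ⁆ a + bd-term K M F ⁅ x ⁆ b ≈ column (lab B) (a , b) (suc x)
        at x = +-cong (trans (term-a x) (sym (δ-lab {B} {b} {x}))) (trans (term-b x) (-‿cong (sym (δ-lab {B} {a} {x}))))

    subst-zero : ∀ {a b} (e : suc a ≡ suc b) → ≡.subst Fin e zero ≡ zero
    subst-zero ≡.refl = ≡.refl

    subst-suc : ∀ {a b} (e : suc a ≡ suc b) (i : Fin a) → ≡.subst Fin e (suc i) ≡ suc (≡.subst Fin (ℕₚ.suc-injective e) i)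
    subst-suc ≡.refl i = ≡.refl

    module _ {K M : Complex n} {B : Subset n} where

      open Edgeface

      edges-of : ∀ fs → (∀ {F} → F ∈ˡ fs → Edgeface K M B F) → List (Edge {n})
      edges-of [] h = []
      edges-of (F ∷ fs) h = (end₁ (h (hereˡ ≡.refl)) , end₂ (h (hereˡ ≡.refl))) ∷ edges-of fs (h ∘ thereˡ)

      edges-length : ∀ fs (h : ∀ {F} → F ∈ˡ fs → Edgeface K M B F) → length (map (bd K M) fs) ≡ length (edges-of fs h)
      edges-length [] h = ≡.refl
      edges-length (F ∷ fs) h = ≡.cong suc (edges-length fs (h ∘ thereˡ))

      edges-hit : ∀ fs (h : ∀ {F} → F ∈ˡ fs → Edgeface K M B F) (len : length (map (bd K M) fs) ≡ length (edges-of fs h)) i x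
        → L.lookup (map (bd K M) fs) i ⁅ x ⁆ ≈ column (lab B) (L.lookup (edges-of fs h) (≡.subst Fin len i)) (suc x)
      edges-hit (F ∷ fs) h len zero x rewrite subst-zero len = hit-column (h (hereˡ ≡.refl)) x
      edges-hit (F ∷ fs) h len (suc i) x rewrite subst-suc len i = edges-hit fs (h ∘ thereˡ) (ℕₚ.suc-injective len) i x

      edges-miss : ∀ fs (h : ∀ {F} → F ∈ˡ fs → Edgeface K M B F) i G → (∃ λ x → G ≡ ⁅ x ⁆) ⊎ L.lookup (map (bd K M) fs) i G ≈ 0#
      edges-miss (F ∷ fs) h zero G = other-zero (h (hereˡ ≡.refl)) G
      edges-miss (F ∷ fs) h (suc i) G = edges-miss fs (h ∘ thereˡ) i G

      edges-of⁻ : ∀ fs (h : ∀ {F} → F ∈ˡ fs → Edgeface K M B F) {a b} → (a , b) ∈ˡ edges-of fs h → pair a b ∈ˡ fs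
      edges-of⁻ (F ∷ fs) h (hereˡ ≡.refl) = hereˡ (≡.sym (F-pair (h (hereˡ ≡.refl))))
      edges-of⁻ (F ∷ fs) h (thereˡ m) = thereˡ (edges-of⁻ fs (h ∘ thereˡ) m)

      edges-of⁺ : ∀ fs (h : ∀ {F} → F ∈ˡ fs → Edgeface K M B F) {F} → F ∈ˡ fs → ∃ λ a → ∃ λ b → (a , b) ∈ˡ edges-of fs h × F ≡ pair a b
      edges-of⁺ (F ∷ fs) h (hereˡ ≡.refl) = _ , _ , hereˡ ≡.refl , F-pair (h (hereˡ ≡.refl))
      edges-of⁺ (F ∷ fs) h (thereˡ m) with edges-of⁺ fs (h ∘ thereˡ) m
      ... | a , b , m′ , e = a , b , thereˡ m′ , e

    module _ {Γ Λ : Complex n} (cΓ : Closed Γ) (cΛ : Closed Λ) (W : Subset n) where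

      private
        K = restrict Γ W
        M = restrict Λ W
        B = verts Λ
        fs = facesCard K M 2

      -- Edges of Γ that lie in Λ are absent from the relative chain group but present in the
      -- skeleton; both their ends are in the root class, so they add no rank.
      rank₂ : rank∂ K M 2 ≡ rk (skeleton Γ) B W
      rank₂ = ≡.trans (graphic-rank (map (bd K M) fs) (lab B) es (edges-length fs good) ⁅_⁆ (edges-hit fs good (edges-length fs good)) (edges-miss fs good))
          (ℕₚ.≤-antisym (ρ-⊆ (lab B) sub) (ρ-span (lab B) es (edges (skeleton Γ) W) spans))
        where
        good : ∀ {F} → F ∈ˡ fs → Edgeface K M B F
        good {F} m = edgeface {K} {M} {B} {F} (proj₂ (∈-faces⁻ {K = K} {M} m)) vertex
          where
          KF = proj₁ (rel⁻ {K = K} {M} (proj₁ (∈-faces⁻ {K = K} {M} m)))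
          vertex : ∀ {x} → F ! x ≡ true → relᵇ K M ⁅ x ⁆ ≡ not (B ! x)
          vertex {x} Fx = ≡.trans (rel-restrict Γ Λ W ⁅ x ⁆) (≡.cong₂ (λ a b → (a ∧ not (Λ ⁅ x ⁆)) ∧ b) (cΓ (proj₁ (restrict⁻ {K = Γ} KF)) (⁅⁆-⊑ Fx)) (subᵇ⁺ {A = ⁅ x ⁆} {B = W} (⁅⁆-⊑ (proj₂ (restrict⁻ {K = Γ} KF) x Fx)))
              ■ (∧-identityʳ _ ■ ≡.cong not (≡.sym (subset! _ x))))
            where
            infixr 3 _■_
            _■_ : ∀ {a b c : Bool} → a ≡ b → b ≡ c → a ≡ c
            _■_ = ≡.trans
        es = edges-of fs good
        sub : ∀ {e} → e ∈ˡ es → e ∈ˡ edges (skeleton Γ) W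
        sub {a , b} m = let p , s = restrict⁻ {K = Γ} (proj₁ (rel⁻ {K = K} {M} (proj₁ (∈-faces⁻ {K = K} {M} (edges-of⁻ fs good m))))) in
          edges⁺ (s a (pair-ˡ a b)) (s b (pair-ʳ a b)) (≡.trans (skeleton≡ Γ a b) p)
        spans : Spans (lab B) es (edges (skeleton Γ) W)
        spans {x} {y} m with edges⁻ {G = skeleton Γ} m
        ... | Wx , Wy , g = go (x Finₚ.≟ y) (bool (Λ (pair x y)))
          where
          Γxy : Γ (pair x y) ≡ true
          Γxy = ≡.trans (≡.sym (skeleton≡ Γ x y)) g
          go : Dec (x ≡ y) → Λ (pair x y) ≡ true ⊎ Λ (pair x y) ≡ false → mergeAll (lab B) es x ≡ mergeAll (lab B) es y
          go (yes ≡.refl) _ = ≡.refl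
          go (no ne) (inj₁ e) = mergeAll-≽ (lab B) es x y (lab-in {B = B} (verts⁺ {K = Λ} cΛ e (pair-ˡ x y)) (verts⁺ {K = Λ} cΛ e (pair-ʳ x y)))
          go (no ne) (inj₂ e) with edges-of⁺ fs good {pair x y} (∈-faces⁺ {K = K} {M} (rel⁺ {K = K} {M} (restrict⁺ {K = Γ} Γxy (pair-⊑ Wx Wy)) (≢true⇒false λ q → t≢f (proj₁ (restrict⁻ {K = Λ} q)) e)) ∣xy∣)
            where
            ∣xy∣ : ∣ pair x y ∣ ≡ 2
            ∣xy∣ = ≡.trans (≡.cong ∣_∣ (pair≡ins x y)) (≡.trans (∣ins∣ ⁅ y ⁆ x (≢true⇒false λ q → ne (⁅⁆⁻ q))) (≡.cong suc (∣⁅x⁆∣≡1 y)))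
          ... | a , b , m′ , q = ends (pair⁻ (≡.subst (λ A → A ! x ≡ true) q (pair-ˡ x y))) (pair⁻ (≡.subst (λ A → A ! y ≡ true) q (pair-ʳ x y)))
            where
            ends : x ≡ a ⊎ x ≡ b → y ≡ a ⊎ y ≡ b → mergeAll (lab B) es x ≡ mergeAll (lab B) es y
            ends (inj₁ ≡.refl) (inj₁ ≡.refl) = ≡.refl
            ends (inj₁ ≡.refl) (inj₂ ≡.refl) = mergeAll-joins (lab B) es m′
            ends (inj₂ ≡.refl) (inj₁ ≡.refl) = ≡.sym (mergeAll-joins (lab B) es m′)
            ends (inj₂ ≡.refl) (inj₂ ≡.refl) = ≡.refl

    rank-zero : ∀ vs → (∀ i G → L.lookup vs i G ≈ 0#) → proj₁ rkF vs ≡ 0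
    rank-zero vs z with proj₁ rkF vs | proj₂ rkF vs
    ... | zero | _ = ≡.refl
    ... | suc r | (ι , _ , ind) , _ = ⊥-elim (0≉1 (sym (ind (λ _ → 1#) (λ G → ∑-0 {suc r} λ i → trans (*-congˡ {1#} (z (ι i) G)) (zeroʳ 1#)) zero)))

    rank-one : ∀ vs (w : Vect) G₀ → w G₀ ≈ 1# → (∀ i G → L.lookup vs i G ≈ w G) → 0 < length vs → proj₁ rkF vs ≡ 1
    rank-one vs w G₀ w≈1 h pos with proj₁ rkF vs | proj₂ rkF vs
    ... | suc zero | _ = ≡.refl
    ... | zero | _ , no-one = ⊥-elim (no-one (λ _ → i₀ vs pos) (λ { zero zero _ → ≡.refl }) indep)
      where
      i₀ : ∀ (vs : List Vect) → 0 < length vs → Fin (length vs)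
      i₀ (_ ∷ _) _ = zero
      indep : Independent (λ (i : Fin 1) → L.lookup vs (i₀ vs pos))
      indep a e zero = trans (sym (*-identityʳ (a zero))) (trans (*-congˡ {a zero} (sym (trans (h (i₀ vs pos) G₀) w≈1))) (trans (sym (+-identityʳ _)) (e G₀)))
    ... | suc (suc r) | (ι , _ , ind) , _ = ⊥-elim (0≉1 (sym (ind a (λ G → trans (+-cong (trans (*-identityˡ _) (h (ι zero) G)) (trans (+-cong (trans (*-congˡ {a (suc zero)} (h (ι (suc zero)) G)) (minus-one (w G))) (∑-0 {r} λ i → zeroˡ (L.lookup vs (ι (suc (suc i))) G))) (+-identityʳ _))) (-‿inverseʳ (w G))) zero)))
      where
      open import Algebra.Properties.Ring (Field.ring 𝔽) using (-1*x≈-x)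
      minus-one : ∀ x → - 1# * x ≈ - x
      minus-one = -1*x≈-x
      a : Fin (suc (suc r)) → Carrier
      a zero = 1#
      a (suc zero) = - 1#
      a (suc (suc _)) = 0#

    lookup-map : ∀ (K M : Complex n) fs (P : Vect → Set ℓ) → (∀ {F} → F ∈ˡ fs → P (bd K M F)) → ∀ i → P (L.lookup (map (bd K M) fs) i)
    lookup-map K M (F ∷ fs) P h zero = h (hereˡ ≡.refl)
    lookup-map K M (F ∷ fs) P h (suc i) = lookup-map K M fs P (h ∘ thereˡ) i

    module _ (K M : Complex n) where

      rank₀ : rank∂ K M 0 ≡ 0
      rank₀ = rank-zero (map (bd K M) (facesCard K M 0)) λ i G → lookup-map K M (facesCard K M 0) (λ v → v G ≈ 0#) (λ {F} m → ∑-0 {n} λ j → bd-out {K} {M} {F} {G} (∣∣≡0 {A = F} (proj₂ (∈-faces⁻ {K = K} {M} m)) j)) i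

      bd-vertex : ∀ {F} → ∣ F ∣ ≡ 1 → ∀ G → bd K M F G ≈ ind (eqᵇ G ⊥ ∧ relᵇ K M G)
      bd-vertex {F} ∣F∣ G with ordered-one F ∣F∣
      ... | b , Fb , βb , only = trans (∑-point (bd-term K M F G) b λ y ne → bd-out {K} {M} {F} {G} (≢true⇒false λ p → ne (only y p))) (go (bool (eqᵇ G ⊥)))
        where
        del-b : del b F ≡ ⊥
        del-b = ⊑-antisym (λ x p → let ne , q = del⁻ {x = b} {F} p in ⊥-elim (ne (only x q))) ⊥⊑
        go : eqᵇ G ⊥ ≡ true ⊎ eqᵇ G ⊥ ≡ false → bd-term K M F G b ≈ ind (eqᵇ G ⊥ ∧ relᵇ K M G)
        go (inj₁ e) = trans (bd-hit {K} {M} {F} Fb (≡.trans (eqᵇ⁻ e) (≡.sym del-b))) (reflexive (≡.cong₂ (λ k r → if r then sgn k else 0#) βb (≡.sym (≡.cong (_∧ relᵇ K M G) e))))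
        go (inj₂ e) = trans (bd-miss {K} {M} {F} {G} λ q → t≢f (≡.trans (≡.cong (λ A → eqᵇ A ⊥) (≡.trans q del-b)) eqᵇ⁺) e) (reflexive (≡.cong (λ b → ind (b ∧ relᵇ K M G)) (≡.sym e)))

      rank₁-zero : relᵇ K M ⊥ ≡ false → rank∂ K M 1 ≡ 0
      rank₁-zero e = rank-zero (map (bd K M) (facesCard K M 1)) λ i G → lookup-map K M (facesCard K M 1) (λ v → v G ≈ 0#)
        (λ {F} m → trans (bd-vertex {F} (proj₂ (∈-faces⁻ {K = K} {M} m)) G) (reflexive (≡.cong ind (≢true⇒false λ q → t≢f (≡.subst (λ A → relᵇ K M A ≡ true) (eqᵇ⁻ (proj₁ (∧⁻ q))) (proj₂ (∧⁻ {eqᵇ G ⊥} q))) e)))) i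

      rank₁-one : relᵇ K M ⊥ ≡ true → 0 < fCard K M 1 → rank∂ K M 1 ≡ 1
      rank₁-one e pos = rank-one (map (bd K M) (facesCard K M 1)) (λ G → ind (eqᵇ G ⊥ ∧ relᵇ K M G)) ⊥ (reflexive (≡.cong ind (∧⁺ (eqᵇ⁺ {A = ⊥ {n}}) e)))
        (λ i G → lookup-map K M (facesCard K M 1) (λ v → v G ≈ ind (eqᵇ G ⊥ ∧ relᵇ K M G)) (λ {F} m → bd-vertex {F} (proj₂ (∈-faces⁻ {K = K} {M} m)) G) i)
        (≡.subst (0 <_) (≡.sym (length-map (bd K M) (facesCard K M 1))) pos)

      rank-empty : ∀ {j} → fCard K M j ≡ 0 → rank∂ K M j ≡ 0
      rank-empty {j} e = rank-zero (map (bd K M) (facesCard K M j)) λ i → ⊥-elim (no-index (≡.trans (length-map (bd K M) (facesCard K M j)) e) i)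
        where
        no-index : ∀ {m} → m ≡ 0 → Fin m → Void
        no-index ≡.refl ()

    -- A star with its centre in the root class, respectively at a vertex of W, spans all edges inside W.
    star : Subset n → Fin n → List (Edge {n})
    star A x = map (x ,_) (filterᵇ (A !_) (L.allFin n))

    star⁺ : ∀ {A x y} → A ! y ≡ true → (x , y) ∈ˡ star A x
    star⁺ {A} {x} {y} p = ∈-map⁺ (x ,_) (∈-filter⁺ _ (∈-allFin y) (Equivalence.from T-≡ p))

    star-length : ∀ A x → length (star A x) ≡ ∣ A ∣
    star-length A x = ≡.trans (length-map (x ,_) (filterᵇ (A !_) (L.allFin n))) (≡.trans (go id) (≡.sym (card≡Σ A)))
      where
      go : ∀ {m} (f : Fin m → Fin n) → length (filterᵇ (A !_) (L.tabulate f)) ≡ ΣF (λ i → 𝟙 (A ! f i))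
      go {zero} f = ≡.refl
      go {suc m} f with A ! f zero
      ... | true = ≡.cong suc (go (f ∘ suc))
      ... | false = go (f ∘ suc)

    -- Supplies the inequalities that make the truncated subtractions in `bettiCard` genuine: the
    -- star has one edge for each vertex that still has to be joined to the centre.
    rk≤star : ∀ {G : Graph {n}} {B W} A x₀ → (∀ {x} → W ! x ≡ true → (∃ λ y → G x y ≡ true ⊎ G y x ≡ true) → lab B x ≡ lab B x₀ ⊎ A ! x ≡ true) → rk G B W ≤ ∣ A ∣
    rk≤star {G} {B} {W} A x₀ h = ℕₚ.≤-trans (ρ-span (lab B) (star A x₀) (edges G W) spans) (ℕₚ.≤-trans (ρ≤length (lab B) (star A x₀)) (ℕₚ.≤-reflexive (star-length A x₀)))
      where
      to-centre : ∀ {x} → lab B x ≡ lab B x₀ ⊎ A ! x ≡ true → mergeAll (lab B) (star A x₀) x ≡ mergeAll (lab B) (star A x₀) x₀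
      to-centre {x} (inj₁ e) = mergeAll-≽ (lab B) (star A x₀) x x₀ e
      to-centre (inj₂ p) = ≡.sym (mergeAll-joins (lab B) (star A x₀) (star⁺ p))
      spans : Spans (lab B) (star A x₀) (edges G W)
      spans {x} {y} m with edges⁻ {G = G} m
      ... | Wx , Wy , g = ≡.trans (to-centre (h Wx (y , inj₁ g))) (≡.sym (to-centre (h Wy (x , inj₂ g))))

    fCard-0 : ∀ (K M : Complex n) → fCard K M 0 ≡ 𝟙 (relᵇ K M ⊥)
    fCard-0 K M = ≡.trans (count≡ΣS (λ G → relᵇ K M G ∧ (∣ G ∣ ≡ᵇ 0))) (count-empty (relᵇ K M))

    fCard-1 : ∀ (K M : Complex n) → fCard K M 1 ≡ ΣF (λ x → 𝟙 (relᵇ K M ⁅ x ⁆))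
    fCard-1 K M = ≡.trans (count≡ΣS (λ G → relᵇ K M G ∧ (∣ G ∣ ≡ᵇ 1))) (count-vertices (relᵇ K M))

    relVerts : Complex n → Complex n → Subset n
    relVerts Γ Λ = subset (λ x → relᵇ Γ Λ ⁅ x ⁆)

    ∣relVerts∣ : ∀ Γ Λ → fCard Γ Λ 1 ≡ ∣ relVerts Γ Λ ∣
    ∣relVerts∣ Γ Λ = ≡.trans (fCard-1 Γ Λ) (≡.trans (ΣF-cong λ x → ≡.cong 𝟙 (≡.sym (subset! (λ x → relᵇ Γ Λ ⁅ x ⁆) x))) (≡.sym (card≡Σ (relVerts Γ Λ))))

    module _ {Γ Λ : Complex n} (cΓ : Closed Γ) (cΛ : Closed Λ) (W : Subset n) where

      private
        K = restrict Γ W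
        M = restrict Λ W
        U = relVerts Γ Λ
        R : Subset n
        R = subset (λ x → W ! x ∧ U ! x)

      ∣R∣ : ∣ R ∣ ≡ cardIn U W
      ∣R∣ = ≡.trans (card≡Σ R) (ΣF-cong λ x → ≡.cong 𝟙 (subset! (λ x → W ! x ∧ U ! x) x))

      faces-1 : fCard K M 1 ≡ cardIn U W
      faces-1 = ≡.trans (fCard-1 K M) (ΣF-cong λ x → ≡.cong 𝟙 (≡.trans (rel-restrict Γ Λ W ⁅ x ⁆) (⇔⇒≡ (to x) (from x))))
        where
        to : ∀ x → relᵇ Γ Λ ⁅ x ⁆ ∧ subᵇ ⁅ x ⁆ W ≡ true → W ! x ∧ U ! x ≡ true
        to x e = ∧⁺ (subᵇ⁻ (proj₂ (∧⁻ {relᵇ Γ Λ ⁅ x ⁆} e)) x (⁅⁆-∋ x)) (≡.trans (subset! _ x) (proj₁ (∧⁻ e)))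
        from : ∀ x → W ! x ∧ U ! x ≡ true → relᵇ Γ Λ ⁅ x ⁆ ∧ subᵇ ⁅ x ⁆ W ≡ true
        from x e = ∧⁺ (≡.trans (≡.sym (subset! _ x)) (proj₂ (∧⁻ {W ! x} e))) (subᵇ⁺ (⁅⁆-⊑ (proj₁ (∧⁻ e))))

      endpoint : ∀ {x} → W ! x ≡ true → (∃ λ y → skeleton Γ x y ≡ true ⊎ skeleton Γ y x ≡ true) → Γ ⁅ x ⁆ ≡ true
      endpoint {x} Wx (y , inj₁ g) = cΓ (≡.trans (≡.sym (skeleton≡ Γ x y)) g) (⁅⁆-⊑ (pair-ˡ x y))
      endpoint {x} Wx (y , inj₂ g) = cΓ (≡.trans (≡.sym (skeleton≡ Γ y x)) g) (⁅⁆-⊑ (pair-ʳ y x))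

      -- The empty face lies in Λ and is absent from the relative complex, so vertices have zero
      -- boundary and there is no homology in degree -1. Index 1 of `bettiCard` is degree 0.
      betti-relative : ∀ {b₀} → Λ ⁅ b₀ ⁆ ≡ true → bettiCard K M 1 ℕ.+ rk (skeleton Γ) (verts Λ) W ≡ cardIn U W × bettiCard K M 0 ≡ 0
      betti-relative {b₀} Λb₀ = ≡.trans (≡.cong₂ (λ a b → (a ∸ b ∸ rank∂ K M 2) ℕ.+ rk (skeleton Γ) (verts Λ) W) faces-1 (rank₁-zero K M rel⊥))
            (≡.trans (≡.cong (λ r → (cardIn U W ∸ r) ℕ.+ rk (skeleton Γ) (verts Λ) W) (rank₂ {Γ} {Λ} cΓ cΛ W)) (ℕₚ.m∸n+n≡m rk≤))
          , ≡.trans (≡.cong (λ f → f ∸ rank∂ K M 0 ∸ rank∂ K M 1) (≡.trans (fCard-0 K M) (≡.cong 𝟙 rel⊥))) (≡.trans (≡.cong (_∸ rank∂ K M 1) (ℕₚ.0∸n≡0 (rank∂ K M 0))) (ℕₚ.0∸n≡0 (rank∂ K M 1)))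
        where
        rel⊥ : relᵇ K M ⊥ ≡ false
        rel⊥ = ≢true⇒false λ e → t≢f (restrict⁺ {K = Λ} {W} (cΛ Λb₀ ⊥⊑) ⊥⊑) (proj₂ (rel⁻ {K = K} {M} e))
        rk≤ : rk (skeleton Γ) (verts Λ) W ≤ cardIn U W
        rk≤ = ≡.subst (rk (skeleton Γ) (verts Λ) W ≤_) ∣R∣ (rk≤star R b₀ λ {x} Wx h → side x Wx (endpoint Wx h) (bool (Λ ⁅ x ⁆)))
          where
          side : ∀ x → W ! x ≡ true → Γ ⁅ x ⁆ ≡ true → Λ ⁅ x ⁆ ≡ true ⊎ Λ ⁅ x ⁆ ≡ false → lab (verts Λ) x ≡ lab (verts Λ) b₀ ⊎ R ! x ≡ true
          side x Wx Γx (inj₁ e) = inj₁ (lab-in {B = verts Λ} (≡.trans (subset! _ x) e) (≡.trans (subset! _ b₀) Λb₀))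
          side x Wx Γx (inj₂ e) = inj₂ (≡.trans (subset! _ x) (∧⁺ Wx (≡.trans (subset! _ x) (rel⁺ {K = Γ} {Λ} Γx e))))

      -- Vertices map onto the empty face as soon as W contains a vertex of Γ, and the 1 on the left
      -- is that unit of rank. If W contains none, the empty face survives as homology in degree -1
      -- and balances it.
      betti-absolute : Γ ⊥ ≡ true → (∀ G → Λ G ≡ false) → bettiCard K M 1 ℕ.+ (1 ℕ.+ rk (skeleton Γ) (verts Λ) W) ≡ cardIn U W ℕ.+ bettiCard K M 0
      betti-absolute Γ⊥ void = go (findF (R !_))
        where
        rel⊥ : relᵇ K M ⊥ ≡ true
        rel⊥ = rel⁺ {K = K} {M} (restrict⁺ {K = Γ} Γ⊥ ⊥⊑) (≢true⇒false λ q → t≢f (proj₁ (restrict⁻ {K = Λ} q)) (void ⊥))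
        betti-0 : ∀ r → rank∂ K M 1 ≡ r → bettiCard K M 0 ≡ 1 ∸ r
        betti-0 r e = ≡.trans (≡.cong₂ (λ f s → f ∸ s ∸ rank∂ K M 1) (≡.trans (fCard-0 K M) (≡.cong 𝟙 rel⊥)) (rank₀ K M)) (≡.cong (1 ∸_) e)
        betti-1 : ∀ r → rank∂ K M 1 ≡ r → bettiCard K M 1 ≡ cardIn U W ∸ r ∸ rk (skeleton Γ) (verts Λ) W
        betti-1 r e = ≡.trans (≡.cong₂ (λ a b → a ∸ b ∸ rank∂ K M 2) faces-1 e) (≡.cong (cardIn U W ∸ r ∸_) (rank₂ {Γ} {Λ} cΓ cΛ W))
        in-R : ∀ x → W ! x ≡ true → Γ ⁅ x ⁆ ≡ true → R ! x ≡ true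
        in-R x Wx Γx = ≡.trans (subset! _ x) (∧⁺ Wx (≡.trans (subset! _ x) (rel⁺ {K = Γ} {Λ} Γx (void ⁅ x ⁆))))
        go : (∃ λ x → R ! x ≡ true) ⊎ (∀ x → R ! x ≡ false) → bettiCard K M 1 ℕ.+ (1 ℕ.+ rk (skeleton Γ) (verts Λ) W) ≡ cardIn U W ℕ.+ bettiCard K M 0
        go (inj₂ h) = ≡.cong₂ ℕ._+_ (≡.trans (betti-1 0 r₁) (≡.cong₂ (λ c k → c ∸ 0 ∸ k) c≡0 rk≡0)) (≡.cong (1 ℕ.+_) rk≡0) ■ ≡.sym (≡.cong₂ ℕ._+_ c≡0 (betti-0 0 r₁))
          where
          infixr 3 _■_
          _■_ : ∀ {a b c : ℕ} → a ≡ b → b ≡ c → a ≡ c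
          _■_ = ≡.trans
          c≡0 : cardIn U W ≡ 0
          c≡0 = ≡.trans (≡.sym ∣R∣) (≡.trans (card≡Σ R) (ΣF-0 λ x → ≡.cong 𝟙 (h x)))
          r₁ : rank∂ K M 1 ≡ 0
          r₁ = rank-empty K M {1} (≡.trans faces-1 c≡0)
          rk≡0 : rk (skeleton Γ) (verts Λ) W ≡ 0
          rk≡0 = ρ-0 (lab (verts Λ)) (edges (skeleton Γ) W) λ {x} {y} m → let Wx , Wy , g = edges⁻ {G = skeleton Γ} m in t≢f (in-R x Wx (endpoint Wx (y , inj₁ g))) (h x)
        go (inj₁ (x₀ , Rx₀)) = ≡.trans (≡.cong₂ (λ b c → b ℕ.+ suc c) (betti-1 1 r₁) ≡.refl) (≡.trans (arith (cardIn U W) (rk (skeleton Γ) (verts Λ) W) rk<) (≡.trans (≡.sym (ℕₚ.+-identityʳ _)) (≡.cong (cardIn U W ℕ.+_) (≡.sym (betti-0 1 r₁)))))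
          where
          r₁ : rank∂ K M 1 ≡ 1
          r₁ = rank₁-one K M rel⊥ (≡.subst (0 <_) (≡.sym (≡.trans faces-1 (≡.sym ∣R∣))) (∈⇒∣∣>0 {A = R} Rx₀))
          rk< : suc (rk (skeleton Γ) (verts Λ) W) ≤ cardIn U W
          rk< = ≡.subst (suc (rk (skeleton Γ) (verts Λ) W) ≤_) (≡.trans (≡.sym (∣del∣ R x₀ Rx₀)) ∣R∣) (s≤s (rk≤star (del x₀ R) x₀ λ {x} Wx h → side x (in-R x Wx (endpoint Wx h)) (x Finₚ.≟ x₀)))
            where
            side : ∀ x → R ! x ≡ true → Dec (x ≡ x₀) → lab (verts Λ) x ≡ lab (verts Λ) x₀ ⊎ del x₀ R ! x ≡ true
            side x Rx (yes ≡.refl) = inj₁ ≡.refl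
            side x Rx (no ne) = inj₂ (≡.trans (del-other R ne) Rx)
          arith : ∀ c r → suc r ≤ c → (c ∸ 1 ∸ r) ℕ.+ suc r ≡ c
          arith (suc c) r (s≤s le) = ≡.trans (ℕₚ.+-suc (c ∸ r) r) (≡.cong suc (ℕₚ.m∸n+n≡m le))

-- Vertex links of a normal pseudomanifold as minimal chains.

module Links where

  open Subsets
  open UnionFind
  open Expectation
  open Chains
  open RankBound
  open MinimalCycles
  open Separators
  open Decomposition
  open Stacked
  open BettiNumbers
  open import Data.Bool using (Bool; true; false; _∧_; not; _xor_)
  open import Data.Bool.Properties using (xor-same; ∧-zeroʳ; T-≡)
  open import Data.Nat using (ℕ; zero; suc; _+_; _≤_; z≤n; s≤s; _≡ᵇ_; >-nonZero)
  open import Data.Nat.Properties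
  open import Data.Fin using (Fin; zero; suc)
  import Data.Fin.Properties as Finₚ
  open import Data.Product using (∃; _×_; _,_; proj₁; proj₂)
  open import Data.Sum using (_⊎_; inj₁; inj₂)
  open import Data.Empty using (⊥-elim) renaming (⊥ to Void)
  open import Data.Fin.Subset using (Subset; ∣_∣; ⊥; ⁅_⁆)
  open import Relation.Nullary using (yes; no)
  open import Relation.Binary.PropositionalEquality using (_≡_; _≢_; refl; sym; trans; cong; cong₂; subst; subst₂)
  open import Function using (_∘_)
  open import Data.Fin.Subset.Properties using (∣⊥∣≡0; ∣⁅x⁆∣≡1)
  open import Data.List.Relation.Unary.Any.Properties using (any⁺; any⁻)
  open import Data.List.Membership.Propositional using (find; lose)
  open import Function.Bundles using (Equivalence)
  import Data.Fin.Subset as FS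

  parity : ℕ → Bool
  parity zero = false
  parity (suc m) = not (parity m)

  parity-+ : ∀ b m → parity (𝟙 b + m) ≡ b xor parity m
  parity-+ true m = refl
  parity-+ false m = refl

  ⊕F≡parity : ∀ {n} (f : Fin n → Bool) → ⊕F f ≡ parity (ΣF (𝟙 ∘ f))
  ⊕F≡parity {zero} f = refl
  ⊕F≡parity {suc n} f = trans (cong (f zero xor_) (⊕F≡parity (f ∘ suc))) (sym (parity-+ (f zero) _))

  odd≤2 : ∀ m → m ≤ 2 → parity m ≡ true → m ≡ 1
  odd≤2 1 _ _ = refl
  odd≤2 2 _ ()
  odd≤2 (suc (suc (suc m))) (s≤s (s≤s ()))

  module _ {n : ℕ} where

    Bd⁺ : ∀ {K : Complex n} {k R G} → K R ≡ true → suc ∣ R ∣ ≡ k → cofaces K R k ≡ 1 → G ⊑ R → Bd K k G ≡ true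
    Bd⁺ {K} {k} {R} {G} KR refl c s = Equivalence.to T-≡ (any⁺ _ (lose (∈-allSubsets R) (Equivalence.from T-≡
      (∧⁺ KR (∧⁺ (≡ᵇ⁺ {∣ R ∣} refl) (∧⁺ (≡ᵇ⁺ c) (subᵇ⁺ s)))))))

    Bd⁻ : ∀ {K : Complex n} {k G} → 1 ≤ k → Bd K k G ≡ true → ∃ λ R → K R ≡ true × suc ∣ R ∣ ≡ k × cofaces K R k ≡ 1 × G ⊑ R
    Bd⁻ {K} {suc k} {G} _ e with find (any⁻ _ (allSubsets n) (Equivalence.from T-≡ e))
    ... | R , _ , t with ∧⁻ {K R} (Equivalence.to T-≡ t)
    ...   | KR , u with ∧⁻ {∣ R ∣ ≡ᵇ k} u
    ...     | c , w with ∧⁻ {cofaces K R (suc k) ≡ᵇ 1} w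
    ...       | o , s = R , KR , cong suc (≡ᵇ⁻ c) , ≡ᵇ⁻ o , subᵇ⁻ s

    Bd-closed : ∀ {K : Complex n} {k} → 1 ≤ k → Closed (Bd K k)
    Bd-closed {K} 1≤k e h with Bd⁻ {K} 1≤k e
    ... | R , KR , c , o , s = Bd⁺ {K} KR c o λ x p → s x (h x p)

    cofaces≡Σ : ∀ (K : Complex n) R {k} → suc ∣ R ∣ ≡ k → cofaces K R k ≡ ΣF (λ x → 𝟙 (not (R ! x) ∧ K (ins x R)))
    cofaces≡Σ K R refl = trans (count≡ΣS (λ F → K F ∧ (∣ F ∣ ≡ᵇ suc ∣ R ∣) ∧ subᵇ R F)) (count-above R K)

    link⁻ : ∀ {K : Complex n} {A H} → link K A H ≡ true → K (H FS.∪ A) ≡ true × (∀ x → H ! x ≡ true → A ! x ≡ false)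
    link⁻ {K} {A} {H} e with ∧⁻ {K (H FS.∪ A)} e
    ... | p , q = p , λ x Hx → ≢true⇒false λ Ax → t≢f (trans (∩! H A x) (∧⁺ Hx Ax)) (trans (cong (_! x) (eqᵇ⁻ q)) (⊥! x))

    link⁺ : ∀ {K : Complex n} {A H} → K (H FS.∪ A) ≡ true → (∀ x → H ! x ≡ true → A ! x ≡ false) → link K A H ≡ true
    link⁺ {K} {A} {H} p h = ∧⁺ p (trans (cong (λ B → eqᵇ B ⊥) (⊑-antisym (λ x q → let a , b = ∧⁻ {H ! x} (trans (sym (∩! H A x)) q) in t≢f b (h x a)) ⊥⊑)) eqᵇ⁺)

    ∪≡ins : ∀ (H : Subset n) v → H FS.∪ ⁅ v ⁆ ≡ ins v H
    ∪≡ins H v = ⊑-antisym (λ x p → to x (∨⁻ {H ! x} (trans (sym (∪! H ⁅ v ⁆ x)) p))) (ins-lub (λ x p → trans (∪! H ⁅ v ⁆ x) (∨⁺ˡ p)) (trans (∪! H ⁅ v ⁆ v) (∨⁺ʳ {H ! v} (⁅⁆-∋ v))))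
      where
      to : ∀ x → H ! x ≡ true ⊎ ⁅ v ⁆ ! x ≡ true → ins v H ! x ≡ true
      to x (inj₁ p) = ins-⊒ v H x p
      to x (inj₂ p) rewrite ⁅⁆⁻ {x = v} p = ins-this v H

    link≡ : ∀ (K : Complex n) v H → link K ⁅ v ⁆ H ≡ K (ins v H) ∧ not (H ! v)
    link≡ K v H = ⇔⇒≡ (λ e → let p , h = link⁻ {K} e in ∧⁺ (trans (cong K (sym (∪≡ins H v))) p) (not⁺ (≢true⇒false λ q → t≢f (⁅⁆-∋ v) (h v q))))
      (λ e → let p , q = ∧⁻ {K (ins v H)} e in link⁺ {K} (trans (cong K (∪≡ins H v)) p) λ x Hx → ≢true⇒false λ r → t≢f (subst (λ y → H ! y ≡ true) (⁅⁆⁻ r) Hx) (not⁻ q))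

    three-true : ∀ {f : Fin n → Bool} {a b c} → a ≢ b → a ≢ c → b ≢ c → f a ≡ true → f b ≡ true → f c ≡ true → 3 ≤ ΣF (𝟙 ∘ f)
    three-true {f} {a} {b} {c} ab ac bc fa fb fc = begin
      3 ≡⟨ sym (trans (∣ins∣ (pair b c) a (≢true⇒false λ p → no-a (pair⁻ p))) (cong suc (trans (cong ∣_∣ (pair≡ins b c)) (trans (∣ins∣ ⁅ c ⁆ b (≢true⇒false λ p → bc (⁅⁆⁻ p))) (cong suc (∣⁅x⁆∣≡1 c)))))) ⟩
      ∣ ins a (pair b c) ∣ ≤⟨ ∣∣-mono {A = ins a (pair b c)} {B = subset f} (ins-lub (pair-⊑ (trans (subset! f b) fb) (trans (subset! f c) fc)) (trans (subset! f a) fa)) ⟩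
      ∣ subset f ∣ ≡⟨ trans (card≡Σ (subset f)) (ΣF-cong λ x → cong 𝟙 (subset! f x)) ⟩
      ΣF (𝟙 ∘ f) ∎
      where
      open ≤-Reasoning
      no-a : a ≡ b ⊎ a ≡ c → Void
      no-a (inj₁ e) = ab e
      no-a (inj₂ e) = ac e

    stacked-cong : ∀ {e} {K K′ : Complex n} → (∀ G → K G ≡ K′ G) → IsStacked e K → IsStacked e K′
    stacked-cong h (simplexBd K S c eq) = simplexBd _ S c λ G → trans (sym (h G)) (eq G)
    stacked-cong h (connSum K K₁ K₂ F s₁ s₂ c p q com eq) = connSum _ K₁ K₂ F s₁ s₂ c p q com λ G → trans (sym (h G)) (eq G)

    rk-cong : ∀ {G H : Graph {n}} {B} → (∀ x y → G x y ≡ H x y) → 𝔼 (rk G B) ≡ 𝔼 (rk H B)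
    rk-cong {G} {H} {B} h = 𝔼-cong λ W → ≤-antisym (rk-mono H G B W λ {x} {y} e → trans (sym (h x y)) e) (rk-mono G H B W λ {x} {y} e → trans (h x y) e)

  module _ {n : ℕ} {d : ℕ} (3≤d : 3 ≤ d) {Δ : Complex n} (np : NormalPseudomanifold Δ d) where

    private
      1≤d : 1 ≤ d
      1≤d = ≤-trans (s≤s z≤n) 3≤d

    Δ-closed : Closed Δ
    Δ-closed {G} {H} e h = proj₁ np G H (λ p → !⇒∈ (h _ (∈⇒! p))) e

    pure : ∀ {G} → Δ G ≡ true → ∃ λ F → Δ F ≡ true × ∣ F ∣ ≡ suc d × G ⊑ F
    pure {G} e with proj₁ (proj₂ (proj₂ np)) G e
    ... | F , ΔF , c , s = F , ΔF , c , λ x p → ∈⇒! (s (!⇒∈ p))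

    at-most-two : ∀ {R} → Δ R ≡ true → ∣ R ∣ ≡ d → cofaces Δ R (suc d) ≤ 2
    at-most-two {R} = proj₁ (proj₂ (proj₂ (proj₂ np))) R

    connected : ∀ {G} → Δ G ≡ true → 1 ≤ ∣ G ∣ → suc ∣ G ∣ ≤ d → Connected (link Δ G)
    connected {G} e p q = proj₂ (proj₂ (proj₂ (proj₂ np))) G e p (≤-pred (subst (suc ∣ G ∣ ≤_) (sym (suc-pred d {{>-nonZero 1≤d}})) q))

    ∂Δ : Complex n
    ∂Δ = Bd Δ (suc d)

    ∂Δ-closed : Closed ∂Δ
    ∂Δ-closed = Bd-closed {K = Δ} (s≤s z≤n)

    module AtVertex (v : Fin n) (Δv : Δ ⁅ v ⁆ ≡ true) where

      -- `Λ` is the link taken in the boundary complex, as in the definition of μ; `Bd-link`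
      -- identifies it with the boundary of the link, as in the equality condition.
      Γ Λ : Complex n
      Γ = link Δ ⁅ v ⁆
      Λ = link ∂Δ ⁅ v ⁆

      Γ⁺ : ∀ {H} → Δ (ins v H) ≡ true → H ! v ≡ false → Γ H ≡ true
      Γ⁺ {H} p q = trans (link≡ Δ v H) (∧⁺ p (not⁺ q))

      Γ⁻ : ∀ {H} → Γ H ≡ true → Δ (ins v H) ≡ true × H ! v ≡ false
      Γ⁻ {H} e with ∧⁻ {Δ (ins v H)} (trans (sym (link≡ Δ v H)) e)
      ... | p , q = p , not⁻ q

      Λ⁺ : ∀ {H} → ∂Δ (ins v H) ≡ true → H ! v ≡ false → Λ H ≡ true
      Λ⁺ {H} p q = trans (link≡ ∂Δ v H) (∧⁺ p (not⁺ q))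

      Λ⁻ : ∀ {H} → Λ H ≡ true → ∂Δ (ins v H) ≡ true × H ! v ≡ false
      Λ⁻ {H} e with ∧⁻ {∂Δ (ins v H)} (trans (sym (link≡ ∂Δ v H)) e)
      ... | p , q = p , not⁻ q

      ins-mono : ∀ {G H} → G ⊑ H → ins v G ⊑ ins v H
      ins-mono {G} {H} h = ins-lub (λ x p → ins-⊒ v H x (h x p)) (ins-this v H)

      Γ-closed : Closed Γ
      Γ-closed e h with Γ⁻ e
      ... | p , q = Γ⁺ (Δ-closed p (ins-mono h)) (≢true⇒false λ r → t≢f (h v r) q)

      Λ-closed : Closed Λ
      Λ-closed e h with Λ⁻ e
      ... | p , q = Λ⁺ (∂Δ-closed p (ins-mono h)) (≢true⇒false λ r → t≢f (h v r) q)

      Γ⊥ : Γ ⊥ ≡ true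
      Γ⊥ = Γ⁺ (trans (cong Δ (ins-⊥ v)) Δv) (⊥! v)

      Z : Chain {n}
      Z F = Γ F ∧ (∣ F ∣ ≡ᵇ d)

      Z⁺ : ∀ {F} → Γ F ≡ true → ∣ F ∣ ≡ d → Z F ≡ true
      Z⁺ p q = ∧⁺ p (≡ᵇ⁺ q)

      Z⁻ : ∀ {F} → Z F ≡ true → Γ F ≡ true × ∣ F ∣ ≡ d
      Z⁻ {F} e with ∧⁻ {Γ F} e
      ... | p , q = p , ≡ᵇ⁻ q

      Γ-pure : ∀ {H} → Γ H ≡ true → ∃ λ F → Z F ≡ true × H ⊑ F
      Γ-pure {H} e with Γ⁻ e
      ... | p , q with pure p
      ...   | F , ΔF , c , s = del v F , Z⁺ (Γ⁺ (trans (cong Δ (ins-del Fv)) ΔF) (del-this v F)) (suc-injective (trans (sym (∣del∣ F v Fv)) c))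
              , λ x Hx → trans (del-other F (≢⇐! Hx q)) (s x (ins-⊒ v H x Hx))
        where
        Fv = s v (ins-this v H)

      Z-clique : ∀ {F x y} → Z F ≡ true → F ! x ≡ true → F ! y ≡ true → skeleton Γ x y ≡ true
      Z-clique e = skeleton⁺ {K = Γ} Γ-closed (proj₁ (Z⁻ e))

      adj≡ : ∀ x y → adj Z x y ≡ skeleton Γ x y
      adj≡ x y = ⇔⇒≡ (λ e → let F , z , p , q = adj⁻ {Z = Z} e in Z-clique z p q)
        (λ e → let F , z , s = Γ-pure (trans (sym (skeleton≡ Γ x y)) e) in adj⁺ {Z = Z} z (s x (pair-ˡ x y)) (s y (pair-ʳ x y)))

      vert≡ : vert Z ≡ verts Γ
      vert≡ = ⊑-antisym (λ x p → let F , z , q = vert⁻ {Z = Z} p in verts⁺ {K = Γ} Γ-closed (proj₁ (Z⁻ z)) q)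
        (λ x p → let F , z , s = Γ-pure (trans (sym (subset! _ x)) p) in vert⁺ z (s x (⁅⁆-∋ x)))

      ⟨Z⟩≡ : ∀ G → ⟨ Z ⟩ G ≡ Γ G
      ⟨Z⟩≡ G = ⇔⇒≡ (λ e → let F , z , s = ⟨⟩⁻ {Z = Z} e in Γ-closed (proj₁ (Z⁻ z)) s) (λ e → let F , z , s = Γ-pure e in ⟨⟩⁺ {Z = Z} z s)

      coface : Subset n → Fin n → Bool
      coface R x = not (ins v R ! x) ∧ Δ (ins x (ins v R))

      Γ-coface : ∀ {R} → R ! v ≡ false → ∀ x → not (R ! x) ∧ Γ (ins x R) ≡ coface R x
      Γ-coface {R} v∉R x with x Finₚ.≟ v
      ... | yes refl = trans (cong (not (R ! x) ∧_) (≢true⇒false λ e → t≢f (ins-this x R) (proj₂ (Γ⁻ e)))) (trans (∧-zeroʳ (not (R ! x))) (sym (cong (λ b → not b ∧ Δ (ins x (ins x R))) (ins-this x R))))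
      ... | no ne = cong₂ (λ a b → not a ∧ b) (sym (ins-other R ne)) (trans (link≡ Δ v (ins x R)) (trans (cong₂ (λ A b → Δ A ∧ not b) (ins-comm v x R) (trans (ins-other R (ne ∘ sym)) v∉R)) (∧-identityʳ _)))
        where open import Data.Bool.Properties using (∧-identityʳ)

      Z-coface : ∀ {R} → R ! v ≡ false → suc ∣ R ∣ ≡ d → ∀ x → not (R ! x) ∧ Z (ins x R) ≡ coface R x
      Z-coface {R} v∉R c x = trans (lem (bool (R ! x))) (Γ-coface v∉R x)
        where
        open import Data.Bool.Properties using (∧-identityʳ)
        lem : R ! x ≡ true ⊎ R ! x ≡ false → not (R ! x) ∧ Z (ins x R) ≡ not (R ! x) ∧ Γ (ins x R)
        lem (inj₁ e) rewrite e = refl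
        lem (inj₂ e) = cong (not (R ! x) ∧_) (trans (cong (Γ (ins x R) ∧_) (≡ᵇ⁺ (trans (∣ins∣ R x e) c))) (∧-identityʳ _))

      coface-count : ∀ {R} → R ! v ≡ false → suc ∣ R ∣ ≡ d → cofaces Δ (ins v R) (suc d) ≡ ΣF (𝟙 ∘ coface R)
      coface-count {R} v∉R c = cofaces≡Σ Δ (ins v R) (cong suc (trans (∣ins∣ R v v∉R) c))

      ∂Z≡parity : ∀ {R} → R ! v ≡ false → suc ∣ R ∣ ≡ d → ∂ Z R ≡ parity (cofaces Δ (ins v R) (suc d))
      ∂Z≡parity {R} v∉R c = trans (⊕F-cong (Z-coface v∉R c)) (trans (⊕F≡parity (coface R)) (cong parity (sym (coface-count v∉R c))))

      two-cofaces : ∀ {R x} → R ! v ≡ false → suc ∣ R ∣ ≡ d → coface R x ≡ true → cofaces Δ (ins v R) (suc d) ≤ 2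
      two-cofaces {R} {x} v∉R c e = at-most-two (Δ-closed (proj₂ (∧⁻ {not (ins v R ! x)} e)) (ins-⊒ x (ins v R))) (trans (∣ins∣ R v v∉R) c)

      -- The mod-2 boundary records the parity of the number of facets of Δ above `ins v R`. With at
      -- most two of them, odd means one, so mod-2 boundary and pseudomanifold boundary agree.
      ridge⁻ : ∀ {R} → ∂ Z R ≡ true → R ! v ≡ false × suc ∣ R ∣ ≡ d × Δ (ins v R) ≡ true × cofaces Δ (ins v R) (suc d) ≡ 1
      ridge⁻ {R} e with ∂-true Z e
      ... | x , x∉R , z with Z⁻ z
      ...   | γ , c with Γ⁻ γ
      ...     | δ′ , v∉ = v∉R , c′ , Δ-closed δ′ (ins-mono (ins-⊒ x R)) , odd≤2 _ (two-cofaces {x = x} v∉R c′ (trans (sym (Z-coface v∉R c′ x)) (∧⁺ (not⁺ x∉R) z))) (trans (sym (∂Z≡parity v∉R c′)) e)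
        where
        v∉R : R ! v ≡ false
        v∉R = ≢true⇒false λ p → t≢f (ins-⊒ x R v p) v∉
        c′ : suc ∣ R ∣ ≡ d
        c′ = trans (sym (∣ins∣ R x x∉R)) c

      ridge-∂ : ∀ {R} → ∂ Z R ≡ true → ∂Δ (ins v R) ≡ true
      ridge-∂ {R} e with ridge⁻ e
      ... | v∉R , c , ΔR , one = Bd⁺ {K = Δ} ΔR (cong suc (trans (∣ins∣ R v v∉R) c)) one λ _ p → p

      -- A set of facets closed under passing across ridges is empty or everything.
      module Spread (D : Chain {n}) (D⊆Z : ∀ {F} → D F ≡ true → Z F ≡ true) (∂D : ∀ R → ∂ D R ≡ false) where

        -- A cycle that uses one facet at `R` uses a second one there. If that were different from
        -- both facets in question, `R` with `v` would lie in three facets of Δ.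
        cross : ∀ {R a b} → R ! a ≡ false → R ! b ≡ false → D (ins a R) ≡ true → Z (ins b R) ≡ true → D (ins b R) ≡ true
        cross {R} {a} {b} a∉R b∉R Da Zb with a Finₚ.≟ b
        ... | yes refl = Da
        ... | no a≢b with ∂-other D (∂D R) a∉R Da
        ...   | w , w≢a , w∉R , Dw with w Finₚ.≟ b
        ...     | yes refl = Dw
        ...     | no w≢b = ⊥-elim (<⇒≱ (three-true {f = coface R} a≢b (w≢a ∘ sym) (w≢b ∘ sym) (is a∉R (D⊆Z Da)) (is b∉R Zb) (is w∉R (D⊆Z Dw)))
                    (subst (_≤ 2) (coface-count v∉R c) (two-cofaces {x = b} v∉R c (is b∉R Zb))))
          where
          v∉R : R ! v ≡ false
          v∉R = ≢true⇒false λ p → t≢f (ins-⊒ b R v p) (proj₂ (Γ⁻ (proj₁ (Z⁻ Zb))))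
          c : suc ∣ R ∣ ≡ d
          c = trans (sym (∣ins∣ R b b∉R)) (proj₂ (Z⁻ Zb))
          is : ∀ {x} → R ! x ≡ false → Z (ins x R) ≡ true → coface R x ≡ true
          is {x} p q = trans (sym (Z-coface v∉R c x)) (∧⁺ (not⁺ p) q)

        -- Strong connectivity of the facets above a face τ of the link, where k is the number of
        -- vertices by which τ falls short of a facet. The cases k = 0 and k = 1 are direct; from
        -- then on the connected link of τ with v leads from one facet to the next.
        Passes : ℕ → Set
        Passes k = ∀ {τ} → τ ! v ≡ false → ∣ τ ∣ + k ≡ d → ∀ {F F′} → τ ⊑ F → τ ⊑ F′ → D F ≡ true → Z F′ ≡ true → D F′ ≡ true

        -- Each edge xw of the walk lies with τ in some facet. The induction hypothesis at τ with x
        -- reaches that facet, and the walk continues from w.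
        walk : ∀ {k} → Passes k → ∀ {τ} → τ ! v ≡ false → suc ∣ τ ∣ + k ≡ d → ∀ {x y} → Walk (link Δ (ins v τ)) x y → τ ! x ≡ false → ∀ {F F′}
          → ins x τ ⊑ F → ins y τ ⊑ F′ → D F ≡ true → Z F′ ≡ true → D F′ ≡ true

        walk {k} IH {τ} v∉τ c {x} here x∉ s s′ DF ZF′ = IH {ins x τ} (≢true⇒false λ p → t≢f (s v p) (proj₂ (Γ⁻ (proj₁ (Z⁻ (D⊆Z DF)))))) (trans (cong (_+ k) (∣ins∣ τ x x∉)) c) s s′ DF ZF′
        walk {k} IH {τ} v∉τ c {x} (step {u = .x} {w} e rest) x∉ {F} {F′} s s′ DF ZF′ with link⁻ {K = Δ} e
        ... | Δe , apart with Γ-pure {ins x (ins w τ)} (Γ⁺ (Δ-closed Δe sub) v∉)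
          where
          sub : ins v (ins x (ins w τ)) ⊑ pair x w FS.∪ ins v τ
          sub z p with ins⁻ {x = v} {ins x (ins w τ)} p
          ... | inj₁ refl = trans (∪! (pair x w) (ins z τ) z) (∨⁺ʳ {pair x w ! z} (ins-this z τ))
          ... | inj₂ q with ins⁻ {x = x} {ins w τ} q
          ...   | inj₁ refl = trans (∪! (pair z w) (ins v τ) z) (∨⁺ˡ (pair-ˡ z w))
          ...   | inj₂ r with ins⁻ {x = w} {τ} r
          ...     | inj₁ refl = trans (∪! (pair x z) (ins v τ) z) (∨⁺ˡ (pair-ʳ x z))
          ...     | inj₂ t = trans (∪! (pair x w) (ins v τ) z) (∨⁺ʳ {pair x w ! z} (ins-⊒ v τ z t))
          v∉ : ins x (ins w τ) ! v ≡ false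
          v∉ = ≢true⇒false λ p → cases (ins⁻ {x = x} {ins w τ} p)
            where
            hits-v : ∀ {z} → pair x w ! z ≡ true → z ≡ v → Void
            hits-v p refl = t≢f (ins-this v τ) (apart v p)
            cases : v ≡ x ⊎ ins w τ ! v ≡ true → Void
            cases (inj₁ q) = hits-v (pair-ˡ x w) (sym q)
            cases (inj₂ q) with ins⁻ {x = w} {τ} q
            ... | inj₁ r = hits-v (pair-ʳ x w) (sym r)
            ... | inj₂ r = t≢f r v∉τ
        ...   | F″ , ZF″ , h = walk IH v∉τ c rest (≢true⇒false λ p → t≢f (ins-⊒ v τ w p) (apart w (pair-ʳ x w)))
                  (ins-lub (λ z p → h z (ins-⊒ x (ins w τ) z (ins-⊒ w τ z p))) (h w (ins-⊒ x (ins w τ) w (ins-this w τ)))) s′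
                  (IH {ins x τ} (≢true⇒false λ p → t≢f (s v p) (proj₂ (Γ⁻ (proj₁ (Z⁻ (D⊆Z DF)))))) (trans (cong (_+ k) (∣ins∣ τ x x∉)) c) s
                    (ins-lub (λ z p → h z (ins-⊒ x (ins w τ) z (ins-⊒ w τ z p))) (h x (ins-this x (ins w τ)))) DF ZF″) ZF′

        spread₀ : Passes 0
        spread₀ {τ} v∉τ c {F} {F′} s s′ DF ZF′ = subst (λ A → D A ≡ true) (trans (sym (full s (proj₂ (Z⁻ (D⊆Z DF))))) (full s′ (proj₂ (Z⁻ ZF′)))) DF
          where
          full : ∀ {F} → τ ⊑ F → ∣ F ∣ ≡ d → τ ≡ F
          full s e = ⊑∧card⇒≡ s (≤-reflexive (trans e (trans (sym c) (+-identityʳ _))))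

        spread₁ : Passes 1
        spread₁ {τ} v∉τ c {F} {F′} s s′ DF ZF′ with new s (proj₂ (Z⁻ (D⊆Z DF))) | new s′ (proj₂ (Z⁻ ZF′))
          where
          new : ∀ {F} → τ ⊑ F → ∣ F ∣ ≡ d → ∃ λ x → τ ! x ≡ false × ins x τ ≡ F
          new {F} s e with card<⇒∃ τ F (≤-reflexive (trans (sym (+-comm ∣ τ ∣ 1)) (trans c (sym e))))
          ... | x , Fx , x∉τ = x , x∉τ , ⊑∧card⇒≡ (ins-lub s Fx) (≤-reflexive (trans e (trans (sym c) (trans (+-comm ∣ τ ∣ 1) (sym (∣ins∣ τ x x∉τ))))))
        ... | a , a∉ , refl | b , b∉ , refl = cross a∉ b∉ DF ZF′

        spread₂ : ∀ {k} → Passes (suc k) → Passes (suc (suc k))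
        spread₂ {k} IH {τ} v∉τ c {F} {F′} s s′ DF ZF′ with new s (proj₂ (Z⁻ (D⊆Z DF))) | new s′ (proj₂ (Z⁻ ZF′))
          where
          new : ∀ {F} → τ ⊑ F → ∣ F ∣ ≡ d → ∃ λ x → F ! x ≡ true × τ ! x ≡ false
          new {F} s e = card<⇒∃ τ F (≤-trans (s≤s (m≤m+n ∣ τ ∣ (suc k))) (≤-reflexive (trans (sym (+-suc ∣ τ ∣ (suc k))) (trans c (sym e)))))
        -- Since τ falls short of a facet by at least two vertices, τ with v has at most d-1
        -- vertices, within the range where links are assumed connected.
        ... | x , Fx , x∉ | y , F′y , y∉ = walk IH v∉τ (trans (sym (+-suc ∣ τ ∣ (suc k))) c)
            (connected {ins v τ} (Δ-closed (proj₁ (Γ⁻ (proj₁ (Z⁻ ZF′)))) (ins-mono s′)) (subst (1 ≤_) (sym (∣ins∣ τ v v∉τ)) (s≤s z≤n))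
              (subst (_≤ d) (cong suc (sym (∣ins∣ τ v v∉τ))) (subst (suc (suc ∣ τ ∣) ≤_) c (≤-trans (≤-reflexive (+-comm 2 ∣ τ ∣)) (+-monoʳ-≤ ∣ τ ∣ (s≤s (s≤s z≤n)))))) x y
              (in-link (D⊆Z DF) s Fx x∉) (in-link ZF′ s′ F′y y∉)) x∉ (ins-lub s Fx) (ins-lub s′ F′y) DF ZF′
          where
          in-link : ∀ {F x} → Z F ≡ true → τ ⊑ F → F ! x ≡ true → τ ! x ≡ false → link Δ (ins v τ) ⁅ x ⁆ ≡ true
          in-link {F} {x} ZF s Fx x∉ = link⁺ {K = Δ} (Δ-closed (proj₁ (Γ⁻ (proj₁ (Z⁻ ZF)))) sub) λ z p → ≢true⇒false λ q → apart (⁅⁆⁻ p) (ins⁻ q)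
            where
            sub : ⁅ x ⁆ FS.∪ ins v τ ⊑ ins v F
            sub z p with ∨⁻ {⁅ x ⁆ ! z} (trans (sym (∪! ⁅ x ⁆ (ins v τ) z)) p)
            ... | inj₁ q rewrite ⁅⁆⁻ {x = x} q = ins-⊒ v F x Fx
            ... | inj₂ q = ins-mono s z q
            apart : ∀ {z} → z ≡ x → z ≡ v ⊎ τ ! z ≡ true → Void
            apart refl (inj₁ refl) = t≢f Fx (proj₂ (Γ⁻ (proj₁ (Z⁻ ZF))))
            apart refl (inj₂ q) = t≢f q x∉


        spread : ∀ k → Passes k
        spread zero = spread₀
        spread (suc zero) = spread₁
        spread (suc (suc k)) = spread₂ (spread (suc k))

        spread-all : ∀ {F₀} → D F₀ ≡ true → ∀ {F} → Z F ≡ true → D F ≡ true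
        spread-all p q = spread d {⊥} (⊥! v) (cong (_+ d) (∣⊥∣≡0 n)) ⊥⊑ ⊥⊑ p q

      facet : ∃ λ σ → Z σ ≡ true
      facet with Γ-pure Γ⊥
      ... | σ , z , _ = σ , z

      module Boundary (∂v : ∂Δ ⁅ v ⁆ ≡ true) where

        free-ridge : ∃ λ R → ∂ Z R ≡ true
        free-ridge with Bd⁻ {K = Δ} (s≤s z≤n) ∂v
        ... | R , ΔR , c , one , s = del v R , trans (∂Z≡parity (del-this v R) (trans (sym (∣del∣ R v Rv)) (suc-injective c))) (cong parity (trans (cong (λ A → cofaces Δ A (suc d)) (ins-del Rv)) one))
          where
          Rv : R ! v ≡ true
          Rv = s v (⁅⁆-∋ v)

        boundary-vertex : ∃ λ b → Λ ⁅ b ⁆ ≡ true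
        boundary-vertex with free-ridge
        ... | R , e with ridge⁻ e
        ...   | v∉R , c , _ with ∣∣>0 R (≤-pred (subst (2 ≤_) (sym c) (≤-trans (s≤s (s≤s z≤n)) 3≤d)))
        ...     | b , Rb = b , Λ-closed (Λ⁺ (ridge-∂ e) v∉R) (⁅⁆-⊑ Rb)

        link-admissible : Admissible d (skeleton Γ) (verts Λ) Z
        link-admissible .Admissible.size e = proj₂ (Z⁻ e)
        link-admissible .Admissible.clique = Z-clique
        link-admissible .Admissible.boundary e x p = verts⁺ {K = Λ} Λ-closed (Λ⁺ (ridge-∂ e) (proj₁ (ridge⁻ e))) p
        -- If Y misses a facet, the rest of Z is a nonempty cycle and hence all of Z. Then Y is
        -- empty and the boundary of Z vanishes, against `free-ridge`.
        link-admissible .Admissible.minimal Y sub eq {F} ZF with bool (Y F)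
        ... | inj₁ e = e
        ... | inj₂ e = t≢f (proj₂ free-ridge) (trans (sym (eq (proj₁ free-ridge))) (⊕F-0 λ x → trans (cong (not (proj₁ free-ridge ! x) ∧_) (Y-empty (ins x (proj₁ free-ridge)))) (∧-zeroʳ _)))
          where
          D : Chain {n}
          D F = Z F ∧ not (Y F)
          ∂D : ∀ R → ∂ D R ≡ false
          ∂D R = trans (∂-cong {Y = D} {Z = λ F → Z F xor Y F} (λ F → lem F (bool (Y F))) R) (trans (∂-xor Z Y R) (trans (cong (∂ Z R xor_) (eq R)) (xor-same (∂ Z R))))
            where
            lem : ∀ F → Y F ≡ true ⊎ Y F ≡ false → Z F ∧ not (Y F) ≡ Z F xor Y F
            lem F (inj₁ e) rewrite sub e | e = refl
            lem F (inj₂ e) rewrite e with Z F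
            ... | true = refl
            ... | false = refl
          Y-empty : ∀ F′ → Y F′ ≡ false
          Y-empty F′ = ≢true⇒false λ y → t≢f y (not⁻ (proj₂ (∧⁻ {Z F′} (Spread.spread-all D (proj₁ ∘ ∧⁻) ∂D {F} (∧⁺ ZF (not⁺ e)) (sub y)))))

        boundary-bound : RankBound d (skeleton Γ) (verts Λ) ∣ verts Γ ∖ verts Λ ∣
        boundary-bound = subst (λ V → RankBound d (skeleton Γ) (verts Λ) ∣ V ∖ verts Λ ∣) vert≡ (rank-bound 3≤d skeleton-symm link-admissible)
          where
          skeleton-symm : Symm (skeleton Γ)
          skeleton-symm {x} {y} e = trans (sym (adj≡ y x)) (adj-symm {Z = Z} (trans (adj≡ x y) e))

      module Interior (∂v : ∂Δ ⁅ v ⁆ ≡ false) where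

        Λ-void : ∀ G → Λ G ≡ false
        Λ-void G = ≢true⇒false λ e → t≢f (∂Δ-closed (proj₁ (Λ⁻ e)) (⁅⁆-⊑ (ins-this v G))) ∂v

        link-cycle : MinCycle d Z
        link-cycle .MinCycle.size e = proj₂ (Z⁻ e)
        link-cycle .MinCycle.closed R = ≢true⇒false λ e → t≢f (Λ⁺ (ridge-∂ e) (proj₁ (ridge⁻ e))) (Λ-void R)
        link-cycle .MinCycle.irreducible D sub ∂D = Spread.spread-all D sub ∂D

        σ : Subset n
        σ = proj₁ facet

        Zσ : Z σ ≡ true
        Zσ = proj₂ facet

        ∣σ∣ : ∣ σ ∣ ≡ d
        ∣σ∣ = proj₂ (Z⁻ Zσ)

        σ-clique : Clique (skeleton Γ) σ
        σ-clique p q _ = Z-clique Zσ p q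

        σ-adj-clique : Clique (adj Z) σ
        σ-adj-clique p q _ = adj⁺ {Z = Z} Zσ p q

        σ⊑ : σ ⊑ verts Γ
        σ⊑ x p = verts⁺ {K = Γ} Γ-closed (proj₁ (Z⁻ Zσ)) p

        σ-count : ∣ verts Γ ∖ σ ∣ + d ≡ ∣ vert Z ∣
        σ-count = trans (cong (∣ verts Γ ∖ σ ∣ +_) (sym ∣σ∣)) (trans (∣∖∣ σ⊑) (cong ∣_∣ (sym vert≡)))

        interior-bound : RankBound d (skeleton Γ) σ ∣ verts Γ ∖ σ ∣
        interior-bound = subst (Bound (Nof {n} d) (Mof {n}) ∣ verts Γ ∖ σ ∣) (rk-cong {G = adj Z} {skeleton Γ} adj≡)
          (cycle-bound 3≤d (adj-symm {Z = Z}) link-cycle (adj⁺ {Z = Z}) Zσ σ-adj-clique ∣σ∣ σ-count)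

        tight→stacked : RankTight d (skeleton Γ) σ ∣ verts Γ ∖ σ ∣ → ∃ λ e → IsStacked e Γ
        tight→stacked t = d , stacked-cong ⟨Z⟩≡ (tight⇒stacked 3≤d (suc ∣ vert Z ∣) ≤-refl link-cycle Zσ σ-adj-clique ∣σ∣ σ-count
          (subst (Tight (Nof {n} d) (Mof {n}) ∣ verts Γ ∖ σ ∣) (sym (rk-cong {G = adj Z} {skeleton Γ} adj≡)) t))

        -- The dimension parameter e is not given; comparing facet sizes of the stacked sphere with
        -- those of the pure link forces e = d.
        stacked→tight : (∃ λ e → IsStacked e Γ) → RankTight d (skeleton Γ) σ ∣ verts Γ ∖ σ ∣
        stacked→tight (e , st) = from (≤-antisym e≤d d≤e) st
          where
          d≤e : d ≤ e
          d≤e = subst (_≤ e) ∣σ∣ (stacked-size st (proj₁ (Z⁻ Zσ)))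
          e≤d : e ≤ d
          e≤d with another-facet (≤-trans 1≤d d≤e) st ⊥
          ... | G , ΓG , c , _ with Γ-pure ΓG
          ...   | F , z , s = subst₂ _≤_ c (proj₂ (Z⁻ z)) (∣∣-mono s)
          from : ∀ {e} → e ≡ d → IsStacked e Γ → RankTight d (skeleton Γ) σ ∣ verts Γ ∖ σ ∣
          from refl st = let A , cA , nA , sA , t = stacked⇒tight 3≤d st in tight-move {G = skeleton Γ} {V = verts Γ} {A = A} {A′ = σ} cA σ-clique sA σ⊑ nA ∣σ∣ t

      -- The facets of Δ above `ins v R` are the facets of the link above R joined with v, so R lies
      -- in one facet of the link exactly when `ins v R` lies in one facet of Δ.
      Bd-link : ∀ G → Bd Γ d G ≡ Λ G
      Bd-link G = ⇔⇒≡ to from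
        where
        same-count : ∀ {R} → R ! v ≡ false → suc ∣ R ∣ ≡ d → cofaces Γ R d ≡ cofaces Δ (ins v R) (suc d)
        same-count {R} v∉R c = trans (cofaces≡Σ Γ R c) (trans (ΣF-cong λ x → cong 𝟙 (Γ-coface v∉R x)) (sym (coface-count v∉R c)))
        to : Bd Γ d G ≡ true → Λ G ≡ true
        to e with Bd⁻ {K = Γ} 1≤d e
        ... | R , ΓR , c , one , s with Γ⁻ ΓR
        ...   | ΔR , v∉R = Λ-closed (Λ⁺ (Bd⁺ {K = Δ} ΔR (cong suc (trans (∣ins∣ R v v∉R) c)) (trans (sym (same-count v∉R c)) one) (λ _ p → p)) v∉R) s
        from : Λ G ≡ true → Bd Γ d G ≡ true
        from e with Λ⁻ e
        ... | ∂G , v∉G with Bd⁻ {K = Δ} (s≤s z≤n) ∂G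
        ...   | R , ΔR , c , one , s = Bd⁺ {K = Γ} (Γ⁺ (trans (cong Δ (ins-del Rv)) ΔR) (del-this v R)) c′ (trans (same-count (del-this v R) c′) (trans (cong (λ A → cofaces Δ A (suc d)) (ins-del Rv)) one))
                  λ x p → trans (del-other R (≢⇐! p v∉G)) (s x (ins-⊒ v G x p))
          where
          Rv : R ! v ≡ true
          Rv = s v (ins-this v G)
          c′ : suc ∣ del v R ∣ ≡ d
          c′ = trans (sym (∣del∣ R v Rv)) (suc-injective c)

-- Clearing denominators.

module Rationals where

  open Subsets
  open Expectation
  open import Data.Nat as ℕ using (ℕ; zero; suc; _∸_; z≤n; s≤s)
  import Data.Nat.Properties as ℕₚ
  open import Data.Nat.Combinatorics using (_C_; nCk≡n!/k![n-k]!; k![n∸k]!∣n!; nC1≡n; nCk+nC[k+1]≡[n+1]C[k+1]; nCk≡nC[n∸k]; nCn≡1)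
  open import Data.Nat.DivMod using (m/n*n≡m)
  import Data.Nat.Tactic.RingSolver as ℕSolver
  open import Data.Integer as ℤ using (ℤ; +_)
  import Data.Integer.Properties as ℤₚ
  import Data.Integer.Tactic.RingSolver as ℤSolver
  open import Data.Rational as ℚ using (ℚ; ½; _/_; toℚᵘ; _+_; _*_; -_; _-_; _≤_)
  open import Data.Rational.Properties as ℚₚ hiding (_≟_)
  open import Data.Rational.Unnormalised as ℚᵘ using (mkℚᵘ; *≡*; *≤*; _≃_)
  import Data.Rational.Unnormalised.Properties as ℚᵘₚ
  open import Data.Fin using (Fin; zero; suc)
  open import Data.Fin.Subset using (Subset; ∣_∣)
  open import Data.Fin.Subset.Properties using (∣p∣≤n)
  open import Data.Vec using ([]; _∷_)
  open import Data.List as L using ([]; _∷_; _++_; map)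
  open import Data.List.Properties using (map-++; map-∘)
  open import Data.Bool using (true; false)
  open import Relation.Binary.PropositionalEquality using (_≡_; refl; sym; trans; cong; cong₂; subst; subst₂; module ≡-Reasoning)
  open import Function using (_∘_)

  qz : ℤ → ℚ
  qz i = i / 1

  q : ℕ → ℚ
  q a = qz (+ a)

  qz-toℚᵘ : ∀ i → toℚᵘ (qz i) ≃ mkℚᵘ i 0
  qz-toℚᵘ i = toℚᵘ-fromℚᵘ (mkℚᵘ i 0)

  qz-+ : ∀ i j → qz (i ℤ.+ j) ≡ qz i + qz j
  qz-+ i j = toℚᵘ-injective (ℚᵘₚ.≃-trans (qz-toℚᵘ (i ℤ.+ j)) (ℚᵘₚ.≃-sym (ℚᵘₚ.≃-trans (toℚᵘ-homo-+ (qz i) (qz j))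
    (ℚᵘₚ.≃-trans (ℚᵘₚ.+-cong (qz-toℚᵘ i) (qz-toℚᵘ j)) (*≡* (lem i j))))))
    where
    lem : ∀ i j → (i ℤ.* + 1 ℤ.+ j ℤ.* + 1) ℤ.* + 1 ≡ (i ℤ.+ j) ℤ.* + 1
    lem = ℤSolver.solve-∀

  qz-* : ∀ i j → qz (i ℤ.* j) ≡ qz i * qz j
  qz-* i j = toℚᵘ-injective (ℚᵘₚ.≃-trans (qz-toℚᵘ (i ℤ.* j)) (ℚᵘₚ.≃-sym (ℚᵘₚ.≃-trans (toℚᵘ-homo-* (qz i) (qz j))
    (ℚᵘₚ.≃-trans (ℚᵘₚ.*-cong (qz-toℚᵘ i) (qz-toℚᵘ j)) (*≡* refl)))))

  q-+ : ∀ a b → q (a ℕ.+ b) ≡ q a + q b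
  q-+ a b = qz-+ (+ a) (+ b)

  q-* : ∀ a b → q (a ℕ.* b) ≡ q a * q b
  q-* a b = trans (cong qz (ℤₚ.pos-* a b)) (qz-* (+ a) (+ b))

  q-mono : ∀ {a b} → a ℕ.≤ b → q a ≤ q b
  q-mono {a} {b} h = toℚᵘ-cancel-≤ (ℚᵘₚ.≤-trans (ℚᵘₚ.≤-reflexive (qz-toℚᵘ (+ a))) (ℚᵘₚ.≤-trans (*≤* (ℤₚ.*-monoʳ-≤-nonNeg (+ 1) (ℤ.+≤+ h))) (ℚᵘₚ.≤-reflexive (ℚᵘₚ.≃-sym (qz-toℚᵘ (+ b))))))

  q-injective : ∀ {a b} → q a ≡ q b → a ≡ b
  q-injective {a} {b} e with ℚᵘₚ.≃-trans (ℚᵘₚ.≃-sym (qz-toℚᵘ (+ a))) (ℚᵘₚ.≃-trans (toℚᵘ-cong e) (qz-toℚᵘ (+ b)))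
  ... | *≡* eq = ℤₚ.+-injective (trans (sym (ℤₚ.*-identityʳ (+ a))) (trans eq (ℤₚ.*-identityʳ (+ b))))

  q-pos : ∀ {a} → 0 ℕ.< a → ℚ.Positive (q a)
  q-pos {suc a} _ = ℚₚ.normalize-pos (suc a) 1

  q-divℕ : ∀ b c → 0 ℕ.< c → q c * divℕ b c ≡ q b
  q-divℕ b (suc c) _ = toℚᵘ-injective (ℚᵘₚ.≃-trans (toℚᵘ-homo-* (q (suc c)) (divℕ b (suc c)))
    (ℚᵘₚ.≃-trans (ℚᵘₚ.*-cong (qz-toℚᵘ (+ suc c)) (toℚᵘ-fromℚᵘ (mkℚᵘ (+ b) c))) (ℚᵘₚ.≃-trans (*≡* (lem (+ suc c) (+ b))) (ℚᵘₚ.≃-sym (qz-toℚᵘ (+ b))))))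
    where
    lem : ∀ c b → (c ℤ.* b) ℤ.* + 1 ≡ b ℤ.* (+ 1 ℤ.* c)
    lem = ℤSolver.solve-∀

  ½-q : ∀ a → q 2 * (½ * q a) ≡ q a
  ½-q a = trans (sym (ℚₚ.*-assoc (q 2) ½ (q a))) (ℚₚ.*-identityˡ (q a))

  sumℚ-++ : ∀ xs ys → sumℚ (xs ++ ys) ≡ sumℚ xs + sumℚ ys
  sumℚ-++ [] ys = sym (ℚₚ.+-identityˡ (sumℚ ys))
  sumℚ-++ (x ∷ xs) ys = trans (cong (λ y → x + y) (sumℚ-++ xs ys)) (sym (ℚₚ.+-assoc x (sumℚ xs) (sumℚ ys)))

  scaled-sum-subsets : ∀ {n} (p : ℚ) (f : Subset n → ℚ) (g : Subset n → ℕ) → (∀ W → p * f W ≡ q (g W)) → p * sumℚ (map f (allSubsets n)) ≡ q (ΣS g)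
  scaled-sum-subsets {zero} p f g h = trans (cong (p *_) (ℚₚ.+-identityʳ (f []))) (h [])
  scaled-sum-subsets {suc n} p f g h = begin
    p * sumℚ (map f (map (false ∷_) (allSubsets n) ++ map (true ∷_) (allSubsets n)))
      ≡⟨ cong (λ l → p * sumℚ l) (trans (map-++ f (map (false ∷_) (allSubsets n)) _) (sym (cong₂ _++_ (map-∘ (allSubsets n)) (map-∘ (allSubsets n))))) ⟩
    p * sumℚ (map (f ∘ (false ∷_)) (allSubsets n) ++ map (f ∘ (true ∷_)) (allSubsets n))
      ≡⟨ cong (p *_) (sumℚ-++ (map (f ∘ (false ∷_)) (allSubsets n)) _) ⟩
    p * (sumℚ (map (f ∘ (false ∷_)) (allSubsets n)) + sumℚ (map (f ∘ (true ∷_)) (allSubsets n)))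
      ≡⟨ ℚₚ.*-distribˡ-+ p _ _ ⟩
    p * sumℚ (map (f ∘ (false ∷_)) (allSubsets n)) + p * sumℚ (map (f ∘ (true ∷_)) (allSubsets n))
      ≡⟨ cong₂ _+_ (scaled-sum-subsets p (f ∘ (false ∷_)) (g ∘ (false ∷_)) (h ∘ (false ∷_))) (scaled-sum-subsets p (f ∘ (true ∷_)) (g ∘ (true ∷_)) (h ∘ (true ∷_))) ⟩
    q (ΣS (g ∘ (false ∷_))) + q (ΣS (g ∘ (true ∷_))) ≡⟨ sym (q-+ (ΣS (g ∘ (false ∷_))) _) ⟩
    q (ΣS (g ∘ (false ∷_)) ℕ.+ ΣS (g ∘ (true ∷_))) ∎
    where open ≡-Reasoning

  scaled-sum-fin : ∀ {m n} (p : ℚ) (ι : Fin m → Fin n) (f : Fin n → ℚ) (g : Fin n → ℕ) → (∀ v → p * f v ≡ q (g v)) → p * sumℚ (map f (L.tabulate ι)) ≡ q (ΣF (g ∘ ι))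
  scaled-sum-fin {zero} p ι f g h = ℚₚ.*-zeroʳ p
  scaled-sum-fin {suc m} p ι f g h = trans (ℚₚ.*-distribˡ-+ p (f (ι zero)) _)
    (trans (cong₂ _+_ (h (ι zero)) (scaled-sum-fin p (ι ∘ suc) f g h)) (sym (q-+ (g (ι zero)) _)))

  opaque
    unfolding fac

    binomial-weight : ∀ {n k} → k ℕ.≤ n → (n C k) ℕ.* wt n k ≡ fac n
    binomial-weight {n} {k} k≤n = trans (cong (ℕ._* wt n k) (nCk≡n!/k![n-k]! k≤n)) (m/n*n≡m {{k !* (n ∸ k) !≢0}} (k![n∸k]!∣n! k≤n))
      where
      open import Data.Nat.Properties using (_!*_!≢0)

  binomial>0 : ∀ {n k} → k ℕ.≤ n → 0 ℕ.< n C k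
  binomial>0 {n} {k} k≤n with n C k | binomial-weight k≤n
  ... | zero | e = subst (0 ℕ.<_) (sym e) (fac>0 n)
  ... | suc _ | _ = s≤s z≤n

  -- The factor (n+1)! cancels the outer 1/(n+1) and turns each reciprocal binomial coefficient into
  -- the integer weight `wt`, so that σ̃ becomes the average `𝔼`.
  scaled-mean : ∀ {n} (b : Subset n → ℕ) → q (fac (suc n)) * (divℕ 1 (suc n) * sumℚ (map (λ W → divℕ (b W) (n C ∣ W ∣)) (allSubsets n))) ≡ q (𝔼 b)
  scaled-mean {n} b = begin
    q (fac (suc n)) * (divℕ 1 (suc n) * S) ≡⟨ cong (_* (divℕ 1 (suc n) * S)) (trans (cong q (trans (fac-suc n) (ℕₚ.*-comm (suc n) (fac n)))) (q-* (fac n) (suc n))) ⟩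
    q (fac n) * q (suc n) * (divℕ 1 (suc n) * S) ≡⟨ ℚₚ.*-assoc (q (fac n)) (q (suc n)) _ ⟩
    q (fac n) * (q (suc n) * (divℕ 1 (suc n) * S)) ≡⟨ cong (q (fac n) *_) (trans (sym (ℚₚ.*-assoc (q (suc n)) (divℕ 1 (suc n)) S)) (trans (cong (_* S) (q-divℕ 1 (suc n) (s≤s z≤n))) (ℚₚ.*-identityˡ S))) ⟩
    q (fac n) * S ≡⟨ scaled-sum-subsets (q (fac n)) (λ W → divℕ (b W) (n C ∣ W ∣)) (λ W → wt n ∣ W ∣ ℕ.* b W) term ⟩
    q (𝔼 b) ∎
    where
    open ≡-Reasoning
    S = sumℚ (map (λ W → divℕ (b W) (n C ∣ W ∣)) (allSubsets n))
    term : ∀ W → q (fac n) * divℕ (b W) (n C ∣ W ∣) ≡ q (wt n ∣ W ∣ ℕ.* b W)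
    term W = begin
      q (fac n) * divℕ (b W) c ≡⟨ cong (λ m → q m * divℕ (b W) c) (trans (sym (binomial-weight (∣p∣≤n W))) (ℕₚ.*-comm c (wt n ∣ W ∣))) ⟩
      q (wt n ∣ W ∣ ℕ.* c) * divℕ (b W) c ≡⟨ cong (_* divℕ (b W) c) (q-* (wt n ∣ W ∣) c) ⟩
      q (wt n ∣ W ∣) * q c * divℕ (b W) c ≡⟨ ℚₚ.*-assoc (q (wt n ∣ W ∣)) (q c) _ ⟩
      q (wt n ∣ W ∣) * (q c * divℕ (b W) c) ≡⟨ cong (q (wt n ∣ W ∣) *_) (q-divℕ (b W) c (binomial>0 (∣p∣≤n W))) ⟩
      q (wt n ∣ W ∣) * q (b W) ≡⟨ sym (q-* (wt n ∣ W ∣) (b W)) ⟩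
      q (wt n ∣ W ∣ ℕ.* b W) ∎
      where c = n C ∣ W ∣

  *-cancel-pos : ∀ {p} a b → ℚ.Positive p → p * a ≡ p * b → a ≡ b
  *-cancel-pos {p} a b pos e = ℚₚ.≤-antisym (ℚₚ.*-cancelˡ-≤-pos p {{pos}} (ℚₚ.≤-reflexive e)) (ℚₚ.*-cancelˡ-≤-pos p {{pos}} (ℚₚ.≤-reflexive (sym e)))

  +-cancel : ∀ a b c → a + c ≡ b + c → a ≡ b
  +-cancel a b c e = trans (sym (back a)) (trans (cong (λ x → x + - c) e) (back b))
    where
    back : ∀ a → (a + c) + - c ≡ a
    back a = trans (ℚₚ.+-assoc a c (- c)) (trans (cong (λ x → a + x) (ℚₚ.+-inverseʳ c)) (ℚₚ.+-identityʳ a))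

  +-cancel-≤ : ∀ a b c → a + c ≤ b + c → a ≤ b
  +-cancel-≤ a b c h = subst₂ _≤_ (back a) (back b) (ℚₚ.+-monoˡ-≤ (- c) h)
    where
    back : ∀ a → (a + c) + - c ≡ a
    back a = trans (ℚₚ.+-assoc a c (- c)) (trans (cong (λ x → a + x) (ℚₚ.+-inverseʳ c)) (ℚₚ.+-identityʳ a))

  -- Comparison of a = (X - Y) / p with b = (P - R) / p without subtractions.
  module Compare {p a b : ℚ} {X Y P R : ℕ} (pos : ℚ.Positive p) (ea : p * a + q Y ≡ q X) (eb : p * b + q R ≡ q P) where

    private
      c = q Y + q R
      left : p * a + c ≡ q (X ℕ.+ R)
      left = trans (sym (ℚₚ.+-assoc (p * a) (q Y) (q R))) (trans (cong (λ x → x + q R) ea) (sym (q-+ X R)))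
      right : p * b + c ≡ q (P ℕ.+ Y)
      right = trans (cong (λ x → p * b + x) (ℚₚ.+-comm (q Y) (q R))) (trans (sym (ℚₚ.+-assoc (p * b) (q R) (q Y))) (trans (cong (λ x → x + q Y) eb) (sym (q-+ P Y))))

    compare-≤ : X ℕ.+ R ℕ.≤ P ℕ.+ Y → a ≤ b
    compare-≤ h = ℚₚ.*-cancelˡ-≤-pos p {{pos}} (+-cancel-≤ (p * a) (p * b) c (subst₂ _≤_ (sym left) (sym right) (q-mono h)))

    compare-≡⁺ : X ℕ.+ R ≡ P ℕ.+ Y → b ≡ a
    compare-≡⁺ h = *-cancel-pos {p} b a pos (+-cancel (p * b) (p * a) c (trans right (trans (cong q (sym h)) (sym left))))

    compare-≡⁻ : b ≡ a → X ℕ.+ R ≡ P ℕ.+ Y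
    compare-≡⁻ h = q-injective (trans (sym left) (trans (cong (λ x → p * x + c) (sym h)) right))

  -- The passage from global equality to equality at every vertex, given the local inequalities.
  ΣF-≡⁻ : ∀ {n} {f g : Fin n → ℕ} → (∀ x → f x ℕ.≤ g x) → ΣF f ≡ ΣF g → ∀ x → f x ≡ g x
  ΣF-≡⁻ {suc n} {f} {g} h e = λ { zero → head-eq ; (suc x) → ΣF-≡⁻ (h ∘ suc) (ℕₚ.+-cancelˡ-≡ (f zero) (ΣF (f ∘ suc)) (ΣF (g ∘ suc)) (trans e (cong (ℕ._+ ΣF (g ∘ suc)) (sym head-eq)))) x }
    where
    head-eq : f zero ≡ g zero
    head-eq = ℕₚ.≤-antisym (h zero) (ℕₚ.+-cancelʳ-≤ (ΣF (g ∘ suc)) (g zero) (f zero) (ℕₚ.≤-trans (ℕₚ.≤-reflexive (sym e)) (ℕₚ.+-monoʳ-≤ (f zero) (ΣF-mono (h ∘ suc)))))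

  -- Doubling avoids the division hidden in the binomial coefficient; at m = d+1 it identifies N
  -- with twice the constant of the theorem.
  two-choose : ∀ m → 2 ℕ.* (suc m C 2) ≡ suc m ℕ.* m
  two-choose zero = refl
  two-choose (suc m) = begin
    2 ℕ.* (suc (suc m) C 2) ≡⟨ cong (2 ℕ.*_) (sym (nCk+nC[k+1]≡[n+1]C[k+1] (suc m) 1)) ⟩
    2 ℕ.* (suc m C 1 ℕ.+ suc m C 2) ≡⟨ cong (λ c → 2 ℕ.* (c ℕ.+ suc m C 2)) (nC1≡n (suc m)) ⟩
    2 ℕ.* (suc m ℕ.+ suc m C 2) ≡⟨ ℕₚ.*-distribˡ-+ 2 (suc m) (suc m C 2) ⟩
    2 ℕ.* suc m ℕ.+ 2 ℕ.* (suc m C 2) ≡⟨ cong (2 ℕ.* suc m ℕ.+_) (two-choose m) ⟩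
    2 ℕ.* suc m ℕ.+ suc m ℕ.* m ≡⟨ rearr m ⟩
    suc (suc m) ℕ.* suc m ∎
    where
    open ≡-Reasoning
    rearr : ∀ m → 2 ℕ.* (1 ℕ.+ m) ℕ.+ (1 ℕ.+ m) ℕ.* m ≡ (2 ℕ.+ m) ℕ.* (1 ℕ.+ m)
    rearr = ℕSolver.solve-∀

  -- With f₋₁ = 0 one has h₁ = f₀ and h₂ = f₁ - d f₀, so g₂ = f₁ - (d+1) f₀; the negative term is
  -- moved to the left.
  g₂-formula : ∀ {n} (Δ Γ : Complex n) d → 1 ℕ.≤ d → fCard Δ Γ 0 ≡ 0 → gNum Δ Γ (suc d) 2 ℤ.+ + suc d ℤ.* + fCard Δ Γ 1 ≡ + fCard Δ Γ 2
  g₂-formula Δ Γ (suc m) _ e rewrite e | nCn≡1 m | nCn≡1 (suc m) | sym (nCk≡nC[n∸k] {1} {suc m} (s≤s z≤n)) | nC1≡n (suc m) = lem (+ (suc (suc m) C m)) (+ (suc (suc m) C (suc m))) (+ suc m) (+ fCard Δ Γ 1) (+ fCard Δ Γ 2)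
    where
    lem : ∀ a b d x y → (+ 1 ℤ.* a ℤ.* + 0 ℤ.+ (ℤ.- (+ 1) ℤ.* d ℤ.* x ℤ.+ (+ 1 ℤ.* + 1 ℤ.* y ℤ.+ + 0))) ℤ.- (ℤ.- (+ 1) ℤ.* b ℤ.* + 0 ℤ.+ (+ 1 ℤ.* + 1 ℤ.* x ℤ.+ + 0)) ℤ.+ (+ 1 ℤ.+ d) ℤ.* x ≡ y
    lem = ℤSolver.solve-∀

-- The inequality at a single vertex.

module LocalInequality where

  open Subsets
  open UnionFind
  open Expectation
  open Chains
  open RankBound
  open MinimalCycles
  open Separators
  open Stacked
  open BettiNumbers
  open Links
  open Rationals
  open import Data.Bool using (true; false; _∧_; not)
  open import Data.Bool.Properties using (∧-comm; ∧-assoc)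
  open import Data.Nat as ℕ using (ℕ; zero; suc; s≤s; z≤n; pred; _≡ᵇ_)
  import Data.Nat.Properties as ℕₚ
  open import Data.Nat.Combinatorics using (_C_)
  import Data.Nat.Tactic.RingSolver as ℕSolver
  open import Data.Fin using (Fin; zero; suc)
  open import Data.Fin.Subset using (Subset; ⁅_⁆; ∣_∣; ⊥)
  open import Data.Fin.Subset.Properties using (∣⁅x⁆∣≡1)
  open import Data.Integer as ℤ using (+_)
  open import Data.Rational as ℚ using (ℚ; ½)
  import Data.Rational.Properties as ℚₚ
  open import Data.Rational.Solver using (module +-*-Solver)
  import Data.List as L
  open import Data.Product using (∃; _×_; _,_; proj₁; proj₂)
  open import Data.Sum using (_⊎_; inj₁; inj₂)
  open import Relation.Binary.PropositionalEquality using (_≡_; refl; sym; trans; cong; cong₂; subst; module ≡-Reasoning)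
  open import Function using (_∘_)
  open import Function.Bundles using (_⇔_; mk⇔)

  open Bound
  open Tight

  -- E = c - r with c = uM/2 and r at least uM(1/2 - 1/N), so E is at most uM/N. Here u is the
  -- number of relative vertices of the link, E its scaled σ̃₀ and r the scaled expected rank.
  module BoundaryArith {N M u E r c : ℕ} (eq : E ℕ.+ r ≡ c) (card : 2 ℕ.* c ≡ u ℕ.* M) (b : Bound N M u r) where

    boundary-arith : N ℕ.* E ℕ.≤ u ℕ.* M
    boundary-arith = ℕₚ.*-cancelˡ-≤ 2 (ℕₚ.+-cancelʳ-≤ (2 ℕ.* N ℕ.* r) _ _ (begin
      2 ℕ.* (N ℕ.* E) ℕ.+ 2 ℕ.* N ℕ.* r ≡⟨ lem N E r ⟩
      N ℕ.* (2 ℕ.* (E ℕ.+ r)) ≡⟨ cong (N ℕ.*_) (trans (cong (2 ℕ.*_) eq) card) ⟩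
      N ℕ.* (u ℕ.* M) ≤⟨ lower b ⟩
      2 ℕ.* N ℕ.* r ℕ.+ 2 ℕ.* (u ℕ.* M) ≡⟨ ℕₚ.+-comm (2 ℕ.* N ℕ.* r) _ ⟩
      2 ℕ.* (u ℕ.* M) ℕ.+ 2 ℕ.* N ℕ.* r ∎))
      where
      open ℕₚ.≤-Reasoning
      lem : ∀ N E r → 2 ℕ.* (N ℕ.* E) ℕ.+ 2 ℕ.* N ℕ.* r ≡ N ℕ.* (2 ℕ.* (E ℕ.+ r))
      lem = ℕSolver.solve-∀

  private
    int₁ : ∀ d M E rσ pr → (2 ℕ.* ((1 ℕ.+ d) ℕ.* (2 ℕ.+ d) ℕ.* E) ℕ.+ 2 ℕ.* ((1 ℕ.+ d) ℕ.* (2 ℕ.+ d)) ℕ.* rσ) ℕ.+ 2 ℕ.* ((1 ℕ.+ d) ℕ.* (2 ℕ.+ d)) ℕ.* (pr ℕ.+ M)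
      ≡ (1 ℕ.+ d) ℕ.* (2 ℕ.+ d) ℕ.* (2 ℕ.* (E ℕ.+ (M ℕ.+ (rσ ℕ.+ pr))))
    int₁ = ℕSolver.solve-∀
    int₂ : ∀ d c j → 2 ℕ.* ((1 ℕ.+ d) ℕ.* (2 ℕ.+ d)) ℕ.* (c ℕ.+ j) ≡ (1 ℕ.+ d) ℕ.* (2 ℕ.+ d) ℕ.* (2 ℕ.* c) ℕ.+ 2 ℕ.* (2 ℕ.+ d) ℕ.* ((1 ℕ.+ d) ℕ.* j)
    int₂ = ℕSolver.solve-∀
    int₃ : ∀ N c e → N ℕ.* (2 ℕ.* (c ℕ.+ e)) ≡ N ℕ.* (2 ℕ.* c) ℕ.+ 2 ℕ.* (N ℕ.* e)
    int₃ = ℕSolver.solve-∀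
    int₄ : ∀ N k d M e → N ℕ.* ((k ℕ.+ d) ℕ.* M) ℕ.+ e ≡ (N ℕ.* (k ℕ.* M) ℕ.+ e) ℕ.+ N ℕ.* (d ℕ.* M)
    int₄ = ℕSolver.solve-∀
    int₅ : ∀ x y z w → x ℕ.+ y ℕ.+ (z ℕ.+ w) ≡ ((x ℕ.+ w) ℕ.+ y) ℕ.+ z
    int₅ = ℕSolver.solve-∀
    int₆ : ∀ d M E → 2 ℕ.* (E ℕ.+ (2 ℕ.+ (2 ℕ.* d)) ℕ.* M) ≡ (2 ℕ.* E ℕ.+ 2 ℕ.* (2 ℕ.+ d) ℕ.* M) ℕ.+ 2 ℕ.* (d ℕ.* M)
    int₆ = ℕSolver.solve-∀
    int₇ : ∀ k d M e → 2 ℕ.* ((k ℕ.+ d) ℕ.* M ℕ.+ e) ≡ (2 ℕ.* (k ℕ.* M) ℕ.+ 2 ℕ.* e) ℕ.+ 2 ℕ.* (d ℕ.* M)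
    int₇ = ℕSolver.solve-∀

  -- E and E₀ are the scaled σ̃₀ and σ̃₋₁ of the link, which has k+d vertices; rσ and r⊥ are the
  -- ranks with a facet σ identified and with nothing identified, and pr is the difference made by
  -- the clique σ. The remaining letters are averages of sizes and of the event that W misses σ.
  module InteriorArith {d M E E₀ k rσ pr r⊥ cU cσ dj : ℕ}
    (eq : E ℕ.+ (M ℕ.+ r⊥) ≡ cU ℕ.+ E₀) (cardU : 2 ℕ.* cU ≡ (k ℕ.+ d) ℕ.* M) (split : rσ ℕ.+ pr ≡ r⊥) (pr≡ : pr ℕ.+ M ≡ cσ ℕ.+ dj)
    (cardσ : 2 ℕ.* cσ ≡ d ℕ.* M) (avoid : suc d ℕ.* dj ≡ M) (b : Bound (suc d ℕ.* suc (suc d)) M k rσ) where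

    private
      N = suc d ℕ.* suc (suc d)
      A A₀ B C D : ℕ
      A = 2 ℕ.* (N ℕ.* E)
      A₀ = 2 ℕ.* (N ℕ.* E₀)
      B = 2 ℕ.* N ℕ.* rσ
      C = 2 ℕ.* (2 ℕ.+ d) ℕ.* M
      D = N ℕ.* (k ℕ.* M)

      -- Eliminating all but E, E₀ and rσ gives the exact identity N(E - E₀) = NkM/2 - (d+2)M - N
      -- rσ, here doubled and without subtraction. Bound and tightness of rσ then translate
      -- directly.
      key : (A ℕ.+ C) ℕ.+ B ≡ D ℕ.+ A₀
      key = ℕₚ.+-cancelʳ-≡ (N ℕ.* (d ℕ.* M)) ((A ℕ.+ C) ℕ.+ B) (D ℕ.+ A₀) (begin
        ((A ℕ.+ C) ℕ.+ B) ℕ.+ N ℕ.* (d ℕ.* M) ≡⟨ sym (int₅ A B (N ℕ.* (d ℕ.* M)) C) ⟩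
        A ℕ.+ B ℕ.+ (N ℕ.* (d ℕ.* M) ℕ.+ C) ≡⟨ cong (A ℕ.+ B ℕ.+_) (sym (trans (int₂ d cσ dj) (cong₂ (λ x y → N ℕ.* x ℕ.+ 2 ℕ.* (2 ℕ.+ d) ℕ.* y) cardσ avoid))) ⟩
        A ℕ.+ B ℕ.+ 2 ℕ.* N ℕ.* (cσ ℕ.+ dj) ≡⟨ cong (λ x → A ℕ.+ B ℕ.+ 2 ℕ.* N ℕ.* x) (sym pr≡) ⟩
        A ℕ.+ B ℕ.+ 2 ℕ.* N ℕ.* (pr ℕ.+ M) ≡⟨ int₁ d M E rσ pr ⟩
        N ℕ.* (2 ℕ.* (E ℕ.+ (M ℕ.+ (rσ ℕ.+ pr)))) ≡⟨ cong (λ x → N ℕ.* (2 ℕ.* x)) (trans (cong (λ r → E ℕ.+ (M ℕ.+ r)) split) eq) ⟩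
        N ℕ.* (2 ℕ.* (cU ℕ.+ E₀)) ≡⟨ int₃ N cU E₀ ⟩
        N ℕ.* (2 ℕ.* cU) ℕ.+ A₀ ≡⟨ cong (λ x → N ℕ.* x ℕ.+ A₀) cardU ⟩
        N ℕ.* ((k ℕ.+ d) ℕ.* M) ℕ.+ A₀ ≡⟨ int₄ N k d M A₀ ⟩
        (D ℕ.+ A₀) ℕ.+ N ℕ.* (d ℕ.* M) ∎)
        where open ≡-Reasoning

      -- The term 2(d+1)M is the share of one interior vertex in (d+1) f₀, scaled by 2M like g₂.
      left = N ℕ.* E ℕ.+ (2 ℕ.+ 2 ℕ.* d) ℕ.* M
      right = (k ℕ.+ d) ℕ.* M ℕ.+ N ℕ.* E₀

    interior-arith : left ℕ.≤ right
    interior-arith = ℕₚ.*-cancelˡ-≤ 2 (begin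
      2 ℕ.* left ≡⟨ int₆ d M (N ℕ.* E) ⟩
      (A ℕ.+ C) ℕ.+ 2 ℕ.* (d ℕ.* M) ≤⟨ ℕₚ.+-monoˡ-≤ (2 ℕ.* (d ℕ.* M)) (ℕₚ.+-cancelʳ-≤ B (A ℕ.+ C) (2 ℕ.* (k ℕ.* M) ℕ.+ A₀) (begin
          (A ℕ.+ C) ℕ.+ B ≡⟨ key ⟩
          D ℕ.+ A₀ ≤⟨ ℕₚ.+-monoˡ-≤ A₀ (lower b) ⟩
          (B ℕ.+ 2 ℕ.* (k ℕ.* M)) ℕ.+ A₀ ≡⟨ trans (ℕₚ.+-assoc B _ A₀) (ℕₚ.+-comm B _) ⟩
          (2 ℕ.* (k ℕ.* M) ℕ.+ A₀) ℕ.+ B ∎)) ⟩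
      (2 ℕ.* (k ℕ.* M) ℕ.+ A₀) ℕ.+ 2 ℕ.* (d ℕ.* M) ≡⟨ sym (int₇ k d M (N ℕ.* E₀)) ⟩
      2 ℕ.* right ∎)
      where open ℕₚ.≤-Reasoning

    private
      reduced : left ≡ right → A ℕ.+ C ≡ 2 ℕ.* (k ℕ.* M) ℕ.+ A₀
      reduced h = ℕₚ.+-cancelʳ-≡ (2 ℕ.* (d ℕ.* M)) (A ℕ.+ C) (2 ℕ.* (k ℕ.* M) ℕ.+ A₀) (trans (sym (int₆ d M (N ℕ.* E))) (trans (cong (2 ℕ.*_) h) (int₇ k d M (N ℕ.* E₀))))

    equality⇒tight : left ≡ right → Tight N M k rσ
    equality⇒tight h = tight (ℕₚ.≤-reflexive (ℕₚ.+-cancelʳ-≡ A₀ (B ℕ.+ 2 ℕ.* (k ℕ.* M)) D (begin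
      (B ℕ.+ 2 ℕ.* (k ℕ.* M)) ℕ.+ A₀ ≡⟨ trans (ℕₚ.+-assoc B _ A₀) (ℕₚ.+-comm B _) ⟩
      (2 ℕ.* (k ℕ.* M) ℕ.+ A₀) ℕ.+ B ≡⟨ cong (ℕ._+ B) (sym (reduced h)) ⟩
      (A ℕ.+ C) ℕ.+ B ≡⟨ key ⟩
      D ℕ.+ A₀ ∎)))
      where open ≡-Reasoning

    tight⇒equality : Tight N M k rσ → left ≡ right
    tight⇒equality t = ℕₚ.*-cancelˡ-≡ left right 2 (trans (int₆ d M (N ℕ.* E)) (trans (cong (ℕ._+ 2 ℕ.* (d ℕ.* M)) (ℕₚ.+-cancelʳ-≡ B (A ℕ.+ C) (2 ℕ.* (k ℕ.* M) ℕ.+ A₀) (begin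
      (A ℕ.+ C) ℕ.+ B ≡⟨ key ⟩
      D ℕ.+ A₀ ≡⟨ cong (ℕ._+ A₀) (ℕₚ.≤-antisym (lower b) (upper t)) ⟩
      (B ℕ.+ 2 ℕ.* (k ℕ.* M)) ℕ.+ A₀ ≡⟨ trans (ℕₚ.+-assoc B _ A₀) (ℕₚ.+-comm B _) ⟩
      (2 ℕ.* (k ℕ.* M) ℕ.+ A₀) ℕ.+ B ∎))) (sym (int₇ k d M (N ℕ.* E₀)))))
      where open ≡-Reasoning

  ΣF-comm : ∀ {m n} (f : Fin m → Fin n → ℕ) → ΣF (λ x → ΣF (f x)) ≡ ΣF (λ y → ΣF (λ x → f x y))
  ΣF-comm {zero} {n} f = sym (ΣF-0 {n} λ _ → refl)
  ΣF-comm {suc m} {n} f = trans (cong (ΣF (f zero) ℕ.+_) (ΣF-comm (f ∘ suc))) (sym (ΣF-+ (f zero) (λ y → ΣF (λ x → f (suc x) y))))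

  module Counting {n : ℕ} (Δ Γ : Complex n) where

    rel-link : ∀ v H → relᵇ (link Δ ⁅ v ⁆) (link Γ ⁅ v ⁆) H ≡ not (H ! v) ∧ relᵇ Δ Γ (ins v H)
    rel-link v H rewrite link≡ Δ v H | link≡ Γ v H with Δ (ins v H) | Γ (ins v H) | H ! v
    ... | true | true | true = refl
    ... | true | true | false = refl
    ... | true | false | true = refl
    ... | true | false | false = refl
    ... | false | _ | true = refl
    ... | false | _ | false = refl

    -- Each relative edge is counted at its two ends.
    edge-count : ΣF (λ v → fCard (link Δ ⁅ v ⁆) (link Γ ⁅ v ⁆) 1) ≡ 2 ℕ.* fCard Δ Γ 2
    edge-count = begin
      ΣF (λ v → fCard (link Δ ⁅ v ⁆) (link Γ ⁅ v ⁆) 1)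
        ≡⟨ ΣF-cong (λ v → trans (count≡ΣS (λ G → relᵇ (link Δ ⁅ v ⁆) (link Γ ⁅ v ⁆) G ∧ (∣ G ∣ ≡ᵇ 1))) (trans (count-vertices (relᵇ (link Δ ⁅ v ⁆) (link Γ ⁅ v ⁆))) (ΣF-cong λ x → cong 𝟙 (rel-link v ⁅ x ⁆)))) ⟩
      ΣF (λ v → ΣF (λ x → 𝟙 (not (⁅ x ⁆ ! v) ∧ relᵇ Δ Γ (ins v ⁅ x ⁆)))) ≡⟨ ΣF-comm (λ v x → 𝟙 (not (⁅ x ⁆ ! v) ∧ relᵇ Δ Γ (ins v ⁅ x ⁆))) ⟩
      ΣF (λ x → ΣF (λ v → 𝟙 (not (⁅ x ⁆ ! v) ∧ relᵇ Δ Γ (ins v ⁅ x ⁆)))) ≡⟨ ΣF-cong (λ x → sym (count-above ⁅ x ⁆ (relᵇ Δ Γ))) ⟩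
      ΣF (λ x → ΣS (λ F → 𝟙 (relᵇ Δ Γ F ∧ (∣ F ∣ ≡ᵇ suc ∣ ⁅ x ⁆ ∣) ∧ subᵇ ⁅ x ⁆ F))) ≡⟨ sym (ΣS-ΣF {n} {n} (λ F x → 𝟙 (relᵇ Δ Γ F ∧ (∣ F ∣ ≡ᵇ suc ∣ ⁅ x ⁆ ∣) ∧ subᵇ ⁅ x ⁆ F))) ⟩
      ΣS (λ F → ΣF (λ x → 𝟙 (relᵇ Δ Γ F ∧ (∣ F ∣ ≡ᵇ suc ∣ ⁅ x ⁆ ∣) ∧ subᵇ ⁅ x ⁆ F))) ≡⟨ ΣS-cong (λ F → at F (bool (relᵇ Δ Γ F ∧ (∣ F ∣ ≡ᵇ 2)))) ⟩
      ΣS (λ F → 2 ℕ.* 𝟙 (relᵇ Δ Γ F ∧ (∣ F ∣ ≡ᵇ 2))) ≡⟨ ΣS-* {n} 2 (λ F → 𝟙 (relᵇ Δ Γ F ∧ (∣ F ∣ ≡ᵇ 2))) ⟩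
      2 ℕ.* ΣS (λ F → 𝟙 (relᵇ Δ Γ F ∧ (∣ F ∣ ≡ᵇ 2))) ≡⟨ cong (2 ℕ.*_) (sym (count≡ΣS (λ F → relᵇ Δ Γ F ∧ (∣ F ∣ ≡ᵇ 2)))) ⟩
      2 ℕ.* fCard Δ Γ 2 ∎
      where
      open ≡-Reasoning
      sub≡ : ∀ F x → subᵇ ⁅ x ⁆ F ≡ F ! x
      sub≡ F x = ⇔⇒≡ (λ e → subᵇ⁻ e x (⁅⁆-∋ x)) (λ e → subᵇ⁺ (⁅⁆-⊑ e))
      regroup : ∀ F x → relᵇ Δ Γ F ∧ (∣ F ∣ ≡ᵇ suc ∣ ⁅ x ⁆ ∣) ∧ subᵇ ⁅ x ⁆ F ≡ (relᵇ Δ Γ F ∧ (∣ F ∣ ≡ᵇ 2)) ∧ F ! x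
      regroup F x = trans (sym (∧-assoc (relᵇ Δ Γ F) _ _)) (cong₂ (λ k b → (relᵇ Δ Γ F ∧ (∣ F ∣ ≡ᵇ suc k)) ∧ b) (∣⁅x⁆∣≡1 x) (sub≡ F x))
      at : ∀ F → relᵇ Δ Γ F ∧ (∣ F ∣ ≡ᵇ 2) ≡ true ⊎ relᵇ Δ Γ F ∧ (∣ F ∣ ≡ᵇ 2) ≡ false
        → ΣF (λ x → 𝟙 (relᵇ Δ Γ F ∧ (∣ F ∣ ≡ᵇ suc ∣ ⁅ x ⁆ ∣) ∧ subᵇ ⁅ x ⁆ F)) ≡ 2 ℕ.* 𝟙 (relᵇ Δ Γ F ∧ (∣ F ∣ ≡ᵇ 2))
      at F (inj₁ e) = trans (ΣF-cong λ x → cong 𝟙 (trans (regroup F x) (cong (_∧ F ! x) e))) (trans (sym (card≡Σ F)) (trans (≡ᵇ⁻ (proj₂ (∧⁻ {relᵇ Δ Γ F} e))) (sym (cong (λ b → 2 ℕ.* 𝟙 b) e))))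
      at F (inj₂ e) = trans (ΣF-0 λ x → cong 𝟙 (trans (regroup F x) (cong (_∧ F ! x) e))) (sym (cong (λ b → 2 ℕ.* 𝟙 b) e))

    vertex-count : fCard Δ Γ 1 ≡ ΣF (λ v → 𝟙 (relᵇ Δ Γ ⁅ v ⁆))
    vertex-count = trans (count≡ΣS (λ G → relᵇ Δ Γ G ∧ (∣ G ∣ ≡ᵇ 1))) (count-vertices (relᵇ Δ Γ))

  module Local {c ℓ} (𝔽 : Field c ℓ) {n d : ℕ} (rkF : Lin.RankFunction 𝔽 n) (3≤d : 3 ℕ.≤ d) {Δ : Complex n} (np : NormalPseudomanifold Δ d) where

    open Betti 𝔽 n rkF
    open Hom 𝔽 n rkF using (bettiCard; σCard)

    M N : ℕ
    M = fac (suc n)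
    N = suc d ℕ.* suc (suc d)

    Eb : Complex n → Complex n → ℕ → ℕ
    Eb Γ Λ j = 𝔼 (λ W → bettiCard (restrict Γ W) (restrict Λ W) j)

    σ-scaled : ∀ Γ Λ j → q M ℚ.* σCard Γ Λ j ≡ q (Eb Γ Λ j)
    σ-scaled Γ Λ j = scaled-mean (λ W → bettiCard (restrict Γ W) (restrict Λ W) j)

    relative-mean : ∀ {Γ Λ : Complex n} → Closed Γ → Closed Λ → (∃ λ b → Λ ⁅ b ⁆ ≡ true) → Eb Γ Λ 1 ℕ.+ 𝔼 (rk (skeleton Γ) (verts Λ)) ≡ 𝔼 (cardIn (relVerts Γ Λ)) × Eb Γ Λ 0 ≡ 0
    relative-mean {Γ} {Λ} cΓ cΛ (b , Λb) = trans (sym (𝔼-+ (λ W → bettiCard (restrict Γ W) (restrict Λ W) 1) (rk (skeleton Γ) (verts Λ)))) (𝔼-cong λ W → proj₁ (betti-relative {Γ} {Λ} cΓ cΛ W Λb))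
      , ΣS-0 λ W → trans (cong (wt n ∣ W ∣ ℕ.*_) (proj₂ (betti-relative {Γ} {Λ} cΓ cΛ W Λb))) (ℕₚ.*-zeroʳ (wt n ∣ W ∣))

    absolute-mean : ∀ {Γ Λ : Complex n} → Closed Γ → Closed Λ → Γ ⊥ ≡ true → (∀ G → Λ G ≡ false) → Eb Γ Λ 1 ℕ.+ (M ℕ.+ 𝔼 (rk (skeleton Γ) (verts Λ))) ≡ 𝔼 (cardIn (relVerts Γ Λ)) ℕ.+ Eb Γ Λ 0
    absolute-mean {Γ} {Λ} cΓ cΛ Γ⊥ void = begin
      Eb Γ Λ 1 ℕ.+ (M ℕ.+ 𝔼 r) ≡⟨ cong (λ m → Eb Γ Λ 1 ℕ.+ (m ℕ.+ 𝔼 r)) (sym (𝔼-1 {n})) ⟩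
      Eb Γ Λ 1 ℕ.+ (𝔼 {n} (λ _ → 1) ℕ.+ 𝔼 r) ≡⟨ cong (Eb Γ Λ 1 ℕ.+_) (sym (𝔼-+ (λ _ → 1) r)) ⟩
      Eb Γ Λ 1 ℕ.+ 𝔼 (λ W → 1 ℕ.+ r W) ≡⟨ sym (𝔼-+ (λ W → bettiCard (restrict Γ W) (restrict Λ W) 1) (λ W → 1 ℕ.+ r W)) ⟩
      𝔼 (λ W → bettiCard (restrict Γ W) (restrict Λ W) 1 ℕ.+ (1 ℕ.+ r W)) ≡⟨ 𝔼-cong (λ W → betti-absolute {Γ} {Λ} cΓ cΛ W Γ⊥ void) ⟩
      𝔼 (λ W → cardIn (relVerts Γ Λ) W ℕ.+ bettiCard (restrict Γ W) (restrict Λ W) 0) ≡⟨ 𝔼-+ (cardIn (relVerts Γ Λ)) (λ W → bettiCard (restrict Γ W) (restrict Λ W) 0) ⟩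
      𝔼 (cardIn (relVerts Γ Λ)) ℕ.+ Eb Γ Λ 0 ∎
      where
      open ≡-Reasoning
      r = rk (skeleton Γ) (verts Λ)

    pred-mean : ∀ (A : Subset n) → 𝔼 (pred ∘ cardIn A) ℕ.+ M ≡ 𝔼 (cardIn A) ℕ.+ 𝔼 (λ W → 𝟙 (disj A W))
    pred-mean A = trans (cong (𝔼 (pred ∘ cardIn A) ℕ.+_) (sym (𝔼-1 {n}))) (trans (sym (𝔼-+ (pred ∘ cardIn A) (λ _ → 1))) (trans (𝔼-cong (pred-cardIn A)) (𝔼-+ (cardIn A) (λ W → 𝟙 (disj A W)))))

    relVerts! : ∀ (Γ Λ : Complex n) x → relVerts Γ Λ ! x ≡ relᵇ Γ Λ ⁅ x ⁆
    relVerts! Γ Λ x = subset! (λ x → relᵇ Γ Λ ⁅ x ⁆) x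

    verts! : ∀ (Γ : Complex n) x → verts Γ ! x ≡ Γ ⁅ x ⁆
    verts! Γ x = subset! (λ x → Γ ⁅ x ⁆) x

    relVerts-∖ : ∀ Γ Λ → relVerts Γ Λ ≡ verts Γ ∖ verts Λ
    relVerts-∖ Γ Λ = ⊑-antisym
      (λ x p → let a , b = rel⁻ {K = Γ} {Λ} (trans (sym (relVerts! Γ Λ x)) p) in ∖⁺ (trans (verts! Γ x) a) (trans (verts! Λ x) b))
      (λ x p → let a , b = ∖⁻ {A = verts Γ} {verts Λ} p in trans (relVerts! Γ Λ x) (rel⁺ {K = Γ} {Λ} (trans (sym (verts! Γ x)) a) (trans (sym (verts! Λ x)) b)))

    verts-cong : ∀ Γ Λ → (∀ G → Γ G ≡ Λ G) → verts Γ ≡ verts Λ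
    verts-cong Γ Λ h = ext λ x → trans (verts! Γ x) (trans (h ⁅ x ⁆) (sym (verts! Λ x)))

    relVerts-cong : ∀ Γ Λ Λ′ → (∀ G → Λ G ≡ Λ′ G) → relVerts Γ Λ ≡ relVerts Γ Λ′
    relVerts-cong Γ Λ Λ′ h = ext λ x → trans (relVerts! Γ Λ x) (trans (cong (λ b → Γ ⁅ x ⁆ ∧ not b) (h ⁅ x ⁆)) (sym (relVerts! Γ Λ′ x)))

    relVerts-void : ∀ Γ Λ → (∀ G → Λ G ≡ false) → relVerts Γ Λ ≡ verts Γ
    relVerts-void Γ Λ h = ext λ x → trans (relVerts! Γ Λ x) (trans (cong (λ b → Γ ⁅ x ⁆ ∧ not b) (h ⁅ x ⁆)) (trans (∧-comm (Γ ⁅ x ⁆) true) (sym (verts! Γ x))))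

    module At (v : Fin n) (Δv : Δ ⁅ v ⁆ ≡ true) where

      open AtVertex 3≤d np v Δv

      f : ℕ
      f = fCard Γ Λ 1

      module OnBoundary (∂v : Bd Δ (suc d) ⁅ v ⁆ ≡ true) where

        open Boundary ∂v

        private
          Λ′ = Bd Γ d
          rel-mean : Eb Γ Λ 1 ℕ.+ 𝔼 (rk (skeleton Γ) (verts Λ)) ≡ 𝔼 (cardIn (relVerts Γ Λ)) × Eb Γ Λ 0 ≡ 0
          rel-mean = relative-mean {Γ} {Λ} Γ-closed Λ-closed boundary-vertex
          U≡ : relVerts Γ Λ ≡ verts Γ ∖ verts Λ
          U≡ = relVerts-∖ Γ Λ
          verts≡ : verts Λ′ ≡ verts Λ
          verts≡ = verts-cong Λ′ Λ Bd-link
          relVerts≡ : relVerts Γ Λ′ ≡ relVerts Γ Λ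
          relVerts≡ = relVerts-cong Γ Λ′ Λ Bd-link

        mean-zero : Eb Γ Λ 0 ≡ 0
        mean-zero = proj₂ rel-mean

        local-boundary : N ℕ.* Eb Γ Λ 1 ℕ.≤ f ℕ.* M
        local-boundary = BoundaryArith.boundary-arith {N} {M} {f} {Eb Γ Λ 1} {𝔼 (rk (skeleton Γ) (verts Λ))} (proj₁ rel-mean)
          (trans (𝔼-cardIn (relVerts Γ Λ)) (cong (ℕ._* M) (sym (∣relVerts∣ Γ Λ))))
          (subst (λ k → RankBound d (skeleton Γ) (verts Λ) k) (trans (cong ∣_∣ (sym U≡)) (sym (∣relVerts∣ Γ Λ))) boundary-bound)

        f≡ : fCard Γ Λ′ 1 ≡ f
        f≡ = trans (∣relVerts∣ Γ Λ′) (trans (cong ∣_∣ relVerts≡) (sym (∣relVerts∣ Γ Λ)))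

        -- `Λ` and `Λ′` agree face by face but are not the same function. The averages are compared
        -- through the rank equation, which depends on them only by vertex sets, and these are equal
        -- as vectors.
        Eb≡ : Eb Γ Λ′ 1 ≡ Eb Γ Λ 1
        Eb≡ = ℕₚ.+-cancelʳ-≡ (𝔼 (rk (skeleton Γ) (verts Λ))) (Eb Γ Λ′ 1) (Eb Γ Λ 1) (trans (cong (λ B → Eb Γ Λ′ 1 ℕ.+ 𝔼 (rk (skeleton Γ) B)) (sym verts≡))
          (trans (proj₁ (relative-mean {Γ} {Λ′} Γ-closed (Bd-closed {K = Γ} (ℕₚ.≤-trans (s≤s z≤n) 3≤d)) (Data.Product.map₂ (λ {b} → trans (Bd-link ⁅ b ⁆)) boundary-vertex)))
            (trans (cong (𝔼 ∘ cardIn) relVerts≡) (sym (proj₁ rel-mean)))))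

        private
          two-C : 2 ℕ.* (suc (suc d) C 2) ≡ N
          two-C = trans (two-choose (suc d)) (ℕₚ.*-comm (suc (suc d)) (suc d))
          lhs-scaled : q (2 ℕ.* M) ℚ.* (q (suc (suc d) C 2) ℚ.* σCard Γ Λ′ 1) ≡ q (N ℕ.* Eb Γ Λ 1)
          lhs-scaled = begin
            q (2 ℕ.* M) ℚ.* (q C₂ ℚ.* s) ≡⟨ cong (ℚ._* (q C₂ ℚ.* s)) (q-* 2 M) ⟩
            q 2 ℚ.* q M ℚ.* (q C₂ ℚ.* s) ≡⟨ rearr (q 2) (q M) (q C₂) s ⟩
            q 2 ℚ.* q C₂ ℚ.* (q M ℚ.* s) ≡⟨ cong₂ ℚ._*_ (trans (sym (q-* 2 C₂)) (cong q two-C)) (trans (σ-scaled Γ Λ′ 1) (cong q Eb≡)) ⟩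
            q N ℚ.* q (Eb Γ Λ 1) ≡⟨ sym (q-* N (Eb Γ Λ 1)) ⟩
            q (N ℕ.* Eb Γ Λ 1) ∎
            where
            open ≡-Reasoning
            C₂ = suc (suc d) C 2
            s = σCard Γ Λ′ 1
            rearr : ∀ t m c s → t ℚ.* m ℚ.* (c ℚ.* s) ≡ t ℚ.* c ℚ.* (m ℚ.* s)
            rearr = +-*-Solver.solve 4 (λ t m c s → t :* m :* (c :* s) := t :* c :* (m :* s)) refl
              where open +-*-Solver
          rhs-scaled : q (2 ℕ.* M) ℚ.* (½ ℚ.* q (fCard Γ Λ′ 1)) ≡ q (f ℕ.* M)
          rhs-scaled = begin
            q (2 ℕ.* M) ℚ.* (½ ℚ.* q (fCard Γ Λ′ 1)) ≡⟨ cong₂ (λ a b → a ℚ.* (½ ℚ.* q b)) (trans (cong q (ℕₚ.*-comm 2 M)) (q-* M 2)) f≡ ⟩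
            q M ℚ.* q 2 ℚ.* (½ ℚ.* q f) ≡⟨ ℚₚ.*-assoc (q M) (q 2) _ ⟩
            q M ℚ.* (q 2 ℚ.* (½ ℚ.* q f)) ≡⟨ cong (q M ℚ.*_) (½-q f) ⟩
            q M ℚ.* q f ≡⟨ trans (sym (q-* M f)) (cong q (ℕₚ.*-comm M f)) ⟩
            q (f ℕ.* M) ∎
            where open ≡-Reasoning
          pos : ℚ.Positive (q (2 ℕ.* M))
          pos = q-pos (ℕₚ.≤-trans (fac>0 (suc n)) (ℕₚ.m≤m+n M _))

        equality-boundary : (q (suc (suc d) C 2) ℚ.* σCard Γ Λ′ 1 ≡ ½ ℚ.* q (fCard Γ Λ′ 1)) ⇔ (N ℕ.* Eb Γ Λ 1 ≡ f ℕ.* M)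
        equality-boundary = mk⇔ (λ e → q-injective (trans (sym lhs-scaled) (trans (cong (q (2 ℕ.* M) ℚ.*_) e) rhs-scaled)))
          (λ e → *-cancel-pos {q (2 ℕ.* M)} _ _ pos (trans lhs-scaled (trans (cong q e) (sym rhs-scaled))))

      module InInterior (∂v : Bd Δ (suc d) ⁅ v ⁆ ≡ false) where

        open Interior ∂v

        private
          k = ∣ verts Γ ∖ σ ∣
          U≡ : relVerts Γ Λ ≡ verts Γ
          U≡ = relVerts-void Γ Λ Λ-void
          f≡ : f ≡ k ℕ.+ d
          f≡ = trans (∣relVerts∣ Γ Λ) (trans (cong ∣_∣ U≡) (trans (sym (∣∖∣ σ⊑)) (cong (k ℕ.+_) ∣σ∣)))
          verts-void : verts Λ ≡ ⊥
          verts-void = ext λ x → trans (subset! (λ x → Λ ⁅ x ⁆) x) (trans (Λ-void ⁅ x ⁆) (sym (⊥! x)))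

        open InteriorArith {d} {M} {Eb Γ Λ 1} {Eb Γ Λ 0} {k} {𝔼 (rk (skeleton Γ) σ)} {𝔼 (pred ∘ cardIn σ)} {𝔼 (rk (skeleton Γ) ⊥)} {𝔼 (cardIn (relVerts Γ Λ))} {𝔼 (cardIn σ)} {𝔼 (λ W → 𝟙 (disj σ W))}
          (subst (λ B → Eb Γ Λ 1 ℕ.+ (M ℕ.+ 𝔼 (rk (skeleton Γ) B)) ≡ 𝔼 (cardIn (relVerts Γ Λ)) ℕ.+ Eb Γ Λ 0) verts-void (absolute-mean {Γ} {Λ} Γ-closed Λ-closed Γ⊥ Λ-void))
          (trans (𝔼-cardIn (relVerts Γ Λ)) (cong (ℕ._* M) (trans (sym (∣relVerts∣ Γ Λ)) f≡)))
          (𝔼-rk-clique {G = skeleton Γ} σ-clique)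
          (pred-mean σ)
          (trans (𝔼-cardIn σ) (cong (ℕ._* M) ∣σ∣))
          (subst (λ c → suc c ℕ.* 𝔼 (λ W → 𝟙 (disj σ W)) ≡ M) ∣σ∣ (𝔼-avoid σ))
          interior-bound

        local-interior : N ℕ.* Eb Γ Λ 1 ℕ.+ (2 ℕ.+ 2 ℕ.* d) ℕ.* M ℕ.≤ f ℕ.* M ℕ.+ N ℕ.* Eb Γ Λ 0
        local-interior = subst (λ m → N ℕ.* Eb Γ Λ 1 ℕ.+ (2 ℕ.+ 2 ℕ.* d) ℕ.* M ℕ.≤ m ℕ.* M ℕ.+ N ℕ.* Eb Γ Λ 0) (sym f≡) interior-arith

        equality-interior : (∃ λ e → IsStacked e Γ) ⇔ (N ℕ.* Eb Γ Λ 1 ℕ.+ (2 ℕ.+ 2 ℕ.* d) ℕ.* M ≡ f ℕ.* M ℕ.+ N ℕ.* Eb Γ Λ 0)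
        equality-interior = mk⇔ (λ s → subst (λ m → N ℕ.* Eb Γ Λ 1 ℕ.+ (2 ℕ.+ 2 ℕ.* d) ℕ.* M ≡ m ℕ.* M ℕ.+ N ℕ.* Eb Γ Λ 0) (sym f≡) (tight⇒equality (stacked→tight s)))
          (λ e → tight→stacked (equality⇒tight (subst (λ m → N ℕ.* Eb Γ Λ 1 ℕ.+ (2 ℕ.+ 2 ℕ.* d) ℕ.* M ≡ m ℕ.* M ℕ.+ N ℕ.* Eb Γ Λ 0) f≡ e)))

-- Summation over the vertices.

module Assembly where

  open Subsets
  open UnionFind
  open Expectation
  open Chains
  open RankBound
  open MinimalCycles
  open Separators
  open Stacked
  open BettiNumbers
  open Links
  open Rationals
  open LocalInequality
  open import Level using (Level)
  open import Data.Bool using (true; false; _∧_; not; if_then_else_)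
  open import Data.Nat as ℕ using (ℕ; suc; s≤s; z≤n; _≡ᵇ_)
  import Data.Nat.Properties as ℕₚ
  open import Data.Nat.Combinatorics using (_C_)
  import Data.Nat.Tactic.RingSolver as ℕSolver
  open import Data.Fin using (Fin; suc)
  open import Data.Fin.Subset using (⁅_⁆; ∣_∣; ⊥)
  open import Data.Integer as ℤ using (+_)
  import Data.Integer.Properties as ℤₚ
  open import Data.Rational as ℚ using (ℚ; _/_; ½; 0ℚ)
  import Data.Rational.Properties as ℚₚ
  open import Data.Rational.Solver using (module +-*-Solver)
  import Data.List as L
  open import Data.Product using (∃; _×_; _,_; proj₁; proj₂)
  open import Data.Sum using (_⊎_; inj₁; inj₂)
  open import Relation.Binary.PropositionalEquality using (_≡_; refl; sym; trans; cong; cong₂; subst₂; module ≡-Reasoning)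
  open import Function using (id)
  open import Function.Bundles using (_⇔_; mk⇔; Equivalence)

  if-true : ∀ {a} {A : Set a} {b} {x y : A} → b ≡ true → (if b then x else y) ≡ x
  if-true refl = refl

  if-false : ∀ {a} {A : Set a} {b} {x y : A} → b ≡ false → (if b then x else y) ≡ y
  if-false refl = refl

  module Global {c ℓ} (𝔽 : Field c ℓ) {n d : ℕ} (rkF : Lin.RankFunction 𝔽 n) (3≤d : 3 ℕ.≤ d) {Δ : Complex n} (np : NormalPseudomanifold Δ d) (hb : HasBoundary Δ d) where

    open Hom 𝔽 n rkF using (σCard; μ)
    open Local 𝔽 rkF 3≤d np

    private
      Λ : Complex n
      Λ = Bd Δ (suc d)

    -- The inequality multiplied by 2(n+1)! and distributed over the vertices, with negative terms
    -- moved to the other side. `r` carries the term (d+1) f₀ at interior vertices, and the sum of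
    -- `f` is 2 f₁ because each relative edge is seen from both ends.
    f e₁ e₀ r lhs rhs : Fin n → ℕ
    f v = fCard (link Δ ⁅ v ⁆) (link Λ ⁅ v ⁆) 1
    e₁ v = if Δ ⁅ v ⁆ then Eb (link Δ ⁅ v ⁆) (link Λ ⁅ v ⁆) 1 else 0
    e₀ v = if Δ ⁅ v ⁆ then Eb (link Δ ⁅ v ⁆) (link Λ ⁅ v ⁆) 0 else 0
    r v = 𝟙 (relᵇ Δ Λ ⁅ v ⁆) ℕ.* ((2 ℕ.+ 2 ℕ.* d) ℕ.* M)
    lhs v = N ℕ.* e₁ v ℕ.+ r v
    rhs v = f v ℕ.* M ℕ.+ N ℕ.* e₀ v

    Condition : Fin n → Set
    Condition v = (Δ ⁅ v ⁆ ≡ true → Λ ⁅ v ⁆ ≡ true → q (suc (suc d) C 2) ℚ.* σCard (link Δ ⁅ v ⁆) (Bd (link Δ ⁅ v ⁆) d) 1 ≡ ½ ℚ.* q (fCard (link Δ ⁅ v ⁆) (Bd (link Δ ⁅ v ⁆) d) 1))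
      × (Δ ⁅ v ⁆ ≡ true → Λ ⁅ v ⁆ ≡ false → ∃ λ e → IsStacked e (link Δ ⁅ v ⁆))

    module _ (v : Fin n) where

      -- Lets the sums run over the whole ground set although only vertices of Δ count.
      outside-zero : Δ ⁅ v ⁆ ≡ false → lhs v ≡ 0 × rhs v ≡ 0
      outside-zero no-v = cong₂ ℕ._+_ (trans (cong (N ℕ.*_) (if-false no-v)) (ℕₚ.*-zeroʳ N)) (cong (λ b → 𝟙 (b ∧ not (Λ ⁅ v ⁆)) ℕ.* ((2 ℕ.+ 2 ℕ.* d) ℕ.* M)) no-v)
        , cong₂ ℕ._+_ (cong (ℕ._* M) f≡0) (trans (cong (N ℕ.*_) (if-false no-v)) (ℕₚ.*-zeroʳ N))
        where
        f≡0 : f v ≡ 0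
        f≡0 = trans (count≡ΣS (λ G → relᵇ (link Δ ⁅ v ⁆) (link Λ ⁅ v ⁆) G ∧ (∣ G ∣ ≡ᵇ 1))) (trans (count-vertices (relᵇ (link Δ ⁅ v ⁆) (link Λ ⁅ v ⁆)))
          (ΣF-0 λ x → cong 𝟙 (≢true⇒false λ e → t≢f (Δ-closed 3≤d np (proj₁ (rel⁻ {K = Δ} {Λ} (proj₂ (∧⁻ {not (⁅ x ⁆ ! v)} (trans (sym (Counting.rel-link Δ Λ v ⁅ x ⁆)) e))))) (⁅⁆-⊑ (ins-this v ⁅ x ⁆))) no-v)))

      module _ (Δv : Δ ⁅ v ⁆ ≡ true) where

        e₁≡ : e₁ v ≡ Eb (link Δ ⁅ v ⁆) (link Λ ⁅ v ⁆) 1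
        e₁≡ = if-true Δv

        e₀≡ : e₀ v ≡ Eb (link Δ ⁅ v ⁆) (link Λ ⁅ v ⁆) 0
        e₀≡ = if-true Δv

        lhs-boundary : Λ ⁅ v ⁆ ≡ true → lhs v ≡ N ℕ.* Eb (link Δ ⁅ v ⁆) (link Λ ⁅ v ⁆) 1
        lhs-boundary ∂v = trans (cong₂ ℕ._+_ (cong (N ℕ.*_) e₁≡) (cong (λ b → 𝟙 b ℕ.* ((2 ℕ.+ 2 ℕ.* d) ℕ.* M)) (trans (cong₂ (λ a b → a ∧ not b) Δv ∂v) refl))) (ℕₚ.+-identityʳ _)

        rhs-boundary : Λ ⁅ v ⁆ ≡ true → rhs v ≡ f v ℕ.* M
        rhs-boundary ∂v = trans (cong (λ e → f v ℕ.* M ℕ.+ N ℕ.* e) (trans e₀≡ (At.OnBoundary.mean-zero v Δv ∂v))) (trans (cong (f v ℕ.* M ℕ.+_) (ℕₚ.*-zeroʳ N)) (ℕₚ.+-identityʳ _))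

        lhs-interior : Λ ⁅ v ⁆ ≡ false → lhs v ≡ N ℕ.* Eb (link Δ ⁅ v ⁆) (link Λ ⁅ v ⁆) 1 ℕ.+ (2 ℕ.+ 2 ℕ.* d) ℕ.* M
        lhs-interior ∂v = cong₂ ℕ._+_ (cong (N ℕ.*_) e₁≡) (trans (cong (λ b → 𝟙 b ℕ.* ((2 ℕ.+ 2 ℕ.* d) ℕ.* M)) (trans (cong₂ (λ a b → a ∧ not b) Δv ∂v) refl)) (ℕₚ.*-identityˡ _))

        rhs-interior : rhs v ≡ f v ℕ.* M ℕ.+ N ℕ.* Eb (link Δ ⁅ v ⁆) (link Λ ⁅ v ⁆) 0
        rhs-interior = cong (λ e → f v ℕ.* M ℕ.+ N ℕ.* e) e₀≡

      local : lhs v ℕ.≤ rhs v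
      local = cases (bool (Δ ⁅ v ⁆)) (bool (Λ ⁅ v ⁆))
        where
        cases : Δ ⁅ v ⁆ ≡ true ⊎ Δ ⁅ v ⁆ ≡ false → Λ ⁅ v ⁆ ≡ true ⊎ Λ ⁅ v ⁆ ≡ false → lhs v ℕ.≤ rhs v
        cases (inj₂ no-v) _ = ℕₚ.≤-trans (ℕₚ.≤-reflexive (proj₁ (outside-zero no-v))) z≤n
        cases (inj₁ Δv) (inj₁ ∂v) = subst₂ ℕ._≤_ (sym (lhs-boundary Δv ∂v)) (sym (rhs-boundary Δv ∂v)) (At.OnBoundary.local-boundary v Δv ∂v)
        cases (inj₁ Δv) (inj₂ ∂v) = subst₂ ℕ._≤_ (sym (lhs-interior Δv ∂v)) (sym (rhs-interior Δv)) (At.InInterior.local-interior v Δv ∂v)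

      condition⁻ : lhs v ≡ rhs v → Condition v
      condition⁻ e = (λ Δv ∂v → Equivalence.from (At.OnBoundary.equality-boundary v Δv ∂v) (trans (sym (lhs-boundary Δv ∂v)) (trans e (rhs-boundary Δv ∂v))))
        , λ Δv ∂v → Equivalence.from (At.InInterior.equality-interior v Δv ∂v) (trans (sym (lhs-interior Δv ∂v)) (trans e (rhs-interior Δv)))

      condition⁺ : Condition v → lhs v ≡ rhs v
      condition⁺ (onB , inI) = cases (bool (Δ ⁅ v ⁆)) (bool (Λ ⁅ v ⁆))
        where
        cases : Δ ⁅ v ⁆ ≡ true ⊎ Δ ⁅ v ⁆ ≡ false → Λ ⁅ v ⁆ ≡ true ⊎ Λ ⁅ v ⁆ ≡ false → lhs v ≡ rhs v
        cases (inj₂ no-v) _ = trans (proj₁ (outside-zero no-v)) (sym (proj₂ (outside-zero no-v)))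
        cases (inj₁ Δv) (inj₁ ∂v) = trans (lhs-boundary Δv ∂v) (trans (Equivalence.to (At.OnBoundary.equality-boundary v Δv ∂v) (onB Δv ∂v)) (sym (rhs-boundary Δv ∂v)))
        cases (inj₁ Δv) (inj₂ ∂v) = trans (lhs-interior Δv ∂v) (trans (Equivalence.to (At.InInterior.equality-interior v Δv ∂v) (inI Δv ∂v)) (sym (rhs-interior Δv)))

    private
      scaled-if : ∀ b (s : ℚ) e → q M ℚ.* s ≡ q e → q M ℚ.* (if b then s else 0ℚ) ≡ q (if b then e else 0)
      scaled-if true s e h = h
      scaled-if false s e h = ℚₚ.*-zeroʳ (q M)

    μ₁-scaled : q M ℚ.* μ Δ Λ 1 ≡ q (ΣF e₁)
    μ₁-scaled = scaled-sum-fin (q M) id (λ v → if Δ ⁅ v ⁆ then σCard (link Δ ⁅ v ⁆) (link Λ ⁅ v ⁆) 1 else 0ℚ) e₁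
      λ v → scaled-if (Δ ⁅ v ⁆) (σCard (link Δ ⁅ v ⁆) (link Λ ⁅ v ⁆) 1) (Eb (link Δ ⁅ v ⁆) (link Λ ⁅ v ⁆) 1) (σ-scaled (link Δ ⁅ v ⁆) (link Λ ⁅ v ⁆) 1)

    μ₀-scaled : q M ℚ.* μ Δ Λ 0 ≡ q (ΣF e₀)
    μ₀-scaled = scaled-sum-fin (q M) id (λ v → if Δ ⁅ v ⁆ then σCard (link Δ ⁅ v ⁆) (link Λ ⁅ v ⁆) 0 else 0ℚ) e₀
      λ v → scaled-if (Δ ⁅ v ⁆) (σCard (link Δ ⁅ v ⁆) (link Λ ⁅ v ⁆) 0) (Eb (link Δ ⁅ v ⁆) (link Λ ⁅ v ⁆) 0) (σ-scaled (link Δ ⁅ v ⁆) (link Λ ⁅ v ⁆) 0)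

    C₂ : ℕ
    C₂ = suc (suc d) C 2

    R X Y P : ℕ
    X = N ℕ.* ΣF e₁
    Y = N ℕ.* ΣF e₀
    P = ΣF f ℕ.* M
    R = ΣF r

    bound-scaled : q (2 ℕ.* M) ℚ.* (q C₂ ℚ.* (μ Δ Λ 1 ℚ.- μ Δ Λ 0)) ℚ.+ q Y ≡ q X
    bound-scaled = begin
      q (2 ℕ.* M) ℚ.* (q C₂ ℚ.* (m₁ ℚ.- m₀)) ℚ.+ q Y ≡⟨ cong₂ (λ a b → a ℚ.* (q C₂ ℚ.* (m₁ ℚ.- m₀)) ℚ.+ b) (q-* 2 M) (trans (q-* N (ΣF e₀)) (cong₂ ℚ._*_ qN (sym μ₀-scaled))) ⟩
      q 2 ℚ.* q M ℚ.* (q C₂ ℚ.* (m₁ ℚ.- m₀)) ℚ.+ q 2 ℚ.* q C₂ ℚ.* (q M ℚ.* m₀) ≡⟨ rearr (q 2) (q M) (q C₂) m₁ m₀ ⟩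
      q 2 ℚ.* q C₂ ℚ.* (q M ℚ.* m₁) ≡⟨ cong₂ ℚ._*_ (sym qN) μ₁-scaled ⟩
      q N ℚ.* q (ΣF e₁) ≡⟨ sym (q-* N (ΣF e₁)) ⟩
      q X ∎
      where
      open ≡-Reasoning
      m₁ = μ Δ Λ 1
      m₀ = μ Δ Λ 0
      qN : q N ≡ q 2 ℚ.* q C₂
      qN = trans (cong q (sym (trans (two-choose (suc d)) (ℕₚ.*-comm (suc (suc d)) (suc d))))) (q-* 2 C₂)
      rearr : ∀ t m c x y → t ℚ.* m ℚ.* (c ℚ.* (x ℚ.- y)) ℚ.+ t ℚ.* c ℚ.* (m ℚ.* y) ≡ t ℚ.* c ℚ.* (m ℚ.* x)
      rearr = +-*-Solver.solve 5 (λ t m c x y → t :* m :* (c :* (x :- y)) :+ t :* c :* (m :* y) := t :* c :* (m :* x)) refl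
        where open +-*-Solver

    -- A free ridge exists, so the empty face belongs to the boundary; this is the vanishing of f₋₁
    -- used in `g₂-formula`.
    no-empty : fCard Δ Λ 0 ≡ 0
    no-empty = trans (count≡ΣS (λ G → relᵇ Δ Λ G ∧ (∣ G ∣ ≡ᵇ 0))) (trans (count-empty (relᵇ Δ Λ)) (cong 𝟙 (≢true⇒false λ e → t≢f ∂⊥ (proj₂ (rel⁻ {K = Δ} {Λ} e)))))
      where
      ∂⊥ : Λ ⊥ ≡ true
      ∂⊥ = let S , ΔS , ∣S∣ , one = hb in Bd⁺ {K = Δ} {suc d} {S} ΔS (cong suc ∣S∣) one ⊥⊑

    R≡ : R ≡ 2 ℕ.* M ℕ.* (suc d ℕ.* fCard Δ Λ 1)
    R≡ = begin
      ΣF (λ v → 𝟙 (relᵇ Δ Λ ⁅ v ⁆) ℕ.* ((2 ℕ.+ 2 ℕ.* d) ℕ.* M)) ≡⟨ ΣF-cong (λ v → ℕₚ.*-comm (𝟙 (relᵇ Δ Λ ⁅ v ⁆)) ((2 ℕ.+ 2 ℕ.* d) ℕ.* M)) ⟩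
      ΣF (λ v → (2 ℕ.+ 2 ℕ.* d) ℕ.* M ℕ.* 𝟙 (relᵇ Δ Λ ⁅ v ⁆)) ≡⟨ ΣF-* ((2 ℕ.+ 2 ℕ.* d) ℕ.* M) (λ v → 𝟙 (relᵇ Δ Λ ⁅ v ⁆)) ⟩
      (2 ℕ.+ 2 ℕ.* d) ℕ.* M ℕ.* ΣF (λ v → 𝟙 (relᵇ Δ Λ ⁅ v ⁆)) ≡⟨ cong ((2 ℕ.+ 2 ℕ.* d) ℕ.* M ℕ.*_) (sym (Counting.vertex-count Δ Λ)) ⟩
      (2 ℕ.+ 2 ℕ.* d) ℕ.* M ℕ.* fCard Δ Λ 1 ≡⟨ rearr d M (fCard Δ Λ 1) ⟩
      2 ℕ.* M ℕ.* (suc d ℕ.* fCard Δ Λ 1) ∎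
      where
      open ≡-Reasoning
      rearr : ∀ d m x → (2 ℕ.+ 2 ℕ.* d) ℕ.* m ℕ.* x ≡ 2 ℕ.* m ℕ.* ((1 ℕ.+ d) ℕ.* x)
      rearr = ℕSolver.solve-∀

    P≡ : P ≡ 2 ℕ.* M ℕ.* fCard Δ Λ 2
    P≡ = trans (cong (ℕ._* M) (Counting.edge-count Δ Λ)) (rearr (fCard Δ Λ 2) M)
      where
      rearr : ∀ x m → 2 ℕ.* x ℕ.* m ≡ 2 ℕ.* m ℕ.* x
      rearr = ℕSolver.solve-∀

    g₂-scaled : q (2 ℕ.* M) ℚ.* qz (gNum Δ Λ (suc d) 2) ℚ.+ q R ≡ q P
    g₂-scaled = begin
      q (2 ℕ.* M) ℚ.* qz g ℚ.+ q R ≡⟨ cong (λ x → q (2 ℕ.* M) ℚ.* qz g ℚ.+ x) (trans (cong q R≡) (q-* (2 ℕ.* M) (suc d ℕ.* fCard Δ Λ 1))) ⟩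
      q (2 ℕ.* M) ℚ.* qz g ℚ.+ q (2 ℕ.* M) ℚ.* q (suc d ℕ.* fCard Δ Λ 1) ≡⟨ sym (ℚₚ.*-distribˡ-+ (q (2 ℕ.* M)) (qz g) _) ⟩
      q (2 ℕ.* M) ℚ.* (qz g ℚ.+ q (suc d ℕ.* fCard Δ Λ 1)) ≡⟨ cong (q (2 ℕ.* M) ℚ.*_) (trans (sym (qz-+ g (+ (suc d ℕ.* fCard Δ Λ 1)))) (cong qz (trans (cong (λ z → g ℤ.+ z) (ℤₚ.pos-* (suc d) (fCard Δ Λ 1))) (g₂-formula Δ Λ d (ℕₚ.≤-trans (s≤s z≤n) 3≤d) no-empty)))) ⟩
      q (2 ℕ.* M) ℚ.* q (fCard Δ Λ 2) ≡⟨ trans (sym (q-* (2 ℕ.* M) (fCard Δ Λ 2))) (cong q (sym P≡)) ⟩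
      q P ∎
      where
      open ≡-Reasoning
      g = gNum Δ Λ (suc d) 2

    X+R : X ℕ.+ R ≡ ΣF lhs
    X+R = trans (cong (ℕ._+ R) (sym (ΣF-* N e₁))) (sym (ΣF-+ (λ v → N ℕ.* e₁ v) r))

    P+Y : P ℕ.+ Y ≡ ΣF rhs
    P+Y = trans (cong₂ ℕ._+_ (trans (ℕₚ.*-comm (ΣF f) M) (trans (sym (ΣF-* M f)) (ΣF-cong λ v → ℕₚ.*-comm M (f v)))) (sym (ΣF-* N e₀))) (sym (ΣF-+ (λ v → f v ℕ.* M) (λ v → N ℕ.* e₀ v)))

    open Compare {q (2 ℕ.* M)} {q C₂ ℚ.* (μ Δ Λ 1 ℚ.- μ Δ Λ 0)} {qz (gNum Δ Λ (suc d) 2)} {X} {Y} {P} {R}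
      (q-pos (ℕₚ.≤-trans (fac>0 (suc n)) (ℕₚ.m≤m+n M _))) bound-scaled g₂-scaled public

    sums-≤ : X ℕ.+ R ℕ.≤ P ℕ.+ Y
    sums-≤ = subst₂ ℕ._≤_ (sym X+R) (sym P+Y) (ΣF-mono local)

    sums-≡⁻ : X ℕ.+ R ≡ P ℕ.+ Y → ∀ v → Condition v
    sums-≡⁻ e v = condition⁻ v (ΣF-≡⁻ local (trans (sym X+R) (trans e P+Y)) v)

    sums-≡⁺ : (∀ v → Condition v) → X ℕ.+ R ≡ P ℕ.+ Y
    sums-≡⁺ h = trans X+R (trans (ΣF-cong λ v → condition⁺ v (h v)) (sym P+Y))

open import Level using (Level)
open import Data.Bool using (true; false)
open import Data.Nat using (ℕ; _≤_; suc)
open import Data.Nat.Combinatorics using (_C_)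
open import Data.Fin.Subset using (⁅_⁆)
open import Data.Integer using (+_)
open import Data.Rational using (ℚ; _/_; ½; _*_; _-_)
open import Data.Product using (_×_; ∃; _,_; proj₁; proj₂)
open import Relation.Binary.PropositionalEquality using (_≡_)
open import Function.Bundles using (_⇔_; mk⇔)

theorem7p3 : ∀ {c ℓ : Level} (𝔽 : Field c ℓ) (n d : ℕ) (Δ : Complex n)
    (rkF : Lin.RankFunction 𝔽 n)
    → 3 ≤ d
    → NormalPseudomanifold Δ d
    → HasBoundary Δ d
    → let ∂Δ = Bd Δ (suc d)
          μ = Hom.μ 𝔽 n rkF
          σ̃ = Hom.σCard 𝔽 n rkF
          g₂ = gNum Δ ∂Δ (suc d) 2 / 1
          K = + (suc (suc d) C 2) / 1
          rhs = K * (μ Δ ∂Δ 1 - μ Δ ∂Δ 0)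
      in (rhs Data.Rational.≤ g₂)
         × (g₂ ≡ rhs ⇔
              ((∀ v → Δ ⁅ v ⁆ ≡ true → ∂Δ ⁅ v ⁆ ≡ true →
                   K * σ̃ (link Δ ⁅ v ⁆) (Bd (link Δ ⁅ v ⁆) d) 1
                   ≡ ½ * (+ fCard (link Δ ⁅ v ⁆) (Bd (link Δ ⁅ v ⁆) d) 1 / 1))
               × (∀ v → Δ ⁅ v ⁆ ≡ true → ∂Δ ⁅ v ⁆ ≡ false →
                   ∃ λ e → IsStacked e (link Δ ⁅ v ⁆))))
theorem7p3 𝔽 n d Δ rkF 3≤d np hb = compare-≤ sums-≤ , mk⇔
  (λ e → let h = sums-≡⁻ (compare-≡⁻ e) in (λ v → proj₁ (h v)) , (λ v → proj₂ (h v)))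
  (λ { (onB , inI) → compare-≡⁺ (sums-≡⁺ λ v → onB v , inI v) })
  where open Assembly.Global 𝔽 rkF 3≤d np hb
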